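{- Let $q\ge 7$ be an odd prime power, $\Sigma_\infty$ a hyperplane of $\mathrm{PG}(4,q)$, and let $\mathcal C$ be a set of $q^2$ affine points together with a set of affine planes ($\mathcal C$-planes) satisfying: (A1) each $\mathcal C$-plane meets $\mathcal C$ in a $q$-arc, and every plane meeting $\mathcal C$ in more than four points is a $\mathcal C$-plane; (A2) any two distinct points of $\mathcal C$ lie in exactly one $\mathcal C$-plane; (A3) each affine point is either in $\mathcal C$, or on no $\mathcal C$-plane, or on exactly two $\mathcal C$-planes. Let $\mathcal S=\{t_A: A\in\mathcal C\}\cup\{t_\infty\}$ (a regular spread of $\Sigma_\infty$), so that the Bruck–Bose plane $\mathcal P(\mathcal S)\cong\mathrm{PG}(2,q^2)$. Let $T_\infty$ be the point at infinity of $\mathcal P(\mathcal S)$ corresponding to $t_\infty$. Then the set consisting of the points of $\mathcal P(\mathcal S)$ corresponding to $\mathcal C$, together with $T_\infty$, is a conic of $\mathcal P(\mathcal S)\cong\mathrm{PG}(2,q^2)$.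
   Context: Affine points/lines/planes are those not contained in $\Sigma_\infty$. A $k$-arc is a set of $k$ points of a plane, no three collinear. For a $\mathcal C$-plane $\pi$, the $q$-arc $\pi\cap\mathcal C$ lies ($q$ odd) in a unique conic $(\pi\cap\mathcal C)\cup\{\pi_\infty\}$ of $\pi$; $\pi_\infty$ is the $\infty$-point of $\pi$, and an $\infty$-point is the $\infty$-point of some $\mathcal C$-plane. The $\mathcal C$-line of $\pi$ is $\pi\cap\Sigma_\infty$; a $0$-point is a point of $\Sigma_\infty$ on no $\mathcal C$-line. The set of all $\infty$-points and $0$-points is a line $t_\infty$ of $\Sigma_\infty$. For $A\in\mathcal C$ and a $\mathcal C$-plane $\pi\ni A$, $A_\pi$ is the point where the tangent at $A$ in $\pi$ to the conic $(\pi\cap\mathcal C)\cup\{\pi_\infty\}$ meets $\Sigma_\infty$; $t_A$ is the set of the $q+1$ points $A_\pi$ over the $q+1$ $\mathcal C$-planes $\pi\ni A$; each $t_A$ is a line and $\mathcal S$ is a regular spread. Bruck–Bose plane $\mathcal P(\mathcal S)$: affine points are the affine points of $\mathrm{PG}(4,q)$, affine lines are the affine planes of $\mathrm{PG}(4,q)$ meeting $\Sigma_\infty$ in a line of $\mathcal S$, and the line at infinity has as points the elements of $\mathcal S$ (an affine plane through $s\in\mathcal S$ is incident with $s$); for regular $\mathcal S$ it is isomorphic to $\mathrm{PG}(2,q^2)$. -}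

module Defs where

open import Level using (Level; _⊔_) renaming (suc to lsuc)
open import Data.Nat using (ℕ; zero; suc; _^_; _≤_) renaming (_*_ to _*ℕ_; _+_ to _+ℕ_)
open import Data.Nat.Primality using (Prime)
open import Data.Fin using (Fin; zero; suc)
open import Data.Product using (Σ; ∃; ∃₂; _×_; _,_; proj₁; proj₂)
open import Data.Sum using (_⊎_; inj₁; inj₂)
open import Data.Unit.Polymorphic using (⊤; tt)
open import Data.Empty.Polymorphic using (⊥)
open import Relation.Nullary using (¬_)
open import Relation.Binary.PropositionalEquality using (_≡_; _≢_)
open import Algebra.Bundles using (CommutativeRing)

OddPrimePower : ℕ → Set
OddPrimePower q =
  (∃₂ λ p k → Prime p × 1 ≤ k × q ≡ p ^ k) × (∃ λ m → q ≡ suc (2 *ℕ m))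

HasExactly : ∀ {a} {n : ℕ} → ℕ → (Fin n → Set a) → Set a
HasExactly {n = n} m P =
  Σ (Fin m → Fin n) λ f →
    (∀ j k → f j ≡ f k → j ≡ k) × (∀ j → P (f j)) × (∀ i → P i → ∃ λ j → f j ≡ i)

AtLeast : ∀ {a} {n : ℕ} → ℕ → (Fin n → Set a) → Set a
AtLeast {n = n} m P =
  Σ (Fin m → Fin n) λ f → (∀ j k → f j ≡ f k → j ≡ k) × (∀ j → P (f j))

-- Linear algebra / projective geometry over a commutative ring
-- (used only for rings that are fields)

module LinAlg {c ℓ} (R : CommutativeRing c ℓ) where
  open CommutativeRing R using (Carrier; _≈_; _+_; _*_; _-_; 0#; 1#)

  IsField : Set (c ⊔ ℓ)
  IsField = (¬ (1# ≈ 0#)) × (∀ x → ¬ (x ≈ 0#) → ∃ λ y → x * y ≈ 1#)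

  HasCard : ℕ → Set (c ⊔ ℓ)
  HasCard m = Σ (Fin m → Carrier) λ e →
    (∀ i j → e i ≈ e j → i ≡ j) × (∀ x → ∃ λ i → e i ≈ x)

  V : ℕ → Set c
  V n = Fin n → Carrier

  _≈v_ : ∀ {n} → V n → V n → Set ℓ
  u ≈v v = ∀ i → u i ≈ v i

  zv : ∀ {n} → V n
  zv _ = 0#

  sumF : ∀ {k} → (Fin k → Carrier) → Carrier
  sumF {zero} f = 0#
  sumF {suc k} f = f zero + sumF (λ j → f (suc j))

  dot : ∀ {n} → V n → V n → Carrier
  dot u v = sumF (λ i → u i * v i)

  combo : ∀ {k n} → (Fin k → Carrier) → (Fin k → V n) → V n
  combo cs w i = sumF (λ j → cs j * w j i)

  NonZero : ∀ {n} → V n → Set ℓ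
  NonZero v = ¬ (v ≈v zv)

  Indep : ∀ {k n} → (Fin k → V n) → Set (c ⊔ ℓ)
  Indep w = ∀ cs → combo cs w ≈v zv → ∀ j → cs j ≈ 0#

  InSpan : ∀ {k n} → (Fin k → V n) → V n → Set (c ⊔ ℓ)
  InSpan w v = ∃ λ cs → v ≈v combo cs w

  -- projective points of PG(n-1, R): nonzero vectors, up to proportionality
  Point : ℕ → Set (c ⊔ ℓ)
  Point n = Σ (V n) NonZero

  Same : ∀ {n} → Point n → Point n → Set (c ⊔ ℓ)
  Same (u , _) (v , _) = ∃ λ a → (¬ (a ≈ 0#)) × (∀ i → u i ≈ a * v i)

  record Sub (n k : ℕ) : Set (c ⊔ ℓ) where
    field
      basis : Fin k → V n
      indep : Indep basis
  open Sub public

  _∈S_ : ∀ {n k} → Point n → Sub n k → Set (c ⊔ ℓ)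
  P ∈S π = InSpan (basis π) (proj₁ P)

  SameSub : ∀ {n k} → Sub n k → Sub n k → Set (c ⊔ ℓ)
  SameSub {n} π π' = ∀ (P : Point n) → (P ∈S π → P ∈S π') × (P ∈S π' → P ∈S π)

  two : ∀ {n} → V n → V n → Fin 2 → V n
  two u v zero = u
  two u v (suc zero) = v

  three : ∀ {n} → V n → V n → V n → Fin 3 → V n
  three u v w zero = u
  three u v w (suc zero) = v
  three u v w (suc (suc zero)) = w

  OnLine : ∀ {n} → Point n → Point n → Point n → Set (c ⊔ ℓ)
  OnLine A B P = InSpan (two (proj₁ A) (proj₁ B)) (proj₁ P)

  NonCollinear : ∀ {n} → Point n → Point n → Point n → Set (c ⊔ ℓ)
  NonCollinear A B C = Indep (three (proj₁ A) (proj₁ B) (proj₁ C))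

  -- ternary quadratic forms given by symmetric 3x3 matrices (q odd)
  M3 : Set c
  M3 = Fin 3 → Fin 3 → Carrier

  f0 f1 f2 : Fin 3
  f0 = zero
  f1 = suc zero
  f2 = suc (suc zero)

  det3 : M3 → Carrier
  det3 M =
      (M f0 f0 * (M f1 f1 * M f2 f2 - M f1 f2 * M f2 f1)
    - M f0 f1 * (M f1 f0 * M f2 f2 - M f1 f2 * M f2 f0))
    + M f0 f2 * (M f1 f0 * M f2 f1 - M f1 f1 * M f2 f0)

  Symmetric : M3 → Set ℓ
  Symmetric M = ∀ i j → M i j ≈ M j i

  NonDegenerate : M3 → Set ℓ
  NonDegenerate M = Symmetric M × ¬ (det3 M ≈ 0#)

  Qform : M3 → V 3 → Carrier
  Qform M x = sumF (λ i → sumF (λ j → x i * M i j * x j))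

  OnConicIn : ∀ {n} → Sub n 3 → M3 → Point n → Set (c ⊔ ℓ)
  OnConicIn π M P = ∃ λ x → (proj₁ P ≈v combo x (basis π)) × (Qform M x ≈ 0#)

  IsConicIn : ∀ {n} {a} → Sub n 3 → (Point n → Set a) → Set (c ⊔ ℓ ⊔ a)
  IsConicIn {n} π S = ∃ λ M → NonDegenerate M ×
    (∀ (P : Point n) → (S P → OnConicIn π M P) × (OnConicIn π M P → S P))

  -- PG(2,R): points and lines are nonzero vectors of R^3 up to scalars,
  -- incidence is vanishing of the dot product
  IsConicPG2 : ∀ {a} → (Point 3 → Set a) → Set (c ⊔ ℓ ⊔ a)
  IsConicPG2 S = ∃ λ M → NonDegenerate M ×
    (∀ (P : Point 3) → (S P → Qform M (proj₁ P) ≈ 0#) × (Qform M (proj₁ P) ≈ 0# → S P))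

module Config {c ℓ} (F : CommutativeRing c ℓ) (q : ℕ) (h : LinAlg.V F 5) where
  open CommutativeRing F using (_≈_; 0#)
  open LinAlg F

  Pt : Set (c ⊔ ℓ)
  Pt = Point 5

  Plane : Set (c ⊔ ℓ)
  Plane = Sub 5 3

  InfP : Pt → Set ℓ
  InfP P = dot h (proj₁ P) ≈ 0#

  Affine : Pt → Set ℓ
  Affine P = ¬ InfP P

  AffinePlane : Plane → Set (c ⊔ ℓ)
  AffinePlane π = ¬ (∀ P → P ∈S π → InfP P)

  record Hyp : Set (lsuc (c ⊔ ℓ)) where
    field
      C : Fin (q *ℕ q) → Pt
      C-affine : ∀ i → Affine (C i)
      C-distinct : ∀ i j → Same (C i) (C j) → i ≡ j
      CP : Plane → Set (c ⊔ ℓ)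
      CP-affine : ∀ π → CP π → AffinePlane π
      A1-arc : ∀ π → CP π →
        HasExactly q (λ i → C i ∈S π) ×
        (∀ i j k → C i ∈S π → C j ∈S π → C k ∈S π → i ≢ j → j ≢ k → i ≢ k →
           NonCollinear (C i) (C j) (C k))
      A1-five : ∀ π → AtLeast 5 (λ i → C i ∈S π) → CP π
      A2 : ∀ i j → i ≢ j →
        (∃ λ π → CP π × C i ∈S π × C j ∈S π) ×
        (∀ π π' → CP π → CP π' → C i ∈S π → C j ∈S π → C i ∈S π' → C j ∈S π' →
           SameSub π π')
      A3 : ∀ P → Affine P →
        (∃ λ i → Same P (C i)) ⊎
        (∀ π → CP π → ¬ (P ∈S π)) ⊎
        (∃₂ λ π₁ π₂ → CP π₁ × CP π₂ × ¬ SameSub π₁ π₂ × P ∈S π₁ × P ∈S π₂ ×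
           (∀ π → CP π → P ∈S π → SameSub π π₁ ⊎ SameSub π π₂))

  module Derived (H : Hyp) where
    open Hyp H

    ConicSet : Plane → Pt → Pt → Set (c ⊔ ℓ)
    ConicSet π X P = (∃ λ i → Same P (C i) × C i ∈S π) ⊎ Same P X

    InftyPointOf : Plane → Pt → Set (c ⊔ ℓ)
    InftyPointOf π X = InfP X × X ∈S π × IsConicIn π (ConicSet π X)

    IsAπ : Fin (q *ℕ q) → Plane → Pt → Set (c ⊔ ℓ)
    IsAπ i π T = CP π × C i ∈S π × InfP T × T ∈S π ×
      (∃ λ X → InftyPointOf π X ×
        (∀ P → OnLine (C i) T P → ConicSet π X P → Same P (C i)))

    tA : Fin (q *ℕ q) → Pt → Set (c ⊔ ℓ)
    tA i T = ∃ λ π → IsAπ i π T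

    InftyPoint : Pt → Set (c ⊔ ℓ)
    InftyPoint T = ∃ λ π → CP π × InftyPointOf π T

    ZeroPoint : Pt → Set (c ⊔ ℓ)
    ZeroPoint T = InfP T × (∀ π → CP π → ¬ (T ∈S π))

    t∞ : Pt → Set (c ⊔ ℓ)
    t∞ T = InftyPoint T ⊎ ZeroPoint T

    SIdx : Set
    SIdx = Fin (q *ℕ q) ⊎ ⊤

    tS : SIdx → Pt → Set (c ⊔ ℓ)
    tS (inj₁ i) = tA i
    tS (inj₂ _) = t∞

    SameT : SIdx → SIdx → Set (c ⊔ ℓ)
    SameT s s' = ∀ T → (tS s T → tS s' T) × (tS s' T → tS s T)

    PtBB : Set (c ⊔ ℓ)
    PtBB = (Σ Pt Affine) ⊎ SIdx

    EqPt : PtBB → PtBB → Set (c ⊔ ℓ)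
    EqPt (inj₁ (P , _)) (inj₁ (Q , _)) = Same P Q
    EqPt (inj₂ s) (inj₂ s') = SameT s s'
    EqPt _ _ = ⊥

    MeetsInfIn : Plane → SIdx → Set (c ⊔ ℓ)
    MeetsInfIn π s = ∀ T → InfP T →
      (T ∈S π → tS s T) × (tS s T → T ∈S π)

    LnBB : Set (c ⊔ ℓ)
    LnBB = (Σ Plane λ π → AffinePlane π × ∃ λ s → MeetsInfIn π s) ⊎ ⊤ {c ⊔ ℓ}

    EqLn : LnBB → LnBB → Set (c ⊔ ℓ)
    EqLn (inj₁ (π , _)) (inj₁ (π' , _)) = SameSub π π'
    EqLn (inj₂ _) (inj₂ _) = ⊤
    EqLn _ _ = ⊥

    IncBB : PtBB → LnBB → Set (c ⊔ ℓ)
    IncBB (inj₁ (P , _)) (inj₁ (π , _)) = P ∈S π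
    IncBB (inj₁ _) (inj₂ _) = ⊥
    IncBB (inj₂ s) (inj₁ (π , _)) = ∀ T → tS s T → T ∈S π
    IncBB (inj₂ s) (inj₂ _) = ⊤

    CsetBB : PtBB → Set (c ⊔ ℓ)
    CsetBB (inj₁ (P , _)) = ∃ λ i → Same P (C i)
    CsetBB (inj₂ (inj₁ _)) = ⊥
    CsetBB (inj₂ (inj₂ _)) = ⊤

    T∞ : PtBB
    T∞ = inj₂ (inj₂ tt)

    record IsoPG2 {k m} (K : CommutativeRing k m) : Set (c ⊔ ℓ ⊔ k ⊔ m) where
      module LK = LinAlg K
      field
        fP : PtBB → LK.Point 3
        fL : LnBB → LK.Point 3
        fP-eq : ∀ p p' → (EqPt p p' → LK.Same (fP p) (fP p')) × (LK.Same (fP p) (fP p') → EqPt p p')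
        fP-onto : ∀ x → ∃ λ p → LK.Same (fP p) x
        fL-eq : ∀ l l' → (EqLn l l' → LK.Same (fL l) (fL l')) × (LK.Same (fL l) (fL l') → EqLn l l')
        fL-onto : ∀ x → ∃ λ l → LK.Same (fL l) x
        f-inc : ∀ p l →
          (IncBB p l → CommutativeRing._≈_ K (LK.dot (proj₁ (fL l)) (proj₁ (fP p))) (CommutativeRing.0# K)) ×
          (CommutativeRing._≈_ K (LK.dot (proj₁ (fL l)) (proj₁ (fP p))) (CommutativeRing.0# K) → IncBB p l)

    Conclusion : ∀ k m → Set (c ⊔ ℓ ⊔ lsuc (k ⊔ m))
    Conclusion k m = (K : CommutativeRing k m) → LinAlg.IsField K → LinAlg.HasCard K (q *ℕ q) →
      Σ (IsoPG2 K) λ φ →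
        LinAlg.IsConicPG2 K (λ x → ∃ λ p → CsetBB p × LinAlg.Same K (IsoPG2.fP φ p) x)

{-# OPTIONS --safe #-}
-- Counting with (A1)-(A3) the points of a C-plane π off C shows that all affine lines of π through
-- some point d at infinity, the axis of π, lie on a second C-plane. Projecting from d turns the
-- C-planes through d into the two rulings of a hyperbolic paraboloid, so C projects onto z = xy. A
-- C-plane not through d then supplies the fifth coordinate: C consists of the points
-- (1, x, y, xy, y² + εx²), where ε is a nonsquare by (A3). With Z = y + x√ε this is the conic of the
-- points (1, Z, Z²) over F(√ε), which is isomorphic to K because both have q² elements. The C-planes
-- lie over the F-lines Z + F D of K, with tangent direction (0, D, 2ZD) at Z; for varying D these
-- directions fill the K-line of (0, 1, 2Z), so the spread consists of K-lines and the Bruck-Bose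
-- plane is the plane over K.
module Submission where

open import Defs
open import Algebra.Bundles using (CommutativeRing; CommutativeMonoid)
import Algebra.Properties.CommutativeMonoid.Sum
import Algebra.Properties.CommutativeSemigroup
import Algebra.Properties.Ring
import Algebra.Properties.Semiring.Mult
open import Data.Empty using (⊥; ⊥-elim)
open import Data.Fin using (Fin; zero; suc; punchIn; punchOut; remQuot; combine; fromℕ<; inject≤; toℕ; finToFun; funToFin)
open import Data.Fin.Permutation using (Permutation; permutation)
open import Data.Fin.Properties using (any?; all?; ¬∀⟶∃¬; punchIn-punchOut; punchOut-injective; <⇒notInjective; remQuot-combine; combine-remQuot; inject≤-injective; punchInᵢ≢i; toℕ-fromℕ<; toℕ<n; finToFun-funToFin) renaming (_≟_ to _≟ᶠ_)
open import Data.Nat as ℕ using (ℕ; zero; suc; _≤_; _<_; s≤s; z≤n)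
open import Data.Nat.Coprimality using (prime⇒coprime; coprime-Bézout)
open import Data.Nat.DivMod using (_%_; _/_; m≡m%n+[m/n]*n; m%n<n)
open import Data.Nat.Divisibility using (_∣_; divides; m%n≡0⇒n∣m)
open import Data.Nat.GCD using (module Bézout)
open import Data.Nat.Primality using (Prime; prime⇒nonZero)
import Data.Nat.Properties as ℕ
open import Data.Product using (∃; _×_; _,_; proj₁; proj₂; Σ; ∃₂; uncurry)
open import Data.Sum using (_⊎_; inj₁; inj₂; [_,_])
open import Data.Vec.Properties using (tabulate-cong; tabulate∘lookup)
open import Function using (_∘_; id; Injective; case_of_)
open import Level using (Level; _⊔_; Lift; lift)
open import Relation.Binary.PropositionalEquality as ≡ using (_≡_; _≢_)
import Relation.Binary.Reasoning.Setoid
open import Relation.Nullary using (¬_; Dec; yes; no)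
open import Relation.Nullary.Decidable using (map′; ¬?; decidable-stable; _×-dec_; _→-dec_)

-- By (A3) a point `v` of a C-plane `π` off C lies on exactly one further C-plane, which meets the
-- affine part of `π` in `v` alone (`v` is isolated) or in a line, whose direction is an axis of
-- `π`. The further plane of an isolated point misses `π` in C; as through a point of C off `π`
-- there is at most one C-plane missing `π`, isolated points inject into the points of any other
-- C-plane that meets `π` in C. So `π` has fewer than `q` isolated points, too few to fill two
-- lines, and this forces axes to exist and to be parallel. An obstacle to the rulings is that
-- planes of PG(4, q) usually meet in one point only; it is overcome by showing that no solid
-- contains three C-planes, so that C-planes meeting a third one in distinct parallel lines are
-- disjoint. The constant `ε` is the product of the slopes of two C-planes through one point of C
-- that share a vertical direction. Since `K` is an arbitrary field with `q²` elements, the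
-- uniqueness of finite fields is proved as well: a partial homomorphism from F(√ε) to `K`, given by
-- its finite graph, is extended by one element at a time.

-- Ring identities by normalisation of polynomials.

module Solver where
  open import Data.Bool using (Bool; true; false; T; _∧_; if_then_else_)
  open import Data.List using (List; []; _∷_)
  open import Data.Nat using (_<ᵇ_; _≡ᵇ_) renaming (_+_ to _+ℕ_; _*_ to _*ℕ_)
  open import Data.Unit using (tt)
  open import Data.Vec using (Vec; []; _∷_)
  open import Data.Vec.N-ary using (N-ary; _$ⁿ_; ∀ⁿ; curryⁿ)

  infixl 6 _:+_ _:-_
  infixl 7 _:*_
  infix 8 :-_
  infix 4 _⊜_

  data Expr : Set where
    var : ℕ → Expr
    :0 :1 : Expr
    _:+_ _:*_ _:-_ : Expr → Expr → Expr
    :-_ : Expr → Expr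

  _⊜_ : Expr → Expr → Expr × Expr
  _⊜_ = _,_

  Mono Poly : Set
  Mono = List ℕ
  Poly = List ((ℕ × ℕ) × Mono)

  -- `lt` and `gt` carry no evidence: soundness only needs to know when two monomials are equal, and
  -- an inadequate order could at worst make the solver reject a true identity.
  data Cmp (m m' : Mono) : Set where
    lt gt : Cmp m m'
    eq : m ≡ m' → Cmp m m'

  cmp : ∀ m m' → Cmp m m'
  cmp [] [] = eq ≡.refl
  cmp [] (_ ∷ _) = lt
  cmp (_ ∷ _) [] = gt
  cmp (i ∷ m) (j ∷ m') with i ℕ.≟ j
  ... | no _ = if i <ᵇ j then lt else gt
  ... | yes ≡.refl with cmp m m'
  ... | lt = lt
  ... | gt = gt
  ... | eq ≡.refl = eq ≡.refl

  insertTerm : ℕ × ℕ → Mono → Poly → Poly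
  insertTerm a m [] = (a , m) ∷ []
  insertTerm a m ((b , m') ∷ p) with cmp m m'
  ... | lt = (a , m) ∷ (b , m') ∷ p
  ... | gt = (b , m') ∷ insertTerm a m p
  ... | eq _ = ((proj₁ a +ℕ proj₁ b , proj₂ a +ℕ proj₂ b) , m') ∷ p

  addPoly : Poly → Poly → Poly
  addPoly [] p = p
  addPoly ((a , m) ∷ p) p' = insertTerm a m (addPoly p p')

  insertVar : ℕ → Mono → Mono
  insertVar i [] = i ∷ []
  insertVar i (j ∷ m) = if i <ᵇ j then i ∷ j ∷ m else j ∷ insertVar i m

  mulMono : Mono → Mono → Mono
  mulMono [] m = m
  mulMono (i ∷ m) m' = insertVar i (mulMono m m')

  -- A coefficient (a , b) stands for a - b.
  mulCoef : ℕ × ℕ → ℕ × ℕ → ℕ × ℕ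
  mulCoef (a , b) (a' , b') = a *ℕ a' +ℕ b *ℕ b' , a *ℕ b' +ℕ b *ℕ a'

  mulTerm : ℕ × ℕ → Mono → Poly → Poly
  mulTerm a m [] = []
  mulTerm a m ((b , m') ∷ p) = insertTerm (mulCoef a b) (mulMono m m') (mulTerm a m p)

  mulPoly : Poly → Poly → Poly
  mulPoly [] p = []
  mulPoly ((a , m) ∷ p) p' = addPoly (mulTerm a m p') (mulPoly p p')

  negPoly : Poly → Poly
  negPoly = mulTerm (0 , 1) []

  norm : Expr → Poly
  norm (var i) = ((1 , 0) , i ∷ []) ∷ []
  norm :0 = []
  norm :1 = ((1 , 0) , []) ∷ []
  norm (e :+ f) = addPoly (norm e) (norm f)
  norm (e :* f) = mulPoly (norm e) (norm f)
  norm (e :- f) = addPoly (norm e) (negPoly (norm f))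
  norm (:- e) = negPoly (norm e)

  -- Terms that cancel are kept by `insertTerm`, so the zero polynomial is recognised by `a = b` in
  -- every coefficient `a - b`. The test is one over the integers, hence valid in every
  -- characteristic.
  isZero : Poly → Bool
  isZero [] = true
  isZero (((a , b) , _) ∷ p) = (a ≡ᵇ b) ∧ isZero p

  vars : ∀ k n → Vec Expr n
  vars k zero = []
  vars k (suc n) = var k ∷ vars (suc k) n

  module RingSolver {c ℓ} (R : CommutativeRing c ℓ) where
    open CommutativeRing R
    open Algebra.Properties.Ring ring
    open Algebra.Properties.Semiring.Mult semiring
      using (×-homo-+; ×1-homo-*; ×-congˡ) renaming (_×_ to _·_)
    open Relation.Binary.Reasoning.Setoid setoid
    private
      module +S = Algebra.Properties.CommutativeSemigroup +-commutativeSemigroup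
      module *S = Algebra.Properties.CommutativeSemigroup *-commutativeSemigroup

    env : ∀ {n} → Vec Carrier n → ℕ → Carrier
    env [] _ = 0#
    env (x ∷ ρ) zero = x
    env (x ∷ ρ) (suc i) = env ρ i

    ⟦_⟧ : Expr → (ℕ → Carrier) → Carrier
    ⟦ var i ⟧ ρ = ρ i
    ⟦ :0 ⟧ ρ = 0#
    ⟦ :1 ⟧ ρ = 1#
    ⟦ e :+ f ⟧ ρ = ⟦ e ⟧ ρ + ⟦ f ⟧ ρ
    ⟦ e :* f ⟧ ρ = ⟦ e ⟧ ρ * ⟦ f ⟧ ρ
    ⟦ e :- f ⟧ ρ = ⟦ e ⟧ ρ - ⟦ f ⟧ ρ
    ⟦ :- e ⟧ ρ = - ⟦ e ⟧ ρ

    private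
      module _ (ρ : ℕ → Carrier) where

        coef : ℕ × ℕ → Carrier
        coef (a , b) = a · 1# - b · 1#

        mono : Mono → Carrier
        mono [] = 1#
        mono (i ∷ m) = ρ i * mono m

        poly : Poly → Carrier
        poly [] = 0#
        poly ((a , m) ∷ p) = coef a * mono m + poly p

        coef-+ : ∀ a b → coef (proj₁ a +ℕ proj₁ b , proj₂ a +ℕ proj₂ b) ≈ coef a + coef b
        coef-+ (a , b) (a' , b') = begin
          (a +ℕ a') · 1# - (b +ℕ b') · 1#
            ≈⟨ +-cong (×-homo-+ 1# a a') (-‿cong (×-homo-+ 1# b b')) ⟩
          (a · 1# + a' · 1#) - (b · 1# + b' · 1#)  ≈⟨ +-congˡ (-‿+-comm _ _) ⟨
          (a · 1# + a' · 1#) + (- (b · 1#) - b' · 1#)  ≈⟨ +S.interchange _ _ _ _ ⟩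
          coef (a , b) + coef (a' , b')  ∎

        coef-* : ∀ a b → coef (mulCoef a b) ≈ coef a * coef b
        coef-* (a , b) (a' , b') = begin
          coef (mulCoef (a , b) (a' , b'))  ≈⟨ coef-+ (a *ℕ a' , a *ℕ b') (b *ℕ b' , b *ℕ a') ⟩
          coef (a *ℕ a' , a *ℕ b') + coef (b *ℕ b' , b *ℕ a')
            ≈⟨ +-cong (+-cong (×1-homo-* a a') (-‿cong (×1-homo-* a b')))
                      (+-cong (×1-homo-* b b') (-‿cong (×1-homo-* b a'))) ⟩
          (A * A' - A * B') + (B * B' - B * A')
            ≈⟨ +-cong (x[y-z]≈xy-xz A A' B') (x[y-z]≈xy-xz B B' A') ⟨
          A * (A' - B') + B * (B' - A')  ≈⟨ +-congˡ (*-congˡ (⁻¹-anti-homo‿- A' B')) ⟨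
          A * (A' - B') + B * - (A' - B')  ≈⟨ +-congˡ (-‿distribʳ-* B _) ⟨
          A * (A' - B') - B * (A' - B')  ≈⟨ [y-z]x≈yx-zx (A' - B') A B ⟨
          (A - B) * (A' - B') ∎
          where
          A = a · 1#
          B = b · 1#
          A' = a' · 1#
          B' = b' · 1#

        insertTerm-sound : ∀ a m p → poly (insertTerm a m p) ≈ coef a * mono m + poly p
        insertTerm-sound a m [] = refl
        insertTerm-sound a m ((b , m') ∷ p) with cmp m m'
        ... | lt = refl
        ... | gt = trans (+-congˡ (insertTerm-sound a m p)) (+S.x∙yz≈y∙xz _ _ _)
        ... | eq ≡.refl = trans (+-congʳ (trans (*-congʳ (coef-+ a b)) (distribʳ _ _ _))) (+-assoc _ _ _)

        addPoly-sound : ∀ p p' → poly (addPoly p p') ≈ poly p + poly p'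
        addPoly-sound [] p' = sym (+-identityˡ _)
        addPoly-sound ((a , m) ∷ p) p' = begin
          _  ≈⟨ insertTerm-sound a m (addPoly p p') ⟩
          _  ≈⟨ +-congˡ (addPoly-sound p p') ⟩
          _  ≈⟨ +-assoc _ _ _ ⟨
          _  ∎

        insertVar-sound : ∀ i m → mono (insertVar i m) ≈ ρ i * mono m
        insertVar-sound i [] = refl
        insertVar-sound i (j ∷ m) with i <ᵇ j
        ... | true = refl
        ... | false = trans (*-congˡ (insertVar-sound i m)) (*S.x∙yz≈y∙xz _ _ _)

        mulMono-sound : ∀ m m' → mono (mulMono m m') ≈ mono m * mono m'
        mulMono-sound [] m' = sym (*-identityˡ _)
        mulMono-sound (i ∷ m) m' = begin
          _  ≈⟨ insertVar-sound i (mulMono m m') ⟩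
          _  ≈⟨ *-congˡ (mulMono-sound m m') ⟩
          _  ≈⟨ *-assoc _ _ _ ⟨
          _  ∎

        mulTerm-sound : ∀ a m p → poly (mulTerm a m p) ≈ (coef a * mono m) * poly p
        mulTerm-sound a m [] = sym (zeroʳ _)
        mulTerm-sound a m ((b , m') ∷ p) = begin
          _  ≈⟨ insertTerm-sound (mulCoef a b) (mulMono m m') (mulTerm a m p) ⟩
          _  ≈⟨ +-cong (*-cong (coef-* a b) (mulMono-sound m m')) (mulTerm-sound a m p) ⟩
          _  ≈⟨ +-congʳ (*S.interchange _ _ _ _) ⟩
          _  ≈⟨ distribˡ _ _ _ ⟨
          _  ∎

        mulPoly-sound : ∀ p p' → poly (mulPoly p p') ≈ poly p * poly p'
        mulPoly-sound [] p' = sym (zeroˡ _)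
        mulPoly-sound ((a , m) ∷ p) p' = begin
          _  ≈⟨ addPoly-sound (mulTerm a m p') (mulPoly p p') ⟩
          _  ≈⟨ +-cong (mulTerm-sound a m p') (mulPoly-sound p p') ⟩
          _  ≈⟨ distribʳ _ _ _ ⟨
          _  ∎

        coef-1 : coef (1 , 0) ≈ 1#
        coef-1 = trans (+-cong (+-identityʳ 1#) -0#≈0#) (+-identityʳ 1#)

        negPoly-sound : ∀ p → poly (negPoly p) ≈ - poly p
        negPoly-sound p = begin
          _  ≈⟨ mulTerm-sound (0 , 1) [] p ⟩
          _  ≈⟨ *-congʳ (trans (*-identityʳ _) (trans (+-identityˡ _) (-‿cong (+-identityʳ 1#)))) ⟩
          _  ≈⟨ -1*x≈-x _ ⟩
          _  ∎

        norm-sound : ∀ e → poly (norm e) ≈ ⟦ e ⟧ ρ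
        norm-sound (var i) = trans (+-identityʳ _) (trans (*-cong coef-1 (*-identityʳ _)) (*-identityˡ _))
        norm-sound :0 = refl
        norm-sound :1 = trans (+-identityʳ _) (trans (*-identityʳ _) coef-1)
        norm-sound (e :+ f) = trans (addPoly-sound (norm e) (norm f)) (+-cong (norm-sound e) (norm-sound f))
        norm-sound (e :* f) = trans (mulPoly-sound (norm e) (norm f)) (*-cong (norm-sound e) (norm-sound f))
        norm-sound (e :- f) = trans (addPoly-sound (norm e) (negPoly (norm f)))
          (+-cong (norm-sound e) (trans (negPoly-sound (norm f)) (-‿cong (norm-sound f))))
        norm-sound (:- e) = trans (negPoly-sound (norm e)) (-‿cong (norm-sound e))

        isZero-sound : ∀ p → T (isZero p) → poly p ≈ 0#
        isZero-sound [] _ = refl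
        isZero-sound (((a , b) , m) ∷ p) z with a ≡ᵇ b in a≡b
        ... | true = trans (+-cong (trans (*-congʳ zeroCoef) (zeroˡ _)) (isZero-sound p z)) (+-identityʳ _)
          where
          zeroCoef : coef (a , b) ≈ 0#
          zeroCoef = trans (+-congʳ (×-congˡ (ℕ.≡ᵇ⇒≡ a b (≡.subst T (≡.sym a≡b) tt)))) (-‿inverseʳ _)

        equate : ∀ e f → T (isZero (norm (e :- f))) → ⟦ e ⟧ ρ ≈ ⟦ f ⟧ ρ
        equate e f z = x∙y⁻¹≈ε⇒x≈y _ _ (trans (sym (norm-sound (e :- f))) (isZero-sound (norm (e :- f)) z))

    forallN : ∀ n {P : Vec Carrier n → Set ℓ} → (∀ ρ → P ρ) → ∀ⁿ n (curryⁿ {n = n} P)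
    forallN zero f = f []
    forallN (suc n) f = λ x → forallN n (λ ρ → f (x ∷ ρ))

    -- The hidden argument is a computed truth value: if the difference normalises to zero it
    -- reduces to the unit type and is inferred, otherwise the call is rejected.
    solve : ∀ n (f : N-ary n Expr (Expr × Expr)) →
      let e = proj₁ (f $ⁿ vars 0 n) ; e' = proj₂ (f $ⁿ vars 0 n) in
      {_ : T (isZero (norm (e :- e')))} →
      ∀ⁿ n (curryⁿ {n = n} λ ρ → ⟦ e ⟧ (env ρ) ≈ ⟦ e' ⟧ (env ρ))
    solve n f {z} = forallN n λ ρ → equate (env ρ) (proj₁ (f $ⁿ vars 0 n)) (proj₂ (f $ⁿ vars 0 n)) z

open Solver using (Expr; :0; :1; _:+_; _:*_; _:-_; :-_; _⊜_; module RingSolver)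

-- Finite sums, dot products and spans.

module Sums {c ℓ} (R : CommutativeRing c ℓ) where
  open import Data.Vec.Functional using (_∷_)
  open CommutativeRing R hiding (zero)
  open LinAlg R
  open RingSolver R
  open Algebra.Properties.Ring ring public using (-0#≈0#; x∙y⁻¹≈ε⇒x≈y)
  open Relation.Binary.Reasoning.Setoid setoid

  opaque
    sumF-cong : ∀ k {f g : Fin k → Carrier} → (∀ i → f i ≈ g i) → sumF f ≈ sumF g
    sumF-cong zero f≈g = refl
    sumF-cong (suc k) f≈g = +-cong (f≈g zero) (sumF-cong k (f≈g ∘ suc))

  opaque
    sumF-0 : ∀ k {f : Fin k → Carrier} → (∀ i → f i ≈ 0#) → sumF f ≈ 0#
    sumF-0 zero f≈0 = refl
    sumF-0 (suc k) f≈0 = trans (+-cong (f≈0 zero) (sumF-0 k (f≈0 ∘ suc))) (+-identityʳ 0#)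

  opaque
    sumF-+ : ∀ k (f g : Fin k → Carrier) → sumF (λ i → f i + g i) ≈ sumF f + sumF g
    sumF-+ zero f g = sym (+-identityʳ 0#)
    sumF-+ (suc k) f g = trans (+-congˡ (sumF-+ k (f ∘ suc) (g ∘ suc)))
      (solve 4 (λ a b x y → a :+ b :+ (x :+ y) ⊜ a :+ x :+ (b :+ y)) _ _ _ _)

  opaque
    sumF-* : ∀ k a (f : Fin k → Carrier) → sumF (λ i → a * f i) ≈ a * sumF f
    sumF-* zero a f = sym (zeroʳ a)
    sumF-* (suc k) a f = trans (+-congˡ (sumF-* k a (f ∘ suc))) (sym (distribˡ a _ _))

  opaque
    sumF-comm : ∀ k m (f : Fin k → Fin m → Carrier) →
      sumF (λ i → sumF (f i)) ≈ sumF (λ j → sumF (λ i → f i j))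
    sumF-comm zero m f = sym (sumF-0 m (λ _ → refl))
    sumF-comm (suc k) m f = trans (+-congˡ (sumF-comm k m (f ∘ suc))) (sym (sumF-+ m (f zero) _))

  infixl 6 _+v_ _-v_
  infixl 7 _*v_

  _+v_ _-v_ : ∀ {n} → V n → V n → V n
  (u +v v) i = u i + v i
  (u -v v) i = u i - v i

  _*v_ : ∀ {n} → Carrier → V n → V n
  (a *v v) i = a * v i

  ≈v-sym : ∀ {n} {u v : V n} → u ≈v v → v ≈v u
  ≈v-sym u≈v i = sym (u≈v i)

  ≈v-trans : ∀ {n} {u v w : V n} → u ≈v v → v ≈v w → u ≈v w
  ≈v-trans u≈v v≈w i = trans (u≈v i) (v≈w i)

  opaque
    dot-congʳ : ∀ {n} (u : V n) {v w : V n} → v ≈v w → dot u v ≈ dot u w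
    dot-congʳ u v≈w = sumF-cong _ (λ i → *-congˡ (v≈w i))

  opaque
    dot-+ : ∀ {n} (u v w : V n) → dot u (v +v w) ≈ dot u v + dot u w
    dot-+ {n} u v w = trans (sumF-cong n (λ i → distribˡ (u i) (v i) (w i))) (sumF-+ n _ _)

  opaque
    dot-* : ∀ {n} (u : V n) a (v : V n) → dot u (a *v v) ≈ a * dot u v
    dot-* {n} u a v = trans
      (sumF-cong n (λ i → solve 3 (λ x a y → x :* (a :* y) ⊜ a :* (x :* y)) (u i) a (v i))) (sumF-* n a _)

  opaque
    dot-lin : ∀ {n} (u : V n) a (v : V n) b (w : V n) → dot u (a *v v +v b *v w) ≈ a * dot u v + b * dot u w
    dot-lin u a v b w = trans (dot-+ u _ _) (+-cong (dot-* u a v) (dot-* u b w))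

  opaque
    dot-0 : ∀ {n} (u : V n) → dot u zv ≈ 0#
    dot-0 {n} u = sumF-0 n (λ i → zeroʳ (u i))

  opaque
    dot-combo : ∀ {k n} (u : V n) (cs : Fin k → Carrier) (w : Fin k → V n) →
      dot u (combo cs w) ≈ sumF (λ j → cs j * dot u (w j))
    dot-combo {zero} u cs w = dot-0 u
    dot-combo {suc k} u cs w =
      trans (dot-+ u (cs zero *v w zero) _) (+-cong (dot-* u _ _) (dot-combo u (cs ∘ suc) (w ∘ suc)))

  opaque
    combo-lin : ∀ {k n} a (cs : Fin k → Carrier) b (ds : Fin k → Carrier) (w : Fin k → V n) →
      combo (λ j → a * cs j + b * ds j) w ≈v (a *v combo cs w +v b *v combo ds w)
    combo-lin {k} a cs b ds w i = begin
      sumF (λ j → (a * cs j + b * ds j) * w j i)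
        ≈⟨ sumF-cong k (λ j → solve 5 (λ a c b d w → (a :* c :+ b :* d) :* w ⊜ a :* (c :* w) :+ b :* (d :* w))
             a (cs j) b (ds j) (w j i)) ⟩
      sumF (λ j → a * (cs j * w j i) + b * (ds j * w j i))  ≈⟨ sumF-+ k _ _ ⟩
      _  ≈⟨ +-cong (sumF-* k a (λ j → cs j * w j i)) (sumF-* k b (λ j → ds j * w j i)) ⟩
      _ ∎

  opaque
    combo-cong : ∀ {k n} {cs ds : Fin k → Carrier} (w : Fin k → V n) →
      (∀ j → cs j ≈ ds j) → combo cs w ≈v combo ds w
    combo-cong {k} w cs≈ds i = sumF-cong k (λ j → *-congʳ (cs≈ds j))

  opaque
    span-lin : ∀ {k n} {w : Fin k → V n} {u v} a b → InSpan w u → InSpan w v → InSpan w (a *v u +v b *v v)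
    span-lin {w = w} a b (cs , p) (ds , q) =
      _ , λ i → trans (+-cong (*-congˡ (p i)) (*-congˡ (q i))) (sym (combo-lin a cs b ds w i))

  opaque
    span-resp : ∀ {k n} {w : Fin k → V n} {u v} → u ≈v v → InSpan w u → InSpan w v
    span-resp u≈v (cs , p) = cs , λ i → trans (sym (u≈v i)) (p i)

  opaque
    span-0 : ∀ {k n} {w : Fin k → V n} → InSpan w zv
    span-0 {k} {w = w} = (λ _ → 0#) , λ i → sym (sumF-0 k (λ j → zeroˡ (w j i)))

  opaque
    span-* : ∀ {k n} {w : Fin k → V n} {u} a → InSpan w u → InSpan w (a *v u)
    span-* a p = span-resp
      (λ i → solve 2 (λ a u → a :* u :+ :0 :* u ⊜ a :* u) a _) (span-lin a 0# p p)

  opaque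
    span-+ : ∀ {k n} {w : Fin k → V n} {u v} → InSpan w u → InSpan w v → InSpan w (u +v v)
    span-+ p q = span-resp (λ i → solve 2 (λ u v → :1 :* u :+ :1 :* v ⊜ u :+ v) _ _) (span-lin 1# 1# p q)

  opaque
    span-- : ∀ {k n} {w : Fin k → V n} {u v} → InSpan w u → InSpan w v → InSpan w (u -v v)
    span-- p q = span-resp (λ i → solve 2 (λ u v → :1 :* u :+ :- :1 :* v ⊜ u :- v) _ _) (span-lin 1# (- 1#) p q)

  opaque
    span-combo : ∀ {k m n} {w : Fin k → V n} (cs : Fin m → Carrier) {v : Fin m → V n} →
      (∀ j → InSpan w (v j)) → InSpan w (combo cs v)
    span-combo {m = zero} cs p = span-0
    span-combo {m = suc m} cs p = span-+ (span-* (cs zero) (p zero)) (span-combo (cs ∘ suc) (p ∘ suc))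

  opaque
    span-gen : ∀ {k n} {w : Fin k → V n} j → InSpan w (w j)
    span-gen {suc k} {w = w} zero = (1# ∷ λ _ → 0#) ,
      λ i → sym (trans (+-cong (*-identityˡ _) (sumF-0 k (λ j → zeroˡ (w (suc j) i)))) (+-identityʳ _))
    span-gen {suc k} {w = w} (suc j) with span-gen {w = w ∘ suc} j
    ... | cs , p = (0# ∷ cs) , λ i → trans (p i) (sym (trans (+-congʳ (zeroˡ _)) (+-identityˡ _)))

-- Linear algebra over a finite field.

module FieldLA {c ℓ} (R : CommutativeRing c ℓ) (isField : LinAlg.IsField R)
  {m : ℕ} (card : LinAlg.HasCard R m) where
  open import Data.Vec.Functional using ([]; _∷_; head; tail)
  open CommutativeRing R hiding (zero)
  open LinAlg R
  open Sums R public
  open RingSolver R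
  open Relation.Binary.Reasoning.Setoid setoid

  elem : Fin m → Carrier
  elem = proj₁ card

  elem-injective : ∀ i j → elem i ≈ elem j → i ≡ j
  elem-injective = proj₁ (proj₂ card)

  opaque
    index : Carrier → Fin m
    index x = proj₁ (proj₂ (proj₂ card) x)

    elem-index : ∀ x → elem (index x) ≈ x
    elem-index x = proj₂ (proj₂ (proj₂ card) x)

  opaque
    index-injective : ∀ {x y} → index x ≡ index y → x ≈ y
    index-injective {x} {y} p = trans (sym (elem-index x)) (trans (reflexive (≡.cong elem p)) (elem-index y))

  opaque
    index-cong : ∀ {x y} → x ≈ y → index x ≡ index y
    index-cong {x} {y} p = elem-injective _ _ (trans (elem-index x) (trans p (sym (elem-index y))))

  opaque
    _≟_ : ∀ x y → Dec (x ≈ y)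
    x ≟ y = map′ index-injective index-cong (index x ≟ᶠ index y)

  opaque
    1≉0 : ¬ 1# ≈ 0#
    1≉0 = proj₁ isField

  opaque
    recip : ∀ {x} → ¬ x ≈ 0# → Carrier
    recip x≉0 = proj₁ (proj₂ isField _ x≉0)

    *-recip : ∀ {x} (x≉0 : ¬ x ≈ 0#) → x * recip x≉0 ≈ 1#
    *-recip x≉0 = proj₂ (proj₂ isField _ x≉0)

  opaque
    recip-* : ∀ {x} (x≉0 : ¬ x ≈ 0#) → recip x≉0 * x ≈ 1#
    recip-* x≉0 = trans (*-comm _ _) (*-recip x≉0)

  opaque
    recip≉0 : ∀ {x} (x≉0 : ¬ x ≈ 0#) → ¬ recip x≉0 ≈ 0#
    recip≉0 {x} x≉0 p = 1≉0 (trans (sym (*-recip x≉0)) (trans (*-congˡ p) (zeroʳ x)))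

  opaque
    *-cancel-0 : ∀ {x y} → ¬ x ≈ 0# → x * y ≈ 0# → y ≈ 0#
    *-cancel-0 {x} {y} x≉0 xy≈0 = begin
      y  ≈⟨ *-identityˡ y ⟨
      1# * y  ≈⟨ *-congʳ (recip-* x≉0) ⟨
      recip x≉0 * x * y  ≈⟨ *-assoc _ _ _ ⟩
      recip x≉0 * (x * y)  ≈⟨ *-congˡ xy≈0 ⟩
      recip x≉0 * 0#  ≈⟨ zeroʳ _ ⟩
      0# ∎

  opaque
    *-≉0 : ∀ {x y} → ¬ x ≈ 0# → ¬ y ≈ 0# → ¬ x * y ≈ 0#
    *-≉0 x≉0 y≉0 xy≈0 = y≉0 (*-cancel-0 x≉0 xy≈0)

  opaque
    zero-product : ∀ x y → x * y ≈ 0# → x ≈ 0# ⊎ y ≈ 0#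
    zero-product x y xy≈0 with x ≟ 0#
    ... | yes x≈0 = inj₁ x≈0
    ... | no x≉0 = inj₂ (*-cancel-0 x≉0 xy≈0)

  opaque
    -≉0 : ∀ {x y} → ¬ x ≈ y → ¬ x - y ≈ 0#
    -≉0 x≉y p = x≉y (x∙y⁻¹≈ε⇒x≈y _ _ p)

  opaque
    -- Exhaustive search through the enumeration; `P` must respect `≈` because an arbitrary witness
    -- is replaced by its listed representative.
    anyF? : ∀ {p} {P : Carrier → Set p} → (∀ {x y} → x ≈ y → P x → P y) →
      (∀ x → Dec (P x)) → Dec (∃ P)
    anyF? resp P? = map′ (λ (i , p) → elem i , p) (λ (x , p) → index x , resp (sym (elem-index x)) p)
      (any? (λ i → P? (elem i)))

  opaque
    anyV? : ∀ {n p} {P : V n → Set p} → (∀ {u v} → u ≈v v → P u → P v) →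
      (∀ v → Dec (P v)) → Dec (∃ P)
    anyV? {zero} resp P? = map′ (λ p → [] , p) (λ (v , p) → resp (λ ()) p) (P? [])
    anyV? {suc n} {P = P} resp P? =
      map′ (λ (x , v , p) → (x ∷ v) , p)
           (λ (v , p) → head v , tail v , resp (λ { zero → refl ; (suc i) → refl }) p)
           (anyF? {P = λ x → ∃ λ v → P (x ∷ v)}
             (λ x≈y (v , p) → v , resp (λ { zero → x≈y ; (suc i) → refl }) p)
             (λ x → anyV? (λ u≈v → resp (λ { zero → refl ; (suc i) → u≈v i })) (λ v → P? (x ∷ v))))

  opaque
    _≟v_ : ∀ {n} (u v : V n) → Dec (u ≈v v)
    u ≟v v = all? (λ i → u i ≟ v i)

  opaque
    nonZero-entry : ∀ {n} {v : V n} → NonZero v → ∃ λ i → ¬ v i ≈ 0#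
    nonZero-entry {v = v} v≉0 = ¬∀⟶∃¬ _ _ (λ i → v i ≟ 0#) v≉0

  opaque
    inSpan? : ∀ {k n} (w : Fin k → V n) v → Dec (InSpan w v)
    inSpan? w v = anyV? (λ cs≈ds p → ≈v-trans p (combo-cong w cs≈ds)) (λ cs → v ≟v combo cs w)

  opaque
    -- Gaussian elimination: if the first column vanishes, the first unit vector is a solution;
    -- otherwise a pivot row removes the first unknown from the other rows, and the pivot equation
    -- then determines it.
    kernel : ∀ k (a : Fin k → V (suc k)) → ∃ λ x → NonZero x × (∀ i → dot (a i) x ≈ 0#)
    kernel zero a = (λ _ → 1#) , (λ p → 1≉0 (p zero)) , λ ()
    kernel (suc k) a with any? (λ i → ¬? (a i zero ≟ 0#))
    ... | no none = (1# ∷ λ _ → 0#) , (λ p → 1≉0 (p zero)) ,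
        λ i → trans (+-cong (trans (*-identityʳ _) (decidable-stable (a i zero ≟ 0#) (λ q → none (i , q))))
                            (sumF-0 (suc k) (λ j → zeroʳ (a i (suc j))))) (+-identityʳ _)
    ... | yes (i , p≉0) = (x₀ ∷ x) , (λ p → x≉0 (p ∘ suc)) , eqs
      where
      ratio : Fin k → Carrier
      ratio l = a (punchIn i l) zero * recip p≉0
      reduced : Fin k → V (suc k)
      reduced l = 1# *v tail (a (punchIn i l)) +v (- ratio l) *v tail (a i)
      x : V (suc k)
      x = proj₁ (kernel k reduced)
      x≉0 : NonZero x
      x≉0 = proj₁ (proj₂ (kernel k reduced))
      s x₀ : Carrier
      s = dot (tail (a i)) x
      x₀ = - (recip p≉0 * s)
      comm : ∀ {n} (u v : V n) → dot u v ≈ dot v u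
      comm {n} u v = sumF-cong n (λ j → *-comm (u j) (v j))
      reducedEq : ∀ l → dot (tail (a (punchIn i l))) x - ratio l * s ≈ 0#
      reducedEq l = begin
        dot (tail (a (punchIn i l))) x - ratio l * s
          ≈⟨ +-cong (comm (tail (a (punchIn i l))) x) (-‿cong (*-congˡ (comm (tail (a i)) x))) ⟩
        dot x (tail (a (punchIn i l))) - ratio l * dot x (tail (a i))
          ≈⟨ solve 3 (λ r t s → t :- r :* s ⊜ :1 :* t :+ (:- r) :* s) (ratio l) _ _ ⟩
        _  ≈⟨ dot-lin x 1# (tail (a (punchIn i l))) (- ratio l) (tail (a i)) ⟨
        dot x (reduced l)  ≈⟨ comm x (reduced l) ⟩
        dot (reduced l) x  ≈⟨ proj₂ (proj₂ (kernel k reduced)) l ⟩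
        0# ∎
      eqs : ∀ j → dot (a j) (x₀ ∷ x) ≈ 0#
      eqs j with i ≟ᶠ j
      ... | yes ≡.refl = begin
        a i zero * - (recip p≉0 * s) + s
          ≈⟨ solve 3 (λ p r s → p :* (:- (r :* s)) :+ s ⊜ (:1 :- p :* r) :* s) (a i zero) (recip p≉0) s ⟩
        (1# - a i zero * recip p≉0) * s  ≈⟨ *-congʳ (+-congˡ (-‿cong (*-recip p≉0))) ⟩
        (1# - 1#) * s  ≈⟨ solve 1 (λ s → (:1 :- :1) :* s ⊜ :0) s ⟩
        0# ∎
      ... | no i≢j = ≡.subst (λ j → dot (a j) (x₀ ∷ x) ≈ 0#) (punchIn-punchOut i≢j) (begin
        a (punchIn i l) zero * - (recip p≉0 * s) + t
          ≈⟨ solve 4 (λ p r s t → p :* (:- (r :* s)) :+ t ⊜ t :- p :* r :* s) (a (punchIn i l) zero) (recip p≉0) s t ⟩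
        t - ratio l * s  ≈⟨ reducedEq l ⟩
        0# ∎)
        where
        l : Fin k
        l = punchOut i≢j
        t : Carrier
        t = dot (tail (a (punchIn i l))) x

  opaque
    -- A relation has to cancel the coordinates with respect to `w`, which are `k` linear conditions
    -- on `suc k` coefficients.
    dependent : ∀ {k n} {w : Fin k → V n} {v : Fin (suc k) → V n} → (∀ j → InSpan w (v j)) →
      ∃ λ x → NonZero x × (combo x v ≈v zv)
    dependent {k} {n} {w} {v} v∈w = x , x≉0 , λ t → begin
      sumF (λ j → x j * v j t)  ≈⟨ sumF-cong (suc k) (λ j → *-congˡ {x j} (proj₂ (v∈w j) t)) ⟩
      sumF (λ j → x j * sumF (λ i → cs j i * w i t))  ≈⟨ sumF-cong (suc k) (λ j → sumF-* k (x j) (λ i → cs j i * w i t)) ⟨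
      sumF (λ j → sumF (λ i → x j * (cs j i * w i t)))  ≈⟨ sumF-comm (suc k) k (λ j i → x j * (cs j i * w i t)) ⟩
      sumF (λ i → sumF (λ j → x j * (cs j i * w i t)))
        ≈⟨ sumF-cong k (λ i → sumF-cong (suc k) (λ j →
             solve 3 (λ x c w → x :* (c :* w) ⊜ w :* (c :* x)) (x j) (cs j i) (w i t))) ⟩
      sumF (λ i → sumF (λ j → w i t * (cs j i * x j)))  ≈⟨ sumF-cong k (λ i → sumF-* (suc k) (w i t) (λ j → cs j i * x j)) ⟩
      sumF (λ i → w i t * dot (λ j → cs j i) x)
        ≈⟨ sumF-0 k (λ i → trans (*-congˡ (eqs i)) (zeroʳ _)) ⟩
      0# ∎
      where
      cs : Fin (suc k) → V k
      cs j = proj₁ (v∈w j)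
      x : V (suc k)
      x = proj₁ (kernel k (λ i j → cs j i))
      x≉0 : NonZero x
      x≉0 = proj₁ (proj₂ (kernel k (λ i j → cs j i)))
      eqs : ∀ i → dot (λ j → cs j i) x ≈ 0#
      eqs = proj₂ (proj₂ (kernel k (λ i j → cs j i)))

  unit : ∀ {n} → Fin n → V n
  unit zero zero = 1#
  unit zero (suc _) = 0#
  unit (suc i) zero = 0#
  unit (suc i) (suc j) = unit i j

  opaque
    unit-expand : ∀ {n} (v : V n) → v ≈v combo v unit
    unit-expand {suc n} v zero =
      sym (trans (+-cong (*-identityʳ _) (sumF-0 n (λ j → zeroʳ (v (suc j))))) (+-identityʳ _))
    unit-expand {suc n} v (suc i) =
      trans (unit-expand (tail v) i) (sym (trans (+-congʳ (zeroʳ _)) (+-identityˡ _)))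

  unit-span : ∀ {n} (v : V n) → InSpan unit v
  unit-span v = v , unit-expand v

  opaque
    -- In a dependency between `v` and the `p j` the coefficient of `v` cannot vanish, as the `p j`
    -- are independent; dividing by it expresses `v`.
    indep-spans : ∀ {k n} {w p : Fin k → V n} → Indep p → (∀ j → InSpan w (p j)) →
      ∀ {v} → InSpan w v → InSpan p v
    indep-spans {w = w} {p} p-indep p∈w {v} v∈w with dependent {w = w} {v = v ∷ p} (λ { zero → v∈w ; (suc j) → p∈w j })
    ... | x , x≉0 , rel with x zero ≟ 0#
    ... | yes x₀≈0 = ⊥-elim (x≉0 λ { zero → x₀≈0 ; (suc j) → p-indep (tail x) (λ t → trans (sym (trans
        (+-congʳ (trans (*-congʳ x₀≈0) (zeroˡ _))) (+-identityˡ _))) (rel t)) j })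
    ... | no x₀≉0 = span-resp
        (λ t → begin
          (- r) * combo (tail x) p t
            ≈⟨ solve 4 (λ r s x v → (:- r) :* s ⊜ r :* x :* v :- r :* (x :* v :+ s)) r _ (x zero) (v t) ⟩
          r * x zero * v t - r * combo x (v ∷ p) t
            ≈⟨ +-cong (*-congʳ (recip-* x₀≉0)) (-‿cong (*-congˡ (rel t))) ⟩
          1# * v t - r * 0#  ≈⟨ solve 2 (λ v r → :1 :* v :- r :* :0 ⊜ v) (v t) r ⟩
          v t ∎)
        (span-* (- r) (span-combo (tail x) (λ j → span-gen j)))
      where
      r : Carrier
      r = recip x₀≉0

  opaque
    indep-basis : ∀ {n} {p : Fin n → V n} → Indep p → ∀ v → InSpan p v
    indep-basis p-indep v = indep-spans p-indep (λ j → unit-span _) (unit-span v)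

  opaque
    annihilator : ∀ {k} (v : Fin k → V (suc k)) → ∃ λ φ → NonZero φ × (∀ j → dot φ (v j) ≈ 0#)
    annihilator {k} v = let φ , φ≉0 , eqs = kernel k v in
      φ , φ≉0 , λ j → trans (sumF-cong (suc k) (λ i → *-comm (φ i) (v j i))) (eqs j)

  opaque
    sumF-single : ∀ {k} (f : Fin k → Carrier) j → (∀ i → ¬ j ≡ i → f i ≈ 0#) → sumF f ≈ f j
    sumF-single {suc k} f zero f≈0 = trans (+-congˡ (sumF-0 k (λ i → f≈0 (suc i) (λ ())))) (+-identityʳ _)
    sumF-single f (suc j) f≈0 = trans (+-cong (f≈0 zero (λ ()))
      (sumF-single (f ∘ suc) j (λ i j≢i → f≈0 (suc i) (λ { ≡.refl → j≢i ≡.refl })))) (+-identityˡ _)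

  opaque
    -- Leave out a vector whose coefficient in the relation is nonzero: a form that kills the
    -- remaining ones kills it too.
    dependent-annihilator : ∀ {k} {b : Fin (suc k) → V (suc k)} x → NonZero x → combo x b ≈v zv →
      ∃ λ φ → NonZero φ × (∀ j → dot φ (b j) ≈ 0#)
    dependent-annihilator {b = b} x x≉0 rel with nonZero-entry x≉0
    ... | j , xⱼ≉0 with annihilator (b ∘ punchIn j)
    ... | φ , φ≉0 , kills = φ , φ≉0 , killsAll
      where
      others : ∀ i → ¬ j ≡ i → dot φ (b i) ≈ 0#
      others i j≢i = ≡.subst (λ i → dot φ (b i) ≈ 0#) (punchIn-punchOut j≢i) (kills (punchOut j≢i))
      killsAll : ∀ i → dot φ (b i) ≈ 0#
      killsAll i with j ≟ᶠ i
      ... | no j≢i = others i j≢i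
      ... | yes ≡.refl = *-cancel-0 xⱼ≉0 (begin
        x j * dot φ (b j)  ≈⟨ sumF-single (λ i → x i * dot φ (b i)) j
                                (λ i j≢i → trans (*-congˡ (others i j≢i)) (zeroʳ _)) ⟨
        sumF (λ i → x i * dot φ (b i))  ≈⟨ dot-combo φ x b ⟨
        dot φ (combo x b)  ≈⟨ dot-congʳ φ rel ⟩
        dot φ zv  ≈⟨ dot-0 φ ⟩
        0# ∎)

-- Counting in finite sets.

opaque
  injective⇒surjective : ∀ {n} (f : Fin n → Fin n) → Injective _≡_ _≡_ f → ∀ y → ∃ λ x → f x ≡ y
  injective⇒surjective {suc n} f inj y with any? (λ x → f x ≟ᶠ y)
  ... | yes hit = hit
  ... | no miss = ⊥-elim (<⇒notInjective {f = λ x → punchOut (y≢f x)} (ℕ.n<1+n n)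
    λ {x} {x'} e → inj (punchOut-injective (y≢f x) (y≢f x') e))
    where
    y≢f : ∀ x → y ≢ f x
    y≢f x e = miss (x , ≡.sym e)

opaque
  fresh : ∀ {k n} (f : Fin k → Fin n) → k < n → ∃ λ x → ∀ j → f j ≢ x
  fresh {k} {n} f k<n with any? (λ x → all? (λ j → ¬? (f j ≟ᶠ x)))
  ... | yes new = new
  ... | no none = ⊥-elim (<⇒notInjective {f = proj₁ ∘ source} k<n
    λ {x} {y} e → ≡.trans (≡.sym (proj₂ (source x))) (≡.trans (≡.cong f e) (proj₂ (source y))))
    where
    source : ∀ x → ∃ λ j → f j ≡ x
    source x with any? (λ j → f j ≟ᶠ x)
    ... | yes hit = hit
    ... | no miss = ⊥-elim (none (x , λ j e → miss (j , e)))

opaque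
  grid-surjective : ∀ {m n} (g : Fin m → Fin n → Fin (m ℕ.* n)) →
    (∀ {a b a' b'} → g a b ≡ g a' b' → a ≡ a' × b ≡ b') → ∀ y → ∃₂ λ a b → g a b ≡ y
  grid-surjective {m} {n} g inj y =
    let k , p = injective⇒surjective (uncurry g ∘ remQuot n) uncurried-injective y in
    proj₁ (remQuot {m} n k) , proj₂ (remQuot {m} n k) , p
    where
    uncurried-injective : Injective _≡_ _≡_ (uncurry g ∘ remQuot n)
    uncurried-injective {k} {k'} e with inj e
    ... | e₁ , e₂ = ≡.trans (≡.sym (combine-remQuot {m} n k))
      (≡.trans (≡.cong₂ combine e₁ e₂) (combine-remQuot {m} n k'))

opaque
  -- In the uses below each hole is a geometric condition that at most one object can meet, which
  -- makes a relation handier than a map.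
  pigeonhole-rel : ∀ {n m r} (R : Fin n → Fin m → Set r) → (∀ x → ∃ (R x)) →
    (∀ {x x' y} → R x y → R x' y → x ≡ x') → m < n → ⊥
  pigeonhole-rel R total inj m<n = <⇒notInjective {f = proj₁ ∘ total} m<n
    λ {x} {x'} e → inj (proj₂ (total x)) (≡.subst (R x') (≡.sym e) (proj₂ (total x')))

opaque
  all-or-any : ∀ {n p r} {P : Fin n → Set p} {Q : Fin n → Set r} → (∀ i → P i ⊎ Q i) → (∀ i → P i) ⊎ ∃ Q
  all-or-any {zero} f = inj₁ λ ()
  all-or-any {suc n} f with f zero | all-or-any (f ∘ suc)
  ... | inj₂ q | _ = inj₂ (zero , q)
  ... | _ | inj₂ (i , q) = inj₂ (suc i , q)
  ... | inj₁ p | inj₁ ps = inj₁ λ { zero → p ; (suc i) → ps i }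

record Setup c ℓ : Set (Level.suc (c ⊔ ℓ)) where
  field
    F : CommutativeRing c ℓ
    isField : LinAlg.IsField F
  open CommutativeRing F
  field
    {q} : ℕ
    card : LinAlg.HasCard F q
    7≤q : 7 ≤ q
    h : LinAlg.V F 5
    H : Config.Hyp F q h
    2≉0 : ¬ 1# + 1# ≈ 0#

-- C-planes: incidence and parallelism.

module CPlanes {c ℓ} (S : Setup c ℓ) where
  open import Data.Vec.Functional using ([]; _∷_)
  open Setup S
  open CommutativeRing F hiding (zero)
  open LinAlg F
  open FieldLA F isField card public
  open Config F q h
  open Hyp H
  open RingSolver F
  open Relation.Binary.Reasoning.Setoid setoid

  I : Set
  I = Fin (q ℕ.* q)

  CPlane : Set (c ⊔ ℓ)
  CPlane = Σ Plane CP

  infix 4 _∈_ _∈?_ _≃_ _≃?_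

  -- A record rather than a bare span condition, so that the vector and the plane can be recovered
  -- from the type of a membership proof. The zero vector belongs to every plane.
  record _∈_ (v : V 5) (π : CPlane) : Set (c ⊔ ℓ) where
    constructor spanned
    field span : InSpan (basis (proj₁ π)) v
  open _∈_ public

  record _≃_ (π σ : CPlane) : Set (c ⊔ ℓ) where
    constructor same
    field sameSub : SameSub (proj₁ π) (proj₁ σ)
  open _≃_ public

  opaque
    _∈?_ : ∀ v π → Dec (v ∈ π)
    v ∈? π = map′ spanned span (inSpan? (basis (proj₁ π)) v)

  gens : CPlane → Fin 3 → V 5
  gens π = basis (proj₁ π)

  opaque
    ∈-resp : ∀ {π u v} → u ≈v v → u ∈ π → v ∈ π
    ∈-resp {π} e (spanned p) = spanned (span-resp {w = gens π} e p)

  opaque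
    ∈-lin : ∀ {π u v} a b → u ∈ π → v ∈ π → (a *v u +v b *v v) ∈ π
    ∈-lin {π} a b (spanned p) (spanned r) = spanned (span-lin {w = gens π} a b p r)

  opaque
    ∈-+ : ∀ {π u v} → u ∈ π → v ∈ π → (u +v v) ∈ π
    ∈-+ {π} (spanned p) (spanned r) = spanned (span-+ {w = gens π} p r)

  opaque
    ∈-- : ∀ {π u v} → u ∈ π → v ∈ π → (u -v v) ∈ π
    ∈-- {π} (spanned p) (spanned r) = spanned (span-- {w = gens π} p r)

  opaque
    ∈-* : ∀ {π u} a → u ∈ π → (a *v u) ∈ π
    ∈-* {π} a (spanned p) = spanned (span-* {w = gens π} a p)

  opaque
    ∈-combo : ∀ {π k} {p : Fin k → V 5} → (∀ j → p j ∈ π) → ∀ {v} → InSpan p v → v ∈ π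
    ∈-combo {π} {p = p} p∈π (cs , e) =
      spanned (span-resp {w = gens π} (≈v-sym e) (span-combo {w = gens π} cs {p} (λ j → span (p∈π j))))

  opaque
    ∈-basis : ∀ {π} j → gens π j ∈ π
    ∈-basis {π} j = spanned (span-gen {w = gens π} j)

  opaque
    ∈-indep : ∀ {π} {p : Fin 3 → V 5} → Indep p → (∀ j → p j ∈ π) → ∀ {v} → v ∈ π → InSpan p v
    ∈-indep {π} {p} p-indep p∈π v∈π =
      indep-spans {w = gens π} {p} p-indep (λ j → span (p∈π j)) (span v∈π)

  opaque
    ≃-sym : ∀ {π σ} → π ≃ σ → σ ≃ π
    ≃-sym (same e) = same λ P → proj₂ (e P) , proj₁ (e P)

  opaque
    ≃-trans : ∀ {π σ τ} → π ≃ σ → σ ≃ τ → π ≃ τ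
    ≃-trans (same e) (same f) = same λ P → proj₁ (f P) ∘ proj₁ (e P) , proj₂ (e P) ∘ proj₂ (f P)

  opaque
    ≃-∈ : ∀ {π σ v} → π ≃ σ → v ∈ π → v ∈ σ
    ≃-∈ {π} {σ} {v} (same e) (spanned v∈π) with v ≟v zv
    ... | yes v≈0 = spanned (span-resp {w = basis (proj₁ σ)} (≈v-sym v≈0) (span-0 {w = basis (proj₁ σ)}))
    ... | no v≉0 = spanned (proj₁ (e (v , v≉0)) v∈π)

  opaque
    indep⇒≃ : ∀ {π σ} {p : Fin 3 → V 5} → Indep p → (∀ j → p j ∈ π) → (∀ j → p j ∈ σ) → π ≃ σ
    indep⇒≃ {π} {σ} {p} p-indep p∈π p∈σ = same λ P →
      (λ v∈π → span (∈-combo {σ} {p = p} p∈σ (∈-indep {π} p-indep p∈π (spanned v∈π)))) ,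
      (λ v∈σ → span (∈-combo {π} {p = p} p∈π (∈-indep {σ} p-indep p∈σ (spanned v∈σ))))

  opaque
    _≃?_ : ∀ π σ → Dec (π ≃ σ)
    π ≃? σ = map′ (indep⇒≃ (indep (proj₁ π)) (∈-basis {π})) (λ e j → ≃-∈ e (∈-basis {π} j))
      (all? (λ j → basis (proj₁ π) j ∈? σ))

  h-C≉0 : ∀ i → ¬ dot h (proj₁ (C i)) ≈ 0#
  h-C≉0 = C-affine

  scale : I → Carrier
  scale i = recip (h-C≉0 i)

  opaque
    -- The representative of `C i` on the affine hyperplane `dot h v = 1`: there equality of points
    -- is equality of vectors, and differences are directions at infinity.
    c⃗ : I → V 5
    c⃗ i = scale i *v proj₁ (C i)

    h-c⃗ : ∀ i → dot h (c⃗ i) ≈ 1#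
    h-c⃗ i = trans (dot-* h (scale i) (proj₁ (C i))) (recip-* (h-C≉0 i))

    c⃗≈ : ∀ i → c⃗ i ≈v (scale i *v proj₁ (C i))
    c⃗≈ i t = refl

    C≈ : ∀ i → proj₁ (C i) ≈v (dot h (proj₁ (C i)) *v c⃗ i)
    C≈ i t = sym (trans (sym (*-assoc _ _ _)) (trans (*-congʳ (*-recip (h-C≉0 i))) (*-identityˡ _)))

    C∈⇒c⃗∈ : ∀ {i π} → C i ∈S proj₁ π → c⃗ i ∈ π
    C∈⇒c⃗∈ {i} {π} p = spanned (span-* {w = basis (proj₁ π)} (scale i) p)

    c⃗∈⇒C∈ : ∀ {i π} → c⃗ i ∈ π → C i ∈S proj₁ π
    c⃗∈⇒C∈ {i} p = span (∈-resp (≈v-sym (C≈ i)) (∈-* (dot h (proj₁ (C i))) p))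

    opaque
      h-≈ : ∀ {u v} → u ≈v v → dot h u ≈ dot h v
      h-≈ = dot-congʳ h

    scaled-c⃗ : ∀ {v i a} → dot h v ≈ 1# → v ≈v (a *v proj₁ (C i)) → v ≈v c⃗ i
    scaled-c⃗ {v} {i} {a} hv e t = trans (e t) (*-congʳ a≈scale)
      where
      a≈scale : a ≈ scale i
      a≈scale = begin
        a  ≈⟨ *-identityʳ a ⟨
        a * 1#  ≈⟨ *-congˡ (*-recip (h-C≉0 i)) ⟨
        a * (dot h (proj₁ (C i)) * scale i)  ≈⟨ *-assoc _ _ _ ⟨
        a * dot h (proj₁ (C i)) * scale i  ≈⟨ *-congʳ (trans (sym (dot-* h a (proj₁ (C i)))) (trans (sym (h-≈ e)) hv)) ⟩
        1# * scale i  ≈⟨ *-identityˡ _ ⟩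
        scale i ∎

    c⃗-injective : ∀ {i j} → c⃗ i ≈v c⃗ j → i ≡ j
    c⃗-injective {i} {j} e = C-distinct i j
      (dot h (proj₁ (C i)) * scale j , *-≉0 (h-C≉0 i) (recip≉0 (h-C≉0 j)) ,
       λ t → trans (C≈ i t) (trans (*-congˡ (e t)) (sym (*-assoc _ _ _))))

    arc-indep : ∀ π {i j k} → c⃗ i ∈ π → c⃗ j ∈ π → c⃗ k ∈ π → i ≢ j → j ≢ k → i ≢ k →
      Indep (c⃗ i ∷ c⃗ j ∷ c⃗ k ∷ [])
    arc-indep (π , cp) {i} {j} {k} i∈ j∈ k∈ i≢j j≢k i≢k cs rel =
      λ { zero → unscale (h-C≉0 i) (all-0 zero)
        ; (suc zero) → unscale (h-C≉0 j) (all-0 (suc zero))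
        ; (suc (suc zero)) → unscale (h-C≉0 k) (all-0 (suc (suc zero))) }
      where
      unscale : ∀ {a b} (b≉0 : ¬ b ≈ 0#) → a * recip b≉0 ≈ 0# → a ≈ 0#
      unscale b≉0 p = *-cancel-0 (recip≉0 b≉0) (trans (*-comm _ _) p)
      ds : Fin 3 → Carrier
      ds = cs zero * scale i ∷ cs (suc zero) * scale j ∷ cs (suc (suc zero)) * scale k ∷ []
      all-0 : ∀ l → ds l ≈ 0#
      all-0 = proj₂ (A1-arc π cp) i j k (c⃗∈⇒C∈ i∈) (c⃗∈⇒C∈ j∈) (c⃗∈⇒C∈ k∈) i≢j j≢k i≢k ds
        (λ t → trans (+-cong (*-assoc _ _ _) (+-cong (*-assoc _ _ _) (+-congʳ (*-assoc _ _ _)))) (rel t))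

  opaque
    pts : CPlane → Fin q → I
    pts (π , cp) = proj₁ (proj₁ (A1-arc π cp))

    pts-injective : ∀ π {a b} → pts π a ≡ pts π b → a ≡ b
    pts-injective (π , cp) = proj₁ (proj₂ (proj₁ (A1-arc π cp))) _ _

    pts∈ : ∀ π a → c⃗ (pts π a) ∈ π
    pts∈ (π , cp) a = C∈⇒c⃗∈ (proj₁ (proj₂ (proj₂ (proj₁ (A1-arc π cp)))) a)

    number : ∀ π {i} → c⃗ i ∈ π → ∃ λ a → pts π a ≡ i
    number (π , cp) {i} i∈π = proj₂ (proj₂ (proj₂ (proj₁ (A1-arc π cp)))) i (c⃗∈⇒C∈ i∈π)

  join : ∀ {i j} → i ≢ j → CPlane
  join {i} {j} i≢j = let π , cp , _ = proj₁ (A2 i j i≢j) in π , cp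

  join-l : ∀ {i j} (i≢j : i ≢ j) → c⃗ i ∈ join i≢j
  join-l {i} {j} i≢j = C∈⇒c⃗∈ (proj₁ (proj₂ (proj₂ (proj₁ (A2 i j i≢j)))))

  join-r : ∀ {i j} (i≢j : i ≢ j) → c⃗ j ∈ join i≢j
  join-r {i} {j} i≢j = C∈⇒c⃗∈ (proj₂ (proj₂ (proj₂ (proj₁ (A2 i j i≢j)))))

  opaque
    join-unique : ∀ {i j π σ} → i ≢ j → c⃗ i ∈ π → c⃗ j ∈ π → c⃗ i ∈ σ → c⃗ j ∈ σ → π ≃ σ
    join-unique {i} {j} {π , cπ} {σ , cσ} i≢j iπ jπ iσ jσ =
      same (proj₂ (A2 i j i≢j) π σ cπ cσ (c⃗∈⇒C∈ iπ) (c⃗∈⇒C∈ jπ) (c⃗∈⇒C∈ iσ) (c⃗∈⇒C∈ jσ))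

  opaque
    common-unique : ∀ {i j π σ} → ¬ π ≃ σ → c⃗ i ∈ π → c⃗ i ∈ σ → c⃗ j ∈ π → c⃗ j ∈ σ → i ≡ j
    common-unique {i} {j} {π} {σ} π≄σ iπ iσ jπ jσ = decidable-stable (i ≟ᶠ j)
      (λ i≢j → π≄σ (join-unique i≢j iπ jπ iσ jσ))

  IsC : V 5 → Set ℓ
  IsC v = ∃ λ i → v ≈v c⃗ i

  opaque
    isC? : ∀ v → Dec (IsC v)
    isC? v = any? (λ i → v ≟v c⃗ i)

  affine≉0 : ∀ {v} → dot h v ≈ 1# → NonZero v
  affine≉0 {v} hv v≈0 = 1≉0 (trans (sym hv) (trans (h-≈ v≈0) (dot-0 h)))

  opaque
    -- (A3) seen from a plane already known to contain `v`: of the exactly two C-planes through `v`,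
    -- one is `π`.
    off-C : ∀ {v} → dot h v ≈ 1# → ¬ IsC v → ∀ π → v ∈ π →
      (∃ λ σ → ¬ σ ≃ π × v ∈ σ) × (∀ σ τ → ¬ σ ≃ π → ¬ τ ≃ π → v ∈ σ → v ∈ τ → σ ≃ τ)
    off-C {v} hv v∉C π v∈π with A3 (v , affine≉0 hv) (λ v∞ → 1≉0 (trans (sym hv) v∞))
    ... | inj₁ (i , a , _ , e) = ⊥-elim (v∉C (i , scaled-c⃗ {v} {i} {a} hv e))
    ... | inj₂ (inj₁ none) = ⊥-elim (none (proj₁ π) (proj₂ π) (span v∈π))
    ... | inj₂ (inj₂ (π₁ , π₂ , c₁ , c₂ , π₁≄π₂ , v∈π₁ , v∈π₂ , only)) = other (which π v∈π) , unique
      where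
      P₁ P₂ : CPlane
      P₁ = π₁ , c₁
      P₂ = π₂ , c₂
      P₁≄P₂ : ¬ P₁ ≃ P₂
      P₁≄P₂ (same e) = π₁≄π₂ e
      which : ∀ τ → v ∈ τ → τ ≃ P₁ ⊎ τ ≃ P₂
      which τ (spanned p) with only (proj₁ τ) (proj₂ τ) p
      ... | inj₁ e = inj₁ (same e)
      ... | inj₂ e = inj₂ (same e)
      other : π ≃ P₁ ⊎ π ≃ P₂ → ∃ λ σ → ¬ σ ≃ π × v ∈ σ
      other (inj₁ e) = P₂ , (λ e' → P₁≄P₂ (≃-sym (≃-trans e' e))) , spanned v∈π₂
      other (inj₂ e) = P₁ , (λ e' → P₁≄P₂ (≃-trans e' e)) , spanned v∈π₁
      unique : ∀ σ τ → ¬ σ ≃ π → ¬ τ ≃ π → v ∈ σ → v ∈ τ → σ ≃ τ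
      unique σ τ σ≄π τ≄π v∈σ v∈τ with which π v∈π | which σ v∈σ | which τ v∈τ
      ... | inj₁ a | inj₁ b | _ = ⊥-elim (σ≄π (≃-trans b (≃-sym a)))
      ... | inj₂ a | inj₂ b | _ = ⊥-elim (σ≄π (≃-trans b (≃-sym a)))
      ... | inj₁ a | _ | inj₁ b = ⊥-elim (τ≄π (≃-trans b (≃-sym a)))
      ... | inj₂ a | _ | inj₂ b = ⊥-elim (τ≄π (≃-trans b (≃-sym a)))
      ... | inj₁ _ | inj₂ a | inj₂ b = ≃-trans a (≃-sym b)
      ... | inj₂ _ | inj₁ a | inj₁ b = ≃-trans a (≃-sym b)

  -- Only points of C count here; the planes may still meet outside C.
  Disj : CPlane → CPlane → Set (c ⊔ ℓ)
  Disj π σ = ∀ i → c⃗ i ∈ π → ¬ c⃗ i ∈ σ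

  opaque
    meet? : ∀ π σ → Disj π σ ⊎ ∃ λ i → c⃗ i ∈ π × c⃗ i ∈ σ
    meet? π σ with any? (λ i → (c⃗ i ∈? π) ×-dec (c⃗ i ∈? σ))
    ... | yes m = inj₂ m
    ... | no none = inj₁ (λ i iπ iσ → none (i , iπ , iσ))

  -- Disjoint planes with `q` points each account for all `q * q` points.
  disjoint-cover : (ρ : Fin q → CPlane) → (∀ {a b} → a ≢ b → Disj (ρ a) (ρ b)) →
    ∀ i → ∃ λ a → c⃗ i ∈ ρ a
  disjoint-cover ρ disj i =
    let a , b , e = grid-surjective (λ a b → pts (ρ a) b) inj i in
    a , ≡.subst (λ i → c⃗ i ∈ ρ a) e (pts∈ (ρ a) b)
    where
    inj : ∀ {a b a' b'} → pts (ρ a) b ≡ pts (ρ a') b' → a ≡ a' × b ≡ b'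
    inj {a} {b} {a'} {b'} e with a ≟ᶠ a'
    ... | yes ≡.refl = ≡.refl , pts-injective (ρ a) e
    ... | no a≢a' = ⊥-elim (disj a≢a' (pts (ρ a) b) (pts∈ (ρ a) b)
      (≡.subst (λ i → c⃗ i ∈ ρ a') (≡.sym e) (pts∈ (ρ a') b')))

  module _ (2≤q : 2 ≤ q) where

    opaque
      second : ∀ π i → ∃ λ j → j ≢ i × c⃗ j ∈ π
      second π i with c⃗ i ∈? π
      ... | no i∉π = let j = pts π (fromℕ< (ℕ.<-trans (s≤s z≤n) 2≤q)) in
        j , (λ { ≡.refl → i∉π (pts∈ π _) }) , pts∈ π _
      ... | yes i∈π = let a , e = number π i∈π
                          b , fresh-b = fresh {k = 1} (λ _ → a) 2≤q in
        pts π b , (λ e' → fresh-b zero (pts-injective π (≡.trans e (≡.sym e')))) , pts∈ π b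

    -- Counting: the q joins of j with the points of π and one plane through j missing π
    -- already cover all q² points.
    parallel-unique : ∀ {j π ρ ρ'} → c⃗ j ∈ ρ → c⃗ j ∈ ρ' → Disj ρ π → Disj ρ' π → ρ ≃ ρ'
    parallel-unique {j} {π} {ρ} {ρ'} j∈ρ j∈ρ' ρ∥π ρ'∥π = decidable-stable (ρ ≃? ρ') λ ρ≄ρ' →
      let m , m≢j , m∈ρ' = second ρ' j
          a , b , e = grid-surjective g inj m in
      hit ρ≄ρ' m≢j m∈ρ' a b e
      where
      j≢ : ∀ a → j ≢ pts π a
      j≢ a e = ρ∥π j j∈ρ (≡.subst (λ i → c⃗ i ∈ π) (≡.sym e) (pts∈ π a))
      β : Fin q → CPlane
      β a = join (j≢ a)
      ja : ∀ a → c⃗ j ∈ β a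
      ja a = join-l (j≢ a)
      -- Each join `β a` contains `j` once; that entry is replaced by the `a`-th point of `ρ`. The
      -- `q * q` entries then list the points of `ρ` and the points other than `j` of all the joins,
      -- each once.
      g : Fin q → Fin q → I
      g a b with pts (β a) b ≟ᶠ j
      ... | yes _ = pts ρ a
      ... | no _ = pts (β a) b
      β∦ : ∀ {σ} a → c⃗ j ∈ σ → Disj σ π → ∀ {i} → i ≢ j → c⃗ i ∈ β a → ¬ c⃗ i ∈ σ
      β∦ {σ} a j∈σ σ∥π i≢j i∈β i∈σ = σ∥π (pts π a)
        (≃-∈ (join-unique i≢j i∈β (ja a) i∈σ j∈σ) (join-r (j≢ a)))
        (pts∈ π a)
      inj : ∀ {a b a' b'} → g a b ≡ g a' b' → a ≡ a' × b ≡ b'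
      inj {a} {b} {a'} {b'} e with pts (β a) b ≟ᶠ j | pts (β a') b' ≟ᶠ j
      ... | yes p | yes p' with pts-injective ρ e
      ... | ≡.refl = ≡.refl , pts-injective (β a) (≡.trans p (≡.sym p'))
      inj {a} {b} {a'} {b'} e | yes p | no n' =
        ⊥-elim (β∦ {ρ} a' j∈ρ ρ∥π n' (pts∈ (β a') b') (≡.subst (λ i → c⃗ i ∈ ρ) e (pts∈ ρ a)))
      inj {a} {b} {a'} {b'} e | no n | yes p' =
        ⊥-elim (β∦ {ρ} a j∈ρ ρ∥π n (pts∈ (β a) b) (≡.subst (λ i → c⃗ i ∈ ρ) (≡.sym e) (pts∈ ρ a')))
      inj {a} {b} {a'} {b'} e | no n | no n' with a ≟ᶠ a'
      ... | yes ≡.refl = ≡.refl , pts-injective (β a) e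
      ... | no a≢a' = ⊥-elim (ρ∥π j j∈ρ (≃-∈ βa≃π (ja a)))
        where
        βa≃βa' : β a ≃ β a'
        βa≃βa' = join-unique n (pts∈ (β a) b) (ja a)
          (≡.subst (λ i → c⃗ i ∈ β a') (≡.sym e) (pts∈ (β a') b')) (ja a')
        βa≃π : β a ≃ π
        βa≃π = join-unique (a≢a' ∘ pts-injective π) (join-r (j≢ a))
          (≃-∈ (≃-sym βa≃βa') (join-r (j≢ a'))) (pts∈ π a) (pts∈ π a')
      hit : ¬ ρ ≃ ρ' → ∀ {m} → m ≢ j → c⃗ m ∈ ρ' → ∀ a b → g a b ≡ m → ⊥
      hit ρ≄ρ' {m} m≢j m∈ρ' a b e with pts (β a) b ≟ᶠ j
      ... | yes _ = ρ≄ρ' (join-unique m≢j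
        (≡.subst (λ i → c⃗ i ∈ ρ) e (pts∈ ρ a)) j∈ρ m∈ρ' j∈ρ')
      ... | no _ = β∦ {ρ'} a j∈ρ' ρ'∥π m≢j (≡.subst (λ i → c⃗ i ∈ β a) e (pts∈ (β a) b)) m∈ρ'

  opaque
    below-q : ∀ {k} → k < 7 → k < q
    below-q k<7 = ℕ.<-≤-trans k<7 7≤q

  2≤q : 2 ≤ q
  2≤q = below-q (s≤s (s≤s z≤n))

  q<q*q : q < q ℕ.* q
  q<q*q = ℕ.m<m*n q q {{ℕ.>-nonZero (ℕ.<-≤-trans (s≤s z≤n) 7≤q)}} 2≤q

  -- Affine points, directions and lines of a C-plane.

  record Aff (v : V 5) : Set ℓ where
    constructor aff
    field h≈1 : dot h v ≈ 1#
  open Aff public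

  record Inf (v : V 5) : Set ℓ where
    constructor inf
    field h≈0 : dot h v ≈ 0#
  open Inf public

  opaque
    Aff-c⃗ : ∀ i → Aff (c⃗ i)
    Aff-c⃗ i = aff (h-c⃗ i)

  Indep₂ : V 5 → V 5 → Set (c ⊔ ℓ)
  Indep₂ d e = ∀ a b → (a *v d +v b *v e) ≈v zv → a ≈ 0# × b ≈ 0#

  opaque
    proportional? : ∀ {d} → NonZero d → ∀ e → (∃ λ k → e ≈v (k *v d)) ⊎ Indep₂ d e
    proportional? {d} d≉0 e with anyF? {P = λ k → e ≈v (k *v d)}
      (λ k≈k' p t → trans (p t) (*-congʳ k≈k')) (λ k → e ≟v (k *v d))
    ... | yes p = inj₁ p
    ... | no none = inj₂ independent
      where
      independent : Indep₂ d e
      independent a b rel with b ≟ 0#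
      ... | no b≉0 = ⊥-elim (none (- (recip b≉0 * a) , λ t → begin
        e t  ≈⟨ solve 4 (λ e d a r → e ⊜ (:- (r :* a)) :* d :+ (r :* (a :* d))  :+ e) (e t) (d t) a (recip b≉0) ⟩
        (- (recip b≉0 * a)) * d t + recip b≉0 * (a * d t) + e t
          ≈⟨ +-congˡ (trans (sym (*-identityˡ _)) (*-congʳ (sym (recip-* b≉0)))) ⟩
        (- (recip b≉0 * a)) * d t + recip b≉0 * (a * d t) + recip b≉0 * b * e t
          ≈⟨ solve 5 (λ e d a r b → (:- (r :* a)) :* d :+ r :* (a :* d) :+ r :* b :* e ⊜
               (:- (r :* a)) :* d :+ r :* (a :* d :+ b :* e)) (e t) (d t) a (recip b≉0) b ⟩
        (- (recip b≉0 * a)) * d t + recip b≉0 * (a * d t + b * e t)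
          ≈⟨ +-congˡ (trans (*-congˡ (rel t)) (zeroʳ _)) ⟩
        (- (recip b≉0 * a)) * d t + 0#  ≈⟨ +-identityʳ _ ⟩
        (- (recip b≉0 * a)) * d t ∎))
      ... | yes b≈0 with a ≟ 0#
      ... | yes a≈0 = a≈0 , b≈0
      ... | no a≉0 = ⊥-elim (d≉0 λ t → *-cancel-0 a≉0
        (trans (sym (trans (+-congˡ (trans (*-congʳ b≈0) (zeroˡ _))) (+-identityʳ _))) (rel t)))

  at : V 5 → V 5 → Carrier → V 5
  at x d t = x +v t *v d

  opaque
    Aff-at : ∀ {x d} t → Aff x → Inf d → Aff (at x d t)
    Aff-at {x} {d} t (aff hx) (inf hd) = aff (begin
      dot h (at x d t)  ≈⟨ dot-+ h x (t *v d) ⟩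
      dot h x + dot h (t *v d)  ≈⟨ +-cong hx (trans (dot-* h t d) (*-congˡ hd)) ⟩
      1# + t * 0#  ≈⟨ solve 1 (λ t → :1 :+ t :* :0 ⊜ :1) t ⟩
      1# ∎)

  opaque
    Inf-- : ∀ {x y} → Aff x → Aff y → Inf (x -v y)
    Inf-- {x} {y} (aff hx) (aff hy) = inf (begin
      dot h (x -v y)
        ≈⟨ h-≈ (λ t → solve 2 (λ x y → x :- y ⊜ :1 :* x :+ (:- :1) :* y) (x t) (y t)) ⟩
      dot h (1# *v x +v (- 1#) *v y)  ≈⟨ dot-lin h 1# x (- 1#) y ⟩
      1# * dot h x + (- 1#) * dot h y  ≈⟨ +-cong (*-congˡ hx) (*-congˡ hy) ⟩
      1# * 1# + (- 1#) * 1#  ≈⟨ solve 0 (:1 :* :1 :+ (:- :1) :* :1 ⊜ :0) ⟩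
      0# ∎)

  opaque
    ∈-at : ∀ {π x d} t → x ∈ π → d ∈ π → at x d t ∈ π
    ∈-at t x∈π d∈π = ∈-+ x∈π (∈-* t d∈π)

  opaque
    at-back : ∀ {x d v t} → v ≈v at x d t → x ≈v at v d (- t)
    at-back {x} {d} {v} {t} e i = sym (trans (+-congʳ (e i))
      (solve 3 (λ x d t → x :+ t :* d :+ (:- t) :* d ⊜ x) (x i) (d i) t))

  opaque
    at-injective : ∀ {x d t u} → NonZero d → at x d t ≈v at x d u → t ≈ u
    at-injective {x} {d} {t} {u} d≉0 e = decidable-stable (t ≟ u) λ t≉u → d≉0 λ i → *-cancel-0 (-≉0 t≉u) (begin
      (t - u) * d i  ≈⟨ solve 4 (λ x d t u → (t :- u) :* d ⊜ (x :+ t :* d) :- (x :+ u :* d)) (x i) (d i) t u ⟩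
      at x d t i - at x d u i  ≈⟨ +-congʳ (e i) ⟩
      at x d u i - at x d u i  ≈⟨ -‿inverseʳ _ ⟩
      0# ∎)

  opaque
    frame-indep : ∀ {x d e} → Aff x → Inf d → Inf e → Indep₂ d e → Indep (x ∷ d ∷ e ∷ [])
    frame-indep {x} {d} {e} hx hd he ind cs rel =
      λ { zero → a≈0 ; (suc zero) → proj₁ both ; (suc (suc zero)) → proj₂ both }
      where
      a b f : Carrier
      a = cs zero
      b = cs (suc zero)
      f = cs (suc (suc zero))
      a≈0 : a ≈ 0#
      a≈0 = begin
        a  ≈⟨ solve 3 (λ a b f → a ⊜ a :* :1 :+ (b :* :0 :+ (f :* :0 :+ :0))) a b f ⟩
        a * 1# + (b * 0# + (f * 0# + 0#))
          ≈⟨ +-cong (*-congˡ (h≈1 hx)) (+-cong (*-congˡ (h≈0 hd)) (+-congʳ (*-congˡ (h≈0 he)))) ⟨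
        a * dot h x + (b * dot h d + (f * dot h e + 0#))  ≈⟨ dot-combo h cs (x ∷ d ∷ e ∷ []) ⟨
        dot h (combo cs (x ∷ d ∷ e ∷ []))  ≈⟨ h-≈ rel ⟩
        dot h zv  ≈⟨ dot-0 h ⟩
        0# ∎
      both : b ≈ 0# × f ≈ 0#
      both = ind b f (λ t → begin
        b * d t + f * e t  ≈⟨ solve 5 (λ b d f e x → b :* d :+ f :* e ⊜ :0 :* x :+ (b :* d :+ (f :* e :+ :0))) b (d t) f (e t) (x t) ⟩
        0# * x t + (b * d t + (f * e t + 0#))  ≈⟨ +-congʳ (*-congʳ a≈0) ⟨
        a * x t + (b * d t + (f * e t + 0#))  ≈⟨ rel t ⟩
        0# ∎)

  opaque
    frame-∈ : ∀ {π x d e} → x ∈ π → d ∈ π → e ∈ π → ∀ j → (x ∷ d ∷ e ∷ []) j ∈ π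
    frame-∈ x∈ d∈ e∈ zero = x∈
    frame-∈ x∈ d∈ e∈ (suc zero) = d∈
    frame-∈ x∈ d∈ e∈ (suc (suc zero)) = e∈

  opaque
    -- Written as the meeting of two lines, through `v` in direction `e` and through `x` in
    -- direction `d`, which is the form in which crossing axes use it.
    frame-coords : ∀ {π x d e v} → Aff x → Inf d → Inf e → Indep₂ d e → x ∈ π → d ∈ π → e ∈ π →
      Aff v → v ∈ π → ∃₂ λ α β → at v e (- β) ≈v at x d α
    frame-coords {π} {x} {d} {e} {v} hx hd he ind x∈ d∈ e∈ hv v∈ =
      b , f , λ t → begin
        v t + (- f) * e t  ≈⟨ +-congʳ (rel t) ⟩
        (a * x t + (b * d t + (f * e t + 0#))) + (- f) * e t  ≈⟨ +-congʳ (+-congʳ (*-congʳ a≈1)) ⟩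
        (1# * x t + (b * d t + (f * e t + 0#))) + (- f) * e t
          ≈⟨ solve 5 (λ b d f e x → (:1 :* x :+ (b :* d :+ (f :* e :+ :0))) :+ (:- f) :* e ⊜ x :+ b :* d) b (d t) f (e t) (x t) ⟩
        x t + b * d t ∎
      where
      cs : Fin 3 → Carrier
      cs = proj₁ (∈-indep (frame-indep hx hd he ind) (frame-∈ x∈ d∈ e∈) v∈)
      rel : v ≈v combo cs (x ∷ d ∷ e ∷ [])
      rel = proj₂ (∈-indep (frame-indep hx hd he ind) (frame-∈ x∈ d∈ e∈) v∈)
      a b f : Carrier
      a = cs zero
      b = cs (suc zero)
      f = cs (suc (suc zero))
      a≈1 : a ≈ 1#
      a≈1 = begin
        a  ≈⟨ solve 3 (λ a b f → a ⊜ a :* :1 :+ (b :* :0 :+ (f :* :0 :+ :0))) a b f ⟩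
        a * 1# + (b * 0# + (f * 0# + 0#))
          ≈⟨ +-cong (*-congˡ (h≈1 hx)) (+-cong (*-congˡ (h≈0 hd)) (+-congʳ (*-congˡ (h≈0 he)))) ⟨
        a * dot h x + (b * dot h d + (f * dot h e + 0#))  ≈⟨ dot-combo h cs (x ∷ d ∷ e ∷ []) ⟨
        dot h (combo cs (x ∷ d ∷ e ∷ []))  ≈⟨ h-≈ rel ⟨
        dot h v  ≈⟨ h≈1 hv ⟩
        1# ∎

  opaque
    no-collinear : ∀ {π x d t t' t'' i j k} → NonZero d → c⃗ i ∈ π → c⃗ j ∈ π → c⃗ k ∈ π →
      i ≢ j → j ≢ k → i ≢ k → c⃗ i ≈v at x d t → c⃗ j ≈v at x d t' → c⃗ k ≈v at x d t'' → ⊥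
    no-collinear {π} {x} {d} {t} {t'} {t''} {i} {j} {k} d≉0 i∈ j∈ k∈ i≢j j≢k i≢k ei ej ek =
      -- These coefficients are the linear relation between the points with parameters `t`, `t'`,
      -- `t''` of a line.
      -≉0 t'≉t'' (arc-indep π i∈ j∈ k∈ i≢j j≢k i≢k (t' - t'' ∷ t'' - t ∷ t - t' ∷ []) (λ l → begin
        (t' - t'') * c⃗ i l + ((t'' - t) * c⃗ j l + ((t - t') * c⃗ k l + 0#))
          ≈⟨ +-cong (*-congˡ (ei l)) (+-cong (*-congˡ (ej l)) (+-congʳ (*-congˡ (ek l)))) ⟩
        (t' - t'') * at x d t l + ((t'' - t) * at x d t' l + ((t - t') * at x d t'' l + 0#))
          ≈⟨ solve 5 (λ x d t t' t'' → (t' :- t'') :* (x :+ t :* d) :+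
               ((t'' :- t) :* (x :+ t' :* d) :+ ((t :- t') :* (x :+ t'' :* d) :+ :0)) ⊜ :0) (x l) (d l) t t' t'' ⟩
        0# ∎) zero)
      where
      t'≉t'' : ¬ t' ≈ t''
      t'≉t'' e = j≢k (c⃗-injective (λ l → trans (ej l) (trans (+-congˡ (*-congʳ e)) (sym (ek l)))))

  opaque
    -- An arc has at most two points on a line. The exceptional parameters are padded with arbitrary
    -- ones when the line carries fewer points of C.
    few-C : ∀ {π x d} → x ∈ π → d ∈ π → NonZero d →
      ∃₂ λ (a b : Fin q) → a ≢ b × (∀ k → a ≢ k → b ≢ k → ¬ IsC (at x d (elem k)))
    few-C {π} {x} {d} x∈π d∈π d≉0 with any? (λ k → isC? (at x d (elem k)))
    ... | no none = let b , a≢b = fresh {1} (λ _ → a) 2≤q in a , b , a≢b zero , λ k _ _ C → none (k , C)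
      where
      a : Fin q
      a = fromℕ< (below-q (s≤s z≤n))
    ... | yes (a , i , ei) with any? (λ k → ¬? (a ≟ᶠ k) ×-dec isC? (at x d (elem k)))
    ... | no none = let b , a≢b = fresh {1} (λ _ → a) 2≤q in a , b , a≢b zero , λ k a≢k _ C → none (k , a≢k , C)
    ... | yes (b , a≢b , j , ej) = a , b , a≢b , λ { k a≢k b≢k (l , el) →
        no-collinear {π} d≉0 (on ei) (on ej) (on el) (apart a≢b ei ej) (apart b≢k ej el) (apart a≢k ei el)
          (≈v-sym ei) (≈v-sym ej) (≈v-sym el) }
      where
      on : ∀ {k l} → at x d (elem k) ≈v c⃗ l → c⃗ l ∈ π
      on {k} e = ∈-resp e (∈-at (elem k) x∈π d∈π)
      apart : ∀ {k k' l l'} → k ≢ k' → at x d (elem k) ≈v c⃗ l → at x d (elem k') ≈v c⃗ l' → l ≢ l'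
      apart k≢k' e e' ≡.refl = k≢k' (elem-injective _ _ (at-injective d≉0 (≈v-trans e (≈v-sym e'))))

  -- Isolated points and axes.

  Alone : CPlane → V 5 → CPlane → Set (c ⊔ ℓ)
  Alone π v σ = v ∈ σ × (∀ u → Aff u → u ∈ π → u ∈ σ → u ≈v v)

  Isolated : CPlane → V 5 → Set (c ⊔ ℓ)
  Isolated π v = ¬ IsC v × ∃ (Alone π v)

  -- An affine line `v + F d` common to `π` and a second C-plane `σ`, anchored at a point `v` off C
  -- so that (A3) applies there.
  record Axis (π : CPlane) (d : V 5) : Set (c ⊔ ℓ) where
    field
      {v} : V 5
      {σ} : CPlane
      off : ¬ IsC v
      hv : Aff v
      v∈π : v ∈ π
      v∈σ : v ∈ σ
      σ≄π : ¬ σ ≃ π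
      d≉0 : NonZero d
      hd : Inf d
      d∈π : d ∈ π
      d∈σ : d ∈ σ

  opaque
    -- The second C-plane through a point off C meets `π` affinely there only, or in another point
    -- `u` as well, and then `u - v` is a common direction. The axis keeps its anchor because later
    -- arguments must know on which line it lies.
    alone-or-axis : ∀ {π v} → Aff v → v ∈ π →
      (IsC v ⊎ Isolated π v) ⊎ (∃ λ d → Σ (Axis π d) λ ax → Axis.v ax ≡ v)
    alone-or-axis {π} {v} hv v∈π with isC? v
    ... | yes C = inj₁ (inj₁ C)
    ... | no off with proj₁ (off-C (h≈1 hv) off π v∈π)
    ... | σ , σ≄π , v∈σ with anyV? {P = λ u → Aff u × u ∈ π × u ∈ σ × ¬ u ≈v v}
        (λ e (hu , u∈π , u∈σ , u≉v) → aff (trans (sym (h-≈ e)) (h≈1 hu)) , ∈-resp e u∈π , ∈-resp e u∈σ , λ e' → u≉v (≈v-trans e e'))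
        (λ u → map′ aff h≈1 (dot h u ≟ 1#) ×-dec ((u ∈? π) ×-dec ((u ∈? σ) ×-dec ¬? (u ≟v v))))
    ... | no none = inj₁ (inj₂ (off , σ , v∈σ , λ u hu u∈π u∈σ →
        decidable-stable (u ≟v v) λ u≉v → none (u , hu , u∈π , u∈σ , u≉v)))
    ... | yes (u , hu , u∈π , u∈σ , u≉v) = inj₂ (u -v v , record
        { off = off ; hv = hv ; v∈π = v∈π ; v∈σ = v∈σ ; σ≄π = σ≄π
        ; d≉0 = λ e → u≉v (λ t → x∙y⁻¹≈ε⇒x≈y _ _ (e t))
        ; hd = Inf-- hu hv ; d∈π = ∈-- u∈π v∈π ; d∈σ = ∈-- u∈σ v∈σ } , ≡.refl)

  opaque
    alone-disjoint : ∀ {π v τ} → ¬ IsC v → Alone π v τ → Disj τ π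
    alone-disjoint off (_ , only) i i∈τ i∈π = off (i , ≈v-sym (only (c⃗ i) (Aff-c⃗ i) i∈π i∈τ))

  opaque
    escape : ∀ π → ∃ λ i → ¬ c⃗ i ∈ π
    escape π = let i , new = fresh (pts π) q<q*q in
      i , λ i∈π → let a , e = number π i∈π in new a e

  -- Isolated points of π inject into the points of σ₀ other than A, where σ₀ ≠ π passes
  -- through A ∈ π, so there are at most q - 1 of them; two lines have more points than that.
  two-isolated-lines : ∀ {π x d y e} → Aff x → Aff y → Inf d → Inf e → NonZero d → NonZero e →
    x ∈ π → y ∈ π → d ∈ π → e ∈ π →
    (∀ k → IsC (at x d (elem k)) ⊎ Isolated π (at x d (elem k))) →
    (∀ k → IsC (at y e (elem k)) ⊎ Isolated π (at y e (elem k))) →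
    (u₀ : Fin q) → (∀ u t → u₀ ≢ u → ¬ at y e (elem u) ≈v at x d t) → ⊥
  two-isolated-lines {π} {x} {d} {y} {e} hx hy hd he d≉0 e≉0 x∈ y∈ d∈ e∈ iso-x iso-y u₀ apart =
    pigeonhole-rel R total R-injective (ℕ.n<1+n (suc q))
    where
    A = pts π (fromℕ< (below-q (s≤s z≤n)))
    A∈π : c⃗ A ∈ π
    A∈π = pts∈ π _
    B = proj₁ (escape π)
    B∉π = proj₂ (escape π)
    A≢B : A ≢ B
    A≢B p = B∉π (≡.subst (λ i → c⃗ i ∈ π) p A∈π)
    σ₀ = join A≢B
    σ₀≄π : ¬ σ₀ ≃ π
    σ₀≄π p = B∉π (≃-∈ p (join-r A≢B))
    Hit : V 5 → Fin q → Set (c ⊔ ℓ)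
    Hit v k = ∃ λ τ → Alone π v τ × Disj τ π × c⃗ (pts σ₀ k) ∈ τ
    hit : ∀ {v} → Isolated π v → ∃ (Hit v)
    hit (off , τ , alone) with meet? τ σ₀
    ... | inj₁ disj = ⊥-elim (σ₀≄π (parallel-unique 2≤q {A} {τ} {σ₀} {π} (join-l A≢B) A∈π
      (λ i i∈σ i∈τ → disj i i∈τ i∈σ) (λ i i∈π i∈τ → alone-disjoint off alone i i∈τ i∈π)))
    ... | inj₂ (m , m∈τ , m∈σ₀) with number σ₀ m∈σ₀
    ... | k , ≡.refl = k , τ , alone , alone-disjoint off alone , m∈τ
    a₀ = proj₁ (number σ₀ (join-l A≢B))
    not-a₀ : ∀ {v} → ¬ Hit v a₀
    not-a₀ (τ , _ , disj , m∈τ) =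
      disj A (≡.subst (λ i → c⃗ i ∈ τ) (proj₂ (number σ₀ (join-l A≢B))) m∈τ) A∈π
    Hit-injective : ∀ {v v' k} → Aff v' → v' ∈ π → Hit v k → Hit v' k → v ≈v v'
    Hit-injective {v} {v'} hv' v'∈π (τ , (_ , only) , disj , m∈τ) (τ' , (v'∈τ' , _) , disj' , m∈τ') =
      ≈v-sym (only v' hv' v'∈π (≃-∈ (parallel-unique 2≤q {π = π} m∈τ' m∈τ disj' disj) v'∈τ'))
    few-x = few-C x∈ d∈ d≉0
    few-y = few-C y∈ e∈ e≉0
    t₁ = proj₁ few-x
    t₂ = proj₁ (proj₂ few-x)
    u₁ = proj₁ few-y
    u₂ = proj₁ (proj₂ few-y)
    fresh₄ = fresh (u₀ ∷ u₁ ∷ u₂ ∷ []) (below-q (s≤s (s≤s (s≤s (s≤s z≤n)))))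
    u₄ = proj₁ fresh₄
    fresh₅ = fresh (u₀ ∷ u₁ ∷ u₂ ∷ u₄ ∷ []) (below-q (s≤s (s≤s (s≤s (s≤s (s≤s z≤n))))))
    u₅ = proj₁ fresh₅
    pos : Fin (2 ℕ.+ q) → V 5
    pos zero = at y e (elem u₄)
    pos (suc zero) = at y e (elem u₅)
    pos (suc (suc k)) = at x d (elem k)
    Aff-pos : ∀ i → Aff (pos i)
    Aff-pos zero = Aff-at _ hy he
    Aff-pos (suc zero) = Aff-at _ hy he
    Aff-pos (suc (suc k)) = Aff-at _ hx hd
    pos∈ : ∀ i → pos i ∈ π
    pos∈ zero = ∈-at _ y∈ e∈
    pos∈ (suc zero) = ∈-at _ y∈ e∈
    pos∈ (suc (suc k)) = ∈-at _ x∈ d∈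
    pos-injective : ∀ i j → pos i ≈v pos j → i ≡ j
    pos-injective zero zero p = ≡.refl
    pos-injective (suc zero) (suc zero) p = ≡.refl
    pos-injective zero (suc zero) p =
      ⊥-elim (proj₂ fresh₅ (suc (suc (suc zero))) (elem-injective _ _ (at-injective e≉0 p)))
    pos-injective (suc zero) zero p =
      ⊥-elim (proj₂ fresh₅ (suc (suc (suc zero))) (elem-injective _ _ (at-injective e≉0 (≈v-sym p))))
    pos-injective zero (suc (suc k)) p = ⊥-elim (apart _ _ (proj₂ fresh₄ zero) p)
    pos-injective (suc zero) (suc (suc k)) p = ⊥-elim (apart _ _ (proj₂ fresh₅ zero) p)
    pos-injective (suc (suc k)) zero p = ⊥-elim (apart _ _ (proj₂ fresh₄ zero) (≈v-sym p))
    pos-injective (suc (suc k)) (suc zero) p = ⊥-elim (apart _ _ (proj₂ fresh₅ zero) (≈v-sym p))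
    pos-injective (suc (suc k)) (suc (suc l)) p =
      ≡.cong (λ k → suc (suc k)) (elem-injective _ _ (at-injective d≉0 p))
    -- The pigeons are the `q` points of the first line and two points of the second, chosen off C
    -- and away from the parameter `u₀`. Isolated points go to points of `σ₀` other than `A`; the
    -- extra hole `zero` and the vacant hole of `A` take the parameters `t₂` and `t₁`, which may
    -- give points of C.
    R : Fin (2 ℕ.+ q) → Fin (1 ℕ.+ q) → Set (c ⊔ ℓ)
    R i zero = Lift (c ⊔ ℓ) (i ≡ suc (suc t₂))
    R i (suc k) = Hit (pos i) k ⊎ (k ≡ a₀ × i ≡ suc (suc t₁))
    R-injective : ∀ {i j k} → R i k → R j k → i ≡ j
    R-injective {k = zero} (lift p) (lift p') = ≡.trans p (≡.sym p')
    R-injective {i} {j} {suc k} (inj₁ p) (inj₁ p') = pos-injective i j (Hit-injective (Aff-pos j) (pos∈ j) p p')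
    R-injective {k = suc k} (inj₁ p) (inj₂ (≡.refl , _)) = ⊥-elim (not-a₀ p)
    R-injective {k = suc k} (inj₂ (≡.refl , _)) (inj₁ p) = ⊥-elim (not-a₀ p)
    R-injective {k = suc k} (inj₂ (_ , p)) (inj₂ (_ , p')) = ≡.trans p (≡.sym p')
    through : ∀ {i} → Isolated π (pos i) → ∃ (R i)
    through iso = let k , p = hit iso in suc k , inj₁ p
    isolated : ∀ {v} → ¬ IsC v → IsC v ⊎ Isolated π v → Isolated π v
    isolated off (inj₁ C) = ⊥-elim (off C)
    isolated off (inj₂ iso) = iso
    total : ∀ i → ∃ (R i)
    total zero = through {zero} (isolated (proj₂ (proj₂ (proj₂ few-y)) u₄
      (proj₂ fresh₄ (suc zero)) (proj₂ fresh₄ (suc (suc zero)))) (iso-y u₄))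
    total (suc zero) = through {suc zero} (isolated (proj₂ (proj₂ (proj₂ few-y)) u₅
      (proj₂ fresh₅ (suc zero)) (proj₂ fresh₅ (suc (suc zero)))) (iso-y u₅))
    total (suc (suc k)) with t₁ ≟ᶠ k | t₂ ≟ᶠ k
    ... | yes ≡.refl | _ = suc a₀ , inj₂ (≡.refl , ≡.refl)
    ... | _ | yes ≡.refl = zero , lift ≡.refl
    ... | no t₁≢k | no t₂≢k =
      through {suc (suc k)} (isolated (proj₂ (proj₂ (proj₂ few-x)) k t₁≢k t₂≢k) (iso-x k))

  toward : I → I → V 5
  toward A B = c⃗ B -v c⃗ A

  opaque
    toward-end : ∀ A B → at (c⃗ A) (toward A B) 1# ≈v c⃗ B
    toward-end A B t = solve 2 (λ a b → a :+ :1 :* (b :- a) ⊜ b) (c⃗ A t) (c⃗ B t)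

  opaque
    toward≉0 : ∀ {A B} → A ≢ B → NonZero (toward A B)
    toward≉0 A≢B e = A≢B (≡.sym (c⃗-injective λ t → x∙y⁻¹≈ε⇒x≈y _ _ (e t)))

  opaque
    Inf-toward : ∀ A B → Inf (toward A B)
    Inf-toward A B = Inf-- (Aff-c⃗ B) (Aff-c⃗ A)

  opaque
    toward-indep : ∀ π {A B B'} → c⃗ A ∈ π → c⃗ B ∈ π → c⃗ B' ∈ π → A ≢ B → A ≢ B' → B ≢ B' →
      Indep₂ (toward A B) (toward A B')
    toward-indep π {A} {B} {B'} A∈ B∈ B'∈ A≢B A≢B' B≢B' a b rel = zeros (suc zero) , zeros (suc (suc zero))
      where
      zeros : ∀ j → (- (a + b) ∷ a ∷ b ∷ []) j ≈ 0#
      zeros = arc-indep π A∈ B∈ B'∈ A≢B B≢B' A≢B' (- (a + b) ∷ a ∷ b ∷ []) (λ t → trans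
        (solve 5 (λ a b x y z → (:- (a :+ b)) :* x :+ (a :* y :+ (b :* z :+ :0)) ⊜ a :* (y :- x) :+ b :* (z :- x))
          a b (c⃗ A t) (c⃗ B t) (c⃗ B' t)) (rel t))

  Clear : CPlane → V 5 → V 5 → Set (c ⊔ ℓ)
  Clear π x d = ∀ k → IsC (at x d (elem k)) ⊎ Isolated π (at x d (elem k))

  opaque
    -- The two secants meet in `A` only, so `two-isolated-lines` applies with parameter 0 as the
    -- exception.
    no-clear-secants : ∀ {π A B B'} → c⃗ A ∈ π → c⃗ B ∈ π → c⃗ B' ∈ π → A ≢ B → A ≢ B' → B ≢ B' →
      Clear π (c⃗ A) (toward A B) → Clear π (c⃗ A) (toward A B') → ⊥
    no-clear-secants {π} {A} {B} {B'} A∈ B∈ B'∈ A≢B A≢B' B≢B' clear clear' =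
      two-isolated-lines (Aff-c⃗ A) (Aff-c⃗ A) (Inf-toward A B) (Inf-toward A B') (toward≉0 A≢B) (toward≉0 A≢B')
        A∈ A∈ (∈-- B∈ A∈) (∈-- B'∈ A∈) clear clear' (index 0#) apart
      where
      apart : ∀ u t → index 0# ≢ u → ¬ at (c⃗ A) (toward A B') (elem u) ≈v at (c⃗ A) (toward A B) t
      apart u t u≢0 e = u≢0 (elem-injective _ _ (trans (elem-index 0#) (sym
        (proj₂ (toward-indep π A∈ B∈ B'∈ A≢B A≢B' B≢B' (- t) (elem u) λ l → begin
          (- t) * toward A B l + elem u * toward A B' l
            ≈⟨ solve 5 (λ a d e t u → (:- t) :* d :+ u :* e ⊜ (a :+ u :* e) :- (a :+ t :* d))
                 (c⃗ A l) (toward A B l) (toward A B' l) t (elem u) ⟩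
          at (c⃗ A) (toward A B') (elem u) l - at (c⃗ A) (toward A B) t l  ≈⟨ +-congʳ (e l) ⟩
          at (c⃗ A) (toward A B) t l - at (c⃗ A) (toward A B) t l  ≈⟨ -‿inverseʳ _ ⟩
          0# ∎)))))

  opaque
    -- The two axis lines meet in a point of `π`. Were it off C, the uniqueness in (A3) would make
    -- the two second planes equal, and a plane that shares this point and both directions with `π`
    -- is `π` itself.
    axes-cross : ∀ {π d e} (a : Axis π d) (b : Axis π e) → Indep₂ d e →
      ∃ λ A → c⃗ A ∈ π × c⃗ A ∈ Axis.σ a × c⃗ A ∈ Axis.σ b ×
        (∃ λ α → c⃗ A ≈v at (Axis.v a) d α)
    axes-cross {π} {d} {e} a b ind
      with frame-coords (Axis.hv a) (Axis.hd a) (Axis.hd b) ind (Axis.v∈π a) (Axis.d∈π a) (Axis.d∈π b) (Axis.hv b) (Axis.v∈π b)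
    ... | α , β , P≈ with isC? (at (Axis.v a) d α)
    ... | yes (A , e) = A , ∈-resp e (∈-at α (Axis.v∈π a) (Axis.d∈π a)) , ∈-resp e (∈-at α (Axis.v∈σ a) (Axis.d∈σ a)) ,
        ∈-resp (≈v-trans P≈ e) (∈-at (- β) (Axis.v∈σ b) (Axis.d∈σ b)) , α , ≈v-sym e
    ... | no off = ⊥-elim (Axis.σ≄π a (indep⇒≃ (frame-indep (Axis.hv a) (Axis.hd a) (Axis.hd b) ind)
        (frame-∈ (Axis.v∈σ a) (Axis.d∈σ a) (≃-∈ (≃-sym σa≃σb) (Axis.d∈σ b)))
        (frame-∈ (Axis.v∈π a) (Axis.d∈π a) (Axis.d∈π b))))
      where
      σa≃σb : Axis.σ a ≃ Axis.σ b
      σa≃σb = proj₂ (off-C (h≈1 (Aff-at α (Axis.hv a) (Axis.hd a))) off π (∈-at α (Axis.v∈π a) (Axis.d∈π a)))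
        (Axis.σ a) (Axis.σ b) (Axis.σ≄π a) (Axis.σ≄π b)
        (∈-at α (Axis.v∈σ a) (Axis.d∈σ a)) (∈-resp P≈ (∈-at (- β) (Axis.v∈σ b) (Axis.d∈σ b)))

  -- A third axis anchored on a secant `AB` is impossible. If it runs along the secant, its second
  -- plane contains `A` and `B` and is `π`. Otherwise it crosses one of the two given axes,
  -- necessarily in `A`, and then its anchor, lying on the secant too, is `A`, although anchors are
  -- off C.
  module CrossingAxes {π : CPlane} {d e : V 5} (a : Axis π d) (b : Axis π e) (ind : Indep₂ d e)
    {A B : I} (A∈π : c⃗ A ∈ π) (A∈σa : c⃗ A ∈ Axis.σ a) (A∈σb : c⃗ A ∈ Axis.σ b)
    (B∈π : c⃗ B ∈ π) (A≢B : A ≢ B) (l : Fin q) {f : V 5} (ax : Axis π f)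
    (v≡ : Axis.v ax ≡ at (c⃗ A) (toward A B) (elem l)) where
    module b = Axis b
    module x = Axis ax
    u = toward A B
    t = elem l
    v≈ : x.v ≈v at (c⃗ A) u t
    v≈ i = reflexive (≡.cong (λ v → v i) v≡)
    along : ¬ (∃ λ k → u ≈v (k *v f))
    along (k , u≈kf) = A≢B (common-unique x.σ≄π A∈σ A∈π (∈-resp (toward-end A B) (∈-at 1# A∈σ u∈σ)) B∈π)
      where
      u∈σ : u ∈ x.σ
      u∈σ = ∈-resp (≈v-sym u≈kf) (∈-* k x.d∈σ)
      A∈σ : c⃗ A ∈ x.σ
      A∈σ = ∈-resp (≈v-sym (at-back v≈)) (∈-at (- t) x.v∈σ u∈σ)
    across : Indep₂ f u → ∀ {g} (y : Axis π g) → c⃗ A ∈ Axis.σ y → ¬ Indep₂ f g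
    across ind-fu y A∈σy ind-fg with axes-cross ax y ind-fg
    ... | A' , A'∈π , _ , A'∈σy , α , e
      with common-unique (Axis.σ≄π y) A∈σy A∈π A'∈σy A'∈π
    ... | ≡.refl = x.off (A , λ i → trans (v≈ i) (trans (+-congˡ (trans (*-congʳ t≈0) (zeroˡ _))) (+-identityʳ _)))
      where
      t≈0 : t ≈ 0#
      t≈0 = proj₂ (ind-fu α t λ i → begin
        α * f i + t * u i
          ≈⟨ solve 5 (λ c α f t u → α :* f :+ t :* u ⊜ (c :+ t :* u) :+ α :* f :- c) (c⃗ A i) α (f i) t (u i) ⟩
        at (c⃗ A) u t i + α * f i - c⃗ A i  ≈⟨ +-congʳ (+-congʳ (v≈ i)) ⟨
        at x.v f α i - c⃗ A i  ≈⟨ +-congʳ (e i) ⟨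
        c⃗ A i - c⃗ A i  ≈⟨ -‿inverseʳ _ ⟩
        0# ∎)
    impossible : ⊥
    impossible with proportional? x.d≉0 u
    ... | inj₁ p = along p
    ... | inj₂ ind-fu with proportional? x.d≉0 d | proportional? x.d≉0 e
    ... | inj₂ ind-fd | _ = across ind-fu a A∈σa ind-fd
    ... | _ | inj₂ ind-fe = across ind-fu b A∈σb ind-fe
    ... | inj₁ (r , d≈rf) | inj₁ (s , e≈sf) = b.d≉0 λ i → trans (e≈sf i) (trans (*-congʳ s≈0) (zeroˡ _))
      where
      s≈0 : s ≈ 0#
      s≈0 = proj₁ (ind s (- r) λ i → begin
        s * d i + (- r) * e i  ≈⟨ +-cong (*-congˡ (d≈rf i)) (*-congˡ (e≈sf i)) ⟩
        s * (r * f i) + (- r) * (s * f i)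
          ≈⟨ solve 3 (λ s r f → s :* (r :* f) :+ (:- r) :* (s :* f) ⊜ :0) s r (f i) ⟩
        0# ∎)
  secant-clear : ∀ {π d e A B} (a : Axis π d) (b : Axis π e) → Indep₂ d e →
    c⃗ A ∈ π → c⃗ A ∈ Axis.σ a → c⃗ A ∈ Axis.σ b → c⃗ B ∈ π → A ≢ B → Clear π (c⃗ A) (toward A B)
  secant-clear {π} {A = A} {B} a b ind A∈π A∈σa A∈σb B∈π A≢B l =
    [ id , (λ (f , ax , v≡) → ⊥-elim
      (CrossingAxes.impossible a b ind {A} {B} A∈π A∈σa A∈σb B∈π A≢B l ax v≡)) ]
    (alone-or-axis (Aff-at (elem l) (Aff-c⃗ A) (Inf-toward A B)) (∈-at (elem l) A∈π (∈-- B∈π A∈π)))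

  -- If two axes crossed, every secant through their common point would carry only isolated points.
  opaque
    axes-parallel : ∀ {π d e} → Axis π d → Axis π e → ∃ λ k → e ≈v (k *v d)
    axes-parallel {π} {d} {e} a b with proportional? (Axis.d≉0 a) e
    ... | inj₁ p = p
    ... | inj₂ ind with axes-cross a b ind
    ... | A , A∈π , A∈σa , A∈σb , _ with number π A∈π
    ... | k₀ , ≡.refl with fresh (k₀ ∷ []) 2≤q
    ... | k , k-new with fresh (k₀ ∷ k ∷ []) (below-q (s≤s (s≤s (s≤s z≤n))))
    ... | k' , k'-new = ⊥-elim (no-clear-secants {π} A∈π (pts∈ π k) (pts∈ π k')
        (k-new zero ∘ pts-injective π) (k'-new zero ∘ pts-injective π) (k'-new (suc zero) ∘ pts-injective π)
        (secant-clear a b ind A∈π A∈σa A∈σb (pts∈ π k) (k-new zero ∘ pts-injective π))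
        (secant-clear a b ind A∈π A∈σa A∈σb (pts∈ π k') (k'-new zero ∘ pts-injective π)))

  opaque
    secant-clear-or-axis : ∀ π k l → let A = c⃗ (pts π k) ; u = toward (pts π k) (pts π l) in
      Clear π A u ⊎ ∃ (Axis π)
    secant-clear-or-axis π k l with all-or-any (λ i → alone-or-axis {π}
      (Aff-at (elem i) (Aff-c⃗ (pts π k)) (Inf-toward (pts π k) (pts π l)))
      (∈-at (elem i) (pts∈ π k) (∈-- (pts∈ π l) (pts∈ π k))))
    ... | inj₁ clear = inj₁ clear
    ... | inj₂ (_ , d , ax , _) = inj₂ (d , ax)

  opaque
    -- Of two secants through one point at most one is clear, and a point that spoils the other
    -- anchors an axis.
    exists-axis : ∀ π → ∃ (Axis π)
    exists-axis π with fresh (fromℕ< 2≤q ∷ []) 2≤q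
    ... | k₁ , new₁ with fresh (fromℕ< 2≤q ∷ k₁ ∷ []) (below-q (s≤s (s≤s (s≤s z≤n))))
    ... | k₂ , new₂ with secant-clear-or-axis π (fromℕ< 2≤q) k₁ | secant-clear-or-axis π (fromℕ< 2≤q) k₂
    ... | inj₂ ax | _ = ax
    ... | _ | inj₂ ax = ax
    ... | inj₁ clear | inj₁ clear' = ⊥-elim (no-clear-secants {π} (pts∈ π _) (pts∈ π _) (pts∈ π _)
      (new₁ zero ∘ pts-injective π) (new₂ zero ∘ pts-injective π) (new₂ (suc zero) ∘ pts-injective π)
      clear clear')

  Lined : CPlane → V 5 → V 5 → Set (c ⊔ ℓ)
  Lined π x d = ∃ λ σ → ¬ σ ≃ π × x ∈ σ × d ∈ σ

  opaque
    axis-∈ : ∀ {π d e} → Axis π d → (ax : Axis π e) → d ∈ Axis.σ ax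
    axis-∈ a b with axes-parallel b a
    ... | k , d≈ke = ∈-resp (≈v-sym d≈ke) (∈-* k (Axis.d∈σ b))

  opaque
    -- A point of the line that is neither on C nor isolated anchors an axis; since all axes of `π`
    -- are parallel, its second plane contains `d` and with it the whole line.
    lined-or-clear : ∀ {π d x} → Axis π d → Aff x → x ∈ π → Lined π x d ⊎ Clear π x d
    lined-or-clear {π} {d} {x} a hx x∈π with all-or-any
      (λ l → alone-or-axis {π} (Aff-at (elem l) hx (Axis.hd a)) (∈-at (elem l) x∈π (Axis.d∈π a)))
    ... | inj₁ clear = inj₂ clear
    ... | inj₂ (l , e , b , v≡) = inj₁ ((Axis.σ b) , (Axis.σ≄π b) ,
        ∈-resp (≈v-sym (at-back (λ i → reflexive (≡.cong (λ v → v i) v≡))))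
          (∈-at (- elem l) (Axis.v∈σ b) (axis-∈ a b)) , axis-∈ a b)

  opaque
    clear-unique : ∀ {π d x y} → Axis π d → Aff x → Aff y → x ∈ π → y ∈ π → Clear π x d → Clear π y d →
      ∃ λ t → y ≈v at x d t
    clear-unique {π} {d} {x} {y} a hx hy x∈ y∈ clear-x clear-y with anyF? {P = λ t → y ≈v at x d t}
      (λ t≈t' p i → trans (p i) (+-congˡ (*-congʳ t≈t'))) (λ t → y ≟v at x d t)
    ... | yes p = p
    ... | no none = ⊥-elim (two-isolated-lines hx hy (Axis.hd a) (Axis.hd a) (Axis.d≉0 a) (Axis.d≉0 a) x∈ y∈ (Axis.d∈π a) (Axis.d∈π a) clear-x clear-y
        (index 0#) (λ u t _ e → none (t - elem u , λ i → begin
          y i  ≈⟨ solve 3 (λ y u d → y ⊜ (y :+ u :* d) :- u :* d) (y i) (elem u) (d i) ⟩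
          at y d (elem u) i - elem u * d i  ≈⟨ +-congʳ (e i) ⟩
          at x d t i - elem u * d i  ≈⟨ solve 4 (λ x t u d → (x :+ t :* d) :- u :* d ⊜ x :+ (t :- u) :* d) (x i) t (elem u) (d i) ⟩
          at x d (t - elem u) i ∎)))

  opaque
    -- Provides a definite point off C on the common line, where (A3) can be applied: were it on C,
    -- the two planes would share two points of C.
    shift-off-C : ∀ {π σ d i} → NonZero d → c⃗ i ∈ π → c⃗ i ∈ σ → d ∈ π → d ∈ σ → ¬ σ ≃ π → ¬ IsC (at (c⃗ i) d 1#)
    shift-off-C {π} {σ} {d} {i} d≉0 i∈π i∈σ d∈π d∈σ σ≄π (j , e) =
      i≢j (common-unique σ≄π i∈σ i∈π (∈-resp e (∈-at 1# i∈σ d∈σ)) (∈-resp e (∈-at 1# i∈π d∈π)))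
      where
      i≢j : i ≢ j
      i≢j ≡.refl = d≉0 λ t → begin
        d t  ≈⟨ solve 2 (λ x d → d ⊜ (x :+ :1 :* d) :- x) (c⃗ i t) (d t) ⟩
        at (c⃗ i) d 1# t - c⃗ i t  ≈⟨ +-congʳ (e t) ⟩
        c⃗ i t - c⃗ i t  ≈⟨ -‿inverseʳ _ ⟩
        0# ∎

  mk-axis : ∀ {π σ d i} → NonZero d → Inf d → c⃗ i ∈ π → c⃗ i ∈ σ → d ∈ π → d ∈ σ → ¬ σ ≃ π → Axis π d
  mk-axis {π} {σ} {d} {i} d≉0 hd i∈π i∈σ d∈π d∈σ σ≄π = record
    { v = at (c⃗ i) d 1# ; σ = σ ; off = shift-off-C d≉0 i∈π i∈σ d∈π d∈σ σ≄π
    ; hv = Aff-at 1# (Aff-c⃗ i) hd ; v∈π = ∈-at 1# i∈π d∈π ; v∈σ = ∈-at 1# i∈σ d∈σ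
    ; σ≄π = σ≄π ; d≉0 = d≉0 ; hd = hd ; d∈π = d∈π ; d∈σ = d∈σ }

opaque
  avoid-two : ∀ {n r} {P : Fin n → Set r} {x y z} → x ≢ y → x ≢ z → y ≢ z → P x → P y → P z →
    ∀ i j → ∃ λ k → k ≢ i × k ≢ j × P k
  avoid-two {x = x} {y} x≢y x≢z y≢z px py pz i j with x ≟ᶠ i | x ≟ᶠ j | y ≟ᶠ i | y ≟ᶠ j
  ... | no n | no n' | _ | _ = _ , n , n' , px
  ... | _ | _ | no n | no n' = _ , n , n' , py
  ... | yes ≡.refl | _ | yes e | _ = ⊥-elim (x≢y (≡.sym e))
  ... | _ | yes ≡.refl | _ | yes e = ⊥-elim (x≢y (≡.sym e))
  ... | yes ≡.refl | _ | _ | yes ≡.refl = _ , x≢z ∘ ≡.sym , y≢z ∘ ≡.sym , pz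
  ... | _ | yes ≡.refl | yes ≡.refl | _ = _ , y≢z ∘ ≡.sym , x≢z ∘ ≡.sym , pz

module NormalForm {c ℓ} (S : Setup c ℓ) where
  open import Data.Vec.Functional using ([]; _∷_)
  open Setup S
  open CommutativeRing F hiding (zero)
  open LinAlg F
  open CPlanes S
  open RingSolver F
  open Relation.Binary.Reasoning.Setoid setoid

  -- No three C-planes in a solid.

  Kills : V 5 → CPlane → Set (c ⊔ ℓ)
  Kills φ π = ∀ {v} → v ∈ π → dot φ v ≈ 0#

  opaque
    kills-span : ∀ {k} {p : Fin k → V 5} φ → (∀ j → dot φ (p j) ≈ 0#) → ∀ {v} → InSpan p v → dot φ v ≈ 0#
    kills-span {k} {p} φ φp≈0 (cs , e) = trans (dot-congʳ φ e) (trans (dot-combo φ cs p)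
      (sumF-0 k (λ j → trans (*-congˡ (φp≈0 j)) (zeroʳ _))))

  opaque
    kills-arc : ∀ φ π {i j k} → c⃗ i ∈ π → c⃗ j ∈ π → c⃗ k ∈ π → i ≢ j → j ≢ k → i ≢ k →
      dot φ (c⃗ i) ≈ 0# → dot φ (c⃗ j) ≈ 0# → dot φ (c⃗ k) ≈ 0# → Kills φ π
    kills-arc φ π {i} {j} {k} i∈ j∈ k∈ i≢j j≢k i≢k pi pj pk v∈ = kills-span {p = c⃗ i ∷ c⃗ j ∷ c⃗ k ∷ []} φ
      (λ { zero → pi ; (suc zero) → pj ; (suc (suc zero)) → pk })
      (∈-indep (arc-indep π i∈ j∈ k∈ i≢j j≢k i≢k) (frame-∈ i∈ j∈ k∈) v∈)

  opaque
    third : ∀ π i j → ∃ λ k → k ≢ i × k ≢ j × c⃗ k ∈ π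
    third π i j with fresh (fromℕ< 2≤q ∷ []) 2≤q
    ... | b , b-new with fresh (fromℕ< 2≤q ∷ b ∷ []) (below-q (s≤s (s≤s (s≤s z≤n))))
    ... | d , d-new = avoid-two (b-new zero ∘ pts-injective π) (d-new zero ∘ pts-injective π)
      (d-new (suc zero) ∘ pts-injective π) (pts∈ π _) (pts∈ π b) (pts∈ π d) i j

  opaque
    -- On the solid `φ = 0` the coordinate `k` is determined by the other four.
    zero-outside : ∀ {φ : V 5} {k u} → ¬ φ k ≈ 0# → dot φ u ≈ 0# → (∀ l → u (punchIn k l) ≈ 0#) → u ≈v zv
    zero-outside {φ} {k} {u} φk≉0 φu≈0 u≈0 i with k ≟ᶠ i
    ... | no k≢i = ≡.subst (λ i → u i ≈ 0#) (punchIn-punchOut k≢i) (u≈0 (punchOut k≢i))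
    ... | yes ≡.refl = *-cancel-0 φk≉0 (trans (sym (sumF-single (λ i → φ i * u i) k
        (λ i k≢i → trans (*-congˡ (≡.subst (λ i → u i ≈ 0#) (punchIn-punchOut k≢i) (u≈0 (punchOut k≢i)))) (zeroʳ _)))) φu≈0)

  -- Six unknown coefficients against the four coordinates of the solid and the condition h = 0.
  opaque
    common-direction : ∀ {φ π σ} → NonZero φ → Kills φ π → Kills φ σ →
      ∃ λ d → NonZero d × Inf d × d ∈ π × d ∈ σ
    common-direction {φ} {π} {σ} φ≉0 φπ φσ with nonZero-entry φ≉0
    ... | k , φk≉0 = d , d≉0 , inf hd≈0 , d∈π , ∈-resp (λ i → sym (x∙y⁻¹≈ε⇒x≈y _ _ (d-d'≈0 i))) d'∈σ
      where
      p s : Fin 3 → V 5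
      p = gens π
      s = gens σ
      glue : (Fin 3 → Carrier) → (Fin 3 → Carrier) → V 6
      glue f g zero = f zero
      glue f g (suc zero) = f (suc zero)
      glue f g (suc (suc zero)) = f (suc (suc zero))
      glue f g (suc (suc (suc j))) = g j
      rows : Fin 5 → V 6
      rows zero = glue (λ j → dot h (p j)) (λ _ → 0#)
      rows (suc l) = glue (λ j → p j (punchIn k l)) (λ j → - s j (punchIn k l))
      x : V 6
      x = proj₁ (kernel 5 rows)
      x≉0 : NonZero x
      x≉0 = proj₁ (proj₂ (kernel 5 rows))
      eqs : ∀ l → dot (rows l) x ≈ 0#
      eqs = proj₂ (proj₂ (kernel 5 rows))
      a b : Fin 3 → Carrier
      a j = x (glueˡ j)
        where
        glueˡ : Fin 3 → Fin 6
        glueˡ zero = zero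
        glueˡ (suc zero) = suc zero
        glueˡ (suc (suc zero)) = suc (suc zero)
      b j = x (suc (suc (suc j)))
      d d' : V 5
      d = combo a p
      d' = combo b s
      d∈π : d ∈ π
      d∈π = ∈-combo {p = p} (∈-basis {π}) (a , λ i → refl)
      d'∈σ : d' ∈ σ
      d'∈σ = ∈-combo {p = s} (∈-basis {σ}) (b , λ i → refl)
      d-d'≈0 : (d -v d') ≈v zv
      d-d'≈0 = zero-outside {φ} {k} φk≉0 (begin
        dot φ (d -v d')  ≈⟨ dot-congʳ φ (λ i → solve 2 (λ x y → x :- y ⊜ :1 :* x :+ (:- :1) :* y) (d i) (d' i)) ⟩
        dot φ (1# *v d +v (- 1#) *v d')  ≈⟨ dot-lin φ 1# d (- 1#) d' ⟩
        1# * dot φ d + (- 1#) * dot φ d'  ≈⟨ +-cong (*-congˡ (φπ d∈π)) (*-congˡ (φσ d'∈σ)) ⟩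
        1# * 0# + (- 1#) * 0#  ≈⟨ solve 0 (:1 :* :0 :+ (:- :1) :* :0 ⊜ :0) ⟩
        0# ∎) (λ l → trans (solve 12 (λ x y z u v w a b c e f g →
          (a :* x :+ (b :* y :+ (c :* z :+ :0))) :- (e :* u :+ (f :* v :+ (g :* w :+ :0))) ⊜
          x :* a :+ (y :* b :+ (z :* c :+ ((:- u) :* e :+ ((:- v) :* f :+ ((:- w) :* g :+ :0))))))
          (p zero (punchIn k l)) (p (suc zero) (punchIn k l)) (p (suc (suc zero)) (punchIn k l))
          (s zero (punchIn k l)) (s (suc zero) (punchIn k l)) (s (suc (suc zero)) (punchIn k l))
          (a zero) (a (suc zero)) (a (suc (suc zero))) (b zero) (b (suc zero)) (b (suc (suc zero)))) (eqs (suc l)))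
      hd≈0 : dot h d ≈ 0#
      hd≈0 = trans (dot-combo h a p) (trans (solve 9 (λ x y z a b c e f g →
        a :* x :+ (b :* y :+ (c :* z :+ :0)) ⊜
        x :* a :+ (y :* b :+ (z :* c :+ (:0 :* e :+ (:0 :* f :+ (:0 :* g :+ :0))))))
        (dot h (p zero)) (dot h (p (suc zero))) (dot h (p (suc (suc zero))))
        (a zero) (a (suc zero)) (a (suc (suc zero))) (b zero) (b (suc zero)) (b (suc (suc zero)))) (eqs zero))
      d≉0 : NonZero d
      d≉0 d≈0 = x≉0 λ
        { zero → indep (proj₁ π) a d≈0 zero
        ; (suc zero) → indep (proj₁ π) a d≈0 (suc zero)
        ; (suc (suc zero)) → indep (proj₁ π) a d≈0 (suc (suc zero))
        ; (suc (suc (suc j))) → indep (proj₁ σ) b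
            (λ i → trans (sym (x∙y⁻¹≈ε⇒x≈y _ _ (d-d'≈0 i))) (d≈0 i)) j }

  -- Two planes of a solid share a direction at infinity. If C lay in a solid, any two C-planes
  -- through a point `A` of C would thus give an axis; axes of a plane being parallel, three
  -- C-planes through `A` would contain a common line, whose points off C contradict (A3).
  not-in-solid : ∀ {φ} → NonZero φ → ¬ (∀ i → dot φ (c⃗ i) ≈ 0#)
  not-in-solid {φ} φ≉0 φC≈0 = contradiction
    where
    kills : ∀ π → Kills φ π
    kills π with third π (pts π (fromℕ< 2≤q)) (pts π (fromℕ< 2≤q))
    ... | j , j≢i , _ , j∈ with third π (pts π (fromℕ< 2≤q)) j
    ... | k , k≢i , k≢j , k∈ = kills-arc φ π (pts∈ π _) j∈ k∈ (j≢i ∘ ≡.sym) (k≢j ∘ ≡.sym) (k≢i ∘ ≡.sym)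
      (φC≈0 _) (φC≈0 _) (φC≈0 _)
    three-planes : ∀ {π σ σ' A} → c⃗ A ∈ π → c⃗ A ∈ σ → c⃗ A ∈ σ' → ¬ σ ≃ π → ¬ σ' ≃ π → ¬ σ ≃ σ' → ⊥
    three-planes {π} {σ} {σ'} A∈π A∈σ A∈σ' σ≄π σ'≄π σ≄σ'
      with common-direction φ≉0 (kills π) (kills σ) | common-direction φ≉0 (kills π) (kills σ')
    ... | d , d≉0 , hd , d∈π , d∈σ | d' , d'≉0 , hd' , d'∈π , d'∈σ' =
      σ≄σ' (proj₂ (off-C (h≈1 (Axis.hv ax)) (Axis.off ax) π (Axis.v∈π ax)) σ σ' σ≄π σ'≄π (Axis.v∈σ ax)
        (∈-at 1# A∈σ' d∈σ'))
      where
      ax : Axis π d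
      ax = mk-axis d≉0 hd A∈π A∈σ d∈π d∈σ σ≄π
      d∈σ' : d ∈ σ'
      d∈σ' with axes-parallel (mk-axis d'≉0 hd' A∈π A∈σ' d'∈π d'∈σ' σ'≄π) ax
      ... | k , d≈kd' = ∈-resp (≈v-sym d≈kd') (∈-* k d'∈σ')
    contradiction : ⊥
    contradiction with escape-any
      where
      escape-any : ∃₂ λ (i j : I) → i ≢ j
      escape-any = let j , new = fresh {1} (λ _ → fromℕ< (ℕ.<-trans (s≤s z≤n) (ℕ.<-trans 2≤q q<q*q))) (ℕ.<-trans 2≤q q<q*q)
        in _ , j , new zero
    -- Three C-planes through `A`: the joins to `B'`, to a point `B` off the first join, and to a
    -- third point `D` of the plane of `B` and `B'`.
    ... | A , B' , A≢B' with escape (join A≢B')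
    ... | B , B∉π with third (join B≢B') B B'
      where
      B≢B' : B ≢ B'
      B≢B' ≡.refl = B∉π (join-r A≢B')
    ... | D , D≢B , D≢B' , D∈ρ = three-planes (join-l A≢B') (join-l A≢B) (join-l A≢D)
      (λ e → B∉π (≃-∈ e (join-r A≢B))) (λ e → D∉π (≃-∈ e (join-r A≢D)))
      (λ e → D∉σ (≃-∈ (≃-sym e) (join-r A≢D)))
      where
      π : CPlane
      π = join A≢B'
      B≢B' : B ≢ B'
      B≢B' ≡.refl = B∉π (join-r A≢B')
      ρ : CPlane
      ρ = join B≢B'
      A≢B : A ≢ B
      A≢B ≡.refl = B∉π (join-l A≢B')
      D∉π : ¬ c⃗ D ∈ π
      D∉π D∈π = B∉π (≃-∈ (join-unique D≢B' D∈ρ (join-r B≢B') D∈π (join-r A≢B')) (join-l B≢B'))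
      A≢D : A ≢ D
      A≢D ≡.refl = D∉π (join-l A≢B')
      D∉σ : ¬ c⃗ D ∈ join A≢B
      D∉σ D∈σ = B∉π (≃-∈ (join-unique A≢B' A∈ρ (join-r B≢B') (join-l A≢B') (join-r A≢B')) (join-l B≢B'))
        where
        A∈ρ : c⃗ A ∈ ρ
        A∈ρ = ≃-∈ (join-unique D≢B D∈σ (join-r A≢B) D∈ρ (join-l B≢B')) (join-l A≢B)

  -- A point B of C off the solid is joined to six points of π; each join meets the solid in
  -- at most two points of C, which leaves room for only five of them.
  three-in-solid : ∀ {φ π σ τ} → NonZero φ → Kills φ π → Kills φ σ → Kills φ τ →
    ¬ σ ≃ π → ¬ τ ≃ π → ¬ σ ≃ τ → ⊥
  three-in-solid {φ} {π} {σ} {τ} φ≉0 φπ φσ φτ σ≄π τ≄π σ≄τ with any? (λ i → ¬? (dot φ (c⃗ i) ≟ 0#))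
  ... | no none = not-in-solid φ≉0 (λ i → decidable-stable (dot φ (c⃗ i) ≟ 0#) (λ n → none (i , n)))
  ... | yes (B , φB≉0) = pigeonhole-rel R total R-injective (ℕ.n<1+n 5)
    where
    x : Fin 6 → I
    x i = pts π (inject≤ i (below-q (s≤s (s≤s (s≤s (s≤s (s≤s (s≤s z≤n))))))))
    x∈ : ∀ i → c⃗ (x i) ∈ π
    x∈ i = pts∈ π _
    x-injective : ∀ {i j} → x i ≡ x j → i ≡ j
    x-injective e = inject≤-injective _ _ _ _ (pts-injective π e)
    ≢B : ∀ {i ρ} → Kills φ ρ → c⃗ i ∈ ρ → i ≢ B
    ≢B φρ i∈ρ ≡.refl = φB≉0 (φρ i∈ρ)
    β : Fin 6 → CPlane
    β i = join (≢B φπ (x∈ i))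
    x∈β : ∀ i → c⃗ (x i) ∈ β i
    x∈β i = join-l (≢B φπ (x∈ i))
    B∈β : ∀ i → c⃗ B ∈ β i
    B∈β i = join-r (≢B φπ (x∈ i))
    β-injective : ∀ {i j} → β i ≃ β j → i ≡ j
    β-injective {i} {j} e = decidable-stable (i ≟ᶠ j) λ i≢j →
      ≢B φπ (≃-∈ (join-unique (i≢j ∘ x-injective) (x∈β i) (≃-∈ (≃-sym e) (x∈β j)) (x∈ i) (x∈ j)) (B∈β i)) ≡.refl
    R : Fin 6 → Fin 5 → Set (c ⊔ ℓ)
    R i zero = c⃗ (x i) ∈ σ
    R i (suc zero) = c⃗ (x i) ∈ τ
    R i (suc (suc zero)) = Disj (β i) σ
    R i (suc (suc (suc zero))) = Disj (β i) τ
    R i (suc (suc (suc (suc zero)))) = ∃ λ m → c⃗ m ∈ β i × c⃗ m ∈ σ × c⃗ m ∈ τ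
    R-injective : ∀ {i j k} → R i k → R j k → i ≡ j
    R-injective {i} {j} {zero} p p' = x-injective (common-unique σ≄π p (x∈ i) p' (x∈ j))
    R-injective {i} {j} {suc zero} p p' = x-injective (common-unique τ≄π p (x∈ i) p' (x∈ j))
    R-injective {i} {j} {suc (suc zero)} p p' = β-injective (parallel-unique 2≤q (B∈β i) (B∈β j) p p')
    R-injective {i} {j} {suc (suc (suc zero))} p p' = β-injective (parallel-unique 2≤q (B∈β i) (B∈β j) p p')
    R-injective {i} {j} {suc (suc (suc (suc zero)))} (m , m∈βi , m∈σ , m∈τ) (m' , m'∈βj , m'∈σ , m'∈τ)
      with common-unique σ≄τ m∈σ m∈τ m'∈σ m'∈τ
    ... | ≡.refl = β-injective (join-unique (≢B φσ m∈σ) m∈βi (B∈β i) m'∈βj (B∈β j))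
    total : ∀ i → ∃ (R i)
    total i with c⃗ (x i) ∈? σ | c⃗ (x i) ∈? τ | meet? (β i) σ | meet? (β i) τ
    ... | yes p | _ | _ | _ = zero , p
    ... | _ | yes p | _ | _ = suc zero , p
    ... | _ | _ | inj₁ p | _ = suc (suc zero) , p
    ... | _ | _ | _ | inj₁ p = suc (suc (suc zero)) , p
    ... | no x∉σ | no x∉τ | inj₂ (m , m∈β , m∈σ) | inj₂ (m' , m'∈β , m'∈τ) with m ≟ᶠ m'
    ... | yes ≡.refl = suc (suc (suc (suc zero))) , m , m∈β , m∈σ , m'∈τ
    ... | no m≢m' = ⊥-elim (φB≉0 (kills-arc φ (β i) (x∈β i) m∈β m'∈β
        (λ e → x∉σ (≡.subst (λ i → c⃗ i ∈ σ) (≡.sym e) m∈σ)) m≢m'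
        (λ e → x∉τ (≡.subst (λ i → c⃗ i ∈ τ) (≡.sym e) m'∈τ)) (φπ (x∈ i)) (φσ m∈σ) (φτ m'∈τ) (B∈β i)))

  -- Lines in the axis direction lie on a second C-plane.

  infix 4 _on_∥_

  _on_∥_ : V 5 → V 5 → V 5 → Set (c ⊔ ℓ)
  y on x ∥ d = ∃ λ t → y ≈v at x d t

  opaque
    on? : ∀ y x d → Dec (y on x ∥ d)
    on? y x d = anyF? (λ t≈t' p i → trans (p i) (+-congˡ (*-congʳ t≈t'))) (λ t → y ≟v at x d t)

  opaque
    on-via : ∀ {s x y d} → s on x ∥ d → s on y ∥ d → y on x ∥ d
    on-via {s} {x} {y} {d} (t , e) (u , e') = t - u , λ i → begin
      y i  ≈⟨ solve 3 (λ y u d → y ⊜ (y :+ u :* d) :- u :* d) (y i) u (d i) ⟩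
      at y d u i - u * d i  ≈⟨ +-congʳ (trans (sym (e' i)) (e i)) ⟩
      at x d t i - u * d i  ≈⟨ solve 4 (λ x t u d → (x :+ t :* d) :- u :* d ⊜ x :+ (t :- u) :* d) (x i) t u (d i) ⟩
      at x d (t - u) i ∎

  opaque
    off-line-indep : ∀ {x y d} → NonZero d → ¬ y on x ∥ d → Indep₂ d (y -v x)
    off-line-indep {x} {y} {d} d≉0 off = [ (λ (k , e) → ⊥-elim (off (k , λ i → begin
        y i  ≈⟨ solve 2 (λ x y → y ⊜ x :+ (y :- x)) (x i) (y i) ⟩
        x i + (y i - x i)  ≈⟨ +-congˡ (e i) ⟩
        at x d k i ∎))) , id ] (proportional? d≉0 (y -v x))

  opaque
    -- A common point off the line would span, with `x` and `d`, both planes.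
    meet-in-line : ∀ {π σ x y d} → ¬ σ ≃ π → NonZero d → Inf d → Aff x → Aff y →
      x ∈ π → y ∈ π → d ∈ π → x ∈ σ → y ∈ σ → d ∈ σ → y on x ∥ d
    meet-in-line {x = x} {y} {d} σ≄π d≉0 hd hx hy xπ yπ dπ xσ yσ dσ = decidable-stable (on? y x d) λ off →
      σ≄π (indep⇒≃ (frame-indep hx hd (Inf-- hy hx) (off-line-indep d≉0 off))
        (frame-∈ xσ dσ (∈-- yσ xσ)) (frame-∈ xπ dπ (∈-- yπ xπ)))

  opaque
    kills-through : ∀ {φ π σ x s d} → Kills φ π → dot φ s ≈ 0# → ¬ s ∈ π → x ∈ π → d ∈ π →
      NonZero d → Inf d → Aff x → Aff s → x ∈ σ → d ∈ σ → s ∈ σ → Kills φ σ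
    kills-through {φ} {π} {σ} {x} {s} {d} φπ φs s∉π xπ dπ d≉0 hd hx hs xσ dσ sσ v∈σ =
      kills-span {p = x ∷ d ∷ (s -v x) ∷ []} φ
        (λ { zero → φπ xπ ; (suc zero) → φπ dπ ; (suc (suc zero)) → φ[s-x] })
        (∈-indep (frame-indep hx hd (Inf-- hs hx) (off-line-indep d≉0 off)) (frame-∈ xσ dσ (∈-- sσ xσ)) v∈σ)
      where
      off : ¬ s on x ∥ d
      off (t , e) = s∉π (∈-resp (≈v-sym e) (∈-at t xπ dπ))
      φ[s-x] : dot φ (s -v x) ≈ 0#
      φ[s-x] = begin
        dot φ (s -v x)  ≈⟨ dot-congʳ φ (λ i → solve 2 (λ x y → x :- y ⊜ :1 :* x :+ (:- :1) :* y) (s i) (x i)) ⟩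
        dot φ (1# *v s +v (- 1#) *v x)  ≈⟨ dot-lin φ 1# s (- 1#) x ⟩
        1# * dot φ s + (- 1#) * dot φ x  ≈⟨ +-cong (*-congˡ φs) (*-congˡ (φπ xπ)) ⟩
        1# * 0# + (- 1#) * 0#  ≈⟨ solve 0 (:1 :* :0 :+ (:- :1) :* :0 ⊜ :0) ⟩
        0# ∎

  -- Otherwise the three planes would lie in the solid spanned by π and the common point s.
  opaque
    affinely-disjoint : ∀ {π σ τ x y d s} → NonZero d → Inf d → ¬ σ ≃ π → ¬ τ ≃ π → Aff x → Aff y → Aff s →
      d ∈ π → d ∈ σ → d ∈ τ → x ∈ π → x ∈ σ → y ∈ π → y ∈ τ → ¬ y on x ∥ d → s ∈ σ → ¬ s ∈ τ
    affinely-disjoint {π} {σ} {τ} {x} {y} {d} {s} d≉0 hd σ≄π τ≄π hx hy hs dπ dσ dτ xπ xσ yπ yτ off sσ sτ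
      with s ∈? π
    ... | yes sπ = off (on-via (meet-in-line σ≄π d≉0 hd hx hs xπ sπ dπ xσ sσ dσ)
                               (meet-in-line τ≄π d≉0 hd hy hs yπ sπ dπ yτ sτ dτ))
    ... | no s∉π with annihilator (s ∷ gens π)
    ... | φ , φ≉0 , φ0 = three-in-solid {φ} {π} φ≉0 φπ
        (kills-through {φ} {π} φπ (φ0 zero) s∉π xπ dπ d≉0 hd hx hs xσ dσ sσ)
        (kills-through {φ} {π} φπ (φ0 zero) s∉π yπ dπ d≉0 hd hy hs yτ dτ sτ)
        σ≄π τ≄π (λ e → off (meet-in-line σ≄π d≉0 hd hx hy xπ yπ dπ xσ (≃-∈ (≃-sym e) yτ) dσ))
      where
      φπ : Kills φ π
      φπ v∈π = kills-span {p = gens π} φ (λ j → φ0 (suc j)) (span v∈π)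

  opaque
    off-line-point : ∀ {π x d} → NonZero d → ∃ λ A → c⃗ A ∈ π × ¬ c⃗ A on x ∥ d
    off-line-point {π} {x} {d} d≉0 with third π (pts π (fromℕ< 2≤q)) (pts π (fromℕ< 2≤q))
    ... | j , j≢i , _ , j∈ with third π (pts π (fromℕ< 2≤q)) j
    ... | k , k≢i , k≢j , k∈ = choose (on? (c⃗ (pts π (fromℕ< 2≤q))) x d) (on? (c⃗ j) x d) (on? (c⃗ k) x d)
      where
      choose : Dec (c⃗ (pts π (fromℕ< 2≤q)) on x ∥ d) → Dec (c⃗ j on x ∥ d) → Dec (c⃗ k on x ∥ d) →
        ∃ λ A → c⃗ A ∈ π × ¬ c⃗ A on x ∥ d
      choose (no n) _ _ = _ , pts∈ π _ , n
      choose _ (no n) _ = _ , j∈ , n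
      choose _ _ (no n) = _ , k∈ , n
      choose (yes (_ , e)) (yes (_ , e')) (yes (_ , e'')) =
        ⊥-elim (no-collinear {π} d≉0 (pts∈ π _) j∈ k∈ (j≢i ∘ ≡.sym) (k≢j ∘ ≡.sym) (k≢i ∘ ≡.sym) e e' e'')

  record IsolatedOn (π : CPlane) (x d : V 5) (k : Fin q) : Set (c ⊔ ℓ) where
    field
      off : ¬ IsC (at x d (elem k))
      τ : CPlane
      alone : Alone π (at x d (elem k)) τ

  opaque
    -- Three, because they lead to three collinear points of another C-plane in `clear-impossible`.
    -- At most two points of the line are on C, so fresh parameters provide them.
    three-isolated : ∀ {π x d} → NonZero d → x ∈ π → d ∈ π → Clear π x d →
      Σ (Fin 3 → Fin q) λ k → (∀ {i j} → k i ≡ k j → i ≡ j) × (∀ i → IsolatedOn π x d (k i))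
    three-isolated {π} {x} {d} d≉0 x∈ d∈ clear with few-C x∈ d∈ d≉0
    ... | a , b , _ , few with fresh (a ∷ b ∷ []) (below-q (s≤s (s≤s (s≤s z≤n))))
    ... | k₀ , new₀ with fresh (a ∷ b ∷ k₀ ∷ []) (below-q (s≤s (s≤s (s≤s (s≤s z≤n)))))
    ... | k₁ , new₁ with fresh (a ∷ b ∷ k₀ ∷ k₁ ∷ []) (below-q (s≤s (s≤s (s≤s (s≤s (s≤s z≤n))))))
    ... | k₂ , new₂ = k₀ ∷ k₁ ∷ k₂ ∷ [] , injective _ _ ,
        λ { zero → iso k₀ (few k₀ (new₀ zero) (new₀ (suc zero)))
          ; (suc zero) → iso k₁ (few k₁ (new₁ zero) (new₁ (suc zero)))
          ; (suc (suc zero)) → iso k₂ (few k₂ (new₂ zero) (new₂ (suc zero))) }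
      where
      iso : ∀ k → ¬ IsC (at x d (elem k)) → IsolatedOn π x d k
      iso k off with clear k
      ... | inj₁ C = ⊥-elim (off C)
      ... | inj₂ (_ , τ , alone) = record { off = off ; τ = τ ; alone = alone }
      injective : ∀ i j → (k₀ ∷ k₁ ∷ k₂ ∷ []) i ≡ (k₀ ∷ k₁ ∷ k₂ ∷ []) j → i ≡ j
      injective zero zero e = ≡.refl
      injective (suc zero) (suc zero) e = ≡.refl
      injective (suc (suc zero)) (suc (suc zero)) e = ≡.refl
      injective zero (suc zero) e = ⊥-elim (new₁ (suc (suc zero)) e)
      injective (suc zero) zero e = ⊥-elim (new₁ (suc (suc zero)) (≡.sym e))
      injective zero (suc (suc zero)) e = ⊥-elim (new₂ (suc (suc zero)) e)
      injective (suc (suc zero)) zero e = ⊥-elim (new₂ (suc (suc zero)) (≡.sym e))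
      injective (suc zero) (suc (suc zero)) e = ⊥-elim (new₂ (suc (suc (suc zero))) e)
      injective (suc (suc zero)) (suc zero) e = ⊥-elim (new₂ (suc (suc (suc zero))) (≡.sym e))

  -- Three isolated points P i = x + k i d lie on planes τ i disjoint from π in C; these meet σ in
  -- distinct points B i of C, one of which lies on a further plane ρ through d, parallel to both
  -- π and τ i.
  clear-impossible : ∀ {π σ x d A} → Axis π d → Axis σ d → ¬ σ ≃ π → Aff x → x ∈ π → Clear π x d →
    c⃗ A ∈ π → c⃗ A ∈ σ → d ∈ σ → ⊥
  clear-impossible {π} {σ} {x} {d} {A} a b σ≄π hx x∈π clear A∈π A∈σ d∈σ
    with three-isolated (Axis.d≉0 a) x∈π (Axis.d∈π a) clear
  ... | k , k-injective , iso = conclude (λ i → lined-or-clear b (Aff-c⃗ (B i)) (B∈σ i))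
    where
    d≉0 : NonZero d
    d≉0 = Axis.d≉0 a
    hd : Inf d
    hd = Axis.hd a
    d∈π : d ∈ π
    d∈π = Axis.d∈π a
    P : Fin 3 → V 5
    P i = at x d (elem (k i))
    hP : ∀ i → Aff (P i)
    hP i = Aff-at (elem (k i)) hx hd
    P∈π : ∀ i → P i ∈ π
    P∈π i = ∈-at (elem (k i)) x∈π d∈π
    τ : Fin 3 → CPlane
    τ i = IsolatedOn.τ (iso i)
    P∈τ : ∀ i → P i ∈ τ i
    P∈τ i = proj₁ (IsolatedOn.alone (iso i))
    only : ∀ i u → Aff u → u ∈ π → u ∈ τ i → u ≈v P i
    only i = proj₂ (IsolatedOn.alone (iso i))
    τ∥π : ∀ i → Disj (τ i) π
    τ∥π i = alone-disjoint (IsolatedOn.off (iso i)) (IsolatedOn.alone (iso i))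
    d∉τ : ∀ i → ¬ d ∈ τ i
    d∉τ i d∈τ = d≉0 λ t → begin
      d t  ≈⟨ solve 2 (λ x d → d ⊜ (x :+ :1 :* d) :- x) (P i t) (d t) ⟩
      at (P i) d 1# t - P i t
        ≈⟨ +-congʳ (only i (at (P i) d 1#) (Aff-at 1# (hP i) hd) (∈-at 1# (P∈π i) d∈π) (∈-at 1# (P∈τ i) d∈τ) t) ⟩
      P i t - P i t  ≈⟨ -‿inverseʳ _ ⟩
      0# ∎
    meet : ∀ i → ∃ λ B → c⃗ B ∈ τ i × c⃗ B ∈ σ
    meet i with meet? (τ i) σ
    ... | inj₂ m = m
    ... | inj₁ disj = ⊥-elim (σ≄π (parallel-unique 2≤q A∈σ A∈π
        (λ j j∈σ j∈τ → disj j j∈τ j∈σ) (λ j j∈π j∈τ → τ∥π i j j∈τ j∈π)))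
    B : Fin 3 → I
    B i = proj₁ (meet i)
    B∈τ : ∀ i → c⃗ (B i) ∈ τ i
    B∈τ i = proj₁ (proj₂ (meet i))
    B∈σ : ∀ i → c⃗ (B i) ∈ σ
    B∈σ i = proj₂ (proj₂ (meet i))
    B-injective : ∀ {i j} → B i ≡ B j → i ≡ j
    B-injective {i} {j} e = k-injective (elem-injective _ _ (at-injective d≉0 (≈v-sym
      (only i (P j) (hP j) (P∈π j) (≃-∈ (parallel-unique 2≤q (B∈τ j)
        (≡.subst (λ B → c⃗ B ∈ τ i) e (B∈τ i)) (τ∥π j) (τ∥π i)) (P∈τ j))))))
    not-lined : ∀ i → ¬ Lined σ (c⃗ (B i)) d
    not-lined i (ρ , ρ≄σ , B∈ρ , d∈ρ) =
      d∉τ i (≃-∈ (parallel-unique 2≤q B∈ρ (B∈τ i) ρ∥π (τ∥π i)) d∈ρ)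
      where
      off : ¬ c⃗ (B i) on c⃗ A ∥ d
      off (t , e) = τ∥π i (B i) (B∈τ i) (∈-resp (≈v-sym e) (∈-at t A∈π d∈π))
      ρ∥π : Disj ρ π
      ρ∥π j j∈ρ j∈π = affinely-disjoint {σ} {π} {ρ} d≉0 hd (σ≄π ∘ ≃-sym) ρ≄σ (Aff-c⃗ A) (Aff-c⃗ (B i)) (Aff-c⃗ j)
        d∈σ d∈π d∈ρ A∈σ A∈π (B∈σ i) B∈ρ off j∈π j∈ρ
    -- None of the lines of `σ` through the `B i` is on a second plane, so all three are clear; but
    -- clear lines in the axis direction coincide, which makes three points of an arc collinear.
    conclude : (∀ i → Lined σ (c⃗ (B i)) d ⊎ Clear σ (c⃗ (B i)) d) → ⊥
    conclude lined = no-collinear {σ} {c⃗ (B zero)} {t = 0#} d≉0 (B∈σ zero) (B∈σ (suc zero)) (B∈σ (suc (suc zero)))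
      (λ e → case (B-injective e) of λ ()) (λ e → case (B-injective e) of λ ()) (λ e → case (B-injective e) of λ ())
      (λ i → solve 2 (λ x d → x ⊜ x :+ :0 :* d) (c⃗ (B zero) i) (d i))
      (proj₂ (same-line (suc zero))) (proj₂ (same-line (suc (suc zero))))
      where
      cleared : ∀ i → Clear σ (c⃗ (B i)) d
      cleared i = [ (λ l → ⊥-elim (not-lined i l)) , id ] (lined i)
      same-line : ∀ i → ∃ λ t → c⃗ (B i) ≈v at (c⃗ (B zero)) d t
      same-line i = clear-unique b (Aff-c⃗ _) (Aff-c⃗ _) (B∈σ zero) (B∈σ i) (cleared zero) (cleared i)

  opaque
    -- At most one line in the axis direction is clear by `clear-unique`; a point of C off it
    -- therefore lies on a lined one, and this supplies the second plane from which
    -- `clear-impossible` starts.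
    all-lined : ∀ {π d x} → Axis π d → Aff x → x ∈ π → Lined π x d
    all-lined {π} {d} {x} a hx x∈π with lined-or-clear a hx x∈π
    ... | inj₁ l = l
    ... | inj₂ clear with off-line-point {π} {x} {d} (Axis.d≉0 a)
    ... | A , A∈π , A-off with lined-or-clear a (Aff-c⃗ A) A∈π
    ... | inj₂ clear' = ⊥-elim (A-off (clear-unique a hx (Aff-c⃗ A) x∈π A∈π clear clear'))
    ... | inj₁ (σ , σ≄π , A∈σ , d∈σ) = ⊥-elim (clear-impossible a
        (mk-axis (Axis.d≉0 a) (Axis.hd a) A∈σ A∈π d∈σ (Axis.d∈π a) (σ≄π ∘ ≃-sym)) σ≄π hx x∈π clear A∈π A∈σ d∈σ)

  -- Linear forms and coordinates.

  record Linear (f : V 5 → Carrier) : Set (c ⊔ ℓ) where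
    field
      resp : ∀ {u v} → u ≈v v → f u ≈ f v
      lin : ∀ a u b v → f (a *v u +v b *v v) ≈ a * f u + b * f v
  open Linear public

  opaque
    lin-combine : ∀ {f g} a b → Linear f → Linear g → Linear (λ v → a * f v + b * g v)
    lin-combine {f} {g} a b lf lg = record
      { resp = λ e → +-cong (*-congˡ (resp lf e)) (*-congˡ (resp lg e))
      ; lin = λ r u s v → trans (+-cong (*-congˡ (lin lf r u s v)) (*-congˡ (lin lg r u s v)))
          (solve 8 (λ a b r s fu fv gu gv → a :* (r :* fu :+ s :* fv) :+ b :* (r :* gu :+ s :* gv) ⊜
            r :* (a :* fu :+ b :* gu) :+ s :* (a :* fv :+ b :* gv)) a b r s (f u) (f v) (g u) (g v)) }

  opaque
    lin-at : ∀ {f} → Linear f → ∀ x d t → f (at x d t) ≈ f x + t * f d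
    lin-at {f} l x d t = begin
      f (at x d t)  ≈⟨ resp l (λ i → solve 3 (λ x t d → x :+ t :* d ⊜ :1 :* x :+ t :* d) (x i) t (d i)) ⟩
      f (1# *v x +v t *v d)  ≈⟨ lin l 1# x t d ⟩
      1# * f x + t * f d  ≈⟨ +-congʳ (*-identityˡ _) ⟩
      f x + t * f d ∎

  opaque
    lin-- : ∀ {f} → Linear f → ∀ u v → f (u -v v) ≈ f u - f v
    lin-- {f} l u v = begin
      f (u -v v)  ≈⟨ resp l (λ i → solve 2 (λ x y → x :- y ⊜ x :+ (:- :1) :* y) (u i) (v i)) ⟩
      f (at u v (- 1#))  ≈⟨ lin-at l u v (- 1#) ⟩
      f u + (- 1#) * f v  ≈⟨ solve 2 (λ x y → x :+ (:- :1) :* y ⊜ x :- y) (f u) (f v) ⟩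
      f u - f v ∎

  opaque
    lin-zv : ∀ {f} → Linear f → f zv ≈ 0#
    lin-zv {f} l = begin
      f zv  ≈⟨ resp l (λ i → solve 0 (:0 ⊜ :0 :* :0 :+ :0 :* :0)) ⟩
      f (0# *v zv +v 0# *v zv)  ≈⟨ lin l 0# zv 0# zv ⟩
      0# * f zv + 0# * f zv  ≈⟨ solve 1 (λ x → :0 :* x :+ :0 :* x ⊜ :0) (f zv) ⟩
      0# ∎

  opaque
    lin-combo : ∀ {k f} → Linear f → (cs : Fin k → Carrier) (p : Fin k → V 5) →
      f (combo cs p) ≈ sumF (λ j → cs j * f (p j))
    lin-combo {zero} l cs p = lin-zv l
    lin-combo {suc k} {f} l cs p = begin
      f (combo cs p)
        ≈⟨ resp l (λ i → solve 2 (λ x y → x :+ y ⊜ x :+ :1 :* y) _ _) ⟩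
      f (at (cs zero *v p zero) (combo (cs ∘ suc) (p ∘ suc)) 1#)  ≈⟨ lin-at l _ _ 1# ⟩
      f (cs zero *v p zero) + 1# * f (combo (cs ∘ suc) (p ∘ suc))
        ≈⟨ +-cong (trans (resp l (λ i → solve 2 (λ a x → a :* x ⊜ :0 :+ a :* x) _ _))
             (trans (lin-at l zv (p zero) (cs zero)) (trans (+-congʳ (lin-zv l)) (+-identityˡ _))))
             (trans (*-identityˡ _) (lin-combo l (cs ∘ suc) (p ∘ suc))) ⟩
      cs zero * f (p zero) + sumF (λ j → cs (suc j) * f (p (suc j))) ∎

  opaque
    lin-kills : ∀ {k f} {p : Fin k → V 5} → Linear f → (∀ j → f (p j) ≈ 0#) → ∀ {v} → InSpan p v → f v ≈ 0#
    lin-kills {k} {f} {p} l fp (cs , e) = trans (resp l e) (trans (lin-combo l cs p)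
      (sumF-0 k (λ j → trans (*-congˡ (fp j)) (zeroʳ _))))

  opaque
    dot-linear : ∀ φ → Linear (dot φ)
    dot-linear φ = record { resp = dot-congʳ φ ; lin = dot-lin φ }

  module Coordinates (b : Fin 5 → V 5) (b-indep : Indep b) where
    opaque
      co : V 5 → V 5
      co v = proj₁ (indep-basis {p = b} b-indep v)

      co-combo : ∀ v → v ≈v combo (co v) b
      co-combo v = proj₂ (indep-basis {p = b} b-indep v)

    opaque
      co-unique : ∀ {v} cs → v ≈v combo cs b → co v ≈v cs
      co-unique {v} cs e i = x∙y⁻¹≈ε⇒x≈y _ _ (trans (solve 2 (λ x y → x :- y ⊜ :1 :* x :+ (:- :1) :* y) _ _)
        (b-indep (λ j → 1# * co v j + (- 1#) * cs j) (λ t → begin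
          combo (λ j → 1# * co v j + (- 1#) * cs j) b t  ≈⟨ combo-lin 1# (co v) (- 1#) cs b t ⟩
          1# * combo (co v) b t + (- 1#) * combo cs b t
            ≈⟨ +-cong (*-congˡ (sym (co-combo v t))) (*-congˡ (sym (e t))) ⟩
          1# * v t + (- 1#) * v t  ≈⟨ solve 1 (λ x → :1 :* x :+ (:- :1) :* x ⊜ :0) (v t) ⟩
          0# ∎) i))

    opaque
      co-linear : ∀ i → Linear (λ v → co v i)
      co-linear i = record
        { resp = λ {u} {v} e → co-unique (co v) (≈v-trans e (co-combo v)) i
        ; lin = λ r u s v → co-unique (λ j → r * co u j + s * co v j)
            (λ t → trans (+-cong (*-congˡ (co-combo u t)) (*-congˡ (co-combo v t)))
              (sym (combo-lin r (co u) s (co v) b t))) i }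

  -- The two rulings by C-planes through a common direction.

  opaque
    -- The line lies on a second C-plane by `all-lined`, and distinct C-planes share at most one
    -- point of C.
    line-unique : ∀ {π d P P'} → Axis π d → c⃗ P ∈ π → c⃗ P' on c⃗ P ∥ d → P ≡ P'
    line-unique {π} {d} {P} {P'} a P∈π (t , e) with all-lined a (Aff-c⃗ P) P∈π
    ... | ρ , ρ≄π , P∈ρ , d∈ρ = common-unique ρ≄π P∈ρ P∈π
      (∈-resp (≈v-sym e) (∈-at t P∈ρ d∈ρ)) (∈-resp (≈v-sym e) (∈-at t P∈π (Axis.d∈π a)))

  opaque
    -- This is (A3) at `c⃗ P + d`, a point off C on all three planes.
    second-unique : ∀ {π ρ ρ' d P} → NonZero d → Inf d → c⃗ P ∈ π → d ∈ π → ¬ ρ ≃ π → ¬ ρ' ≃ π →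
      c⃗ P ∈ ρ → d ∈ ρ → c⃗ P ∈ ρ' → d ∈ ρ' → ρ ≃ ρ'
    second-unique {π} {ρ} {ρ'} {d} {P} d≉0 hd Pπ dπ ρ≄π ρ'≄π Pρ dρ Pρ' dρ' =
      proj₂ (off-C (h≈1 (Aff-at 1# (Aff-c⃗ P) hd)) (shift-off-C d≉0 Pπ Pρ dπ dρ ρ≄π) π (∈-at 1# Pπ dπ))
        ρ ρ' ρ≄π ρ'≄π (∈-at 1# Pρ dρ) (∈-at 1# Pρ' dρ')

  opaque
    ruling-disjoint : ∀ {σ ρ ρ' d Q Q'} → NonZero d → Inf d → d ∈ σ → ¬ ρ ≃ σ → ¬ ρ' ≃ σ → d ∈ ρ → d ∈ ρ' →
      c⃗ Q ∈ ρ → c⃗ Q ∈ σ → c⃗ Q' ∈ ρ' → c⃗ Q' ∈ σ → Q ≢ Q' → Disj ρ ρ'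
    ruling-disjoint {σ} {ρ} {ρ'} {d} {Q} {Q'} d≉0 hd dσ ρ≄σ ρ'≄σ dρ dρ' Qρ Qσ Q'ρ' Q'σ Q≢Q' i iρ iρ' =
      affinely-disjoint d≉0 hd ρ≄σ ρ'≄σ (Aff-c⃗ Q) (Aff-c⃗ Q') (Aff-c⃗ i) dσ dρ dρ' Qσ Qρ Q'σ Q'ρ'
        (λ (t , e) → Q≢Q' (common-unique ρ≄σ Qρ Qσ (∈-resp (≈v-sym e) (∈-at t Qρ dρ)) Q'σ)) iρ iρ'

  opaque
    -- The second planes through the `q` points of `σ` in the axis direction are pairwise disjoint,
    -- so they partition C. They form one ruling.
    ruling-cover : ∀ {σ d} → Axis σ d → ∀ P →
      ∃ λ ρ → ¬ ρ ≃ σ × d ∈ ρ × c⃗ P ∈ ρ × ∃ λ Q → c⃗ Q ∈ ρ × c⃗ Q ∈ σ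
    ruling-cover {σ} {d} a P = collect (disjoint-cover ρ disjoint P)
      where
      lines : ∀ k → Lined σ (c⃗ (pts σ k)) d
      lines k = all-lined a (Aff-c⃗ (pts σ k)) (pts∈ σ k)
      ρ : Fin q → CPlane
      ρ k = proj₁ (lines k)
      disjoint : ∀ {k l} → k ≢ l → Disj (ρ k) (ρ l)
      disjoint {k} {l} k≢l = ruling-disjoint (Axis.d≉0 a) (Axis.hd a) (Axis.d∈π a)
        (proj₁ (proj₂ (lines k))) (proj₁ (proj₂ (lines l)))
        (proj₂ (proj₂ (proj₂ (lines k)))) (proj₂ (proj₂ (proj₂ (lines l))))
        (proj₁ (proj₂ (proj₂ (lines k)))) (pts∈ σ k) (proj₁ (proj₂ (proj₂ (lines l)))) (pts∈ σ l)
        (k≢l ∘ pts-injective σ)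
      collect : (∃ λ k → c⃗ P ∈ ρ k) → ∃ λ ρ → ¬ ρ ≃ σ × d ∈ ρ × c⃗ P ∈ ρ × ∃ λ Q → c⃗ Q ∈ ρ × c⃗ Q ∈ σ
      collect (k , P∈ρ) = ρ k , proj₁ (proj₂ (lines k)) , proj₂ (proj₂ (proj₂ (lines k))) , P∈ρ ,
        pts σ k , proj₁ (proj₂ (proj₂ (lines k))) , pts∈ σ k

  opaque
    -- If `ρ` is `π`, it shares `Q'` with `τ`. Otherwise `ρ` misses `π`, and if `τ` missed `ρ` too,
    -- then `τ` would be `π` by `parallel-unique` at `Q'`.
    ruling-cross : ∀ {π σ ρ τ d O Q Q'} → NonZero d → Inf d → ¬ σ ≃ π → c⃗ O ∈ π → c⃗ O ∈ σ → d ∈ π → d ∈ σ →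
      ¬ ρ ≃ σ → d ∈ ρ → c⃗ Q ∈ ρ → c⃗ Q ∈ σ → ¬ τ ≃ π → d ∈ τ → c⃗ Q' ∈ τ → c⃗ Q' ∈ π →
      ∃ λ R → c⃗ R ∈ ρ × c⃗ R ∈ τ
    ruling-cross {π} {σ} {ρ} {τ} {d} {O} {Q} {Q'} d≉0 hd σ≄π Oπ Oσ dπ dσ ρ≄σ dρ Qρ Qσ τ≄π dτ Q'τ Q'π
      with meet? ρ τ
    ... | inj₂ m = m
    ... | inj₁ disj with Q ≟ᶠ O
    ... | yes ≡.refl = ⊥-elim (disj Q' (≃-∈ (second-unique {σ} d≉0 hd Oσ dσ (σ≄π ∘ ≃-sym) ρ≄σ Oπ dπ Qρ dρ) Q'π) Q'τ)
    ... | no Q≢O = ⊥-elim (τ≄π (parallel-unique 2≤q Q'τ Q'π (λ i iτ iρ → disj i iρ iτ)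
        (ruling-disjoint d≉0 hd dσ (σ≄π ∘ ≃-sym) ρ≄σ dπ dρ Oπ Oσ Qρ Qσ (Q≢O ∘ ≡.sym))))

  opaque
    linear-on : ∀ {ρ P P' d f} → Linear f → Axis ρ d → c⃗ P ∈ ρ → c⃗ P' ∈ ρ → P ≢ P' →
      f (c⃗ P) ≈ 0# → f (c⃗ P') ≈ 0# → f d ≈ 0# → ∀ {v} → v ∈ ρ → f v ≈ 0#
    linear-on {ρ} {P} {P'} {d} {f} l a P∈ P'∈ P≢P' fP fP' fd v∈ =
      lin-kills {p = c⃗ P ∷ d ∷ (c⃗ P' -v c⃗ P) ∷ []} l
        (λ { zero → fP ; (suc zero) → fd
           ; (suc (suc zero)) → trans (lin-- l (c⃗ P') (c⃗ P)) (trans (+-cong fP' (-‿cong fP)) (-‿inverseʳ 0#)) })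
        (∈-indep (frame-indep (Aff-c⃗ P) (Axis.hd a) (Inf-- (Aff-c⃗ P') (Aff-c⃗ P))
            (off-line-indep (Axis.d≉0 a) (λ on → P≢P' (line-unique a P∈ on))))
          (frame-∈ P∈ (Axis.d∈π a) (∈-- P'∈ P∈)) v∈)

  opaque
    form-onto : ∀ ρ (f : V 5 → Carrier) →
      (∀ {P P'} → c⃗ P ∈ ρ → c⃗ P' ∈ ρ → f (c⃗ P) ≈ f (c⃗ P') → P ≡ P') → ∀ r → ∃ λ P → c⃗ P ∈ ρ × f (c⃗ P) ≈ r
    form-onto ρ f inj r =
      let k , e = injective⇒surjective (λ k → index (f (c⃗ (pts ρ k))))
                    (λ {k} {l} e → pts-injective ρ (inj (pts∈ ρ k) (pts∈ ρ l) (index-injective e))) (index r) in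
      pts ρ k , pts∈ ρ k , index-injective e

  -- Coordinates in which the projection of C from d is the hyperbolic paraboloid z = xy.
  record Paraboloid (d : V 5) : Set (c ⊔ ℓ) where
    field
      x y z g : V 5 → Carrier
      x-lin : Linear x
      y-lin : Linear y
      z-lin : Linear z
      g-lin : Linear g
      hd : dot h d ≈ 0#
      x-d : x d ≈ 0#
      y-d : y d ≈ 0#
      z-d : z d ≈ 0#
      g-d : g d ≈ 1#
      joint-injective : ∀ v → dot h v ≈ 0# → x v ≈ 0# → y v ≈ 0# → z v ≈ 0# → g v ≈ 0# → v ≈v zv
      joint-surjective : ∀ w a b r s → ∃ λ v → dot h v ≈ w × x v ≈ a × y v ≈ b × z v ≈ r × g v ≈ s
      z≈xy : ∀ P → z (c⃗ P) ≈ x (c⃗ P) * y (c⃗ P)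
      onto : ∀ a b → ∃ λ P → x (c⃗ P) ≈ a × y (c⃗ P) ≈ b
      determined : ∀ {P P'} → x (c⃗ P) ≈ x (c⃗ P') → y (c⃗ P) ≈ y (c⃗ P') → P ≡ P'
      x-plane : ∀ P → ∃ λ ρ → c⃗ P ∈ ρ × d ∈ ρ × (∀ P' → x (c⃗ P') ≈ x (c⃗ P) → c⃗ P' ∈ ρ)
      O E : I
      x-E : x (c⃗ E) ≈ 1#
      y-E : y (c⃗ E) ≈ 1#
      x-O : x (c⃗ O) ≈ 0#
      y-O : y (c⃗ O) ≈ 0#
      π σ : CPlane
      σ≄π : ¬ σ ≃ π
      O∈π : c⃗ O ∈ π
      O∈σ : c⃗ O ∈ σ
      d∈π : d ∈ π
      d∈σ : d ∈ σ
      x-π : ∀ {v} → v ∈ π → x v ≈ 0#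
      y-σ : ∀ {v} → v ∈ σ → y v ≈ 0#

  -- `O A E B` becomes a skew quadrilateral of the two rulings after projection from `d`: `π` and
  -- `π'` contain the sides `OB` and `AE`, `σ` and `σ'` the sides `OA` and `BE`.
  module Frame {π σ π' σ' : CPlane} {d : V 5} {O A B E : I} (d≉0 : NonZero d) (hd : Inf d)
    (d∈π : d ∈ π) (d∈σ : d ∈ σ) (d∈π' : d ∈ π') (d∈σ' : d ∈ σ')
    (σ≄π : ¬ σ ≃ π) (π'≄σ : ¬ π' ≃ σ) (σ'≄π : ¬ σ' ≃ π)
    (O∈π : c⃗ O ∈ π) (O∈σ : c⃗ O ∈ σ) (A∈σ : c⃗ A ∈ σ) (A∈π' : c⃗ A ∈ π') (B∈π : c⃗ B ∈ π) (B∈σ' : c⃗ B ∈ σ')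
    (E∈π' : c⃗ E ∈ π') (E∈σ' : c⃗ E ∈ σ') (O≢A : O ≢ A) (O≢B : O ≢ B) where

    π≄σ : ¬ π ≃ σ
    π≄σ = σ≄π ∘ ≃-sym

    axis-π : Axis π d
    axis-π = mk-axis d≉0 hd O∈π O∈σ d∈π d∈σ σ≄π

    axis-σ : Axis σ d
    axis-σ = mk-axis d≉0 hd O∈σ O∈π d∈σ d∈π π≄σ

    axis-ρ : ∀ {ρ Q} → ¬ ρ ≃ σ → d ∈ ρ → c⃗ Q ∈ ρ → c⃗ Q ∈ σ → Axis ρ d
    axis-ρ ρ≄σ d∈ρ Q∈ρ Q∈σ = mk-axis d≉0 hd Q∈ρ Q∈σ d∈ρ d∈σ (ρ≄σ ∘ ≃-sym)

    axis-τ : ∀ {τ Q} → ¬ τ ≃ π → d ∈ τ → c⃗ Q ∈ τ → c⃗ Q ∈ π → Axis τ d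
    axis-τ τ≄π d∈τ Q∈τ Q∈π = mk-axis d≉0 hd Q∈τ Q∈π d∈τ d∈π (τ≄π ∘ ≃-sym)

    axis-π' : Axis π' d
    axis-π' = axis-ρ π'≄σ d∈π' A∈π' A∈σ

    axis-σ' : Axis σ' d
    axis-σ' = axis-τ σ'≄π d∈σ' B∈σ' B∈π

    opaque
      π∥π' : Disj π π'
      π∥π' = ruling-disjoint d≉0 hd d∈σ π≄σ π'≄σ d∈π d∈π' O∈π O∈σ A∈π' A∈σ O≢A

      σ∥σ' : Disj σ σ'
      σ∥σ' = ruling-disjoint d≉0 hd d∈π σ≄π σ'≄π d∈σ d∈σ' O∈σ O∈π B∈σ' B∈π O≢B

      A≢E : A ≢ E
      A≢E ≡.refl = σ∥σ' A A∈σ E∈σ'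

      B≢E : B ≢ E
      B≢E ≡.refl = π∥π' B B∈π E∈π'

    -- Chosen so that `(x, y, z)` takes the values `(0, 0, 0)`, `(1, 0, 0)`, `(0, 1, 0)`,
    -- `(1, 1, 1)` at `O`, `A`, `B`, `E`, all on the surface `z = xy`, and vanishes at the centre
    -- `d` of the projection.
    frame : Fin 5 → V 5
    frame = c⃗ O ∷ (c⃗ A -v c⃗ O) ∷ (c⃗ B -v c⃗ O) ∷ ((c⃗ E -v c⃗ A) -v (c⃗ B -v c⃗ O)) ∷ d ∷ []

    opaque
      -- A solid containing the frame would contain `π`, `σ` and `π'`, each spanned by two corners
      -- and `d`.
      not-annihilated : ∀ {φ} → NonZero φ → ¬ (∀ j → dot φ (frame j) ≈ 0#)
      not-annihilated {φ} φ≉0 φ0 = three-in-solid {φ} {π} {σ} {π'} φ≉0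
        (linear-on l axis-π O∈π B∈π O≢B φO φB φd) (linear-on l axis-σ O∈σ A∈σ O≢A φO φA φd)
        (linear-on l axis-π' A∈π' E∈π' A≢E φA φE φd) σ≄π (λ e → π∥π' A (≃-∈ e A∈π') A∈π') (π'≄σ ∘ ≃-sym)
        where
        l : Linear (dot φ)
        l = dot-linear φ
        φO : dot φ (c⃗ O) ≈ 0#
        φO = φ0 zero
        φd : dot φ d ≈ 0#
        φd = φ0 (suc (suc (suc (suc zero))))
        end : ∀ u v → dot φ (u -v v) ≈ 0# → dot φ v ≈ 0# → dot φ u ≈ 0#
        end u v p r = trans (x∙y⁻¹≈ε⇒x≈y _ _ (trans (sym (lin-- l u v)) p)) r
        φA : dot φ (c⃗ A) ≈ 0#
        φA = end (c⃗ A) (c⃗ O) (φ0 (suc zero)) φO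
        φB : dot φ (c⃗ B) ≈ 0#
        φB = end (c⃗ B) (c⃗ O) (φ0 (suc (suc zero))) φO
        φE : dot φ (c⃗ E) ≈ 0#
        φE = end (c⃗ E) (c⃗ A) (end (c⃗ E -v c⃗ A) (c⃗ B -v c⃗ O) (φ0 (suc (suc (suc zero)))) (φ0 (suc (suc zero)))) φA

      frame-independent : Indep frame
      frame-independent cs rel j = decidable-stable (cs j ≟ 0#) λ cj≉0 →
        let φ , φ≉0 , φ0 = dependent-annihilator {b = frame} cs (λ cs≈0 → cj≉0 (cs≈0 j)) rel in not-annihilated {φ} φ≉0 φ0

    open Coordinates frame frame-independent public

    w x y z g : V 5 → Carrier
    w v = co v zero
    x v = co v (suc zero)
    y v = co v (suc (suc zero))
    z v = co v (suc (suc (suc zero)))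
    g v = co v (suc (suc (suc (suc zero))))

    x-lin : Linear x
    x-lin = co-linear _
    y-lin : Linear y
    y-lin = co-linear _
    z-lin : Linear z
    z-lin = co-linear _
    g-lin : Linear g
    g-lin = co-linear _

    opaque
      co-O : co (c⃗ O) ≈v (1# ∷ 0# ∷ 0# ∷ 0# ∷ 0# ∷ [])
      co-O = co-unique _ λ t → solve 5 (λ o a b e d → o ⊜ :1 :* o :+ (:0 :* (a :- o) :+ (:0 :* (b :- o) :+
        (:0 :* ((e :- a) :- (b :- o)) :+ (:0 :* d :+ :0))))) (c⃗ O t) (c⃗ A t) (c⃗ B t) (c⃗ E t) (d t)

    opaque
      co-A : co (c⃗ A) ≈v (1# ∷ 1# ∷ 0# ∷ 0# ∷ 0# ∷ [])
      co-A = co-unique _ λ t → solve 5 (λ o a b e d → a ⊜ :1 :* o :+ (:1 :* (a :- o) :+ (:0 :* (b :- o) :+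
        (:0 :* ((e :- a) :- (b :- o)) :+ (:0 :* d :+ :0))))) (c⃗ O t) (c⃗ A t) (c⃗ B t) (c⃗ E t) (d t)

    opaque
      co-B : co (c⃗ B) ≈v (1# ∷ 0# ∷ 1# ∷ 0# ∷ 0# ∷ [])
      co-B = co-unique _ λ t → solve 5 (λ o a b e d → b ⊜ :1 :* o :+ (:0 :* (a :- o) :+ (:1 :* (b :- o) :+
        (:0 :* ((e :- a) :- (b :- o)) :+ (:0 :* d :+ :0))))) (c⃗ O t) (c⃗ A t) (c⃗ B t) (c⃗ E t) (d t)

    opaque
      co-E : co (c⃗ E) ≈v (1# ∷ 1# ∷ 1# ∷ 1# ∷ 0# ∷ [])
      co-E = co-unique _ λ t → solve 5 (λ o a b e d → e ⊜ :1 :* o :+ (:1 :* (a :- o) :+ (:1 :* (b :- o) :+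
        (:1 :* ((e :- a) :- (b :- o)) :+ (:0 :* d :+ :0))))) (c⃗ O t) (c⃗ A t) (c⃗ B t) (c⃗ E t) (d t)

    opaque
      co-d : co d ≈v (0# ∷ 0# ∷ 0# ∷ 0# ∷ 1# ∷ [])
      co-d = co-unique _ λ t → solve 5 (λ o a b e d → d ⊜ :0 :* o :+ (:0 :* (a :- o) :+ (:0 :* (b :- o) :+
        (:0 :* ((e :- a) :- (b :- o)) :+ (:1 :* d :+ :0))))) (c⃗ O t) (c⃗ A t) (c⃗ B t) (c⃗ E t) (d t)

    opaque
      w≈h : ∀ v → w v ≈ dot h v
      w≈h v = sym (begin
        dot h v  ≈⟨ h-≈ (co-combo v) ⟩
        dot h (combo (co v) frame)  ≈⟨ dot-combo h (co v) frame ⟩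
        sumF (λ j → co v j * dot h (frame j))
          ≈⟨ +-cong (*-congˡ (h-c⃗ O)) (+-cong (*-congˡ (h≈0 (Inf-toward O A))) (+-cong (*-congˡ (h≈0 (Inf-toward O B)))
               (+-cong (*-congˡ (trans (lin-- (dot-linear h) (c⃗ E -v c⃗ A) (c⃗ B -v c⃗ O))
                 (+-cong (h≈0 (Inf-toward A E)) (-‿cong (h≈0 (Inf-toward O B)))))) (+-congʳ (*-congˡ (h≈0 hd)))))) ⟩
        w v * 1# + (x v * 0# + (y v * 0# + (z v * (0# - 0#) + (g v * 0# + 0#))))
          ≈⟨ solve 5 (λ w x y z g → w :* :1 :+ (x :* :0 :+ (y :* :0 :+ (z :* (:0 :- :0) :+ (g :* :0 :+ :0)))) ⊜ w)
               (w v) (x v) (y v) (z v) (g v) ⟩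
        w v ∎)

    opaque
      w-c⃗ : ∀ P → w (c⃗ P) ≈ 1#
      w-c⃗ P = trans (w≈h (c⃗ P)) (h-c⃗ P)

    -- A form a w + b x + e y + f z vanishes on a plane through d as soon as it does at two of its C-points.
    form : (a b e f : Carrier) → V 5 → Carrier
    form a b e f v = 1# * (a * w v + b * x v) + 1# * (e * y v + f * z v)

    opaque
      form-linear : ∀ a b e f → Linear (form a b e f)
      form-linear a b e f = lin-combine 1# 1# (lin-combine a b (co-linear _) (co-linear _)) (lin-combine e f (co-linear _) (co-linear _))

    opaque
      form-d : ∀ a b e f → form a b e f d ≈ 0#
      form-d a b e f = trans (+-cong (*-congˡ (+-cong (*-congˡ (co-d zero)) (*-congˡ (co-d (suc zero)))))
          (*-congˡ (+-cong (*-congˡ (co-d (suc (suc zero)))) (*-congˡ (co-d (suc (suc (suc zero))))))))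
        (solve 4 (λ a b e f → :1 :* (a :* :0 :+ b :* :0) :+ :1 :* (e :* :0 :+ f :* :0) ⊜ :0) a b e f)

    opaque
      form-at : ∀ {P u v r} a b e f → x (c⃗ P) ≈ u → y (c⃗ P) ≈ v → z (c⃗ P) ≈ r →
        form a b e f (c⃗ P) ≈ 1# * (a * 1# + b * u) + 1# * (e * v + f * r)
      form-at {P} a b e f xP yP zP = +-cong (*-congˡ (+-cong (*-congˡ (w-c⃗ P)) (*-congˡ xP)))
        (*-congˡ (+-cong (*-congˡ yP) (*-congˡ zP)))

    opaque
      form-on : ∀ {ρ P P' u v r u' v' r'} a b e f → Axis ρ d → c⃗ P ∈ ρ → c⃗ P' ∈ ρ → P ≢ P' →
        x (c⃗ P) ≈ u → y (c⃗ P) ≈ v → z (c⃗ P) ≈ r → x (c⃗ P') ≈ u' → y (c⃗ P') ≈ v' → z (c⃗ P') ≈ r' →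
        1# * (a * 1# + b * u) + 1# * (e * v + f * r) ≈ 0# →
        1# * (a * 1# + b * u') + 1# * (e * v' + f * r') ≈ 0# → ∀ {V} → V ∈ ρ → form a b e f V ≈ 0#
      form-on a b e f ax P∈ P'∈ P≢P' p1 p2 p3 r1 r2 r3 e1 e2 =
        linear-on (form-linear a b e f) ax P∈ P'∈ P≢P' (trans (form-at a b e f p1 p2 p3) e1)
          (trans (form-at a b e f r1 r2 r3) e2) (form-d a b e f)

    opaque
      on-π : ∀ {V} → V ∈ π → x V ≈ 0# × z V ≈ 0#
      on-π V∈ = linear-on x-lin axis-π O∈π B∈π O≢B (co-O _) (co-B _) (co-d _) V∈ ,
                linear-on z-lin axis-π O∈π B∈π O≢B (co-O _) (co-B _) (co-d _) V∈

    opaque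
      on-σ : ∀ {V} → V ∈ σ → y V ≈ 0# × z V ≈ 0#
      on-σ V∈ = linear-on y-lin axis-σ O∈σ A∈σ O≢A (co-O _) (co-A _) (co-d _) V∈ ,
                linear-on z-lin axis-σ O∈σ A∈σ O≢A (co-O _) (co-A _) (co-d _) V∈

    opaque
      on-π' : ∀ {P} → c⃗ P ∈ π' → x (c⃗ P) ≈ 1# × z (c⃗ P) ≈ y (c⃗ P)
      on-π' {P} P∈ =
        x∙y⁻¹≈ε⇒x≈y _ _ (trans (sym (trans (form-at (- 1#) 1# 0# 0# refl refl refl)
            (solve 3 (λ x y z → :1 :* ((:- :1) :* :1 :+ :1 :* x) :+ :1 :* (:0 :* y :+ :0 :* z) ⊜ x :- :1) _ _ _)))
          (form-on (- 1#) 1# 0# 0# axis-π' A∈π' E∈π' A≢E (co-A _) (co-A _) (co-A _) (co-E _) (co-E _) (co-E _)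
            (solve 0 (:1 :* ((:- :1) :* :1 :+ :1 :* :1) :+ :1 :* (:0 :* :0 :+ :0 :* :0) ⊜ :0))
            (solve 0 (:1 :* ((:- :1) :* :1 :+ :1 :* :1) :+ :1 :* (:0 :* :1 :+ :0 :* :1) ⊜ :0)) P∈)) ,
        x∙y⁻¹≈ε⇒x≈y _ _ (trans (sym (trans (form-at 0# 0# (- 1#) 1# refl refl refl)
            (solve 3 (λ x y z → :1 :* (:0 :* :1 :+ :0 :* x) :+ :1 :* ((:- :1) :* y :+ :1 :* z) ⊜ z :- y) _ _ _)))
          (form-on 0# 0# (- 1#) 1# axis-π' A∈π' E∈π' A≢E (co-A _) (co-A _) (co-A _) (co-E _) (co-E _) (co-E _)
            (solve 0 (:1 :* (:0 :* :1 :+ :0 :* :1) :+ :1 :* ((:- :1) :* :0 :+ :1 :* :0) ⊜ :0))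
            (solve 0 (:1 :* (:0 :* :1 :+ :0 :* :1) :+ :1 :* ((:- :1) :* :1 :+ :1 :* :1) ⊜ :0)) P∈))

    opaque
      on-σ' : ∀ {P} → c⃗ P ∈ σ' → y (c⃗ P) ≈ 1# × z (c⃗ P) ≈ x (c⃗ P)
      on-σ' {P} P∈ =
        x∙y⁻¹≈ε⇒x≈y _ _ (trans (sym (trans (form-at (- 1#) 0# 1# 0# refl refl refl)
            (solve 3 (λ x y z → :1 :* ((:- :1) :* :1 :+ :0 :* x) :+ :1 :* (:1 :* y :+ :0 :* z) ⊜ y :- :1) _ _ _)))
          (form-on (- 1#) 0# 1# 0# axis-σ' B∈σ' E∈σ' B≢E (co-B _) (co-B _) (co-B _) (co-E _) (co-E _) (co-E _)
            (solve 0 (:1 :* ((:- :1) :* :1 :+ :0 :* :0) :+ :1 :* (:1 :* :1 :+ :0 :* :0) ⊜ :0))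
            (solve 0 (:1 :* ((:- :1) :* :1 :+ :0 :* :1) :+ :1 :* (:1 :* :1 :+ :0 :* :1) ⊜ :0)) P∈)) ,
        x∙y⁻¹≈ε⇒x≈y _ _ (trans (sym (trans (form-at 0# (- 1#) 0# 1# refl refl refl)
            (solve 3 (λ x y z → :1 :* (:0 :* :1 :+ (:- :1) :* x) :+ :1 :* (:0 :* y :+ :1 :* z) ⊜ z :- x) _ _ _)))
          (form-on 0# (- 1#) 0# 1# axis-σ' B∈σ' E∈σ' B≢E (co-B _) (co-B _) (co-B _) (co-E _) (co-E _) (co-E _)
            (solve 0 (:1 :* (:0 :* :1 :+ (:- :1) :* :0) :+ :1 :* (:0 :* :1 :+ :1 :* :0) ⊜ :0))
            (solve 0 (:1 :* (:0 :* :1 :+ (:- :1) :* :1) :+ :1 :* (:0 :* :1 :+ :1 :* :1) ⊜ :0)) P∈))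

    opaque
      mod-d : ∀ v → w v ≈ 0# → x v ≈ 0# → y v ≈ 0# → z v ≈ 0# → v ≈v (g v *v d)
      mod-d v w0 x0 y0 z0 t = trans (co-combo v t) (trans
        (+-cong (*-congʳ w0) (+-cong (*-congʳ x0) (+-cong (*-congʳ y0) (+-congʳ (*-congʳ z0)))))
        (solve 6 (λ o a b e g d → :0 :* o :+ (:0 :* a :+ (:0 :* b :+ (:0 :* e :+ (g :* d :+ :0)))) ⊜ g :* d)
          (frame zero t) (frame (suc zero) t) (frame (suc (suc zero)) t) (frame (suc (suc (suc zero))) t) (g v) (d t)))

    opaque
      -- The points differ by a multiple of `d`, and a line in the axis direction has at most one
      -- point of C.
      same-coords : ∀ {P P'} → x (c⃗ P) ≈ x (c⃗ P') → y (c⃗ P) ≈ y (c⃗ P') → z (c⃗ P) ≈ z (c⃗ P') → P ≡ P'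
      same-coords {P} {P'} ex ey ez with ruling-cover axis-σ P
      ... | ρ , ρ≄σ , d∈ρ , P∈ρ , Q , Q∈ρ , Q∈σ = line-unique (axis-ρ ρ≄σ d∈ρ Q∈ρ Q∈σ) P∈ρ
        (g (c⃗ P' -v c⃗ P) , λ t → trans (solve 2 (λ x y → y ⊜ x :+ (y :- x)) (c⃗ P t) (c⃗ P' t))
          (+-congˡ (mod-d (c⃗ P' -v c⃗ P) (diff (co-linear _) (trans (w-c⃗ P) (sym (w-c⃗ P'))))
            (diff x-lin ex) (diff y-lin ey) (diff z-lin ez) t)))
        where
        diff : ∀ {f} → Linear f → f (c⃗ P) ≈ f (c⃗ P') → f (c⃗ P' -v c⃗ P) ≈ 0#
        diff l e = trans (lin-- l (c⃗ P') (c⃗ P)) (trans (+-congˡ (-‿cong e)) (-‿inverseʳ _))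

    opaque
      x-onto-σ : ∀ a → ∃ λ Q → c⃗ Q ∈ σ × x (c⃗ Q) ≈ a
      x-onto-σ = form-onto σ x λ P∈ P'∈ e → same-coords e
        (trans (proj₁ (on-σ P∈)) (sym (proj₁ (on-σ P'∈)))) (trans (proj₂ (on-σ P∈)) (sym (proj₂ (on-σ P'∈))))

    opaque
      y-onto-π : ∀ b → ∃ λ Q → c⃗ Q ∈ π × y (c⃗ Q) ≈ b
      y-onto-π = form-onto π y λ P∈ P'∈ e → same-coords
        (trans (proj₁ (on-π P∈)) (sym (proj₁ (on-π P'∈)))) e (trans (proj₂ (on-π P∈)) (sym (proj₂ (on-π P'∈))))

    -- A plane of the ruling of `π` projects to the line joining `(a, 0, 0)` on `σ` to `(a', 1, a')`
    -- on `σ'`. On `z = xy` such a line has constant `x`, so the point is to prove `a = a'`.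
    module Transversal {ρ : CPlane} {Q R : I} (ρ≄σ : ¬ ρ ≃ σ) (d∈ρ : d ∈ ρ) (Q∈ρ : c⃗ Q ∈ ρ) (Q∈σ : c⃗ Q ∈ σ)
      (R∈ρ : c⃗ R ∈ ρ) (R∈σ' : c⃗ R ∈ σ') where

      a a' : Carrier
      a = x (c⃗ Q)
      a' = x (c⃗ R)

      opaque
        Q≢R : Q ≢ R
        Q≢R ≡.refl = σ∥σ' Q Q∈σ R∈σ'

        on-ρ : ∀ {P} → c⃗ P ∈ ρ → x (c⃗ P) ≈ a + (a' - a) * y (c⃗ P) × z (c⃗ P) ≈ a' * y (c⃗ P)
        on-ρ {P} P∈ =
          x∙y⁻¹≈ε⇒x≈y _ _ (trans (sym (trans (form-at (- a) 1# (- (a' - a)) 0# refl refl refl)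
              (solve 5 (λ a a' x y z → :1 :* ((:- a) :* :1 :+ :1 :* x) :+ :1 :* ((:- (a' :- a)) :* y :+ :0 :* z) ⊜
                x :- (a :+ (a' :- a) :* y)) a a' _ _ _)))
            (form-on (- a) 1# (- (a' - a)) 0# (axis-ρ ρ≄σ d∈ρ Q∈ρ Q∈σ) Q∈ρ R∈ρ Q≢R
              refl (proj₁ (on-σ Q∈σ)) (proj₂ (on-σ Q∈σ)) refl (proj₁ (on-σ' R∈σ')) (proj₂ (on-σ' R∈σ'))
              (solve 2 (λ a a' → :1 :* ((:- a) :* :1 :+ :1 :* a) :+ :1 :* ((:- (a' :- a)) :* :0 :+ :0 :* :0) ⊜ :0) a a')
              (solve 2 (λ a a' → :1 :* ((:- a) :* :1 :+ :1 :* a') :+ :1 :* ((:- (a' :- a)) :* :1 :+ :0 :* a') ⊜ :0) a a') P∈)) ,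
          x∙y⁻¹≈ε⇒x≈y _ _ (trans (sym (trans (form-at 0# 0# (- a') 1# refl refl refl)
              (solve 4 (λ a' x y z → :1 :* (:0 :* :1 :+ :0 :* x) :+ :1 :* ((:- a') :* y :+ :1 :* z) ⊜ z :- a' :* y) a' _ _ _)))
            (form-on 0# 0# (- a') 1# (axis-ρ ρ≄σ d∈ρ Q∈ρ Q∈σ) Q∈ρ R∈ρ Q≢R
              refl (proj₁ (on-σ Q∈σ)) (proj₂ (on-σ Q∈σ)) refl (proj₁ (on-σ' R∈σ')) (proj₂ (on-σ' R∈σ'))
              (solve 2 (λ a a' → :1 :* (:0 :* :1 :+ :0 :* a) :+ :1 :* ((:- a') :* :0 :+ :1 :* :0) ⊜ :0) a a')
              (solve 2 (λ a a' → :1 :* (:0 :* :1 :+ :0 :* a') :+ :1 :* ((:- a') :* :1 :+ :1 :* a') ⊜ :0) a a') P∈))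

        ρ≃π'⇒ : ρ ≃ π' → a ≈ 1# × a' ≈ 1#
        ρ≃π'⇒ e = proj₁ (on-π' (≃-∈ e Q∈ρ)) , proj₁ (on-π' (≃-∈ e R∈ρ))

        a≈1⇒ : a ≈ 1# → ρ ≃ π'
        a≈1⇒ a≈1 with same-coords {Q} {A} (trans a≈1 (sym (co-A _)))
          (trans (proj₁ (on-σ Q∈σ)) (sym (co-A _))) (trans (proj₂ (on-σ Q∈σ)) (sym (co-A _)))
        ... | ≡.refl = second-unique d≉0 hd A∈σ d∈σ ρ≄σ π'≄σ Q∈ρ d∈ρ A∈π' d∈π'

        a'≈1⇒ : a' ≈ 1# → ρ ≃ π'
        a'≈1⇒ a'≈1 with same-coords {R} {E} (trans a'≈1 (sym (co-E _)))
          (trans (proj₁ (on-σ' R∈σ')) (sym (co-E _))) (trans (proj₂ (on-σ' R∈σ')) (trans a'≈1 (sym (co-E _))))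
        ... | ≡.refl = decidable-stable (ρ ≃? π') λ ρ≄π' → ruling-disjoint d≉0 hd d∈σ ρ≄σ π'≄σ d∈ρ d∈π'
            Q∈ρ Q∈σ A∈π' A∈σ
            (λ { ≡.refl → ρ≄π' (second-unique d≉0 hd A∈σ d∈σ ρ≄σ π'≄σ Q∈ρ d∈ρ A∈π' d∈π') })
            E R∈ρ E∈π'

        -- The opposite line at height b = (a' - 1)/(a' - a) would meet this one at infinity.
        untwisted : a ≈ a'
        untwisted = decidable-stable (a ≟ a') λ a≉a' → skew a≉a' (y-onto-π _)
          where
          skew : (a≉a' : ¬ a ≈ a') → (∃ λ Q' → c⃗ Q' ∈ π × y (c⃗ Q') ≈ (a' - 1#) * recip (-≉0 (a≉a' ∘ sym))) → ⊥
          skew a≉a' (Q' , Q'∈π , yQ'≈b) with all-lined axis-π (Aff-c⃗ Q') Q'∈π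
          ... | τ , τ≄π , Q'∈τ , d∈τ
            with ruling-cross d≉0 hd σ≄π O∈π O∈σ d∈π d∈σ π'≄σ d∈π' A∈π' A∈σ τ≄π d∈τ Q'∈τ Q'∈π
               | ruling-cross d≉0 hd σ≄π O∈π O∈σ d∈π d∈σ ρ≄σ d∈ρ Q∈ρ Q∈σ τ≄π d∈τ Q'∈τ Q'∈π
          ... | R' , R'∈π' , R'∈τ | P , P∈ρ , P∈τ =
            [ (λ b≈0 → a≉a' (agree (a'≈1⇒ (x∙y⁻¹≈ε⇒x≈y _ _ (a'-1≈0 b≈0))))) ,
              (λ 1-a≈0 → a≉a' (agree (a≈1⇒ (sym (x∙y⁻¹≈ε⇒x≈y _ _ 1-a≈0))))) ] (zero-product b (1# - a) product)
            where
            agree : ρ ≃ π' → a ≈ a'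
            agree e = trans (proj₁ (ρ≃π'⇒ e)) (sym (proj₂ (ρ≃π'⇒ e)))
            r b b' X Y Z : Carrier
            r = recip (-≉0 (a≉a' ∘ sym))
            b = (a' - 1#) * r
            b' = y (c⃗ R')
            X = x (c⃗ P)
            Y = y (c⃗ P)
            Z = z (c⃗ P)
            Q'≢R' : Q' ≢ R'
            Q'≢R' ≡.refl = π∥π' Q' Q'∈π R'∈π'
            ax-τ : Axis τ d
            ax-τ = axis-τ τ≄π d∈τ Q'∈τ Q'∈π
            Y≈ : Y - (b + (b' - b) * X) ≈ 0#
            Y≈ = trans (sym (trans (form-at (- b) (- (b' - b)) 1# 0# refl refl refl)
                (solve 5 (λ b b' x y z → :1 :* ((:- b) :* :1 :+ (:- (b' :- b)) :* x) :+ :1 :* (:1 :* y :+ :0 :* z) ⊜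
                  y :- (b :+ (b' :- b) :* x)) b b' X Y Z)))
              (form-on (- b) (- (b' - b)) 1# 0# ax-τ Q'∈τ R'∈τ Q'≢R'
                (proj₁ (on-π Q'∈π)) yQ'≈b (proj₂ (on-π Q'∈π)) (proj₁ (on-π' R'∈π')) refl (proj₂ (on-π' R'∈π'))
                (solve 2 (λ b b' → :1 :* ((:- b) :* :1 :+ (:- (b' :- b)) :* :0) :+ :1 :* (:1 :* b :+ :0 :* :0) ⊜ :0) b b')
                (solve 2 (λ b b' → :1 :* ((:- b) :* :1 :+ (:- (b' :- b)) :* :1) :+ :1 :* (:1 :* b' :+ :0 :* b') ⊜ :0) b b') P∈τ)
            Z≈ : Z - b' * X ≈ 0#
            Z≈ = trans (sym (trans (form-at 0# (- b') 0# 1# refl refl refl)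
                (solve 4 (λ b' x y z → :1 :* (:0 :* :1 :+ (:- b') :* x) :+ :1 :* (:0 :* y :+ :1 :* z) ⊜
                  z :- b' :* x) b' X Y Z)))
              (form-on 0# (- b') 0# 1# ax-τ Q'∈τ R'∈τ Q'≢R'
                (proj₁ (on-π Q'∈π)) yQ'≈b (proj₂ (on-π Q'∈π)) (proj₁ (on-π' R'∈π')) refl (proj₂ (on-π' R'∈π'))
                (solve 2 (λ b b' → :1 :* (:0 :* :1 :+ (:- b') :* :0) :+ :1 :* (:0 :* b :+ :1 :* :0) ⊜ :0) b b')
                (solve 1 (λ b' → :1 :* (:0 :* :1 :+ (:- b') :* :1) :+ :1 :* (:0 :* b' :+ :1 :* b') ⊜ :0) b') P∈τ)
            b[a'-a] : b * (a' - a) ≈ a' - 1#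
            b[a'-a] = trans (*-assoc _ _ _) (trans (*-congˡ (recip-* (-≉0 (a≉a' ∘ sym)))) (*-identityʳ _))
            a'-1≈0 : b ≈ 0# → a' - 1# ≈ 0#
            a'-1≈0 b≈0 = trans (sym b[a'-a]) (trans (*-congʳ b≈0) (zeroˡ _))
            -- Eliminates the coordinates of the common point `P` from the two equations of `ρ` and
            -- the two of `τ`, using the choice of `b`. Either factor being zero identifies `ρ` with
            -- `π'`, where `a` and `a'` are both 1.
            product : b * (1# - a) ≈ 0#
            product = begin
              b * (1# - a)
                ≈⟨ solve 7 (λ a a' b b' x y z → b :* (:1 :- a) ⊜
                     (b :* (a' :- a) :- (a' :- :1)) :* y :- (y :- (b :+ (b' :- b) :* x)) :+ (z :- b' :* x) :- (z :- a' :* y)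
                       :+ b :* (x :- (a :+ (a' :- a) :* y)))
                     a a' b b' X Y Z ⟩
              (b * (a' - a) - (a' - 1#)) * Y - (Y - (b + (b' - b) * X)) + (Z - b' * X) - (Z - a' * Y) + b * (X - (a + (a' - a) * Y))
                ≈⟨ +-cong (+-cong (+-cong (+-cong (*-congʳ (trans (+-congʳ b[a'-a]) (-‿inverseʳ _))) (-‿cong Y≈)) Z≈)
                     (-‿cong (trans (+-congʳ (proj₂ (on-ρ P∈ρ))) (-‿inverseʳ _))))
                     (*-congˡ (trans (+-congʳ (proj₁ (on-ρ P∈ρ))) (-‿inverseʳ _))) ⟩
              0# * Y - 0# + 0# - 0# + b * 0#  ≈⟨ solve 2 (λ y b → :0 :* y :- :0 :+ :0 :- :0 :+ b :* :0 ⊜ :0) Y b ⟩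
              0# ∎

        x-const : ∀ {P} → c⃗ P ∈ ρ → x (c⃗ P) ≈ a
        x-const {P} P∈ = begin
          x (c⃗ P)  ≈⟨ proj₁ (on-ρ P∈) ⟩
          a + (a' - a) * y (c⃗ P)  ≈⟨ +-congˡ (*-congʳ (trans (+-congˡ (-‿cong untwisted)) (-‿inverseʳ _))) ⟩
          a + 0# * y (c⃗ P)  ≈⟨ solve 2 (λ a y → a :+ :0 :* y ⊜ a) a _ ⟩
          a ∎

        z-const : ∀ {P} → c⃗ P ∈ ρ → z (c⃗ P) ≈ a * y (c⃗ P)
        z-const P∈ = trans (proj₂ (on-ρ P∈)) (*-congʳ (sym untwisted))

    opaque
      ruled : ∀ P → ∃ λ ρ → ¬ ρ ≃ σ × d ∈ ρ × c⃗ P ∈ ρ × ∃ λ Q → c⃗ Q ∈ ρ × c⃗ Q ∈ σ ×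
        (∀ {P'} → c⃗ P' ∈ ρ → x (c⃗ P') ≈ x (c⃗ Q) × z (c⃗ P') ≈ x (c⃗ Q) * y (c⃗ P'))
      ruled P with ruling-cover axis-σ P
      ... | ρ , ρ≄σ , d∈ρ , P∈ρ , Q , Q∈ρ , Q∈σ
        with ruling-cross d≉0 hd σ≄π O∈π O∈σ d∈π d∈σ ρ≄σ d∈ρ Q∈ρ Q∈σ σ'≄π d∈σ' B∈σ' B∈π
      ... | R , R∈ρ , R∈σ' = ρ , ρ≄σ , d∈ρ , P∈ρ , Q , Q∈ρ , Q∈σ , λ P'∈ →
        Transversal.x-const ρ≄σ d∈ρ Q∈ρ Q∈σ R∈ρ R∈σ' P'∈ , Transversal.z-const ρ≄σ d∈ρ Q∈ρ Q∈σ R∈ρ R∈σ' P'∈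

    opaque
      z≈xy : ∀ P → z (c⃗ P) ≈ x (c⃗ P) * y (c⃗ P)
      z≈xy P with ruled P
      ... | ρ , _ , _ , P∈ρ , Q , _ , _ , on = trans (proj₂ (on P∈ρ)) (*-congʳ (sym (proj₁ (on P∈ρ))))

    opaque
      onto : ∀ a b → ∃ λ P → x (c⃗ P) ≈ a × y (c⃗ P) ≈ b
      onto a b with x-onto-σ a
      ... | Q₀ , Q₀∈σ , xQ₀≈a with ruled Q₀
      ... | ρ , _ , _ , Q₀∈ρ , Q , _ , _ , on
        with form-onto ρ y (λ P∈ P'∈ e → same-coords (trans (proj₁ (on P∈)) (sym (proj₁ (on P'∈)))) e
               (trans (proj₂ (on P∈)) (trans (*-congˡ e) (sym (proj₂ (on P'∈)))))) b
      ... | P , P∈ρ , yP≈b = P , trans (proj₁ (on P∈ρ)) (trans (sym (proj₁ (on Q₀∈ρ))) xQ₀≈a) , yP≈b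

    opaque
      x-plane : ∀ P → ∃ λ ρ → c⃗ P ∈ ρ × d ∈ ρ × (∀ P' → x (c⃗ P') ≈ x (c⃗ P) → c⃗ P' ∈ ρ)
      x-plane P with ruled P
      ... | ρ , ρ≄σ , d∈ρ , P∈ρ , Q , Q∈ρ , Q∈σ , on = ρ , P∈ρ , d∈ρ , λ P' e → lies P' e (ruled P')
        where
        lies : ∀ P' → x (c⃗ P') ≈ x (c⃗ P) → (∃ λ ρ → ¬ ρ ≃ σ × d ∈ ρ × c⃗ P' ∈ ρ × ∃ λ Q → c⃗ Q ∈ ρ × c⃗ Q ∈ σ ×
          (∀ {P'} → c⃗ P' ∈ ρ → x (c⃗ P') ≈ x (c⃗ Q) × z (c⃗ P') ≈ x (c⃗ Q) * y (c⃗ P'))) → c⃗ P' ∈ ρ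
        lies P' e (ρ' , ρ'≄σ , d∈ρ' , P'∈ρ' , Q' , Q'∈ρ' , Q'∈σ , on')
          with same-coords {Q'} {Q} (trans (sym (proj₁ (on' P'∈ρ'))) (trans e (proj₁ (on P∈ρ))))
            (trans (proj₁ (on-σ Q'∈σ)) (sym (proj₁ (on-σ Q∈σ)))) (trans (proj₂ (on-σ Q'∈σ)) (sym (proj₂ (on-σ Q∈σ))))
        ... | ≡.refl = ≃-∈ (second-unique d≉0 hd Q∈σ d∈σ ρ'≄σ ρ≄σ Q'∈ρ' d∈ρ' Q∈ρ d∈ρ) P'∈ρ'

    paraboloid : Paraboloid d
    paraboloid = record
      { x = x ; y = y ; z = z ; g = g ; x-lin = x-lin ; y-lin = y-lin ; z-lin = z-lin ; g-lin = g-lin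
      ; hd = h≈0 hd ; x-d = co-d _ ; y-d = co-d _ ; z-d = co-d _ ; g-d = co-d _
      ; joint-injective = λ v hv xv yv zv gv t → trans (mod-d v (trans (w≈h v) hv) xv yv zv t) (trans (*-congʳ gv) (zeroˡ _))
      ; joint-surjective = λ w a b r s → let cs = w ∷ a ∷ b ∷ r ∷ s ∷ [] ; v = combo cs frame
                                             val = co-unique {v} cs (λ t → refl) in
          v , trans (sym (w≈h v)) (val _) , val _ , val _ , val _ , val _
      ; z≈xy = z≈xy ; onto = onto
      ; determined = λ {P} {P'} ex ey → same-coords ex ey (trans (z≈xy P) (trans (*-cong ex ey) (sym (z≈xy P'))))
      ; x-plane = x-plane ; O = O ; E = E
      ; x-E = co-E _ ; y-E = co-E _ ; x-O = co-O _ ; y-O = co-O _ ; π = π ; σ = σ ; σ≄π = σ≄π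
      ; O∈π = O∈π ; O∈σ = O∈σ ; d∈π = d∈π ; d∈σ = d∈σ
      ; x-π = λ V∈ → proj₁ (on-π V∈) ; y-σ = λ V∈ → proj₁ (on-σ V∈) }

  opaque
    -- The quadrilateral starts from neighbours `A` on `σ` and `B` on `π` of the corner `O`;
    -- `all-lined` gives the opposite sides through them, and these cross in `E`.
    exists-paraboloid : ∀ {π σ d O} → NonZero d → Inf d → c⃗ O ∈ π → c⃗ O ∈ σ → d ∈ π → d ∈ σ → ¬ σ ≃ π → Paraboloid d
    exists-paraboloid {π} {σ} {d} {O} d≉0 hd O∈π O∈σ d∈π d∈σ σ≄π with second 2≤q σ O | second 2≤q π O
    ... | A , A≢O , A∈σ | B , B≢O , B∈π
      with all-lined (mk-axis d≉0 hd O∈σ O∈π d∈σ d∈π (σ≄π ∘ ≃-sym)) (Aff-c⃗ A) A∈σ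
         | all-lined (mk-axis d≉0 hd O∈π O∈σ d∈π d∈σ σ≄π) (Aff-c⃗ B) B∈π
    ... | π' , π'≄σ , A∈π' , d∈π' | σ' , σ'≄π , B∈σ' , d∈σ'
      with ruling-cross d≉0 hd σ≄π O∈π O∈σ d∈π d∈σ π'≄σ d∈π' A∈π' A∈σ σ'≄π d∈σ' B∈σ' B∈π
    ... | E , E∈π' , E∈σ' = Frame.paraboloid d≉0 hd d∈π d∈σ d∈π' d∈σ' σ≄π π'≄σ σ'≄π
      O∈π O∈σ A∈σ A∈π' B∈π B∈σ' E∈π' E∈σ' (A≢O ∘ ≡.sym) (B≢O ∘ ≡.sym)

  opaque
    linear⇒dot : ∀ {f} → Linear f → ∃ λ φ → ∀ v → f v ≈ dot φ v
    linear⇒dot {f} l = (λ i → f (unit i)) , λ v → begin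
      f v  ≈⟨ resp l (unit-expand v) ⟩
      f (combo v unit)  ≈⟨ lin-combo l v unit ⟩
      sumF (λ j → v j * f (unit j))  ≈⟨ sumF-cong 5 (λ j → *-comm (v j) (f (unit j))) ⟩
      dot (λ i → f (unit i)) v ∎

  opaque
    linear-not-in-solid : ∀ {f v} → Linear f → ¬ f v ≈ 0# → ¬ (∀ P → f (c⃗ P) ≈ 0#)
    linear-not-in-solid {f} {v} l fv≉0 fC≈0 with linear⇒dot l
    ... | φ , f≈φ = not-in-solid {φ}
      (λ φ≈0 → fv≉0 (trans (f≈φ v) (sumF-0 5 (λ i → trans (*-congʳ (φ≈0 i)) (zeroˡ (v i))))))
      (λ P → trans (sym (f≈φ (c⃗ P))) (fC≈0 P))

  opaque
    lin-* : ∀ {f} → Linear f → ∀ a v → f (a *v v) ≈ a * f v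
    lin-* {f} l a v = begin
      f (a *v v)  ≈⟨ resp l (λ i → solve 2 (λ a v → a :* v ⊜ a :* v :+ :0 :* v) a (v i)) ⟩
      f (a *v v +v 0# *v v)  ≈⟨ lin l a v 0# v ⟩
      a * f v + 0# * f v  ≈⟨ solve 2 (λ a v → a :* v :+ :0 :* v ⊜ a :* v) a (f v) ⟩
      a * f v ∎

  triple : Carrier → V 5 → Carrier → V 5 → Carrier → V 5 → V 5
  triple a u b v r w = (a *v u +v b *v v) +v r *v w

  opaque
    lin-triple : ∀ {f} → Linear f → ∀ a u b v r w → f (triple a u b v r w) ≈ a * f u + b * f v + r * f w
    lin-triple l a u b v r w = trans (lin-at l (a *v u +v b *v v) w r) (+-congʳ (lin l a u b v))

  opaque
    ∈-triple : ∀ {ω u v w} a b r → u ∈ ω → v ∈ ω → w ∈ ω → triple a u b v r w ∈ ω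
    ∈-triple a b r u∈ v∈ w∈ = ∈-+ (∈-lin a b u∈ v∈) (∈-* r w∈)

  -- C-planes that avoid the centre of projection.

  module Over {d : V 5} (p : Paraboloid d) where
    open Paraboloid p public

    h-lin : Linear (dot h)
    h-lin = dot-linear h

    opaque
      multiple-of-d : ∀ v → dot h v ≈ 0# → x v ≈ 0# → y v ≈ 0# → z v ≈ 0# → v ≈v (g v *v d)
      multiple-of-d v hv xv yv zv i = x∙y⁻¹≈ε⇒x≈y _ _ (trans
        (solve 3 (λ v g d → v :- g :* d ⊜ v :+ (:- g) :* d) (v i) (g v) (d i))
        (joint-injective (at v d (- g v)) (zero-at h-lin hv hd≈0) (zero-at x-lin xv x-d) (zero-at y-lin yv y-d)
          (zero-at z-lin zv z-d)
          (trans (lin-at g-lin v d (- g v)) (trans (+-congˡ (*-congˡ g-d))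
            (solve 1 (λ g → g :+ (:- g) :* :1 ⊜ :0) (g v)))) i))
        where
        hd≈0 : dot h d ≈ 0#
        hd≈0 = hd
        zero-at : ∀ {f} → Linear f → f v ≈ 0# → f d ≈ 0# → f (at v d (- g v)) ≈ 0#
        zero-at l fv fd = trans (lin-at l v d (- g v)) (trans (+-cong fv (trans (*-congˡ fd) (zeroʳ _))) (+-identityʳ _))

    module Avoiding {ω : CPlane} (d∉ω : ¬ d ∈ ω) where

      opaque
        -- Such a `v` is a multiple of `d`, and a nonzero one would put `d` into `ω`.
        vanish : ∀ {v} → v ∈ ω → dot h v ≈ 0# → x v ≈ 0# → y v ≈ 0# → z v ≈ 0# → v ≈v zv
        vanish {v} v∈ hv xv yv zv with g v ≟ 0#
        ... | yes gv≈0 = joint-injective v hv xv yv zv gv≈0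
        ... | no gv≉0 = ⊥-elim (d∉ω (∈-resp (λ i → begin
          recip gv≉0 * v i  ≈⟨ *-congˡ (multiple-of-d v hv xv yv zv i) ⟩
          recip gv≉0 * (g v * d i)  ≈⟨ *-assoc _ _ _ ⟨
          recip gv≉0 * g v * d i  ≈⟨ trans (*-congʳ (recip-* gv≉0)) (*-identityˡ _) ⟩
          d i ∎) (∈-* (recip gv≉0) v∈)))

      opaque
        -- Points of C with equal `x` share a C-plane through `d`, which differs from `ω`.
        x-injective : ∀ {P P'} → c⃗ P ∈ ω → c⃗ P' ∈ ω → x (c⃗ P) ≈ x (c⃗ P') → P ≡ P'
        x-injective {P} {P'} P∈ P'∈ e with x-plane P
        ... | ρ , P∈ρ , d∈ρ , same-x = common-unique (λ ρ≃ω → d∉ω (≃-∈ ρ≃ω d∈ρ)) P∈ρ P∈ (same-x P' (sym e)) P'∈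

      opaque
        x-onto : ∀ a → ∃ λ P → c⃗ P ∈ ω × x (c⃗ P) ≈ a
        x-onto = form-onto ω x x-injective

      opaque
        -- For constant `y` the surface `z = xy` contains a line, so the projected points would be
        -- collinear; as the projection is injective on `ω`, the points themselves would be
        -- dependent.
        no-level : ∀ {P₁ P₂ P₃} → c⃗ P₁ ∈ ω → c⃗ P₂ ∈ ω → c⃗ P₃ ∈ ω → P₁ ≢ P₂ → P₂ ≢ P₃ → P₁ ≢ P₃ → ∀ {r} →
          y (c⃗ P₁) ≈ r → y (c⃗ P₂) ≈ r → y (c⃗ P₃) ≈ r → ⊥
        no-level {P₁} {P₂} {P₃} P₁∈ P₂∈ P₃∈ n₁₂ n₂₃ n₁₃ {r} y₁ y₂ y₃ = n₂₃ (x-injective P₂∈ P₃∈ (x∙y⁻¹≈ε⇒x≈y _ _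
          (arc-indep ω P₁∈ P₂∈ P₃∈ n₁₂ n₂₃ n₁₃ (x₂ - x₃ ∷ x₃ - x₁ ∷ x₁ - x₂ ∷ [])
            (λ i → trans (solve 3 (λ a b e → a :+ (b :+ (e :+ :0)) ⊜ a :+ b :+ e) _ _ _)
              (vanish (∈-triple _ _ _ P₁∈ P₂∈ P₃∈) hv xv yv zv₀ i)) zero)))
          where
          x₁ x₂ x₃ : Carrier
          x₁ = x (c⃗ P₁)
          x₂ = x (c⃗ P₂)
          x₃ = x (c⃗ P₃)
          v : V 5
          v = triple (x₂ - x₃) (c⃗ P₁) (x₃ - x₁) (c⃗ P₂) (x₁ - x₂) (c⃗ P₃)
          value : ∀ {f a b e} → Linear f → f (c⃗ P₁) ≈ a → f (c⃗ P₂) ≈ b → f (c⃗ P₃) ≈ e →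
            (x₂ - x₃) * a + (x₃ - x₁) * b + (x₁ - x₂) * e ≈ 0# → f v ≈ 0#
          value l e₁ e₂ e₃ total = trans (lin-triple l _ _ _ _ _ _)
            (trans (+-cong (+-cong (*-congˡ e₁) (*-congˡ e₂)) (*-congˡ e₃)) total)
          flat : ∀ r → (x₂ - x₃) * r + (x₃ - x₁) * r + (x₁ - x₂) * r ≈ 0#
          flat = solve 4 (λ x₁ x₂ x₃ r → (x₂ :- x₃) :* r :+ (x₃ :- x₁) :* r :+ (x₁ :- x₂) :* r ⊜ :0) x₁ x₂ x₃
          hv : dot h v ≈ 0#
          hv = value h-lin (h-c⃗ P₁) (h-c⃗ P₂) (h-c⃗ P₃) (flat 1#)
          xv : x v ≈ 0#
          xv = value x-lin refl refl refl
            (solve 3 (λ a b e → (b :- e) :* a :+ (e :- a) :* b :+ (a :- b) :* e ⊜ :0) x₁ x₂ x₃)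
          yv : y v ≈ 0#
          yv = value y-lin y₁ y₂ y₃ (flat r)
          zv₀ : z v ≈ 0#
          zv₀ = value z-lin (trans (z≈xy P₁) (*-congˡ y₁)) (trans (z≈xy P₂) (*-congˡ y₂)) (trans (z≈xy P₃) (*-congˡ y₃))
            (solve 4 (λ a b e r → (b :- e) :* (a :* r) :+ (e :- a) :* (b :* r) :+ (a :- b) :* (e :* r) ⊜ :0) x₁ x₂ x₃ r)

      opaque
        -- The exception `x₀` is there for a section that splits into two lines, one of them with
        -- constant `x`.
        not-level : ∀ x₀ r → ¬ (∀ {P} → c⃗ P ∈ ω → ¬ x (c⃗ P) ≈ x₀ → y (c⃗ P) ≈ r)
        not-level x₀ r level with fresh (index x₀ ∷ []) 2≤q
        ... | k₁ , new₁ with fresh (index x₀ ∷ k₁ ∷ []) (below-q (s≤s (s≤s (s≤s z≤n))))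
        ... | k₂ , new₂ with fresh (index x₀ ∷ k₁ ∷ k₂ ∷ []) (below-q (s≤s (s≤s (s≤s (s≤s z≤n)))))
        ... | k₃ , new₃ with x-onto (elem k₁) | x-onto (elem k₂) | x-onto (elem k₃)
        ... | P₁ , P₁∈ , e₁ | P₂ , P₂∈ , e₂ | P₃ , P₃∈ , e₃ = no-level P₁∈ P₂∈ P₃∈
          (apart e₁ e₂ (new₂ (suc zero))) (apart e₂ e₃ (new₃ (suc (suc zero)))) (apart e₁ e₃ (new₃ (suc zero)))
          (level P₁∈ (away e₁ (new₁ zero))) (level P₂∈ (away e₂ (new₂ zero))) (level P₃∈ (away e₃ (new₃ zero)))
          where
          apart : ∀ {P P' k k'} → x (c⃗ P) ≈ elem k → x (c⃗ P') ≈ elem k' → k ≢ k' → P ≢ P'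
          apart e e' k≢k' ≡.refl = k≢k' (elem-injective _ _ (trans (sym e) e'))
          away : ∀ {P k} → x (c⃗ P) ≈ elem k → index x₀ ≢ k → ¬ x (c⃗ P) ≈ x₀
          away e n e' = n (elem-injective _ _ (trans (elem-index x₀) (trans (sym e') e)))

      -- The projection from d is a plane section of z = xy through the point at infinity common
      -- to no ruling, that is, y is an affine function of x on it.
      opaque
        line : ∃₂ λ s t → ¬ s ≈ 0# × (∀ {v} → v ∈ ω → y v ≈ s * x v + t * dot h v)
        line with annihilator (d ∷ gens ω)
        ... | φ , φ≉0 , φ0 = conclude
          where
          φω : Kills φ ω
          φω v∈ = kills-span {p = gens ω} φ (λ j → φ0 (suc j)) (span v∈)
          e-h e-x e-y e-z : V 5
          e-h = proj₁ (joint-surjective 1# 0# 0# 0# 0#)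
          e-x = proj₁ (joint-surjective 0# 1# 0# 0# 0#)
          e-y = proj₁ (joint-surjective 0# 0# 1# 0# 0#)
          e-z = proj₁ (joint-surjective 0# 0# 0# 1# 0#)
          δ α β γ : Carrier
          δ = dot φ e-h
          α = dot φ e-x
          β = dot φ e-y
          γ = dot φ e-z
          expand : ∀ v → dot φ v ≈ δ * dot h v + α * x v + β * y v + γ * z v
          expand v = begin
            dot φ v  ≈⟨ dot-congʳ φ (λ i → solve 2 (λ r v → v ⊜ r :+ (v :- r)) (rest i) (v i)) ⟩
            dot φ (rest +v (v -v rest))  ≈⟨ dot-+ φ rest (v -v rest) ⟩
            dot φ rest + dot φ (v -v rest)
              ≈⟨ +-cong (at-rest (dot-linear φ) refl refl refl refl)
                   (trans (dot-congʳ φ (multiple-of-d (v -v rest) (none h-lin eh) (none x-lin ex) (none y-lin ey) (none z-lin ez)))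
                     (trans (dot-* φ _ d) (trans (*-congˡ (φ0 zero)) (zeroʳ _)))) ⟩
            (dot h v * δ + x v * α) + (y v * β + z v * γ) + 0#
              ≈⟨ solve 8 (λ h x y z a b e f → (h :* a :+ x :* b) :+ (y :* e :+ z :* f) :+ :0 ⊜
                   a :* h :+ b :* x :+ e :* y :+ f :* z) (dot h v) (x v) (y v) (z v) δ α β γ ⟩
            δ * dot h v + α * x v + β * y v + γ * z v ∎
            where
            rest : V 5
            rest = (dot h v *v e-h +v x v *v e-x) +v (y v *v e-y +v z v *v e-z)
            at-rest : ∀ {f a b e r} → Linear f → f e-h ≈ a → f e-x ≈ b → f e-y ≈ e → f e-z ≈ r →
              f rest ≈ (dot h v * a + x v * b) + (y v * e + z v * r)
            at-rest {f} l ea eb ee er = trans (resp l (λ i → solve 2 (λ a b → a :+ b ⊜ :1 :* a :+ :1 :* b) _ _))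
              (trans (lin l 1# (dot h v *v e-h +v x v *v e-x) 1# (y v *v e-y +v z v *v e-z))
                (trans (+-cong (*-identityˡ _) (*-identityˡ _)) (+-cong
                  (trans (lin l _ _ _ _) (+-cong (*-congˡ ea) (*-congˡ eb))) (trans (lin l _ _ _ _) (+-cong (*-congˡ ee) (*-congˡ er))))))
            none : ∀ {f} → Linear f → f rest ≈ f v → f (v -v rest) ≈ 0#
            none l e = trans (lin-- l v rest) (trans (+-congˡ (-‿cong e)) (-‿inverseʳ _))
            vals : ∀ w a b r s → let u = proj₁ (joint-surjective w a b r s) in dot h u ≈ w × x u ≈ a × y u ≈ b × z u ≈ r × g u ≈ s
            vals w a b r s = proj₂ (joint-surjective w a b r s)
            eh : dot h rest ≈ dot h v
            eh = trans (at-rest h-lin (proj₁ (vals _ _ _ _ _)) (proj₁ (vals _ _ _ _ _)) (proj₁ (vals _ _ _ _ _)) (proj₁ (vals _ _ _ _ _)))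
              (solve 4 (λ h x y z → (h :* :1 :+ x :* :0) :+ (y :* :0 :+ z :* :0) ⊜ h) _ _ _ _)
            ex : x rest ≈ x v
            ex = trans (at-rest x-lin (proj₁ (proj₂ (vals _ _ _ _ _))) (proj₁ (proj₂ (vals _ _ _ _ _)))
                (proj₁ (proj₂ (vals _ _ _ _ _))) (proj₁ (proj₂ (vals _ _ _ _ _))))
              (solve 4 (λ h x y z → (h :* :0 :+ x :* :1) :+ (y :* :0 :+ z :* :0) ⊜ x) _ _ _ _)
            ey : y rest ≈ y v
            ey = trans (at-rest y-lin (proj₁ (proj₂ (proj₂ (vals _ _ _ _ _)))) (proj₁ (proj₂ (proj₂ (vals _ _ _ _ _))))
                (proj₁ (proj₂ (proj₂ (vals _ _ _ _ _)))) (proj₁ (proj₂ (proj₂ (vals _ _ _ _ _)))))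
              (solve 4 (λ h x y z → (h :* :0 :+ x :* :0) :+ (y :* :1 :+ z :* :0) ⊜ y) _ _ _ _)
            ez : z rest ≈ z v
            ez = trans (at-rest z-lin (proj₁ (proj₂ (proj₂ (proj₂ (vals _ _ _ _ _))))) (proj₁ (proj₂ (proj₂ (proj₂ (vals _ _ _ _ _)))))
                (proj₁ (proj₂ (proj₂ (proj₂ (vals _ _ _ _ _))))) (proj₁ (proj₂ (proj₂ (proj₂ (vals _ _ _ _ _))))))
              (solve 4 (λ h x y z → (h :* :0 :+ x :* :0) :+ (y :* :0 :+ z :* :1) ⊜ z) _ _ _ _)
          on-C : ∀ {P} → c⃗ P ∈ ω → δ + α * x (c⃗ P) + β * y (c⃗ P) + γ * (x (c⃗ P) * y (c⃗ P)) ≈ 0#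
          on-C {P} P∈ = trans (sym (trans (expand (c⃗ P)) (+-cong (+-congʳ (+-congʳ (trans (*-congˡ (h-c⃗ P)) (*-identityʳ _))))
            (*-congˡ (z≈xy P))))) (φω P∈)
          γ≈0 : γ ≈ 0#
          γ≈0 = decidable-stable (γ ≟ 0#) bent
            where
            -- With `γ` nonzero the section reads `(x + β/γ)(y + α/γ) = const`. Since `x` takes the
            -- value `-β/γ` on `ω`, the constant is 0, and `y = -α/γ` at all other points.
            bent : ¬ ¬ γ ≈ 0#
            bent γ≉0 with x-onto (- (β * recip γ≉0))
            ... | P₀ , P₀∈ , x₀≈ = not-level (x (c⃗ P₀)) (- (α * r)) λ {P} P∈ x≉x₀ → x∙y⁻¹≈ε⇒x≈y _ _
              (*-cancel-0 (-≉0 x≉x₀) (trans (step P) (trans (*-congˡ (trans (+-cong (on-C P∈) (-‿cong (on-C P₀∈)))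
                (-‿inverseʳ 0#))) (zeroʳ r))))
              where
              r x₀ y₀ : Carrier
              r = recip γ≉0
              x₀ = x (c⃗ P₀)
              y₀ = y (c⃗ P₀)
              step : ∀ P → (x (c⃗ P) - x₀) * (y (c⃗ P) - - (α * r)) ≈
                r * ((δ + α * x (c⃗ P) + β * y (c⃗ P) + γ * (x (c⃗ P) * y (c⃗ P))) - (δ + α * x₀ + β * y₀ + γ * (x₀ * y₀)))
              step P = begin
                (X - x₀) * (Y - - (α * r))  ≈⟨ *-congʳ (+-congˡ (-‿cong x₀≈)) ⟩
                (X - - (β * r)) * (Y - - (α * r))
                  ≈⟨ solve 6 (λ x y a b r g → (x :- :- (b :* r)) :* (y :- :- (a :* r)) ⊜
                       r :* (a :* x :+ b :* y) :+ x :* y :+ a :* b :* r :* r) X Y α β r γ ⟩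
                r * (α * X + β * Y) + X * Y + α * β * r * r
                  ≈⟨ +-congʳ (+-congˡ (trans (sym (*-identityˡ _)) (*-congʳ (sym (recip-* γ≉0))))) ⟩
                r * (α * X + β * Y) + r * γ * (X * Y) + α * β * r * r
                  ≈⟨ solve 7 (λ x y a b r g d → r :* (a :* x :+ b :* y) :+ r :* g :* (x :* y) :+ a :* b :* r :* r ⊜
                       r :* ((d :+ a :* x :+ b :* y :+ g :* (x :* y)) :- (d :+ a :* (:- (b :* r))))) X Y α β r γ δ ⟩
                r * ((δ + α * X + β * Y + γ * (X * Y)) - (δ + α * (- (β * r))))  ≈⟨ *-congˡ (+-congˡ (-‿cong (sym tail₀))) ⟩
                r * ((δ + α * X + β * Y + γ * (X * Y)) - (δ + α * x₀ + β * y₀ + γ * (x₀ * y₀))) ∎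
                where
                X Y : Carrier
                X = x (c⃗ P)
                Y = y (c⃗ P)
                tail₀ : δ + α * x₀ + β * y₀ + γ * (x₀ * y₀) ≈ δ + α * (- (β * r))
                tail₀ = begin
                  δ + α * x₀ + β * y₀ + γ * (x₀ * y₀)
                    ≈⟨ +-cong (+-congʳ (+-congˡ (*-congˡ x₀≈))) (*-congˡ (*-congʳ x₀≈)) ⟩
                  δ + α * (- (β * r)) + β * y₀ + γ * (- (β * r) * y₀)
                    ≈⟨ solve 6 (λ d a b g r y → d :+ a :* (:- (b :* r)) :+ b :* y :+ g :* (:- (b :* r) :* y) ⊜
                         d :+ a :* (:- (b :* r)) :+ b :* y :* (:1 :- r :* g)) δ α β γ r y₀ ⟩
                  δ + α * (- (β * r)) + β * y₀ * (1# - r * γ)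
                    ≈⟨ +-congˡ (*-congˡ (trans (+-congˡ (-‿cong (recip-* γ≉0))) (-‿inverseʳ 1#))) ⟩
                  δ + α * (- (β * r)) + β * y₀ * 0#  ≈⟨ trans (+-congˡ (zeroʳ _)) (+-identityʳ _) ⟩
                  δ + α * (- (β * r)) ∎
          -- Otherwise `δ + α x = 0` for every value of `x`, so `φ` vanishes on all of C.
          β≉0 : ¬ β ≈ 0#
          β≉0 β≈0 = not-in-solid {φ} φ≉0 λ P → trans (expand (c⃗ P)) (trans
              (+-cong (+-cong (+-cong (*-congʳ δ≈0) (*-congʳ α≈0)) (*-congʳ β≈0)) (*-congʳ γ≈0))
              (solve 4 (λ a b e f → :0 :* a :+ :0 :* b :+ :0 :* e :+ :0 :* f ⊜ :0) _ _ _ _))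
            where
            at-x : ∀ a → δ + α * a ≈ 0#
            at-x a = let P , P∈ , xP≈a = x-onto a in begin
              δ + α * a  ≈⟨ solve 5 (λ d a x y z → d :+ a :* x ⊜ d :+ a :* x :+ :0 :* y :+ :0 :* z) δ α a (y (c⃗ P)) (x (c⃗ P) * y (c⃗ P)) ⟩
              δ + α * a + 0# * y (c⃗ P) + 0# * (x (c⃗ P) * y (c⃗ P))
                ≈⟨ +-cong (+-cong (+-congˡ (*-congˡ (sym xP≈a))) (*-congʳ (sym β≈0))) (*-congʳ (sym γ≈0)) ⟩
              δ + α * x (c⃗ P) + β * y (c⃗ P) + γ * (x (c⃗ P) * y (c⃗ P))  ≈⟨ on-C P∈ ⟩
              0# ∎
            δ≈0 : δ ≈ 0#
            δ≈0 = trans (solve 2 (λ d a → d ⊜ d :+ a :* :0) δ α) (at-x 0#)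
            α≈0 : α ≈ 0#
            α≈0 = trans (solve 2 (λ d a → a ⊜ (d :+ a :* :1) :- (d :+ a :* :0)) δ α)
              (trans (+-cong (at-x 1#) (-‿cong (at-x 0#))) (-‿inverseʳ 0#))
          s t : Carrier
          s = - (α * recip β≉0)
          t = - (δ * recip β≉0)
          on-ω : ∀ {v} → v ∈ ω → y v ≈ s * x v + t * dot h v
          on-ω {v} v∈ = begin
            y v  ≈⟨ trans (sym (*-identityˡ _)) (*-congʳ (sym (recip-* β≉0))) ⟩
            recip β≉0 * β * y v
              ≈⟨ solve 8 (λ r b y d a x h z → r :* b :* y ⊜ r :* (d :* h :+ a :* x :+ b :* y :+ :0 :* z) :+
                   ((:- (a :* r)) :* x :+ (:- (d :* r)) :* h)) (recip β≉0) β (y v) δ α (x v) (dot h v) (z v) ⟩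
            recip β≉0 * (δ * dot h v + α * x v + β * y v + 0# * z v) + (s * x v + t * dot h v)
              ≈⟨ +-congʳ (*-congˡ (trans (+-congˡ (*-congʳ (sym γ≈0))) (trans (sym (expand v)) (φω v∈)))) ⟩
            recip β≉0 * 0# + (s * x v + t * dot h v)  ≈⟨ trans (+-congʳ (zeroʳ _)) (+-identityˡ _) ⟩
            s * x v + t * dot h v ∎
          conclude : ∃₂ λ s t → ¬ s ≈ 0# × (∀ {v} → v ∈ ω → y v ≈ s * x v + t * dot h v)
          conclude with x-onto 0#
          ... | P₀ , _ , x₀≈0 = s , t , (λ s≈0 → not-level 0# t λ {P} P∈ _ → begin
              y (c⃗ P)  ≈⟨ on-ω P∈ ⟩
              s * x (c⃗ P) + t * dot h (c⃗ P)  ≈⟨ +-cong (*-congʳ s≈0) (*-congˡ (h-c⃗ P)) ⟩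
              0# * x (c⃗ P) + t * 1#  ≈⟨ solve 2 (λ x t → :0 :* x :+ t :* :1 ⊜ t) _ t ⟩
              t ∎) , on-ω

  module Verticals {d : V 5} (p : Paraboloid d) where
    open Over p public

    -- The point at infinity of the parabolas y = s x + t, z = xy.
    record Vertical (e : V 5) : Set ℓ where
      field
        h-e : dot h e ≈ 0#
        x-e : x e ≈ 0#
        y-e : y e ≈ 0#
        z-e : z e ≈ 1#
    open Vertical public

    opaque
      vertical≉0 : ∀ {e} → Vertical e → NonZero e
      vertical≉0 ve e≈0 = 1≉0 (trans (sym (z-e ve)) (trans (resp z-lin e≈0) (lin-zv z-lin)))

    opaque
      -- On a plane spanned by a point, `d` and `e` both `x` and `y` are constant on the affine
      -- points, and together they determine a point of C; but a C-plane has at least two.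
      vertical-avoids : ∀ {e μ} → Vertical e → e ∈ μ → ¬ d ∈ μ
      vertical-avoids {e} {μ} ve e∈ d∈ with second 2≤q μ (pts μ (fromℕ< 2≤q))
      ... | P' , P'≢P , P'∈
        with frame-coords (Aff-c⃗ (pts μ (fromℕ< 2≤q))) (inf hd) (inf (h-e ve)) independent (pts∈ μ _) d∈ e∈ (Aff-c⃗ P') P'∈
        where
        independent : Indep₂ d e
        independent a b rel = a≈0 , b≈0
          where
          b≈0 : b ≈ 0#
          b≈0 = begin
            b  ≈⟨ solve 2 (λ a b → b ⊜ a :* :0 :+ b :* :1) a b ⟩
            a * 0# + b * 1#  ≈⟨ +-cong (*-congˡ z-d) (*-congˡ (z-e ve)) ⟨
            a * z d + b * z e  ≈⟨ lin z-lin a d b e ⟨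
            z (a *v d +v b *v e)  ≈⟨ trans (resp z-lin rel) (lin-zv z-lin) ⟩
            0# ∎
          a≈0 : a ≈ 0#
          a≈0 = begin
            a  ≈⟨ solve 2 (λ a g → a ⊜ a :* :1 :+ :0 :* g) a (g e) ⟩
            a * 1# + 0# * g e  ≈⟨ +-cong (*-congˡ g-d) (*-congʳ b≈0) ⟨
            a * g d + b * g e  ≈⟨ lin g-lin a d b e ⟨
            g (a *v d +v b *v e)  ≈⟨ trans (resp g-lin rel) (lin-zv g-lin) ⟩
            0# ∎
      ... | α , β , same-point = P'≢P (determined (agree x-lin x-d (x-e ve)) (agree y-lin y-d (y-e ve)))
        where
        agree : ∀ {f} → Linear f → f d ≈ 0# → f e ≈ 0# → f (c⃗ P') ≈ f (c⃗ (pts μ (fromℕ< 2≤q)))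
        agree {f} l fd fe = begin
          f (c⃗ P')  ≈⟨ solve 2 (λ f b → f ⊜ f :+ (:- b) :* :0) (f (c⃗ P')) β ⟩
          f (c⃗ P') + (- β) * 0#  ≈⟨ +-congˡ (*-congˡ fe) ⟨
          f (c⃗ P') + (- β) * f e  ≈⟨ trans (sym (lin-at l _ e (- β))) (trans (resp l same-point) (lin-at l _ d α)) ⟩
          f (c⃗ (pts μ (fromℕ< 2≤q))) + α * f d  ≈⟨ trans (+-congˡ (trans (*-congˡ fd) (zeroʳ α))) (+-identityʳ _) ⟩
          f (c⃗ (pts μ (fromℕ< 2≤q))) ∎

    opaque
      -- A C-plane through `O` that contains `d` is `π`, where `x` vanishes, or the second such
      -- plane `σ`, where `y` does.
      avoids-d : ∀ {P ω} → c⃗ O ∈ ω → c⃗ P ∈ ω → ¬ x (c⃗ P) ≈ 0# → ¬ y (c⃗ P) ≈ 0# → ¬ d ∈ ω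
      avoids-d {P} {ω} O∈ω P∈ω xP≉0 yP≉0 d∈ω with ω ≃? π
      ... | yes ω≃π = xP≉0 (x-π (≃-∈ ω≃π P∈ω))
      ... | no ω≄π = yP≉0 (y-σ (≃-∈ (second-unique d≉0 (inf hd) O∈π d∈π ω≄π σ≄π O∈ω d∈ω O∈σ d∈σ) P∈ω))
        where
        d≉0 : NonZero d
        d≉0 d≈0 = 1≉0 (trans (sym g-d) (trans (resp g-lin d≈0) (lin-zv g-lin)))

    -- Here `ω` cuts C in the points over the line `y = s x + t`, which project to the parabola
    -- `z = x (s x + t)`.
    module Slope {ω : CPlane} (d∉ω : ¬ d ∈ ω) {s t : Carrier} (s≉0 : ¬ s ≈ 0#)
      (on-ω : ∀ {v} → v ∈ ω → y v ≈ s * x v + t * dot h v) where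
      open Avoiding d∉ω

      opaque
        y-on : ∀ {P} → c⃗ P ∈ ω → y (c⃗ P) ≈ s * x (c⃗ P) + t
        y-on {P} P∈ = trans (on-ω P∈) (+-congˡ (trans (*-congˡ (h-c⃗ P)) (*-identityʳ t)))

      opaque
        on-line : ∀ {P} → y (c⃗ P) ≈ s * x (c⃗ P) + t → c⃗ P ∈ ω
        on-line {P} e with x-onto (x (c⃗ P))
        ... | P' , P'∈ , x≈ = ≡.subst (λ P → c⃗ P ∈ ω)
          (determined x≈ (trans (y-on P'∈) (trans (+-congʳ (*-congˡ x≈)) (sym e)))) P'∈

      opaque
        vertical-multiple : ∀ {e v} → Vertical e → e ∈ ω → v ∈ ω → dot h v ≈ 0# → x v ≈ 0# → v ≈v (z v *v e)
        vertical-multiple {e} {v} ve e∈ v∈ hv xv i = x∙y⁻¹≈ε⇒x≈y _ _ (trans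
          (solve 3 (λ v z e → v :- z :* e ⊜ v :+ (:- z) :* e) (v i) (z v) (e i))
          (vanish (∈-at (- z v) v∈ e∈) (zero-at h-lin hv (h-e ve)) (zero-at x-lin xv (x-e ve)) (zero-at y-lin yv (y-e ve))
            (trans (lin-at z-lin v e (- z v)) (trans (+-congˡ (*-congˡ (z-e ve))) (solve 1 (λ z → z :+ (:- z) :* :1 ⊜ :0) (z v)))) i))
          where
          zero-at : ∀ {f} → Linear f → f v ≈ 0# → f e ≈ 0# → f (at v e (- z v)) ≈ 0#
          zero-at l fv fe = trans (lin-at l v e (- z v)) (trans (+-cong fv (trans (*-congˡ fe) (zeroʳ _))) (+-identityʳ _))
          yv : y v ≈ 0#
          yv = trans (on-ω v∈) (trans (+-cong (*-congˡ xv) (*-congˡ hv)) (solve 2 (λ s t → s :* :0 :+ t :* :0 ⊜ :0) s t))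

      opaque
        z-on : ∀ {P a} → c⃗ P ∈ ω → x (c⃗ P) ≈ a → z (c⃗ P) ≈ a * (s * a + t)
        z-on {P} P∈ e = trans (z≈xy P) (*-cong e (trans (y-on P∈) (+-congʳ (*-congˡ e))))

      -- The combination b P₁ - P_b + (1 - b) P₀ of the points with x = 1, b, 0.
      opaque
        second-difference : ∃₂ λ b v → ¬ b * (1# - b) ≈ 0# × v ∈ ω × dot h v ≈ 0# × x v ≈ 0# × y v ≈ 0# ×
          z v ≈ b * (1# - b) * s × (∀ f (k : Carrier → Carrier) → Linear f →
            (∀ {P a} → c⃗ P ∈ ω → x (c⃗ P) ≈ a → f (c⃗ P) ≈ k a) → f v ≈ b * k 1# + (- 1#) * k b + (1# - b) * k 0#)
        second-difference with fresh (index 0# ∷ index 1# ∷ []) (below-q (s≤s (s≤s (s≤s z≤n))))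
        ... | i , new with x-onto 1# | x-onto (elem i) | x-onto 0#
        ... | P₁ , P₁∈ , x₁ | P₂ , P₂∈ , x₂ | P₀ , P₀∈ , x₀ = b , v , *-≉0 b≉0 (-≉0 (b≉1 ∘ sym)) , v∈ ,
            trans (total h-lin (λ _ → 1#) (λ {P} _ _ → h-c⃗ P)) (solve 1 (λ b → b :* :1 :+ (:- :1) :* :1 :+ (:1 :- b) :* :1 ⊜ :0) b) ,
            trans (total x-lin id (λ _ e → e)) (solve 1 (λ b → b :* :1 :+ (:- :1) :* b :+ (:1 :- b) :* :0 ⊜ :0) b) ,
            trans (total y-lin (λ a → s * a + t) (λ P∈ e → trans (y-on P∈) (+-congʳ (*-congˡ e))))
              (solve 3 (λ b s t → b :* (s :* :1 :+ t) :+ (:- :1) :* (s :* b :+ t) :+ (:1 :- b) :* (s :* :0 :+ t) ⊜ :0) b s t) ,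
            trans (total z-lin (λ a → a * (s * a + t)) z-on)
              (solve 3 (λ b s t → b :* (:1 :* (s :* :1 :+ t)) :+ (:- :1) :* (b :* (s :* b :+ t)) :+ (:1 :- b) :* (:0 :* (s :* :0 :+ t)) ⊜
                b :* (:1 :- b) :* s) b s t) ,
            λ f k l on → total l k on
          where
          b : Carrier
          b = elem i
          b≉0 : ¬ b ≈ 0#
          b≉0 e = new zero (elem-injective _ _ (trans (elem-index 0#) (sym e)))
          b≉1 : ¬ b ≈ 1#
          b≉1 e = new (suc zero) (elem-injective _ _ (trans (elem-index 1#) (sym e)))
          v : V 5
          v = triple b (c⃗ P₁) (- 1#) (c⃗ P₂) (1# - b) (c⃗ P₀)
          v∈ : v ∈ ω
          v∈ = ∈-triple _ _ _ P₁∈ P₂∈ P₀∈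
          total : ∀ {f} → Linear f → (k : Carrier → Carrier) → (∀ {P a} → c⃗ P ∈ ω → x (c⃗ P) ≈ a → f (c⃗ P) ≈ k a) →
            f v ≈ b * k 1# + (- 1#) * k b + (1# - b) * k 0#
          total l k on = trans (lin-triple l _ _ _ _ _ _)
            (+-cong (+-cong (*-congˡ (on P₁∈ x₁)) (*-congˡ (on P₂∈ x₂))) (*-congˡ (on P₀∈ x₀)))

      opaque
        vertical : ∃ λ e → Vertical e × e ∈ ω
        vertical with second-difference
        ... | b , v , b≉0 , v∈ , hv , xv , yv , zv≈ , _ = r *v v , record
            { h-e = zero-* h-lin hv ; x-e = zero-* x-lin xv ; y-e = zero-* y-lin yv
            ; z-e = trans (lin-* z-lin r v) (trans (*-congˡ zv≈) (recip-* n)) } , ∈-* r v∈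
          where
          n : ¬ b * (1# - b) * s ≈ 0#
          n = *-≉0 b≉0 s≉0
          r : Carrier
          r = recip n
          zero-* : ∀ {f} → Linear f → f v ≈ 0# → f (r *v v) ≈ 0#
          zero-* l fv = trans (lin-* l r v) (trans (*-congˡ fv) (zeroʳ r))

      -- Any other direction in ω is that of a secant.
      opaque
        axis-vertical : ∀ {X e} → Axis ω X → Vertical e → e ∈ ω → ∃ λ k → e ≈v (k *v X)
        axis-vertical {X} {e} ax ve e∈ with x X ≟ 0#
        ... | yes xX≈0 = recip zX≉0 , λ i → begin
            e i  ≈⟨ trans (sym (*-identityˡ _)) (*-congʳ (sym (recip-* zX≉0))) ⟩
            recip zX≉0 * z X * e i  ≈⟨ *-assoc _ _ _ ⟩
            recip zX≉0 * (z X * e i)  ≈⟨ *-congˡ (X≈ze i) ⟨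
            recip zX≉0 * X i ∎
          where
          X≈ze : X ≈v (z X *v e)
          X≈ze = vertical-multiple ve e∈ (Axis.d∈π ax) (h≈0 (Axis.hd ax)) xX≈0
          zX≉0 : ¬ z X ≈ 0#
          zX≉0 z≈0 = Axis.d≉0 ax λ i → trans (X≈ze i) (trans (*-congʳ z≈0) (zeroˡ _))
        ... | no α≉0 = ⊥-elim (pick (n ≟ 0#))
          where
          α r s⁻ n : Carrier
          α = x X
          r = recip α≉0
          s⁻ = recip s≉0
          -- The chord of `z = x (s x + t)` between the abscissas `a` and `n - a` has slope
          -- `s n + t`; this `n` makes it equal to the slope `z X / x X` of the axis.
          n = (z X * r - t) * s⁻
          secant : ∀ a → ¬ n - a ≈ a → ⊥
          secant a n-a≉a with x-onto a | x-onto (n - a)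
          ... | P , P∈ , xP | P' , P'∈ , xP' = n-a≉a (trans (sym xP') (trans
              (sym (reflexive (≡.cong (λ P → x (c⃗ P)) (line-unique ax P∈ ((m * r) , on))))) xP))
            where
            m : Carrier
            m = (n - a) - a
            v : V 5
            v = triple m X (- α) (c⃗ P') α (c⃗ P)
            value : ∀ {f b b'} → Linear f → f (c⃗ P') ≈ b' → f (c⃗ P) ≈ b → f v ≈ m * f X + (- α) * b' + α * b
            value l e' e = trans (lin-triple l _ _ _ _ _ _) (+-cong (+-congˡ (*-congˡ e')) (*-congˡ e))
            v≈0 : v ≈v zv
            v≈0 i = trans (vertical-multiple ve e∈ (∈-triple _ _ _ (Axis.d∈π ax) P'∈ P∈)
                (trans (value h-lin (h-c⃗ P') (h-c⃗ P)) (trans (+-congʳ (+-congʳ (*-congˡ (h≈0 (Axis.hd ax)))))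
                  (solve 2 (λ m a → m :* :0 :+ (:- a) :* :1 :+ a :* :1 ⊜ :0) m α)))
                (trans (value x-lin xP' xP) (solve 3 (λ n a α → ((n :- a) :- a) :* α :+ (:- α) :* (n :- a) :+ α :* a ⊜ :0) n a α)) i)
              (trans (*-congʳ zv≈0) (zeroˡ _))
              where
              zv≈0 : z v ≈ 0#
              zv≈0 = begin
                z v  ≈⟨ value z-lin (z-on P'∈ xP') (z-on P∈ xP) ⟩
                m * z X + (- α) * ((n - a) * (s * (n - a) + t)) + α * (a * (s * a + t))
                  ≈⟨ solve 6 (λ n a z α s t → ((n :- a) :- a) :* z :+ (:- α) :* ((n :- a) :* (s :* (n :- a) :+ t)) :+ α :* (a :* (s :* a :+ t)) ⊜
                       ((n :- a) :- a) :* (z :- α :* (s :* n :+ t))) n a (z X) α s t ⟩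
                m * (z X - α * (s * n + t))  ≈⟨ *-congˡ (+-congˡ (-‿cong (*-congˡ (+-congʳ s*n)))) ⟩
                m * (z X - α * ((z X * r - t) + t))
                  ≈⟨ solve 5 (λ m z α r t → m :* (z :- α :* ((z :* r :- t) :+ t)) ⊜ m :* (z :* (:1 :- r :* α))) m (z X) α r t ⟩
                m * (z X * (1# - r * α))  ≈⟨ *-congˡ (*-congˡ (trans (+-congˡ (-‿cong (recip-* α≉0))) (-‿inverseʳ 1#))) ⟩
                m * (z X * 0#)  ≈⟨ trans (*-congˡ (zeroʳ _)) (zeroʳ m) ⟩
                0# ∎
                where
                s*n : s * n ≈ z X * r - t
                s*n = trans (solve 3 (λ s k r → s :* (k :* r) ⊜ r :* s :* k) s (z X * r - t) s⁻)
                  (trans (*-congʳ (recip-* s≉0)) (*-identityˡ _))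
            on : c⃗ P' ≈v at (c⃗ P) X (m * r)
            on i = begin
              c⃗ P' i  ≈⟨ trans (sym (*-identityˡ _)) (*-congʳ (sym (recip-* α≉0))) ⟩
              r * α * c⃗ P' i
                ≈⟨ solve 6 (λ r α p' p m x → r :* α :* p' ⊜ r :* α :* p :+ m :* r :* x :- r :* (m :* x :+ (:- α) :* p' :+ α :* p))
                     r α (c⃗ P' i) (c⃗ P i) m (X i) ⟩
              r * α * c⃗ P i + m * r * X i - r * (m * X i + (- α) * c⃗ P' i + α * c⃗ P i)
                ≈⟨ +-cong (+-congʳ (trans (*-congʳ (recip-* α≉0)) (*-identityˡ _))) (-‿cong (trans (*-congˡ (v≈0 i)) (zeroʳ r))) ⟩
              c⃗ P i + m * r * X i - 0#  ≈⟨ solve 1 (λ a → a :- :0 ⊜ a) _ ⟩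
              at (c⃗ P) X (m * r) i ∎
          -- The abscissas 0 and `n` differ unless `n = 0`, and then 1 and -1 do, because 2 is
          -- nonzero.
          pick : Dec (n ≈ 0#) → ⊥
          pick (no n≉0) = secant 0# (λ e → n≉0 (trans (solve 1 (λ n → n ⊜ n :- :0) n) e))
          pick (yes n≈0) = secant 1# (λ e → 2≉0 (begin
            1# + 1#  ≈⟨ +-congˡ (sym e) ⟩
            1# + (n - 1#)  ≈⟨ solve 1 (λ n → :1 :+ (n :- :1) ⊜ n) n ⟩
            n  ≈⟨ n≈0 ⟩
            0# ∎))

  -- The fifth coordinate and the constant `ε`.

  record Canonical : Set (c ⊔ ℓ) where
    field
      x y z w : V 5 → Carrier
      x-lin : Linear x
      y-lin : Linear y
      z-lin : Linear z
      w-lin : Linear w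
      joint-injective : ∀ v → dot h v ≈ 0# → x v ≈ 0# → y v ≈ 0# → z v ≈ 0# → w v ≈ 0# → v ≈v zv
      joint-surjective : ∀ k a b r s → ∃ λ v → dot h v ≈ k × x v ≈ a × y v ≈ b × z v ≈ r × w v ≈ s
      ε : Carrier
      ε-nonsquare : ∀ m → ¬ m * m ≈ ε
      z≈xy : ∀ P → z (c⃗ P) ≈ x (c⃗ P) * y (c⃗ P)
      w≈y²+εx² : ∀ P → w (c⃗ P) ≈ y (c⃗ P) * y (c⃗ P) + ε * (x (c⃗ P) * x (c⃗ P))
      onto : ∀ a b → ∃ λ P → x (c⃗ P) ≈ a × y (c⃗ P) ≈ b

  module _ {d : V 5} (p : Paraboloid d) where
    open Verticals p

    opaque
      line-of : ∀ {e μ} → Vertical e → e ∈ μ → ∃₂ λ s t → ¬ s ≈ 0# × (∀ {v} → v ∈ μ → y v ≈ s * x v + t * dot h v)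
      line-of ve e∈ = Avoiding.line (vertical-avoids ve e∈)

    opaque
      -- Lines of different slopes in the `(x, y)` plane meet, and the point of C over the meeting
      -- point would be on both planes.
      parallel-slope : ∀ {e ω μ s t s' t'} (ve : Vertical e) (e∈ω : e ∈ ω) (e∈μ : e ∈ μ) → ¬ s ≈ 0# → ¬ s' ≈ 0# →
        (∀ {v} → v ∈ ω → y v ≈ s * x v + t * dot h v) → (∀ {v} → v ∈ μ → y v ≈ s' * x v + t' * dot h v) →
        Disj ω μ ⊎ ω ≃ μ → s ≈ s'
      parallel-slope {e} {ω} {μ} {s} {t} {s'} {t'} ve e∈ω e∈μ s≉0 s'≉0 on-ω on-μ par = decidable-stable (s ≟ s') cross
        where
        module ω = Slope (vertical-avoids ve e∈ω) s≉0 on-ω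
        module μ = Slope (vertical-avoids ve e∈μ) s'≉0 on-μ
        cross : ¬ ¬ s ≈ s'
        cross s≉s' with onto ((t' - t) * recip (-≉0 s≉s')) (s * ((t' - t) * recip (-≉0 s≉s')) + t)
        ... | P , xP , yP = [ (λ disj → disj P P∈ω P∈μ) , (λ e → s≉s' (equal e)) ] par
          where
          r a : Carrier
          r = recip (-≉0 s≉s')
          a = (t' - t) * r
          P∈ω : c⃗ P ∈ ω
          P∈ω = ω.on-line (trans yP (+-congʳ (*-congˡ (sym xP))))
          P∈μ : c⃗ P ∈ μ
          P∈μ = μ.on-line (begin
            y (c⃗ P)  ≈⟨ yP ⟩
            s * a + t  ≈⟨ solve 5 (λ s s' t t' r → s :* ((t' :- t) :* r) :+ t ⊜
              s' :* ((t' :- t) :* r) :+ t' :+ (t' :- t) :* (r :* (s :- s') :- :1)) s s' t t' r ⟩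
            s' * a + t' + (t' - t) * (r * (s - s') - 1#)
              ≈⟨ +-congˡ (*-congˡ (trans (+-congʳ (recip-* (-≉0 s≉s'))) (-‿inverseʳ 1#))) ⟩
            s' * a + t' + (t' - t) * 0#  ≈⟨ trans (+-congˡ (zeroʳ _)) (+-identityʳ _) ⟩
            s' * a + t'  ≈⟨ +-congʳ (*-congˡ (sym xP)) ⟩
            s' * x (c⃗ P) + t' ∎)
          equal : ω ≃ μ → s ≈ s'
          equal e with Avoiding.x-onto (vertical-avoids ve e∈ω) 0# | Avoiding.x-onto (vertical-avoids ve e∈ω) 1#
          ... | P₀ , P₀∈ , x₀ | P₁ , P₁∈ , x₁ = begin
            s  ≈⟨ solve 2 (λ s t → s ⊜ (s :* :1 :+ t) :- (s :* :0 :+ t)) s t ⟩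
            (s * 1# + t) - (s * 0# + t)  ≈⟨ +-cong (at-1 x₁ P₁∈) (-‿cong (at-1 x₀ P₀∈)) ⟩
            (s' * 1# + t') - (s' * 0# + t')  ≈⟨ solve 2 (λ s t → (s :* :1 :+ t) :- (s :* :0 :+ t) ⊜ s) s' t' ⟩
            s' ∎
            where
            at-1 : ∀ {P a} → x (c⃗ P) ≈ a → c⃗ P ∈ ω → s * a + t ≈ s' * a + t'
            at-1 xP P∈ = trans (+-congʳ (*-congˡ (sym xP))) (trans (sym (ω.y-on P∈))
              (trans (μ.y-on (≃-∈ e P∈)) (+-congʳ (*-congˡ xP))))

    opaque
      -- Since `σ₁` and `ω` share `P₀` and `e`, the direction `e` is an axis of `σ₁`, and `ω`
      -- belongs to the ruling it induces. Every plane of that ruling is disjoint from `ω` or equal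
      -- to it, hence has the slope `s`.
      class-plane : ∀ {e ω σ₁ P₀ s t} (ve : Vertical e) → e ∈ ω → e ∈ σ₁ → ¬ σ₁ ≃ ω → c⃗ P₀ ∈ ω → c⃗ P₀ ∈ σ₁ → ¬ s ≈ 0# →
        (∀ {v} → v ∈ ω → y v ≈ s * x v + t * dot h v) → ∀ P → ∃ λ μ → e ∈ μ × c⃗ P ∈ μ ×
        (∀ {P'} → y (c⃗ P') - s * x (c⃗ P') ≈ y (c⃗ P) - s * x (c⃗ P) → c⃗ P' ∈ μ)
      class-plane {e} {ω} {σ₁} {P₀} {s} {t} ve e∈ω e∈σ σ≄ω P₀∈ω P₀∈σ s≉0 on-ω P
        with ruling-cover (mk-axis (vertical≉0 ve) (inf (h-e ve)) P₀∈σ P₀∈ω e∈σ e∈ω (σ≄ω ∘ ≃-sym)) P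
      ... | μ , μ≄σ , e∈μ , P∈μ , Q , Q∈μ , Q∈σ with line-of ve e∈μ
      ... | s' , t' , s'≉0 , on-μ = μ , e∈μ , P∈μ , λ {P'} same-u → μ.on-line (begin
          y (c⃗ P')  ≈⟨ solve 3 (λ y s x → y ⊜ s :* x :+ (y :- s :* x)) (y (c⃗ P')) s (x (c⃗ P')) ⟩
          s * x (c⃗ P') + (y (c⃗ P') - s * x (c⃗ P'))  ≈⟨ +-cong (*-congʳ s≈s') (trans same-u (trans (+-cong (μ.y-on P∈μ) (-‿cong (*-congʳ s≈s')))
            (solve 3 (λ s x t → (s :* x :+ t) :- s :* x ⊜ t) s' (x (c⃗ P)) t'))) ⟩
          s' * x (c⃗ P') + t' ∎)
        where
        module μ = Slope (vertical-avoids ve e∈μ) s'≉0 on-μ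
        par : Disj ω μ ⊎ ω ≃ μ
        par with P₀ ≟ᶠ Q
        ... | yes ≡.refl = inj₂ (second-unique (vertical≉0 ve) (inf (h-e ve)) P₀∈σ e∈σ (σ≄ω ∘ ≃-sym) μ≄σ P₀∈ω e∈ω Q∈μ e∈μ)
        ... | no P₀≢Q = inj₁ (ruling-disjoint (vertical≉0 ve) (inf (h-e ve)) e∈σ (σ≄ω ∘ ≃-sym) μ≄σ e∈ω e∈μ P₀∈ω P₀∈σ Q∈μ Q∈σ P₀≢Q)
        s≈s' : s ≈ s'
        s≈s' = parallel-slope ve e∈ω e∈μ s≉0 s'≉0 on-ω on-μ par

    opaque
      -- The weights `-1`, `1 - b`, `b` have sum 0; if the combination also cancels `x`, it is a
      -- multiple of the vertical `e`, which `f` kills.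
      affine-on : ∀ {e μ f} → Vertical e → e ∈ μ → Linear f → f e ≈ 0# → ∀ {P₁ P₂ P₃} → c⃗ P₁ ∈ μ → c⃗ P₂ ∈ μ → c⃗ P₃ ∈ μ →
        ∀ b → (- 1#) * x (c⃗ P₁) + (1# - b) * x (c⃗ P₂) + b * x (c⃗ P₃) ≈ 0# →
        f (c⃗ P₁) ≈ (1# - b) * f (c⃗ P₂) + b * f (c⃗ P₃)
      affine-on {e} {μ} {f} ve e∈ l fe {P₁} {P₂} {P₃} P₁∈ P₂∈ P₃∈ b balance with line-of ve e∈
      ... | s , t , s≉0 , on-μ = begin
        f (c⃗ P₁)  ≈⟨ solve 4 (λ a b m k → a ⊜ (:1 :- b) :* m :+ b :* k :- ((:- :1) :* a :+ (:1 :- b) :* m :+ b :* k)) _ b _ _ ⟩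
        (1# - b) * f (c⃗ P₂) + b * f (c⃗ P₃) - ((- 1#) * f (c⃗ P₁) + (1# - b) * f (c⃗ P₂) + b * f (c⃗ P₃))
          ≈⟨ +-congˡ (-‿cong (trans (sym (lin-triple l _ _ _ _ _ _)) fv≈0)) ⟩
        (1# - b) * f (c⃗ P₂) + b * f (c⃗ P₃) - 0#  ≈⟨ solve 1 (λ a → a :- :0 ⊜ a) _ ⟩
        (1# - b) * f (c⃗ P₂) + b * f (c⃗ P₃) ∎
        where
        v : V 5
        v = triple (- 1#) (c⃗ P₁) (1# - b) (c⃗ P₂) b (c⃗ P₃)
        v≈ : v ≈v (z v *v e)
        v≈ = Slope.vertical-multiple (vertical-avoids ve e∈) s≉0 on-μ ve e∈ (∈-triple _ _ _ P₁∈ P₂∈ P₃∈)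
          (trans (lin-triple h-lin (- 1#) (c⃗ P₁) (1# - b) (c⃗ P₂) b (c⃗ P₃)) (trans (+-cong (+-cong (*-congˡ (h-c⃗ P₁)) (*-congˡ (h-c⃗ P₂))) (*-congˡ (h-c⃗ P₃)))
            (solve 1 (λ b → (:- :1) :* :1 :+ (:1 :- b) :* :1 :+ b :* :1 ⊜ :0) b)))
          (trans (lin-triple x-lin _ _ _ _ _ _) balance)
        fv≈0 : f v ≈ 0#
        fv≈0 = trans (resp l v≈) (trans (lin-* l (z v) e) (trans (*-congˡ fe) (zeroʳ _)))

    -- The planes `ω` and `σ₁` through `P₀` share the vertical `e`, and their slopes give two
    -- families of parallel lines, `u` constant and `v` constant. The form `f`, which is `g`
    -- corrected to vanish at `e`, is affine along every line of both families, hence biaffine in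
    -- `u` and `v` on C.
    module Biaffine {e : V 5} {ω σ₁ : CPlane} {P₀ : I} {s t s' t' : Carrier} (ve : Vertical e) (e∈ω : e ∈ ω) (e∈σ : e ∈ σ₁)
      (σ≄ω : ¬ σ₁ ≃ ω) (P₀∈ω : c⃗ P₀ ∈ ω) (P₀∈σ : c⃗ P₀ ∈ σ₁) (s≉0 : ¬ s ≈ 0#) (s'≉0 : ¬ s' ≈ 0#)
      (on-ω : ∀ {v} → v ∈ ω → y v ≈ s * x v + t * dot h v)
      (on-σ : ∀ {v} → v ∈ σ₁ → y v ≈ s' * x v + t' * dot h v) where
      private
        module ω = Slope (vertical-avoids ve e∈ω) s≉0 on-ω
        module σ₁ = Slope (vertical-avoids ve e∈σ) s'≉0 on-σ

      opaque
        -- With equal slopes the two lines through the image of `P₀` would coincide, and with them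
        -- the planes.
        s'≉s : ¬ s' ≈ s
        s'≉s s'≈s with second 2≤q ω P₀
        ... | P , P≢P₀ , P∈ω = σ≄ω (join-unique P≢P₀ (σ₁.on-line P-on) P₀∈σ P∈ω P₀∈ω)
          where
          t≈t' : t ≈ t'
          t≈t' = begin
            t  ≈⟨ solve 3 (λ s x t → t ⊜ (s :* x :+ t) :- s :* x) s (x (c⃗ P₀)) t ⟩
            (s * x (c⃗ P₀) + t) - s * x (c⃗ P₀)  ≈⟨ +-cong (trans (sym (ω.y-on P₀∈ω)) (σ₁.y-on P₀∈σ)) (-‿cong (*-congʳ (sym s'≈s))) ⟩
            (s' * x (c⃗ P₀) + t') - s' * x (c⃗ P₀)  ≈⟨ solve 3 (λ s x t → (s :* x :+ t) :- s :* x ⊜ t) s' (x (c⃗ P₀)) t' ⟩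
            t' ∎
          P-on : y (c⃗ P) ≈ s' * x (c⃗ P) + t'
          P-on = trans (ω.y-on P∈ω) (+-cong (*-congʳ (sym s'≈s)) t≈t')

      D r : Carrier
      D = s' - s
      r = recip (-≉0 s'≉s)

      D*r : D * r ≈ 1#
      D*r = *-recip (-≉0 s'≉s)

      u v f : V 5 → Carrier
      u w = 1# * y w + (- s) * x w
      v w = 1# * y w + (- s') * x w
      f w = 1# * g w + (- g e) * z w

      opaque
        u-lin : Linear u
        u-lin = lin-combine 1# (- s) y-lin x-lin
      opaque
        v-lin : Linear v
        v-lin = lin-combine 1# (- s') y-lin x-lin
      opaque
        f-lin : Linear f
        f-lin = lin-combine 1# (- g e) g-lin z-lin

      opaque
        f-e : f e ≈ 0#
        f-e = trans (+-congˡ (*-congˡ (z-e ve))) (solve 1 (λ g → :1 :* g :+ (:- g) :* :1 ⊜ :0) (g e))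

      opaque
        x-uv : ∀ w → x w ≈ (u w - v w) * r
        x-uv w = begin
          x w  ≈⟨ trans (sym (*-identityˡ _)) (*-congʳ (sym D*r)) ⟩
          D * r * x w  ≈⟨ solve 5 (λ s s' r x y → (s' :- s) :* r :* x ⊜ ((:1 :* y :+ (:- s) :* x) :- (:1 :* y :+ (:- s') :* x)) :* r) s s' r (x w) (y w) ⟩
          (u w - v w) * r ∎

      opaque
        point : ∀ a b → ∃ λ P → u (c⃗ P) ≈ a × v (c⃗ P) ≈ b
        point a b with onto ((a - b) * r) (a + s * ((a - b) * r))
        ... | P , xP , yP = P , trans (+-cong (*-congˡ yP) (*-congˡ xP))
              (solve 3 (λ a s k → :1 :* (a :+ s :* k) :+ (:- s) :* k ⊜ a) a s ((a - b) * r)) ,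
            trans (+-cong (*-congˡ yP) (*-congˡ xP)) (trans
              (solve 5 (λ a b s s' r → :1 :* (a :+ s :* ((a :- b) :* r)) :+ (:- s') :* ((a :- b) :* r) ⊜ a :- (a :- b) :* ((s' :- s) :* r)) a b s s' r)
              (trans (+-congˡ (-‿cong (*-congˡ D*r))) (solve 2 (λ a b → a :- (a :- b) :* :1 ⊜ b) a b)))

      opaque
        u-line : ∀ {P₁ P₂ P₃ a b} → u (c⃗ P₁) ≈ a → u (c⃗ P₂) ≈ a → u (c⃗ P₃) ≈ a →
          v (c⃗ P₁) ≈ b → v (c⃗ P₂) ≈ 0# → v (c⃗ P₃) ≈ 1# → f (c⃗ P₁) ≈ (1# - b) * f (c⃗ P₂) + b * f (c⃗ P₃)
        u-line {P₁} {P₂} {P₃} {a} {b} u₁ u₂ u₃ v₁ v₂ v₃ with class-plane ve e∈ω e∈σ σ≄ω P₀∈ω P₀∈σ s≉0 on-ω P₁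
        ... | μ , e∈μ , P₁∈ , collect = affine-on ve e∈μ f-lin f-e P₁∈ (collect (level u₂)) (collect (level u₃)) b
            (trans (+-cong (+-cong (*-congˡ (coord u₁ v₁)) (*-congˡ (coord u₂ v₂))) (*-congˡ (coord u₃ v₃)))
              (solve 3 (λ a b r → (:- :1) :* ((a :- b) :* r) :+ (:1 :- b) :* ((a :- :0) :* r) :+ b :* ((a :- :1) :* r) ⊜ :0) a b r))
          where
          coord : ∀ {P a b} → u (c⃗ P) ≈ a → v (c⃗ P) ≈ b → x (c⃗ P) ≈ (a - b) * r
          coord {P} eu ev = trans (x-uv (c⃗ P)) (*-congʳ (+-cong eu (-‿cong ev)))
          plain : ∀ P → y (c⃗ P) - s * x (c⃗ P) ≈ u (c⃗ P)
          plain P = solve 3 (λ y s x → y :- s :* x ⊜ :1 :* y :+ (:- s) :* x) _ _ _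
          level : ∀ {P} → u (c⃗ P) ≈ a → y (c⃗ P) - s * x (c⃗ P) ≈ y (c⃗ P₁) - s * x (c⃗ P₁)
          level {P} e' = trans (plain P) (trans e' (trans (sym u₁) (sym (plain P₁))))

      opaque
        v-line : ∀ {P₁ P₂ P₃ a b} → v (c⃗ P₁) ≈ b → v (c⃗ P₂) ≈ b → v (c⃗ P₃) ≈ b →
          u (c⃗ P₁) ≈ a → u (c⃗ P₂) ≈ 0# → u (c⃗ P₃) ≈ 1# → f (c⃗ P₁) ≈ (1# - a) * f (c⃗ P₂) + a * f (c⃗ P₃)
        v-line {P₁} {P₂} {P₃} {a} {b} v₁ v₂ v₃ u₁ u₂ u₃
          with class-plane ve e∈σ e∈ω (σ≄ω ∘ ≃-sym) P₀∈σ P₀∈ω s'≉0 on-σ P₁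
        ... | μ , e∈μ , P₁∈ , collect = affine-on ve e∈μ f-lin f-e P₁∈ (collect (level v₂)) (collect (level v₃)) a
            (trans (+-cong (+-cong (*-congˡ (coord u₁ v₁)) (*-congˡ (coord u₂ v₂))) (*-congˡ (coord u₃ v₃)))
              (solve 3 (λ a b r → (:- :1) :* ((a :- b) :* r) :+ (:1 :- a) :* ((:0 :- b) :* r) :+ a :* ((:1 :- b) :* r) ⊜ :0) a b r))
          where
          coord : ∀ {P a b} → u (c⃗ P) ≈ a → v (c⃗ P) ≈ b → x (c⃗ P) ≈ (a - b) * r
          coord {P} eu ev = trans (x-uv (c⃗ P)) (*-congʳ (+-cong eu (-‿cong ev)))
          plain : ∀ P → y (c⃗ P) - s' * x (c⃗ P) ≈ v (c⃗ P)
          plain P = solve 3 (λ y s x → y :- s :* x ⊜ :1 :* y :+ (:- s) :* x) _ _ _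
          level : ∀ {P} → v (c⃗ P) ≈ b → y (c⃗ P) - s' * x (c⃗ P) ≈ y (c⃗ P₁) - s' * x (c⃗ P₁)
          level {P} e' = trans (plain P) (trans e' (trans (sym v₁) (sym (plain P₁))))

      c₀ c₁ c₂ c₃ : Carrier
      F₀₀ F₀₁ F₁₀ F₁₁ : Carrier
      F₀₀ = f (c⃗ (proj₁ (point 0# 0#)))
      F₀₁ = f (c⃗ (proj₁ (point 0# 1#)))
      F₁₀ = f (c⃗ (proj₁ (point 1# 0#)))
      F₁₁ = f (c⃗ (proj₁ (point 1# 1#)))
      c₀ = F₀₀
      c₁ = F₁₀ - F₀₀
      c₂ = F₀₁ - F₀₀
      c₃ = F₁₁ - F₁₀ - F₀₁ + F₀₀

      biaffine : ∀ P → f (c⃗ P) ≈ c₀ + c₁ * u (c⃗ P) + c₂ * v (c⃗ P) + c₃ * (u (c⃗ P) * v (c⃗ P))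
      biaffine P with point 0# 0# | point 0# 1# | point 1# 0# | point 1# 1# | point (u (c⃗ P)) 0# | point (u (c⃗ P)) 1#
      ... | Q₀₀ , u₀₀ , v₀₀ | Q₀₁ , u₀₁ , v₀₁ | Q₁₀ , u₁₀ , v₁₀ | Q₁₁ , u₁₁ , v₁₁ | R₀ , u₀ , v₀ | R₁ , u₁ , v₁ = begin
        f (c⃗ P)  ≈⟨ u-line refl u₀ u₁ refl v₀ v₁ ⟩
        (1# - b) * f (c⃗ R₀) + b * f (c⃗ R₁)
          ≈⟨ +-cong (*-congˡ (v-line v₀ v₀₀ v₁₀ u₀ u₀₀ u₁₀)) (*-congˡ (v-line v₁ v₀₁ v₁₁ u₁ u₀₁ u₁₁)) ⟩
        (1# - b) * ((1# - a) * f (c⃗ Q₀₀) + a * f (c⃗ Q₁₀)) + b * ((1# - a) * f (c⃗ Q₀₁) + a * f (c⃗ Q₁₁))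
          ≈⟨ solve 6 (λ a b f00 f01 f10 f11 → (:1 :- b) :* ((:1 :- a) :* f00 :+ a :* f10) :+ b :* ((:1 :- a) :* f01 :+ a :* f11) ⊜
               f00 :+ (f10 :- f00) :* a :+ (f01 :- f00) :* b :+ (f11 :- f10 :- f01 :+ f00) :* (a :* b)) a b _ _ _ _ ⟩
        _ ∎
        where
        a b : Carrier
        a = u (c⃗ P)
        b = v (c⃗ P)

      n : V 5 → Carrier
      n w = 1# * (1# * f w + (- c₀) * dot h w) + 1# * ((- c₁) * u w + (- c₂) * v w)

      opaque
        n-lin : Linear n
        n-lin = lin-combine 1# 1# (lin-combine 1# (- c₀) f-lin h-lin) (lin-combine (- c₁) (- c₂) u-lin v-lin)

      opaque
        n-C : ∀ P → n (c⃗ P) ≈ c₃ * (u (c⃗ P) * v (c⃗ P))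
        n-C P = trans (+-congʳ (*-congˡ (+-cong (*-congˡ (biaffine P)) (*-congˡ (h-c⃗ P)))))
          (solve 6 (λ c₀ c₁ c₂ c₃ u v → :1 :* (:1 :* (c₀ :+ c₁ :* u :+ c₂ :* v :+ c₃ :* (u :* v)) :+ (:- c₀) :* :1) :+
            :1 :* ((:- c₁) :* u :+ (:- c₂) :* v) ⊜ c₃ :* (u :* v)) c₀ c₁ c₂ c₃ _ _)

      opaque
        n-g : ∀ w → n w ≈ g w + (- g e * z w - c₀ * dot h w - c₁ * (y w - s * x w) - c₂ * (y w - s' * x w))
        n-g w = solve 11 (λ g γ z c₀ h c₁ y s x c₂ s' →
          :1 :* (:1 :* (:1 :* g :+ (:- γ) :* z) :+ (:- c₀) :* h) :+ :1 :* ((:- c₁) :* (:1 :* y :+ (:- s) :* x) :+ (:- c₂) :* (:1 :* y :+ (:- s') :* x)) ⊜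
          g :+ ((:- γ) :* z :- c₀ :* h :- c₁ :* (y :- s :* x) :- c₂ :* (y :- s' :* x))) (g w) (g e) (z w) c₀ (dot h w) c₁ (y w) s (x w) c₂ s'

      opaque
        -- Otherwise `n`, which is 1 at `d`, would vanish on C and put it into a solid.
        c₃≉0 : ¬ c₃ ≈ 0#
        c₃≉0 c₃≈0 = linear-not-in-solid {v = d} n-lin
          (λ nd≈0 → 1≉0 (trans (sym (trans (n-g d) (trans (+-cong g-d (+-cong (+-cong (+-cong (*-congˡ z-d) (-‿cong (*-congˡ hd)))
            (-‿cong (*-congˡ (+-cong y-d (-‿cong (*-congˡ x-d)))))) (-‿cong (*-congˡ (+-cong y-d (-‿cong (*-congˡ x-d)))))))
            (solve 6 (λ γ c₀ c₁ c₂ s s' → :1 :+ ((:- γ) :* :0 :- c₀ :* :0 :- c₁ :* (:0 :- s :* :0) :- c₂ :* (:0 :- s' :* :0)) ⊜ :1)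
              (g e) c₀ c₁ c₂ s s')))) nd≈0))
          (λ P → trans (n-C P) (trans (*-congʳ c₃≈0) (zeroˡ _)))

      k : Carrier
      k = recip c₃≉0

      -- On C the form `n / c₃` is `u v = y² - (s + s') x y + s s' x²`; adding `(s + s') z` removes
      -- the mixed term. This is the origin of `ε = s s'`.
      w : V 5 → Carrier
      w v = k * n v + (s + s') * z v

      opaque
        w-lin : Linear w
        w-lin = lin-combine k (s + s') n-lin z-lin

      opaque
        w-C : ∀ P → w (c⃗ P) ≈ y (c⃗ P) * y (c⃗ P) + s * s' * (x (c⃗ P) * x (c⃗ P))
        w-C P = begin
          k * n (c⃗ P) + (s + s') * z (c⃗ P)  ≈⟨ +-cong (*-congˡ (n-C P)) (*-congˡ (z≈xy P)) ⟩
          k * (c₃ * (u (c⃗ P) * v (c⃗ P))) + (s + s') * (x (c⃗ P) * y (c⃗ P))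
            ≈⟨ +-congʳ (trans (sym (*-assoc _ _ _)) (*-congʳ (recip-* c₃≉0))) ⟩
          1# * (u (c⃗ P) * v (c⃗ P)) + (s + s') * (x (c⃗ P) * y (c⃗ P))
            ≈⟨ solve 4 (λ x y s s' → :1 :* ((:1 :* y :+ (:- s) :* x) :* (:1 :* y :+ (:- s') :* x)) :+ (s :+ s') :* (x :* y) ⊜
                 y :* y :+ s :* s' :* (x :* x)) (x (c⃗ P)) (y (c⃗ P)) s s' ⟩
          y (c⃗ P) * y (c⃗ P) + s * s' * (x (c⃗ P) * x (c⃗ P)) ∎

      opaque
        w-injective : ∀ v → dot h v ≈ 0# → x v ≈ 0# → y v ≈ 0# → z v ≈ 0# → w v ≈ 0# → v ≈v zv
        w-injective v hv xv yv zv wv = joint-injective v hv xv yv zv (begin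
          g v  ≈⟨ solve 2 (λ g m → g ⊜ (g :+ m) :- m) (g v) rest ⟩
          (g v + rest) - rest  ≈⟨ +-cong (trans (sym (n-g v)) nv≈0) (-‿cong rest≈0) ⟩
          0# - 0#  ≈⟨ -‿inverseʳ 0# ⟩
          0# ∎)
          where
          rest : Carrier
          rest = - g e * z v - c₀ * dot h v - c₁ * (y v - s * x v) - c₂ * (y v - s' * x v)
          rest≈0 : rest ≈ 0#
          rest≈0 = trans (+-cong (+-cong (+-cong (*-congˡ zv) (-‿cong (*-congˡ hv)))
            (-‿cong (*-congˡ (+-cong yv (-‿cong (*-congˡ xv)))))) (-‿cong (*-congˡ (+-cong yv (-‿cong (*-congˡ xv))))))
            (solve 6 (λ γ c₀ c₁ c₂ s s' → (:- γ) :* :0 :- c₀ :* :0 :- c₁ :* (:0 :- s :* :0) :- c₂ :* (:0 :- s' :* :0) ⊜ :0)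
              (g e) c₀ c₁ c₂ s s')
          nv≈0 : n v ≈ 0#
          nv≈0 = *-cancel-0 (recip≉0 c₃≉0) (trans (solve 3 (λ kn s z → kn ⊜ (kn :+ s :* z) :- s :* z) (k * n v) (s + s') (z v))
            (trans (+-cong wv (-‿cong (trans (*-congˡ zv) (zeroʳ _)))) (-‿inverseʳ 0#)))

      opaque
        w-surjective : ∀ κ a b m j → ∃ λ v → dot h v ≈ κ × x v ≈ a × y v ≈ b × z v ≈ m × w v ≈ j
        w-surjective κ a b m j with joint-surjective κ a b m (c₃ * (j - (s + s') * m) - (- g e * m - c₀ * κ - c₁ * (b - s * a) - c₂ * (b - s' * a)))
        ... | V , hV , xV , yV , zV , gV = V , hV , xV , yV , zV , (begin
          k * n V + (s + s') * z V  ≈⟨ +-cong (*-congˡ (trans (n-g V) (+-cong gV (+-cong (+-cong (+-cong (*-congˡ zV) (-‿cong (*-congˡ hV)))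
            (-‿cong (*-congˡ (+-cong yV (-‿cong (*-congˡ xV)))))) (-‿cong (*-congˡ (+-cong yV (-‿cong (*-congˡ xV))))))))) (*-congˡ zV) ⟩
          k * (c₃ * (j - (s + s') * m) - R + R) + (s + s') * m
            ≈⟨ solve 6 (λ k c₃ j S m R → k :* (c₃ :* (j :- S :* m) :- R :+ R) :+ S :* m ⊜ k :* c₃ :* (j :- S :* m) :+ S :* m) k c₃ j (s + s') m R ⟩
          k * c₃ * (j - (s + s') * m) + (s + s') * m  ≈⟨ +-congʳ (*-congʳ (recip-* c₃≉0)) ⟩
          1# * (j - (s + s') * m) + (s + s') * m  ≈⟨ solve 3 (λ j S m → :1 :* (j :- S :* m) :+ S :* m ⊜ j) j (s + s') m ⟩
          j ∎)
          where
          R : Carrier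
          R = - g e * m - c₀ * κ - c₁ * (b - s * a) - c₂ * (b - s' * a)

      ε : Carrier
      ε = s * s'

      opaque
        -- Compares the second differences of `z` and `w` along `μ`, which are `b (1 - b) s₁` and
        -- `b (1 - b) (s₁² + ε)`. The slopes of all C-planes through `e'` are thus roots of one
        -- quadratic with constant term `ε`.
        w-slope : ∀ {e' μ s₁ t₁} → Vertical e' → e' ∈ μ → ¬ s₁ ≈ 0# →
          (∀ {v} → v ∈ μ → y v ≈ s₁ * x v + t₁ * dot h v) → s₁ * w e' ≈ s₁ * s₁ + ε
        w-slope {e'} {μ} {s₁} {t₁} ve' e'∈ s₁≉0 on-μ with Slope.second-difference (vertical-avoids ve' e'∈) s₁≉0 on-μ
        ... | b , V , b≉0 , V∈ , hV , xV , yV , zV , differences = x∙y⁻¹≈ε⇒x≈y _ _ (*-cancel-0 b≉0 (begin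
          b * (1# - b) * (s₁ * w e' - (s₁ * s₁ + ε))
            ≈⟨ solve 4 (λ b s we ε → b :* (:1 :- b) :* (s :* we :- (s :* s :+ ε)) ⊜ b :* (:1 :- b) :* s :* we :- b :* (:1 :- b) :* (s :* s :+ ε))
                 b s₁ (w e') ε ⟩
          b * (1# - b) * s₁ * w e' - b * (1# - b) * (s₁ * s₁ + ε)
            ≈⟨ +-congʳ (trans (*-congʳ (sym zV)) (sym (trans (resp w-lin (μ.vertical-multiple ve' e'∈ V∈ hV xV)) (lin-* w-lin (z V) e')))) ⟩
          w V - b * (1# - b) * (s₁ * s₁ + ε)  ≈⟨ +-congʳ (differences w k' w-lin w-on) ⟩
          b * k' 1# + (- 1#) * k' b + (1# - b) * k' 0# - b * (1# - b) * (s₁ * s₁ + ε)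
            ≈⟨ solve 4 (λ b s t ε → b :* ((s :* :1 :+ t) :* (s :* :1 :+ t) :+ ε :* (:1 :* :1)) :+
                 (:- :1) :* ((s :* b :+ t) :* (s :* b :+ t) :+ ε :* (b :* b)) :+
                 (:1 :- b) :* ((s :* :0 :+ t) :* (s :* :0 :+ t) :+ ε :* (:0 :* :0)) :- b :* (:1 :- b) :* (s :* s :+ ε) ⊜ :0) b s₁ t₁ ε ⟩
          0# ∎))
          where
          module μ = Slope (vertical-avoids ve' e'∈) s₁≉0 on-μ
          k' : Carrier → Carrier
          k' a = (s₁ * a + t₁) * (s₁ * a + t₁) + ε * (a * a)
          w-on : ∀ {P a} → c⃗ P ∈ μ → x (c⃗ P) ≈ a → w (c⃗ P) ≈ k' a
          w-on {P} {a} P∈ e = trans (w-C P) (+-cong (*-cong y≈ y≈) (*-congˡ (*-cong e e)))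
            where
            y≈ : y (c⃗ P) ≈ s₁ * a + t₁
            y≈ = trans (μ.y-on P∈) (+-congʳ (*-congˡ e))

      -- A square root m of ε would make the direction of the plane over y = m x a fixed point of
      -- the pairing of C-planes with a common axis.
      ε-nonsquare : ∀ m → ¬ m * m ≈ ε
      ε-nonsquare m m²≈ε with onto 1# m
      ... | P , xP , yP = refute
        where
        m≉0 : ¬ m ≈ 0#
        m≉0 m≈0 = *-≉0 s≉0 s'≉0 (trans (sym m²≈ε) (trans (*-congʳ m≈0) (zeroˡ m)))
        O≢P : O ≢ P
        O≢P ≡.refl = 1≉0 (trans (sym xP) x-O)
        ω' : CPlane
        ω' = join O≢P
        d∉ω' : ¬ d ∈ ω'
        d∉ω' = avoids-d (join-l O≢P) (join-r O≢P) (λ e → 1≉0 (trans (sym xP) e)) (λ e → m≉0 (trans (sym yP) e))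
        through-O : ∀ {μ s₁ t₁} → c⃗ O ∈ μ → (∀ {v} → v ∈ μ → y v ≈ s₁ * x v + t₁ * dot h v) → t₁ ≈ 0#
        through-O {μ} {s₁} {t₁} O∈ on-μ = begin
          t₁  ≈⟨ solve 2 (λ s t → t ⊜ s :* :0 :+ t :* :1) s₁ t₁ ⟩
          s₁ * 0# + t₁ * 1#  ≈⟨ +-cong (*-congˡ x-O) (*-congˡ (h-c⃗ O)) ⟨
          s₁ * x (c⃗ O) + t₁ * dot h (c⃗ O)  ≈⟨ on-μ O∈ ⟨
          y (c⃗ O)  ≈⟨ y-O ⟩
          0# ∎
        refute : ⊥
        refute with Avoiding.line d∉ω' | exists-axis ω'
        ... | s₁ , t₁ , s₁≉0 , on-ω' | X , ax with Slope.vertical d∉ω' s₁≉0 on-ω' | all-lined ax (Aff-c⃗ O) (join-l O≢P)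
        ... | e₁ , ve₁ , e₁∈ω' | μ , μ≄ω' , O∈μ , X∈μ with Slope.axis-vertical d∉ω' s₁≉0 on-ω' ax ve₁ e₁∈ω'
        ... | κ , e₁≈κX = second-plane (line-of ve₁ e₁∈μ)
          where
          e₁∈μ : e₁ ∈ μ
          e₁∈μ = ∈-resp (≈v-sym e₁≈κX) (∈-* κ X∈μ)
          m≈s₁ : m ≈ s₁
          m≈s₁ = begin
            m  ≈⟨ yP ⟨
            y (c⃗ P)  ≈⟨ Slope.y-on d∉ω' s₁≉0 on-ω' (join-r O≢P) ⟩
            s₁ * x (c⃗ P) + t₁  ≈⟨ +-cong (*-congˡ xP) (through-O (join-l O≢P) on-ω') ⟩
            s₁ * 1# + 0#  ≈⟨ solve 1 (λ s → s :* :1 :+ :0 ⊜ s) s₁ ⟩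
            s₁ ∎
          second-plane : (∃₂ λ s t → ¬ s ≈ 0# × (∀ {v} → v ∈ μ → y v ≈ s * x v + t * dot h v)) → ⊥
          second-plane (s₂ , t₂ , s₂≉0 , on-μ) = μ≄ω' (join-unique O≢P O∈μ P∈μ (join-l O≢P) (join-r O≢P))
            where
            -- Both slopes are roots of `s² - w(e₁) s + ε`, and `s₁² = ε` makes `s₁` a double root.
            difference : s₁ * ((s₁ - s₂) * (s₁ - s₂)) ≈ 0#
            difference = begin
              s₁ * ((s₁ - s₂) * (s₁ - s₂))
                ≈⟨ solve 4 (λ a b w ε → a :* ((a :- b) :* (a :- b)) ⊜ b :* (a :* w :- (a :* a :+ ε)) :- a :* (b :* w :- (b :* b :+ ε)) :+ (a :- b) :* (a :* a :- ε))
                     s₁ s₂ (w e₁) ε ⟩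
              s₂ * (s₁ * w e₁ - (s₁ * s₁ + ε)) - s₁ * (s₂ * w e₁ - (s₂ * s₂ + ε)) + (s₁ - s₂) * (s₁ * s₁ - ε)
                ≈⟨ +-cong (+-cong (*-congˡ (vanishing (w-slope ve₁ e₁∈ω' s₁≉0 on-ω'))) (-‿cong (*-congˡ (vanishing (w-slope ve₁ e₁∈μ s₂≉0 on-μ)))))
                     (*-congˡ (vanishing (trans (*-cong (sym m≈s₁) (sym m≈s₁)) m²≈ε))) ⟩
              s₂ * 0# - s₁ * 0# + (s₁ - s₂) * 0#  ≈⟨ solve 2 (λ a b → b :* :0 :- a :* :0 :+ (a :- b) :* :0 ⊜ :0) s₁ s₂ ⟩
              0# ∎
              where
              vanishing : ∀ {a b} → a ≈ b → a - b ≈ 0#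
              vanishing e = trans (+-congʳ e) (-‿inverseʳ _)
            s₁≈s₂ : s₁ ≈ s₂
            s₁≈s₂ = x∙y⁻¹≈ε⇒x≈y s₁ s₂ ([ id , id ] (zero-product (s₁ - s₂) (s₁ - s₂) (*-cancel-0 s₁≉0 difference)))
            P∈μ : c⃗ P ∈ μ
            P∈μ = Slope.on-line (vertical-avoids ve₁ e₁∈μ) s₂≉0 on-μ (begin
              y (c⃗ P)  ≈⟨ yP ⟩
              m  ≈⟨ trans m≈s₁ s₁≈s₂ ⟩
              s₂  ≈⟨ solve 1 (λ s → s ⊜ s :* :1 :+ :0) s₂ ⟩
              s₂ * 1# + 0#  ≈⟨ +-cong (*-congˡ (sym xP)) (sym (through-O O∈μ on-μ)) ⟩
              s₂ * x (c⃗ P) + t₂ ∎)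

      normal-form : Canonical
      normal-form = record
        { x = x ; y = y ; z = z ; w = w ; x-lin = x-lin ; y-lin = y-lin ; z-lin = z-lin ; w-lin = w-lin
        ; joint-injective = w-injective ; joint-surjective = w-surjective ; ε = ε ; ε-nonsquare = ε-nonsquare
        ; z≈xy = z≈xy ; w≈y²+εx² = w-C ; onto = onto }

    opaque
      -- `O` and `E` have `(x, y)` equal to `(0, 0)` and `(1, 1)`, so their join avoids `d`. The
      -- axis of the join is its vertical direction, and the second plane through `O` in that
      -- direction is the partner that `Biaffine` takes.
      paraboloid⇒canonical : Canonical
      paraboloid⇒canonical = build
        where
        O≢E : O ≢ E
        O≢E e = 1≉0 (trans (sym x-E) (trans (reflexive (≡.cong (λ P → x (c⃗ P)) (≡.sym e))) x-O))
        ω : CPlane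
        ω = join O≢E
        d∉ω : ¬ d ∈ ω
        d∉ω = avoids-d (join-l O≢E) (join-r O≢E) (λ e → 1≉0 (trans (sym x-E) e)) (λ e → 1≉0 (trans (sym y-E) e))
        build : Canonical
        build with Avoiding.line d∉ω | exists-axis ω
        ... | s , t , s≉0 , on-ω | X , ax with Slope.vertical d∉ω s≉0 on-ω | all-lined ax (Aff-c⃗ O) (join-l O≢E)
        ... | e , ve , e∈ω | σ₁ , σ≄ω , O∈σ , X∈σ with Slope.axis-vertical d∉ω s≉0 on-ω ax ve e∈ω
        ... | κ , e≈κX with line-of ve (∈-resp {σ₁} (≈v-sym e≈κX) (∈-* κ X∈σ))
        ... | s' , t' , s'≉0 , on-σ = Biaffine.normal-form ve e∈ω (∈-resp (≈v-sym e≈κX) (∈-* κ X∈σ)) σ≄ω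
          (join-l O≢E) O∈σ s≉0 s'≉0 on-ω on-σ

  opaque
    canonical : Canonical
    canonical with fresh {1} (λ _ → fromℕ< (ℕ.<-trans (s≤s z≤n) (ℕ.<-trans 2≤q q<q*q))) (ℕ.<-trans 2≤q q<q*q)
    ... | j , i≢j with exists-axis (join (i≢j zero))
    ... | d , ax with all-lined ax (Aff-c⃗ j) (join-r (i≢j zero))
    ... | σ , σ≄π , j∈σ , d∈σ = paraboloid⇒canonical
      (exists-paraboloid (Axis.d≉0 ax) (Axis.hd ax) (join-r (i≢j zero)) j∈σ (Axis.d∈π ax) d∈σ σ≄π)

-- The right side is the Gram determinant of `u`, `v` and the unit vector `i` for the bilinear form
-- `m`, the left side the square of the determinant of these three vectors times the determinant of
-- `m`. Solver expressions let one formula serve all three `i`.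
gramᴱ : Fin 3 → (u v : Fin 3 → Expr) (m : Fin 3 → Fin 3 → Expr) → Expr × Expr
gramᴱ i u v m = minorᴱ i :* minorᴱ i :* detᴱ ⊜
  pairᴱ u u :* (pairᴱ v v :* m i i :- colᴱ v :* rowᴱ v i) :- pairᴱ u v :* (pairᴱ v u :* m i i :- colᴱ v :* rowᴱ u i) :+
    colᴱ u :* (pairᴱ v u :* rowᴱ v i :- pairᴱ v v :* rowᴱ u i)
  where
  z₀ z₁ z₂ : Fin 3
  z₀ = zero
  z₁ = suc zero
  z₂ = suc (suc zero)
  rowᴱ : (Fin 3 → Expr) → Fin 3 → Expr
  rowᴱ x i = m i z₀ :* x z₀ :+ m i z₁ :* x z₁ :+ m i z₂ :* x z₂
  pairᴱ : (x y : Fin 3 → Expr) → Expr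
  pairᴱ x y = x z₀ :* rowᴱ y z₀ :+ x z₁ :* rowᴱ y z₁ :+ x z₂ :* rowᴱ y z₂
  colᴱ : (Fin 3 → Expr) → Expr
  colᴱ x = x z₀ :* m z₀ i :+ x z₁ :* m z₁ i :+ x z₂ :* m z₂ i
  minorᴱ : Fin 3 → Expr
  minorᴱ zero = u z₁ :* v z₂ :- u z₂ :* v z₁
  minorᴱ (suc zero) = u z₂ :* v z₀ :- u z₀ :* v z₂
  minorᴱ (suc (suc zero)) = u z₀ :* v z₁ :- u z₁ :* v z₀
  detᴱ : Expr
  detᴱ = (m z₀ z₀ :* (m z₁ z₁ :* m z₂ z₂ :- m z₁ z₂ :* m z₂ z₁) :- m z₀ z₁ :* (m z₁ z₀ :* m z₂ z₂ :- m z₁ z₂ :* m z₂ z₀))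
    :+ m z₀ z₂ :* (m z₁ z₀ :* m z₂ z₁ :- m z₁ z₁ :* m z₂ z₀)

-- C as a conic over a quadratic extension.

record Extension {c ℓ κ μ} (F : CommutativeRing c ℓ) (K : CommutativeRing κ μ) : Set (c ⊔ ℓ ⊔ κ ⊔ μ) where
  private
    module F = CommutativeRing F
    module K = CommutativeRing K
  field
    ι : F.Carrier → K.Carrier
    ι-cong : ∀ {a b} → a F.≈ b → ι a K.≈ ι b
    ι-+ : ∀ a b → ι (a F.+ b) K.≈ (ι a K.+ ι b)
    ι-* : ∀ a b → ι (a F.* b) K.≈ (ι a K.* ι b)
    ι-0 : ι F.0# K.≈ K.0#
    ι-1 : ι F.1# K.≈ K.1#
    ι-≉0 : ∀ {a} → ¬ a F.≈ F.0# → ¬ ι a K.≈ K.0#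
    ω : K.Carrier
    basis-spans : ∀ Z → ∃₂ λ a b → Z K.≈ (ι a K.+ (ι b K.* ω))
    basis-indep : ∀ a b → (ι a K.+ (ι b K.* ω)) K.≈ K.0# → a F.≈ F.0# × b F.≈ F.0#

-- `(h, X, Y)` identifies `V 5` with `F × K × K` over `F`, and C with the set of all `(1, Z, Z²)`.
record ConicForm {c ℓ κ μ} (F : CommutativeRing c ℓ) (K : CommutativeRing κ μ) (ext : Extension F K)
  (h : LinAlg.V F 5) {n : Set} (c⃗ : n → LinAlg.V F 5) : Set (c ⊔ ℓ ⊔ κ ⊔ μ) where
  private
    module F = CommutativeRing F
    module K = CommutativeRing K
  open LinAlg F
  open Extension ext
  field
    X Y : V 5 → K.Carrier
    X-resp : ∀ {u v} → u ≈v v → X u K.≈ X v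
    Y-resp : ∀ {u v} → u ≈v v → Y u K.≈ Y v
    X-lin : ∀ a u b v → X (λ i → (a F.* u i) F.+ (b F.* v i)) K.≈ ((ι a K.* X u) K.+ (ι b K.* X v))
    Y-lin : ∀ a u b v → Y (λ i → (a F.* u i) F.+ (b F.* v i)) K.≈ ((ι a K.* Y u) K.+ (ι b K.* Y v))
    joint-injective : ∀ v → dot h v F.≈ F.0# → X v K.≈ K.0# → Y v K.≈ K.0# → v ≈v zv
    joint-surjective : ∀ a Z W → ∃ λ v → dot h v F.≈ a × X v K.≈ Z × Y v K.≈ W
    Y≈X² : ∀ P → Y (c⃗ P) K.≈ (X (c⃗ P) K.* X (c⃗ P))
    X-onto : ∀ Z → ∃ λ P → X (c⃗ P) K.≈ Z

record ConicModel {c ℓ} (S : Setup c ℓ) κ μ : Set (c ⊔ ℓ ⊔ Level.suc (κ ⊔ μ)) where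
  open Setup S
  field
    K : CommutativeRing κ μ
    isFieldK : LinAlg.IsField K
  open CommutativeRing K
  field
    cardK : LinAlg.HasCard K (q ℕ.* q)
    ext : Extension F K
    form : ConicForm F K ext h (CPlanes.c⃗ S)
    2≉0ᴷ : ¬ 1# + 1# ≈ 0#

-- C-planes, tangents and spread lines in coordinates over `K`.

module BruckBose {c ℓ κ μ} (S : Setup c ℓ) (model : ConicModel S κ μ) where
  open import Data.Unit.Polymorphic using (tt)
  open import Data.Vec.Functional using ([]; _∷_)
  open Setup S
  open ConicModel model
  open CommutativeRing F hiding (zero)
  open LinAlg F
  open CPlanes S
  open Config F q h hiding (Plane)
  open Hyp H
  open Derived H
  open Extension ext
  open ConicForm form

  module K = CommutativeRing K
  module LK = LinAlg K
  module KF = FieldLA K isFieldK cardK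
  open K using () renaming (Carrier to 𝕂; _≈_ to _≋_; _+_ to _⊞_; _*_ to _⊠_; -_ to ⊟_; _-_ to _⊖_; 0# to 𝟘; 1# to 𝟙)
  open RingSolver F
  module S = RingSolver K
  open Relation.Binary.Reasoning.Setoid setoid

  𝟚 : 𝕂
  𝟚 = 𝟙 ⊞ 𝟙

  -- v has coordinates (a, Z, W) ∈ F × K × K.
  record Coords (v : V 5) (a : Carrier) (Z W : 𝕂) : Set (ℓ ⊔ μ) where
    constructor coords
    field
      h≈ : dot h v ≈ a
      X≋ : X v ≋ Z
      Y≋ : Y v ≋ W
  open Coords public

  own : ∀ v → Coords v (dot h v) (X v) (Y v)
  own v = coords refl K.refl K.refl

  opaque
    coords-cong : ∀ {v a b Z Z' W W'} → Coords v a Z W → a ≈ b → Z ≋ Z' → W ≋ W' → Coords v b Z' W'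
    coords-cong (coords p r s) e e' e'' = coords (trans p e) (K.trans r e') (K.trans s e'')

  opaque
    coords-resp : ∀ {u v a Z W} → u ≈v v → Coords u a Z W → Coords v a Z W
    coords-resp e (coords p r s) = coords (trans (sym (h-≈ e)) p) (K.trans (K.sym (X-resp e)) r) (K.trans (K.sym (Y-resp e)) s)

  opaque
    coords-lin : ∀ {u v a b Z Z' W W'} r s → Coords u a Z W → Coords v b Z' W' →
      Coords (r *v u +v s *v v) (r * a + s * b) (ι r ⊠ Z ⊞ ι s ⊠ Z') (ι r ⊠ W ⊞ ι s ⊠ W')
    coords-lin {u} {v} r s (coords p e f) (coords p' e' f') = coords
      (trans (dot-lin h r u s v) (+-cong (*-congˡ p) (*-congˡ p')))
      (K.trans (X-lin r u s v) (K.+-cong (K.*-congˡ e) (K.*-congˡ e')))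
      (K.trans (Y-lin r u s v) (K.+-cong (K.*-congˡ f) (K.*-congˡ f')))

  opaque
    ι-neg : ∀ a → ι (- a) ≋ ⊟ ι a
    ι-neg a = KF.x∙y⁻¹≈ε⇒x≈y _ _ (K.trans (S.solve 2 (λ x y → x :- :- y ⊜ x :+ y) _ _)
      (K.trans (K.sym (ι-+ (- a) a)) (K.trans (ι-cong (-‿inverseˡ a)) ι-0)))

  opaque
    ι-injective : ∀ {a b} → ι a ≋ ι b → a ≈ b
    ι-injective {a} {b} e = decidable-stable (a ≟ b) λ a≉b → ι-≉0 (-≉0 a≉b)
      (K.trans (ι-+ a (- b)) (K.trans (K.+-cong e (ι-neg b)) (K.-‿inverseʳ _)))

  opaque
    coords-* : ∀ {u a Z W} r → Coords u a Z W → Coords (r *v u) (r * a) (ι r ⊠ Z) (ι r ⊠ W)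
    coords-* {u} {a} {Z} {W} r cu = coords-resp (λ i → solve 2 (λ r u → r :* u :+ :0 :* u ⊜ r :* u) r (u i))
      (coords-cong (coords-lin r 0# cu cu) (solve 2 (λ r u → r :* u :+ :0 :* u ⊜ r :* u) r a) (drop Z) (drop W))
      where
      drop : ∀ Z → ι r ⊠ Z ⊞ ι 0# ⊠ Z ≋ ι r ⊠ Z
      drop Z = K.trans (K.+-congˡ (K.*-congʳ ι-0)) (S.solve 2 (λ r u → r :* u :+ :0 :* u ⊜ r :* u) (ι r) Z)

  opaque
    coords-+ : ∀ {u v a b Z Z' W W'} → Coords u a Z W → Coords v b Z' W' → Coords (u +v v) (a + b) (Z ⊞ Z') (W ⊞ W')
    coords-+ {u} {v} cu cv = coords-resp (λ i → solve 2 (λ u v → :1 :* u :+ :1 :* v ⊜ u :+ v) (u i) (v i))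
      (coords-cong (coords-lin 1# 1# cu cv) (solve 2 (λ u v → :1 :* u :+ :1 :* v ⊜ u :+ v) _ _) (ones _ _) (ones _ _))
      where
      ones : ∀ Z Z' → ι 1# ⊠ Z ⊞ ι 1# ⊠ Z' ≋ Z ⊞ Z'
      ones Z Z' = K.+-cong (K.trans (K.*-congʳ ι-1) (K.*-identityˡ _)) (K.trans (K.*-congʳ ι-1) (K.*-identityˡ _))

  opaque
    coords-unique : ∀ {u v a Z W} → Coords u a Z W → Coords v a Z W → u ≈v v
    coords-unique {u} {v} {a} {Z} {W} (coords p e f) cv i = x∙y⁻¹≈ε⇒x≈y _ _ (trans
        (solve 2 (λ u v → u :- v ⊜ u :+ (:- :1) :* v) (u i) (v i))
        (joint-injective (u +v (- 1#) *v v) (h≈ diff) (X≋ diff) (Y≋ diff) i))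
      where
      cancel : ∀ Z → Z ⊞ ι (- 1#) ⊠ Z ≋ 𝟘
      cancel Z = K.trans (K.+-congˡ (K.*-congʳ (K.trans (ι-neg 1#) (K.-‿cong ι-1))))
        (S.solve 1 (λ Z → Z :+ (:- :1) :* Z ⊜ :0) Z)
      diff : Coords (u +v (- 1#) *v v) 0# 𝟘 𝟘
      diff = coords-cong (coords-+ (coords p e f) (coords-* (- 1#) cv)) (solve 1 (λ a → a :+ (:- :1) :* a ⊜ :0) a) (cancel Z) (cancel W)

  opaque
    coords-0 : ∀ {v} → Coords v 0# 𝟘 𝟘 → v ≈v zv
    coords-0 {v} (coords p e f) = joint-injective v p e f

  opaque
    coords-zv : Coords zv 0# 𝟘 𝟘
    coords-zv = coords-resp (λ i → zeroˡ _) (coords-cong (coords-* 0# (own zv)) (zeroˡ _)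
      (K.trans (K.*-congʳ ι-0) (K.zeroˡ _)) (K.trans (K.*-congʳ ι-0) (K.zeroˡ _)))

  vec : Carrier → 𝕂 → 𝕂 → V 5
  vec a Z W = proj₁ (joint-surjective a Z W)

  coords-vec : ∀ a Z W → Coords (vec a Z W) a Z W
  coords-vec a Z W = let p , e , f = proj₂ (joint-surjective a Z W) in coords p e f

  opaque
    coords-c⃗ : ∀ P → Coords (c⃗ P) 1# (X (c⃗ P)) (X (c⃗ P) ⊠ X (c⃗ P))
    coords-c⃗ P = coords (h-c⃗ P) K.refl (Y≈X² P)

  opaque
    X-injective : ∀ {P P'} → X (c⃗ P) ≋ X (c⃗ P') → P ≡ P'
    X-injective {P} {P'} e = c⃗-injective (coords-unique (coords-c⃗ P)
      (coords-cong (coords-c⃗ P') refl (K.sym e) (K.*-cong (K.sym e) (K.sym e))))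

  -- The C-plane over the line Z + F D of the (a, Z) ↦ (1, Z, Z²) parametrisation of C.
  module Over (Z D : 𝕂) (D≉0 : ¬ D ≋ 𝟘) where
    -- The coefficients of 1, `s`, `s²` in `(1, Z + s D, (Z + s D)²)`: the point over `Z`, the
    -- tangent direction there, and the point at infinity of the parabola.
    p₀ p₁ p₂ : V 5
    p₀ = vec 1# Z (Z ⊠ Z)
    p₁ = vec 0# D (𝟚 ⊠ Z ⊠ D)
    p₂ = vec 0# 𝟘 (D ⊠ D)

    X-of Y-of : (Fin 3 → Carrier) → 𝕂
    X-of x = ι (x zero) ⊠ Z ⊞ ι (x (suc zero)) ⊠ D
    Y-of x = ι (x zero) ⊠ (Z ⊠ Z) ⊞ ι (x (suc zero)) ⊠ (𝟚 ⊠ Z ⊠ D) ⊞ ι (x (suc (suc zero))) ⊠ (D ⊠ D)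

    opaque
      coords-combo : ∀ x → Coords (combo x (three p₀ p₁ p₂)) (x zero) (X-of x) (Y-of x)
      coords-combo x = coords-resp (λ i → solve 3 (λ a b c → a :+ b :+ c ⊜ a :+ (b :+ (c :+ :0))) _ _ _)
        (coords-cong (coords-+ (coords-lin (x zero) (x (suc zero)) (coords-vec _ _ _) (coords-vec _ _ _))
            (coords-* (x (suc (suc zero))) (coords-vec _ _ _)))
          (solve 3 (λ a b c → a :* :1 :+ b :* :0 :+ c :* :0 ⊜ a) _ _ _)
          (S.solve 2 (λ a b → a :+ b :* :0 ⊜ a) _ _) K.refl)

    opaque
      independent : Indep (three p₀ p₁ p₂)
      independent x rel = λ { zero → a≈0 ; (suc zero) → b≈0 ; (suc (suc zero)) → e≈0 }
        where
        z : Coords zv (x zero) (X-of x) (Y-of x)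
        z = coords-resp rel (coords-combo x)
        a≈0 : x zero ≈ 0#
        a≈0 = trans (sym (h≈ z)) (dot-0 h)
        ιa≋0 : ι (x zero) ≋ 𝟘
        ιa≋0 = K.trans (ι-cong a≈0) ι-0
        stable : ∀ {b} → ¬ ¬ ι b ≋ 𝟘 → b ≈ 0#
        stable {b} n = decidable-stable (b ≟ 0#) (λ b≉0 → n (ι-≉0 b≉0))
        b≈0 : x (suc zero) ≈ 0#
        b≈0 = stable λ ιb≉0 → KF.*-≉0 ιb≉0 D≉0 (K.trans (S.solve 2 (λ z b → b ⊜ :0 :* z :+ b) Z _)
          (K.trans (K.+-congʳ (K.*-congʳ (K.sym ιa≋0))) (K.trans (K.sym (X≋ z)) (X≋ coords-zv))))
        e≈0 : x (suc (suc zero)) ≈ 0#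
        e≈0 = stable λ ιe≉0 → KF.*-≉0 ιe≉0 (KF.*-≉0 D≉0 D≉0) (K.trans
          (S.solve 3 (λ z w e → e ⊜ :0 :* z :+ :0 :* w :+ e) (Z ⊠ Z) (𝟚 ⊠ Z ⊠ D) _)
          (K.trans (K.+-congʳ (K.+-cong (K.*-congʳ (K.sym ιa≋0)) (K.*-congʳ (K.sym (K.trans (ι-cong b≈0) ι-0)))))
            (K.trans (K.sym (Y≋ z)) (Y≋ coords-zv))))

    plane : Sub 5 3
    plane = record { basis = three p₀ p₁ p₂ ; indep = independent }

    opaque
      in-plane : ∀ {v} x → Coords v (x zero) (X-of x) (Y-of x) → v ≈v combo x (three p₀ p₁ p₂)
      in-plane x cv = coords-unique cv (coords-combo x)

    param : Carrier → Fin 3 → Carrier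
    param s zero = 1#
    param s (suc zero) = s
    param s (suc (suc zero)) = s * s

    opaque
      param-Y : ∀ s → Y-of (param s) ≋ (Z ⊞ ι s ⊠ D) ⊠ (Z ⊞ ι s ⊠ D)
      param-Y s = K.trans (K.+-cong (K.+-congʳ (K.*-congʳ ι-1)) (K.*-congʳ (ι-* s s)))
        (S.solve 3 (λ z d s → :1 :* (z :* z) :+ s :* ((:1 :+ :1) :* z :* d) :+ s :* s :* (d :* d) ⊜ (z :+ s :* d) :* (z :+ s :* d)) Z D (ι s))

    opaque
      param-X : ∀ s → X-of (param s) ≋ Z ⊞ ι s ⊠ D
      param-X s = K.+-congʳ (K.trans (K.*-congʳ ι-1) (K.*-identityˡ Z))

    opaque
      point : ∀ s → ∃ λ P → X (c⃗ P) ≋ Z ⊞ ι s ⊠ D × c⃗ P ≈v combo (param s) (three p₀ p₁ p₂)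
      point s with X-onto (Z ⊞ ι s ⊠ D)
      ... | P , e = P , e , in-plane (param s) (coords-cong (coords-c⃗ P) refl (K.trans e (K.sym (param-X s)))
        (K.trans (K.*-cong e e) (K.sym (param-Y s))))

    opaque
      point-injective : ∀ {s s'} → proj₁ (point s) ≡ proj₁ (point s') → s ≈ s'
      point-injective {s} {s'} e = ι-injective (KF.x∙y⁻¹≈ε⇒x≈y _ _ (KF.*-cancel-0 D≉0 (K.trans
        (S.solve 4 (λ z d s s' → d :* (s :- s') ⊜ (z :+ s :* d) :- (z :+ s' :* d)) Z D (ι s) (ι s'))
        (K.trans (K.+-congʳ (K.trans (K.sym (proj₁ (proj₂ (point s)))) (K.trans (K.reflexive (≡.cong (λ P → X (c⃗ P)) e))
          (proj₁ (proj₂ (point s')))))) (K.-‿inverseʳ _)))))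

    opaque
      -- By (A1) five of the points with parameter `s` in `F` suffice.
      CP-plane : CP plane
      CP-plane = A1-five plane ((λ i → proj₁ (point (elem (inj i)))) ,
        (λ i j e → inject≤-injective _ _ i j (elem-injective _ _ (point-injective e))) ,
        λ i → span-resp {w = three p₀ p₁ p₂} (≈v-sym (C≈ _)) (span-* {w = three p₀ p₁ p₂} _ (param (elem (inj i)) , proj₂ (proj₂ (point (elem (inj i)))))))
        where
        inj : Fin 5 → Fin q
        inj i = inject≤ i (ℕ.<⇒≤ (below-q (s≤s (s≤s (s≤s (s≤s (s≤s (s≤s z≤n))))))))

    cplane : CPlane
    cplane = plane , CP-plane

    opaque
      ∈-cplane : ∀ {v} x → Coords v (x zero) (X-of x) (Y-of x) → v ∈ cplane
      ∈-cplane x cv = spanned (x , in-plane x cv)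

    opaque
      cplane-∈ : ∀ {v} → v ∈ cplane → ∃ λ x → Coords v (x zero) (X-of x) (Y-of x)
      cplane-∈ (spanned (x , e)) = x , coords-resp (≈v-sym e) (coords-combo x)

    opaque
      ∈-shift : ∀ {P} s → X (c⃗ P) ≋ Z ⊞ ι s ⊠ D → c⃗ P ∈ cplane
      ∈-shift {P} s e = ∈-cplane (param s) (coords-cong (coords-c⃗ P) refl (K.trans e (K.sym (param-X s)))
        (K.trans (K.*-cong e e) (K.sym (param-Y s))))

  opaque
    -- Two points of C determine their C-plane, and the plane over the `F`-line through their
    -- parameters contains both.
    through : ∀ π {i} → c⃗ i ∈ π → ∃ λ D → Σ (¬ D ≋ 𝟘) λ D≉0 → π ≃ Over.cplane (X (c⃗ i)) D D≉0
    through π {i} i∈ with second 2≤q π i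
    ... | j , j≢i , j∈ = D , D≉0 , join-unique j≢i j∈ i∈
        (∈-shift 1# (K.trans (S.solve 2 (λ a b → b ⊜ a :+ :1 :* (b :- a)) (X (c⃗ i)) (X (c⃗ j))) (K.+-congˡ (K.*-congʳ (K.sym ι-1)))))
        (∈-shift 0# (K.trans (S.solve 2 (λ a b → a ⊜ a :+ :0 :* (b :- a)) (X (c⃗ i)) (X (c⃗ j))) (K.+-congˡ (K.*-congʳ (K.sym ι-0)))))
      where
      D : 𝕂
      D = X (c⃗ j) ⊖ X (c⃗ i)
      D≉0 : ¬ D ≋ 𝟘
      D≉0 = KF.-≉0 (j≢i ∘ X-injective)
      open Over (X (c⃗ i)) D D≉0

  -- A nondegenerate conic contains no three collinear points: the Gram matrix of a totally isotropic
  -- pair u, v and a unit vector has determinant zero, which is a squared minor of (u, v) times det M.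
  opaque
    collinear-conic : ∀ {π : Sub 5 3} {p} {S : Pt → Set p} → IsConicIn π S → ∀ A B T → S A → S B → S T →
      ∀ {a b} → ¬ a ≈ 0# → ¬ b ≈ 0# → proj₁ T ≈v (a *v proj₁ A +v b *v proj₁ B) → Indep₂ (proj₁ A) (proj₁ B) → ⊥
    collinear-conic {π} (M , (M-sym , det≉0) , onConic) A B T SA SB ST {a} {b} a≉0 b≉0 T≈ ind
      with proj₁ (onConic A) SA | proj₁ (onConic B) SB | proj₁ (onConic T) ST
    ... | u , A≈ , Qu | v , B≈ , Qv | t , T≈t , Qt = contradiction
      where
      z₀ z₁ z₂ : Fin 3
      z₀ = zero
      z₁ = suc zero
      z₂ = suc (suc zero)
      row : V 3 → Fin 3 → Carrier
      row x i = M i z₀ * x z₀ + M i z₁ * x z₁ + M i z₂ * x z₂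
      pair : V 3 → V 3 → Carrier
      pair x y = x z₀ * row y z₀ + x z₁ * row y z₁ + x z₂ * row y z₂
      col : V 3 → Fin 3 → Carrier
      col x i = x z₀ * M z₀ i + x z₁ * M z₁ i + x z₂ * M z₂ i
      minor : V 3 → V 3 → Fin 3 → Carrier
      minor x y zero = x z₁ * y z₂ - x z₂ * y z₁
      minor x y (suc zero) = x z₂ * y z₀ - x z₀ * y z₂
      minor x y (suc (suc zero)) = x z₀ * y z₁ - x z₁ * y z₀
      Q≈pair : ∀ x → Qform M x ≈ pair x x
      Q≈pair x = solve 12 (λ a b c m00 m01 m02 m10 m11 m12 m20 m21 m22 →
        (a :* m00 :* a :+ (a :* m01 :* b :+ (a :* m02 :* c :+ :0))) :+ ((b :* m10 :* a :+ (b :* m11 :* b :+ (b :* m12 :* c :+ :0))) :+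
          ((c :* m20 :* a :+ (c :* m21 :* b :+ (c :* m22 :* c :+ :0))) :+ :0)) ⊜
        a :* (m00 :* a :+ m01 :* b :+ m02 :* c) :+ b :* (m10 :* a :+ m11 :* b :+ m12 :* c) :+ c :* (m20 :* a :+ m21 :* b :+ m22 :* c))
        (x z₀) (x z₁) (x z₂) (M z₀ z₀) (M z₀ z₁) (M z₀ z₂) (M z₁ z₀) (M z₁ z₁) (M z₁ z₂) (M z₂ z₀) (M z₂ z₁) (M z₂ z₂)
      t≈ : ∀ j → t j ≈ a * u j + b * v j
      t≈ j = x∙y⁻¹≈ε⇒x≈y _ _ (trans (solve 2 (λ x y → x :- y ⊜ :1 :* x :+ (:- :1) :* y) (t j) _)
        (indep π (λ j → 1# * t j + (- 1#) * (a * u j + b * v j)) (λ i → begin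
          combo (λ j → 1# * t j + (- 1#) * (a * u j + b * v j)) (basis π) i  ≈⟨ combo-lin 1# t (- 1#) (λ j → a * u j + b * v j) (basis π) i ⟩
          1# * combo t (basis π) i + (- 1#) * combo (λ j → a * u j + b * v j) (basis π) i
            ≈⟨ +-cong (*-congˡ (sym (T≈t i))) (*-congˡ (trans (combo-lin a u b v (basis π) i) (sym (+-cong (*-congˡ (A≈ i)) (*-congˡ (B≈ i)))))) ⟩
          1# * proj₁ T i + (- 1#) * (a * proj₁ A i + b * proj₁ B i)  ≈⟨ +-congʳ (*-congˡ (T≈ i)) ⟩
          1# * (a * proj₁ A i + b * proj₁ B i) + (- 1#) * (a * proj₁ A i + b * proj₁ B i)
            ≈⟨ solve 1 (λ x → :1 :* x :+ (:- :1) :* x ⊜ :0) _ ⟩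
          0# ∎) j))
      row-cong : ∀ {x y : V 3} → (∀ j → x j ≈ y j) → ∀ i → row x i ≈ row y i
      row-cong e i = +-cong (+-cong (*-congˡ (e z₀)) (*-congˡ (e z₁))) (*-congˡ (e z₂))
      pair-sym : pair u v ≈ pair v u
      pair-sym = begin
        pair u v  ≈⟨ solve 15 (λ a b c x y z m00 m01 m02 m10 m11 m12 m20 m21 m22 →
            a :* (m00 :* x :+ m01 :* y :+ m02 :* z) :+ b :* (m10 :* x :+ m11 :* y :+ m12 :* z) :+ c :* (m20 :* x :+ m21 :* y :+ m22 :* z) ⊜
            x :* (m00 :* a :+ m10 :* b :+ m20 :* c) :+ y :* (m01 :* a :+ m11 :* b :+ m21 :* c) :+ z :* (m02 :* a :+ m12 :* b :+ m22 :* c))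
            (u z₀) (u z₁) (u z₂) (v z₀) (v z₁) (v z₂) (M z₀ z₀) (M z₀ z₁) (M z₀ z₂) (M z₁ z₀) (M z₁ z₁) (M z₁ z₂) (M z₂ z₀) (M z₂ z₁) (M z₂ z₂) ⟩
        _  ≈⟨ +-cong (+-cong (*-congˡ (flip z₀)) (*-congˡ (flip z₁))) (*-congˡ (flip z₂)) ⟩
        pair v u ∎
        where
        flip : ∀ i → M z₀ i * u z₀ + M z₁ i * u z₁ + M z₂ i * u z₂ ≈ row u i
        flip i = +-cong (+-cong (*-congʳ (M-sym z₀ i)) (*-congʳ (M-sym z₁ i))) (*-congʳ (M-sym z₂ i))
      -- Polarisation: the form vanishes at `u`, `v` and `a u + b v`, which leaves `2 a b` times the
      -- pairing of `u` and `v`.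
      uv≈0 : (1# + 1#) * pair u v ≈ 0#
      uv≈0 = *-cancel-0 (*-≉0 a≉0 b≉0) (begin
        a * b * ((1# + 1#) * pair u v)  ≈⟨ solve 3 (λ a b p → a :* b :* ((:1 :+ :1) :* p) ⊜ a :* b :* (p :+ p)) a b (pair u v) ⟩
        a * b * (pair u v + pair u v)  ≈⟨ *-congˡ (+-congˡ pair-sym) ⟩
        a * b * (pair u v + pair v u)
          ≈⟨ solve 17 (λ p q a b c x y z m00 m01 m02 m10 m11 m12 m20 m21 m22 →
            p :* q :* ((a :* (m00 :* x :+ m01 :* y :+ m02 :* z) :+ b :* (m10 :* x :+ m11 :* y :+ m12 :* z) :+ c :* (m20 :* x :+ m21 :* y :+ m22 :* z)) :+
                       (x :* (m00 :* a :+ m01 :* b :+ m02 :* c) :+ y :* (m10 :* a :+ m11 :* b :+ m12 :* c) :+ z :* (m20 :* a :+ m21 :* b :+ m22 :* c))) ⊜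
            ((p :* a :+ q :* x) :* (m00 :* (p :* a :+ q :* x) :+ m01 :* (p :* b :+ q :* y) :+ m02 :* (p :* c :+ q :* z)) :+
             (p :* b :+ q :* y) :* (m10 :* (p :* a :+ q :* x) :+ m11 :* (p :* b :+ q :* y) :+ m12 :* (p :* c :+ q :* z)) :+
             (p :* c :+ q :* z) :* (m20 :* (p :* a :+ q :* x) :+ m21 :* (p :* b :+ q :* y) :+ m22 :* (p :* c :+ q :* z)))
            :- p :* p :* (a :* (m00 :* a :+ m01 :* b :+ m02 :* c) :+ b :* (m10 :* a :+ m11 :* b :+ m12 :* c) :+ c :* (m20 :* a :+ m21 :* b :+ m22 :* c))
            :- q :* q :* (x :* (m00 :* x :+ m01 :* y :+ m02 :* z) :+ y :* (m10 :* x :+ m11 :* y :+ m12 :* z) :+ z :* (m20 :* x :+ m21 :* y :+ m22 :* z)))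
            a b (u z₀) (u z₁) (u z₂) (v z₀) (v z₁) (v z₂) (M z₀ z₀) (M z₀ z₁) (M z₀ z₂) (M z₁ z₀) (M z₁ z₁) (M z₁ z₂) (M z₂ z₀) (M z₂ z₁) (M z₂ z₂) ⟩
        pair (λ j → a * u j + b * v j) (λ j → a * u j + b * v j) - a * a * pair u u - b * b * pair v v
          ≈⟨ +-cong (+-cong (trans (sym (+-cong (+-cong (*-cong (t≈ z₀) (row-cong t≈ z₀)) (*-cong (t≈ z₁) (row-cong t≈ z₁)))
                 (*-cong (t≈ z₂) (row-cong t≈ z₂)))) (trans (sym (Q≈pair t)) Qt))
               (-‿cong (*-congˡ (trans (sym (Q≈pair u)) Qu)))) (-‿cong (*-congˡ (trans (sym (Q≈pair v)) Qv))) ⟩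
        0# - a * a * 0# - b * b * 0#  ≈⟨ solve 2 (λ a b → :0 :- a :* a :* :0 :- b :* b :* :0 ⊜ :0) a b ⟩
        0# ∎)
      uv₀ : pair u v ≈ 0#
      uv₀ = *-cancel-0 2≉0 uv≈0
      gram : ∀ i → minor u v i * minor u v i * det3 M ≈ 0#
      gram i = trans (gram-identity i) (trans
        (+-cong (+-cong (*-congʳ (trans (sym (Q≈pair u)) Qu)) (-‿cong (*-congʳ uv₀)))
          (*-congˡ (+-cong (*-congʳ (trans (sym pair-sym) uv₀)) (-‿cong (*-congʳ (trans (sym (Q≈pair v)) Qv))))))
        (solve 5 (λ a b c p q → :0 :* a :- :0 :* b :+ c :* (:0 :* p :- :0 :* q) ⊜ :0) _ _ _ _ _))
        where
        gram-identity : ∀ i → minor u v i * minor u v i * det3 M ≈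
          pair u u * (pair v v * M i i - col v i * row v i) - pair u v * (pair v u * M i i - col v i * row u i) +
            col u i * (pair v u * row v i - pair v v * row u i)
        gram-identity zero = solve 15 (λ a b c x y z m00 m01 m02 m10 m11 m12 m20 m21 m22 →
          gramᴱ zero (a ∷ b ∷ c ∷ []) (x ∷ y ∷ z ∷ []) ((m00 ∷ m01 ∷ m02 ∷ []) ∷ (m10 ∷ m11 ∷ m12 ∷ []) ∷ (m20 ∷ m21 ∷ m22 ∷ []) ∷ []))
          (u z₀) (u z₁) (u z₂) (v z₀) (v z₁) (v z₂) (M z₀ z₀) (M z₀ z₁) (M z₀ z₂) (M z₁ z₀) (M z₁ z₁) (M z₁ z₂) (M z₂ z₀) (M z₂ z₁) (M z₂ z₂)
        gram-identity (suc zero) = solve 15 (λ a b c x y z m00 m01 m02 m10 m11 m12 m20 m21 m22 →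
          gramᴱ (suc zero) (a ∷ b ∷ c ∷ []) (x ∷ y ∷ z ∷ []) ((m00 ∷ m01 ∷ m02 ∷ []) ∷ (m10 ∷ m11 ∷ m12 ∷ []) ∷ (m20 ∷ m21 ∷ m22 ∷ []) ∷ []))
          (u z₀) (u z₁) (u z₂) (v z₀) (v z₁) (v z₂) (M z₀ z₀) (M z₀ z₁) (M z₀ z₂) (M z₁ z₀) (M z₁ z₁) (M z₁ z₂) (M z₂ z₀) (M z₂ z₁) (M z₂ z₂)
        gram-identity (suc (suc zero)) = solve 15 (λ a b c x y z m00 m01 m02 m10 m11 m12 m20 m21 m22 →
          gramᴱ (suc (suc zero)) (a ∷ b ∷ c ∷ []) (x ∷ y ∷ z ∷ []) ((m00 ∷ m01 ∷ m02 ∷ []) ∷ (m10 ∷ m11 ∷ m12 ∷ []) ∷ (m20 ∷ m21 ∷ m22 ∷ []) ∷ []))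
          (u z₀) (u z₁) (u z₂) (v z₀) (v z₁) (v z₂) (M z₀ z₀) (M z₀ z₁) (M z₀ z₂) (M z₁ z₀) (M z₁ z₁) (M z₁ z₂) (M z₂ z₀) (M z₂ z₁) (M z₂ z₂)
      minor≈0 : ∀ i → minor u v i ≈ 0#
      minor≈0 i = decidable-stable (minor u v i ≟ 0#) λ n → det≉0 (*-cancel-0 (*-≉0 n n) (gram i))
      proportional : ∀ i j → u i * v j ≈ u j * v i
      proportional i j = x∙y⁻¹≈ε⇒x≈y _ _ (minors i j)
        where
        neg : ∀ {a b} → a - b ≈ 0# → b - a ≈ 0#
        neg {a} {b} e = trans (solve 2 (λ a b → b :- a ⊜ :- (a :- b)) a b) (trans (-‿cong e) -0#≈0#)
        minors : ∀ i j → u i * v j - u j * v i ≈ 0#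
        minors zero zero = -‿inverseʳ _
        minors (suc zero) (suc zero) = -‿inverseʳ _
        minors (suc (suc zero)) (suc (suc zero)) = -‿inverseʳ _
        minors (suc zero) (suc (suc zero)) = minor≈0 zero
        minors (suc (suc zero)) zero = minor≈0 (suc zero)
        minors zero (suc zero) = minor≈0 (suc (suc zero))
        minors (suc (suc zero)) (suc zero) = neg (minor≈0 zero)
        minors zero (suc (suc zero)) = neg (minor≈0 (suc zero))
        minors (suc zero) zero = neg (minor≈0 (suc (suc zero)))
      relation : ∀ α β → (∀ j → α * u j + β * v j ≈ 0#) → α ≈ 0# × β ≈ 0#
      relation α β e = ind α β λ i → trans (+-cong (*-congˡ (A≈ i)) (*-congˡ (B≈ i)))
        (trans (sym (combo-lin α u β v (basis π) i)) (sumF-0 3 (λ j → trans (*-congʳ (e j)) (zeroˡ (basis π j i)))))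
      u≈0 : ∀ i → u i ≈ 0#
      u≈0 i = proj₂ (relation (- v i) (u i) λ j → trans (+-congˡ (proportional i j))
        (solve 2 (λ v u → (:- v) :* u :+ u :* v ⊜ :0) (v i) (u j)))
      contradiction : ⊥
      contradiction = 1≉0 (proj₁ (relation 1# 0# λ j → trans (+-congʳ (*-congˡ (u≈0 j)))
        (solve 1 (λ v → :1 :* :0 :+ :0 :* v ⊜ :0) (v j))))

  scale≉0 : ∀ i → ¬ scale i ≈ 0#
  scale≉0 i = recip≉0 (h-C≉0 i)

  Point-c⃗ : I → Pt
  Point-c⃗ i = c⃗ i , affine≉0 (h-c⃗ i)

  same-refl : ∀ (P : Pt) → Same P P
  same-refl P = 1# , 1≉0 , λ i → sym (*-identityˡ _)

  same-c⃗ : ∀ i → Same (Point-c⃗ i) (C i)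
  same-c⃗ i = scale i , scale≉0 i , c⃗≈ i

  opaque
    same⇒multiple : ∀ (P : Pt) {i} → Same P (C i) → ∃ λ a → ¬ a ≈ 0# × proj₁ P ≈v (a *v c⃗ i)
    same⇒multiple P {i} (a , a≉0 , e) = a * dot h (proj₁ (C i)) , *-≉0 a≉0 (h-C≉0 i) ,
      λ t → trans (e t) (trans (*-congˡ (C≈ i t)) (sym (*-assoc _ _ _)))

  same-C-injective : ∀ {i j} → Same (C i) (C j) → i ≡ j
  same-C-injective {i} {j} = C-distinct i j

  opaque
    not-infinite : ∀ (P : Pt) {i} → InfP P → ¬ Same P (C i)
    not-infinite P {i} hP (a , a≉0 , e) = *-≉0 a≉0 (h-C≉0 i) (trans (sym (dot-* h a (proj₁ (C i)))) (trans (sym (h-≈ e)) hP))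

  opaque
    multiple≉0 : ∀ {r v} (T : Pt) → proj₁ T ≈v (r *v v) → ¬ r ≈ 0#
    multiple≉0 T e r≈0 = proj₂ T (λ i → trans (e i) (trans (*-congʳ r≈0) (zeroˡ _)))

  opaque
    ι-cancel : ∀ {r D} → ¬ D ≋ 𝟘 → ι r ⊠ D ≋ 𝟘 → r ≈ 0#
    ι-cancel {r} D≉0 e = decidable-stable (r ≟ 0#) λ r≉0 → KF.*-≉0 (ι-≉0 r≉0) D≉0 e

  module _ (Z D : 𝕂) (D≉0 : ¬ D ≋ 𝟘) where
    open Over Z D D≉0

    opaque
      infinite-coords : ∀ {v} → dot h v ≈ 0# → v ∈ cplane → ∃₂ λ r s → v ≈v (r *v p₁ +v s *v p₂) ×
        X v ≋ ι r ⊠ D × Y v ≋ ι r ⊠ (𝟚 ⊠ Z ⊠ D) ⊞ ι s ⊠ (D ⊠ D)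
      infinite-coords {v} hv v∈ with cplane-∈ v∈
      ... | x , cv = x (suc zero) , x (suc (suc zero)) ,
          coords-unique cv' (coords-cong (coords-lin (x (suc zero)) (x (suc (suc zero))) (coords-vec _ _ _) (coords-vec _ _ _))
            (solve 2 (λ r s → r :* :0 :+ s :* :0 ⊜ :0) _ _) (S.solve 2 (λ r s → r :+ s :* :0 ⊜ r) _ _) K.refl) , X≋ cv' , Y≋ cv'
        where
        ι0 : ι (x zero) ≋ 𝟘
        ι0 = K.trans (ι-cong (trans (sym (h≈ cv)) hv)) ι-0
        cv' : Coords v 0# (ι (x (suc zero)) ⊠ D) (ι (x (suc zero)) ⊠ (𝟚 ⊠ Z ⊠ D) ⊞ ι (x (suc (suc zero))) ⊠ (D ⊠ D))
        cv' = coords hv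
          (K.trans (X≋ cv) (K.trans (K.+-congʳ (K.*-congʳ ι0)) (S.solve 2 (λ z a → :0 :* z :+ a ⊜ a) _ _)))
          (K.trans (Y≋ cv) (K.trans (K.+-congʳ (K.+-congʳ (K.*-congʳ ι0))) (S.solve 3 (λ z a b → :0 :* z :+ a :+ b ⊜ a :+ b) _ _ _)))

    opaque
      -- The secant through the parameters `a` and `n - a` has direction `p₁ + n p₂`. With
      -- `n = s / r` it passes through `T`, which would be a third point of the conic on it.
      no-secant-point : ∀ {π : CPlane} (T : Pt) → π ≃ cplane → IsConicIn (proj₁ π) (ConicSet (proj₁ π) T) →
        ∀ {r s} → ¬ r ≈ 0# → ¬ proj₁ T ≈v (r *v p₁ +v s *v p₂)
      no-secant-point {π} T e conic {r} {s} r≉0 T≈ = pick (n ≟ 0#)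
        where
        r⁻ n : Carrier
        r⁻ = recip r≉0
        n = s * r⁻
        secant : ∀ a → ¬ n - a ≈ a → ⊥
        secant a n-a≉a with point a | point (n - a) | point-injective {n - a} {a}
        ... | A , _ , A≈ | B , _ , B≈ | inj = collinear-conic {proj₁ π} {S = ConicSet (proj₁ π) T} conic (Point-c⃗ A) (Point-c⃗ B) T
            (inj₁ (A , same-c⃗ A , on A≈)) (inj₁ (B , same-c⃗ B , on B≈)) (inj₂ (same-refl T))
            {a = - (r * k)} {b = r * k} (λ e → *-≉0 r≉0 k≉0 (trans (solve 1 (λ x → x ⊜ :- :- x) _) (trans (-‿cong e) -0#≈0#))) (*-≉0 r≉0 k≉0)
            T≈AB AB-indep
          where
          k : Carrier
          k = recip (-≉0 n-a≉a)
          k≉0 : ¬ k ≈ 0#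
          k≉0 = recip≉0 (-≉0 n-a≉a)
          k* : k * ((n - a) - a) ≈ 1#
          k* = recip-* (-≉0 n-a≉a)
          multiplier : ∀ l → c⃗ B ≈v (l *v c⃗ A) → l ≈ 1#
          multiplier l e = trans (solve 1 (λ l → l ⊜ l :* :1) l) (trans (*-congˡ (sym (h-c⃗ A))) (trans (sym (dot-* h l (c⃗ A))) (trans (sym (h-≈ e)) (h-c⃗ B))))
          AB-indep : Indep₂ (c⃗ A) (c⃗ B)
          AB-indep with proportional? (affine≉0 (h-c⃗ A)) (c⃗ B)
          ... | inj₁ (l , e') = ⊥-elim (n-a≉a (inj (≡.sym (c⃗-injective (λ i → sym (trans (e' i)
            (trans (*-congʳ (multiplier l e')) (*-identityˡ _))))))))
          ... | inj₂ ind = ind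
          on : ∀ {P a} → c⃗ P ≈v combo (param a) (three p₀ p₁ p₂) → C P ∈S proj₁ π
          on {P} {a} e' = c⃗∈⇒C∈ (≃-∈ (≃-sym e) (spanned (param a , e')))
          T≈AB : proj₁ T ≈v (- (r * k) *v c⃗ A +v (r * k) *v c⃗ B)
          T≈AB i = begin
            proj₁ T i  ≈⟨ T≈ i ⟩
            r * p₁ i + s * p₂ i
              ≈⟨ +-cong (*-congʳ (trans (sym (*-identityʳ r)) (*-congˡ (sym k*)))) (*-congʳ s≈) ⟩
            r * (k * ((n - a) - a)) * p₁ i + r * (k * ((n - a) - a)) * n * p₂ i
              ≈⟨ solve 7 (λ r k n a p₀ p₁ p₂ → r :* (k :* ((n :- a) :- a)) :* p₁ :+ r :* (k :* ((n :- a) :- a)) :* n :* p₂ ⊜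
                   (:- (r :* k)) :* (:1 :* p₀ :+ (a :* p₁ :+ (a :* a :* p₂ :+ :0))) :+
                     r :* k :* (:1 :* p₀ :+ ((n :- a) :* p₁ :+ ((n :- a) :* (n :- a) :* p₂ :+ :0)))) r k n a (p₀ i) (p₁ i) (p₂ i) ⟩
            - (r * k) * combo (param a) (three p₀ p₁ p₂) i + r * k * combo (param (n - a)) (three p₀ p₁ p₂) i
              ≈⟨ +-cong (*-congˡ (sym (A≈ i))) (*-congˡ (sym (B≈ i))) ⟩
            - (r * k) * c⃗ A i + r * k * c⃗ B i ∎
            where
            s≈ : s ≈ r * (k * ((n - a) - a)) * n
            s≈ = begin
              s  ≈⟨ trans (sym (*-identityʳ s)) (*-congˡ (sym (recip-* r≉0))) ⟩
              s * (r⁻ * r)  ≈⟨ solve 3 (λ s r⁻ r → s :* (r⁻ :* r) ⊜ r :* :1 :* (s :* r⁻)) s r⁻ r ⟩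
              r * 1# * n  ≈⟨ *-congʳ (*-congˡ (sym k*)) ⟩
              r * (k * ((n - a) - a)) * n ∎
        pick : Dec (n ≈ 0#) → ⊥
        pick (no n≉0) = secant 0# (λ e → n≉0 (trans (solve 1 (λ n → n ⊜ n :- :0) n) e))
        pick (yes n≈0) = secant 1# (λ e → 2≉0 (begin
          1# + 1#  ≈⟨ +-congˡ (sym e) ⟩
          1# + (n - 1#)  ≈⟨ solve 1 (λ n → :1 :+ (n :- :1) ⊜ n) n ⟩
          n  ≈⟨ n≈0 ⟩
          0# ∎))

    opaque
      infty-multiple : ∀ {π : CPlane} (T : Pt) → π ≃ cplane → InftyPointOf (proj₁ π) T → ∃ λ s → proj₁ T ≈v (s *v p₂)
      infty-multiple {π} T e (hT , T∈π , conic) with infinite-coords hT (≃-∈ e (spanned T∈π))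
      ... | r , s , T≈ , _ with r ≟ 0#
      ... | yes r≈0 = s , λ i → trans (T≈ i) (trans (+-congʳ (*-congʳ r≈0)) (solve 2 (λ a b → :0 :* a :+ b ⊜ b) (p₁ i) _))
      ... | no r≉0 = ⊥-elim (no-secant-point {π} T e conic r≉0 T≈)

    -- Twice the form `x₀ x₂ - x₁²`, to avoid halves; it vanishes at the coordinates `(1, s, s²)` of
    -- C and at `(0, 0, 1)`.
    matrix : M3
    matrix zero (suc (suc zero)) = 1#
    matrix (suc (suc zero)) zero = 1#
    matrix (suc zero) (suc zero) = - (1# + 1#)
    matrix _ _ = 0#

    opaque
      matrix-form : ∀ x → Qform matrix x ≈ (1# + 1#) * (x zero * x (suc (suc zero)) - x (suc zero) * x (suc zero))
      matrix-form x = solve 3 (λ a b c →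
        (a :* :0 :* a :+ (a :* :0 :* b :+ (a :* :1 :* c :+ :0))) :+ ((b :* :0 :* a :+ (b :* (:- (:1 :+ :1)) :* b :+ (b :* :0 :* c :+ :0))) :+
          ((c :* :1 :* a :+ (c :* :0 :* b :+ (c :* :0 :* c :+ :0))) :+ :0)) ⊜ (:1 :+ :1) :* (a :* c :- b :* b))
        (x zero) (x (suc zero)) (x (suc (suc zero)))

    opaque
      matrix-nondegenerate : NonDegenerate matrix
      matrix-nondegenerate = symmetric , λ d≈0 → 2≉0 (trans (solve 0 (:1 :+ :1 ⊜
          (:0 :* ((:- (:1 :+ :1)) :* :0 :- :0 :* :0) :- :0 :* (:0 :* :0 :- :0 :* :1)) :+ :1 :* (:0 :* :0 :- (:- (:1 :+ :1)) :* :1))) d≈0)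
        where
        symmetric : Symmetric matrix
        symmetric zero zero = refl
        symmetric zero (suc zero) = refl
        symmetric zero (suc (suc zero)) = refl
        symmetric (suc zero) zero = refl
        symmetric (suc zero) (suc zero) = refl
        symmetric (suc zero) (suc (suc zero)) = refl
        symmetric (suc (suc zero)) zero = refl
        symmetric (suc (suc zero)) (suc zero) = refl
        symmetric (suc (suc zero)) (suc (suc zero)) = refl

    opaque
      p₂-infinite : dot h p₂ ≈ 0#
      p₂-infinite = h≈ (coords-vec 0# 𝟘 (D ⊠ D))

    opaque
      param-of : ∀ {P} → c⃗ P ∈ cplane → ∃ λ s → c⃗ P ≈v combo (param s) (three p₀ p₁ p₂)
      param-of {P} P∈ with cplane-∈ P∈
      ... | x , cP with point (x (suc zero))
      ... | P' , X' , P'≈ = x (suc zero) , ≡.subst (λ P → c⃗ P ≈v combo (param (x (suc zero))) (three p₀ p₁ p₂))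
        (X-injective (K.trans X' (K.sym (K.trans (X≋ cP) (K.+-congʳ (K.trans (K.*-congʳ (K.trans (ι-cong (trans (sym (h≈ cP)) (h-c⃗ P))) ι-1))
          (K.*-identityˡ Z))))))) P'≈

    opaque
      multiple-p₂ : ∀ r → (r *v p₂) ≈v combo (0# ∷ 0# ∷ r ∷ []) (three p₀ p₁ p₂)
      multiple-p₂ r i = solve 4 (λ r a b c → r :* c ⊜ :0 :* a :+ (:0 :* b :+ (r :* c :+ :0))) r (p₀ i) (p₁ i) (p₂ i)

    opaque
      -- A zero of the form with nonzero first coordinate is proportional to some `(1, s, s²)`,
      -- hence on C; one with first coordinate 0 is a multiple of `p₂`.
      over-infty : ∀ (T : Pt) {r} → ¬ r ≈ 0# → proj₁ T ≈v (r *v p₂) → InftyPointOf plane T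
      over-infty T {r} r≉0 T≈ = trans (h-≈ T≈) (trans (dot-* h r p₂) (trans (*-congˡ p₂-infinite) (zeroʳ r))) ,
        ((0# ∷ 0# ∷ r ∷ []) , ≈v-trans T≈ (multiple-p₂ r)) , matrix , matrix-nondegenerate , λ P → to P , from P
        where
        to : ∀ P → ConicSet plane T P → OnConicIn plane matrix P
        to P (inj₁ (i , same-i , i∈)) with same⇒multiple P same-i | param-of {i} (C∈⇒c⃗∈ i∈)
        ... | a , _ , P≈ | s , i≈ = (λ j → a * param s j) ,
          (λ t → trans (P≈ t) (trans (*-congˡ (i≈ t)) (trans (sym (sumF-* 3 a (λ j → param s j * three p₀ p₁ p₂ j t)))
            (sumF-cong 3 (λ j → sym (*-assoc a (param s j) (three p₀ p₁ p₂ j t))))))) ,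
          trans (matrix-form (λ j → a * param s j)) (solve 2 (λ a s → (:1 :+ :1) :* (a :* :1 :* (a :* (s :* s)) :- a :* s :* (a :* s)) ⊜ :0) a s)
        to P (inj₂ (a , _ , P≈)) = (0# ∷ 0# ∷ a * r ∷ []) ,
          ≈v-trans (λ t → trans (P≈ t) (trans (*-congˡ (T≈ t)) (sym (*-assoc _ _ _)))) (multiple-p₂ (a * r)) ,
          trans (matrix-form (0# ∷ 0# ∷ a * r ∷ [])) (solve 1 (λ b → (:1 :+ :1) :* (:0 :* b :- :0 :* :0) ⊜ :0) (a * r))
        from : ∀ P → OnConicIn plane matrix P → ConicSet plane T P
        from P (x , P≈ , Qx) with x zero ≟ 0#
        ... | yes x₀≈0 = inj₂ (b * recip r≉0 , *-≉0 b≉0 (recip≉0 r≉0) , λ t → begin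
              proj₁ P t  ≈⟨ P≈b t ⟩
              b * p₂ t  ≈⟨ *-congʳ (trans (sym (*-identityʳ b)) (*-congˡ (sym (recip-* r≉0)))) ⟩
              b * (recip r≉0 * r) * p₂ t  ≈⟨ solve 4 (λ b k r p → b :* (k :* r) :* p ⊜ b :* k :* (r :* p)) b (recip r≉0) r (p₂ t) ⟩
              b * recip r≉0 * (r * p₂ t)  ≈⟨ *-congˡ (sym (T≈ t)) ⟩
              b * recip r≉0 * proj₁ T t ∎)
            where
            b : Carrier
            b = x (suc (suc zero))
            x₁≈0 : x (suc zero) ≈ 0#
            x₁≈0 = [ id , id ] (zero-product (x (suc zero)) (x (suc zero)) (begin
              x (suc zero) * x (suc zero)  ≈⟨ solve 2 (λ b c → b :* b ⊜ :0 :* c :- (:0 :* c :- b :* b)) (x (suc zero)) b ⟩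
              0# * b - (0# * b - x (suc zero) * x (suc zero))  ≈⟨ +-congˡ (-‿cong (trans (+-congʳ (*-congʳ (sym x₀≈0))) xx≈0)) ⟩
              0# * b - 0#  ≈⟨ solve 1 (λ b → :0 :* b :- :0 ⊜ :0) b ⟩
              0# ∎))
              where
              xx≈0 : x zero * b - x (suc zero) * x (suc zero) ≈ 0#
              xx≈0 = *-cancel-0 2≉0 (trans (sym (matrix-form x)) Qx)
            P≈b : proj₁ P ≈v (b *v p₂)
            P≈b t = trans (P≈ t) (trans (+-cong (*-congʳ x₀≈0) (+-congʳ (*-congʳ x₁≈0)))
              (solve 4 (λ b c d e → :0 :* c :+ (:0 :* d :+ (b :* e :+ :0)) ⊜ b :* e) b (p₀ t) (p₁ t) (p₂ t)))
            b≉0 : ¬ b ≈ 0#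
            b≉0 = multiple≉0 P P≈b
        ... | no x₀≉0 with point (x (suc zero) * recip x₀≉0)
        ... | i , _ , i≈ = inj₁ (i , (x zero * scale i , *-≉0 x₀≉0 (scale≉0 i) ,
              λ t → trans (P≈i t) (trans (*-congˡ (c⃗≈ i t)) (sym (*-assoc _ _ _)))) , c⃗∈⇒C∈ {i} {cplane} (spanned (param s , i≈)))
            where
            k s : Carrier
            k = recip x₀≉0
            s = x (suc zero) * k
            x₁≈ : x (suc zero) ≈ x zero * s
            x₁≈ = trans (trans (sym (*-identityʳ _)) (*-congˡ (sym (*-recip x₀≉0)))) (solve 3 (λ a b k → b :* (a :* k) ⊜ a :* (b :* k)) (x zero) _ k)
            x₂≈ : x (suc (suc zero)) ≈ x zero * (s * s)
            x₂≈ = x∙y⁻¹≈ε⇒x≈y _ _ (*-cancel-0 x₀≉0 (trans (solve 3 (λ a s c → a :* (c :- a :* (s :* s)) ⊜ a :* c :- a :* s :* (a :* s)) (x zero) s _)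
              (trans (+-congˡ (-‿cong (sym (*-cong x₁≈ x₁≈)))) (*-cancel-0 2≉0 (trans (sym (matrix-form x)) Qx)))))
            P≈i : proj₁ P ≈v (x zero *v c⃗ i)
            P≈i t = begin
              proj₁ P t  ≈⟨ P≈ t ⟩
              x zero * p₀ t + (x (suc zero) * p₁ t + (x (suc (suc zero)) * p₂ t + 0#))
                ≈⟨ +-congˡ (+-cong (*-congʳ x₁≈) (+-congʳ (*-congʳ x₂≈))) ⟩
              x zero * p₀ t + (x zero * s * p₁ t + (x zero * (s * s) * p₂ t + 0#))
                ≈⟨ solve 5 (λ a s p₀ p₁ p₂ → a :* p₀ :+ (a :* s :* p₁ :+ (a :* (s :* s) :* p₂ :+ :0)) ⊜
                     a :* (:1 :* p₀ :+ (s :* p₁ :+ (s :* s :* p₂ :+ :0)))) (x zero) s (p₀ t) (p₁ t) (p₂ t) ⟩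
              x zero * combo (param s) (three p₀ p₁ p₂) t  ≈⟨ *-congˡ (sym (i≈ t)) ⟩
              x zero * c⃗ i t ∎

  -- Homogeneous coordinates on the line at infinity: `(1, 2 Z)` is the tangent direction at the
  -- point with parameter `Z`, and `(0, 1)` belongs to `t∞`.
  α β : SIdx → 𝕂
  α (inj₁ i) = 𝟙
  α (inj₂ _) = 𝟘
  β (inj₁ i) = 𝟚 ⊠ X (c⃗ i)
  β (inj₂ _) = 𝟙

  -- The K-line of directions (0, κ α, κ β), an F-plane whose points form the spread line t s.
  Dir : SIdx → V 5 → Set (ℓ ⊔ κ ⊔ μ)
  Dir s v = dot h v ≈ 0# × ∃ λ r → X v ≋ r ⊠ α s × Y v ≋ r ⊠ β s

  opaque
    zero-point : ∀ (T : Pt) → ¬ Coords (proj₁ T) 0# 𝟘 𝟘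
    zero-point T cT = proj₂ T (coords-0 cT)

  opaque
    -- Write `T = r p₁ + s p₂`. If only `s` is nonzero, the line from `C i` to `T` contains the
    -- ∞-point; if both are nonzero, it contains the point of C with parameter `s / r`. There
    -- remains `s = 0`, the direction `(D, 2 Z D)` up to `F`.
    tangent⇒dir : ∀ i T → tA i T → Dir (inj₁ i) (proj₁ T)
    tangent⇒dir i T (π , cp , Ci∈π , hT , T∈π , X∞ , infty , only) with through (π , cp) {i} (C∈⇒c⃗∈ Ci∈π)
    ... | D , D≉0 , e with infinite-coords (X (c⃗ i)) D D≉0 hT (≃-∈ e (spanned T∈π))
                         | infty-multiple (X (c⃗ i)) D D≉0 {π , cp} X∞ e infty
    ... | r , s , T≈ , XT , YT | s' , X∞≈ with r ≟ 0# | s ≟ 0#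
    ... | _ | yes s≈0 = hT , X (proj₁ T) , K.sym (K.*-identityʳ _) , K.trans YT (K.trans (K.+-congˡ (K.*-congʳ (K.trans (ι-cong s≈0) ι-0)))
        (K.trans (S.solve 4 (λ r z d w → r :* ((:1 :+ :1) :* z :* d) :+ :0 :* w ⊜ r :* d :* ((:1 :+ :1) :* z)) (ι r) (X (c⃗ i)) D _)
          (K.*-congʳ (K.sym XT))))
    ... | yes r≈0 | no s≉0 = ⊥-elim (not-infinite X∞ {i} (proj₁ infty) (only X∞
        ((0# ∷ s' * recip s≉0 ∷ []) , λ t → begin
          proj₁ X∞ t  ≈⟨ X∞≈ t ⟩
          s' * p₂ t  ≈⟨ *-congʳ (trans (sym (*-identityʳ s')) (*-congˡ (sym (recip-* s≉0)))) ⟩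
          s' * (recip s≉0 * s) * p₂ t
            ≈⟨ solve 6 (λ s' k s p₁ p₂ c → s' :* (k :* s) :* p₂ ⊜ :0 :* c :+ (s' :* k :* (:0 :* p₁ :+ s :* p₂) :+ :0)) s' (recip s≉0) s (p₁ t) (p₂ t) (proj₁ (C i) t) ⟩
          0# * proj₁ (C i) t + (s' * recip s≉0 * (0# * p₁ t + s * p₂ t) + 0#)
            ≈⟨ +-congˡ (+-congʳ (*-congˡ (sym (trans (T≈ t) (+-congʳ (*-congʳ r≈0)))))) ⟩
          0# * proj₁ (C i) t + (s' * recip s≉0 * proj₁ T t + 0#) ∎)
        (inj₂ (same-refl X∞))))
        where open Over (X (c⃗ i)) D D≉0
    ... | no r≉0 | no s≉0 = ⊥-elim (impossible (point n) (point 0#) point-injective)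
        where
        open Over (X (c⃗ i)) D D≉0
        k n : Carrier
        k = recip r≉0
        n = s * k
        impossible : (∃ λ P → X (c⃗ P) ≋ X (c⃗ i) ⊞ ι n ⊠ D × c⃗ P ≈v combo (param n) (three p₀ p₁ p₂)) →
          (∃ λ P → X (c⃗ P) ≋ X (c⃗ i) ⊞ ι 0# ⊠ D × c⃗ P ≈v combo (param 0#) (three p₀ p₁ p₂)) →
          (∀ {s s'} → proj₁ (point s) ≡ proj₁ (point s') → s ≈ s') → ⊥
        impossible (j , Xj , j≈) (i' , Xi' , i≈) _ = *-≉0 s≉0 (recip≉0 r≉0) (ι-cancel D≉0 (KF.x∙y⁻¹≈ε⇒x≈y _ _ (K.trans
            (S.solve 2 (λ z d → d :- :0 ⊜ (z :+ d) :- z) (X (c⃗ i)) (ι n ⊠ D))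
            (K.trans (K.+-congʳ (K.trans (K.sym Xj) (K.reflexive (≡.cong (λ P → X (c⃗ P)) j≡i)))) (K.-‿inverseʳ _)))))
          where
          i'≡i : i' ≡ i
          i'≡i = X-injective (K.trans Xi' (K.trans (K.+-congˡ (K.*-congʳ ι-0)) (S.solve 2 (λ z d → z :+ :0 :* d ⊜ z) _ _)))
          ci≈p₀ : c⃗ i ≈v p₀
          ci≈p₀ t = trans (reflexive (≡.cong (λ P → c⃗ P t) (≡.sym i'≡i))) (trans (i≈ t)
            (solve 3 (λ a b c → :1 :* a :+ (:0 :* b :+ (:0 :* :0 :* c :+ :0)) ⊜ a) (p₀ t) (p₁ t) (p₂ t)))
          j-on : c⃗ j ≈v at (c⃗ i) (proj₁ T) (n * k)
          j-on t = begin
            c⃗ j t  ≈⟨ j≈ t ⟩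
            1# * p₀ t + (n * p₁ t + (n * n * p₂ t + 0#))
              ≈⟨ +-congˡ (+-congʳ (*-congʳ (trans (sym (*-identityʳ n)) (*-congˡ (sym (recip-* r≉0)))))) ⟩
            1# * p₀ t + (n * (k * r) * p₁ t + (n * n * p₂ t + 0#))
              ≈⟨ solve 7 (λ s k r p₀ p₁ p₂ n → :1 :* p₀ :+ (n :* (k :* r) :* p₁ :+ (n :* (s :* k) :* p₂ :+ :0)) ⊜ p₀ :+ n :* k :* (r :* p₁ :+ s :* p₂))
                   s k r (p₀ t) (p₁ t) (p₂ t) n ⟩
            p₀ t + n * k * (r * p₁ t + s * p₂ t)  ≈⟨ +-cong (sym (ci≈p₀ t)) (*-congˡ (sym (T≈ t))) ⟩
            at (c⃗ i) (proj₁ T) (n * k) t ∎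
          on-line : OnLine (C i) T (C j)
          on-line = (dot h (proj₁ (C j)) * scale i ∷ dot h (proj₁ (C j)) * (n * k) ∷ []) , λ t → begin
            proj₁ (C j) t  ≈⟨ C≈ j t ⟩
            dot h (proj₁ (C j)) * c⃗ j t  ≈⟨ *-congˡ (trans (j-on t) (+-congʳ (c⃗≈ i t))) ⟩
            dot h (proj₁ (C j)) * (scale i * proj₁ (C i) t + n * k * proj₁ T t)
              ≈⟨ solve 5 (λ h s a m b → h :* (s :* a :+ m :* b) ⊜ h :* s :* a :+ (h :* m :* b :+ :0)) _ _ _ _ _ ⟩
            _ ∎
          j≡i : j ≡ i
          j≡i = same-C-injective (only (C j) on-line (inj₁ (j , same-refl (C j) ,
            c⃗∈⇒C∈ {j} {π , cp} (≃-∈ (≃-sym e) (spanned (param n , j≈))))))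

  opaque
    -- The plane is the one over `Z + F D` with `D = X T`. If `a c⃗ i + b T` is proportional to a
    -- point of C, comparing `X` and `Y` gives `(b D)² = 0`; if it is proportional to the ∞-point,
    -- its coordinate `b D` vanishes.
    dir⇒tangent : ∀ i T → Dir (inj₁ i) (proj₁ T) → tA i T
    dir⇒tangent i T (hT , D , XT , YT) = plane , CP-plane , c⃗∈⇒C∈ {i} {cplane} Ci∈ , hT , span T∈ ,
        X∞ , over-infty (X (c⃗ i)) D D≉0 X∞ 1≉0 (λ t → sym (*-identityˡ _)) , only
      where
      D≉0 : ¬ D ≋ 𝟘
      D≉0 D≈0 = zero-point T (coords hT (K.trans XT (K.trans (K.*-congʳ D≈0) (K.zeroˡ _))) (K.trans YT (K.trans (K.*-congʳ D≈0) (K.zeroˡ _))))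
      open Over (X (c⃗ i)) D D≉0
      Z : 𝕂
      Z = X (c⃗ i)
      Ci∈ : c⃗ i ∈ cplane
      Ci∈ = ∈-shift 0# (K.trans (S.solve 2 (λ a b → a ⊜ a :+ :0 :* b) Z D) (K.+-congˡ (K.*-congʳ (K.sym ι-0))))
      T∈ : proj₁ T ∈ cplane
      T∈ = ∈-cplane (0# ∷ 1# ∷ 0# ∷ []) (coords hT
        (K.trans XT (K.trans (S.solve 2 (λ z d → d :* :1 ⊜ :0 :* z :+ :1 :* d) Z D) (K.sym (K.+-cong (K.*-congʳ ι-0) (K.*-congʳ ι-1)))))
        (K.trans YT (K.trans (S.solve 2 (λ z d → d :* ((:1 :+ :1) :* z) ⊜ :0 :* (z :* z) :+ :1 :* ((:1 :+ :1) :* z :* d) :+ :0 :* (d :* d)) Z D)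
          (K.sym (K.+-cong (K.+-cong (K.*-congʳ ι-0) (K.*-congʳ ι-1)) (K.*-congʳ ι-0))))))
      X∞ : Pt
      X∞ = p₂ , λ p₂≈0 → KF.*-≉0 D≉0 D≉0 (K.trans (K.sym (Y≋ (coords-vec 0# 𝟘 (D ⊠ D)))) (K.trans (Y-resp p₂≈0) (Y≋ coords-zv)))
      only : ∀ P → OnLine (C i) T P → ConicSet plane X∞ P → Same P (C i)
      only P (cs , P≈) conic = finish conic
        where
        a b : Carrier
        a = cs zero * dot h (proj₁ (C i))
        b = cs (suc zero)
        P≈' : proj₁ P ≈v (a *v c⃗ i +v b *v proj₁ T)
        P≈' t = trans (P≈ t) (+-cong (trans (*-congˡ (C≈ i t)) (sym (*-assoc _ _ _))) (+-identityʳ _))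
        cP : Coords (proj₁ P) a (ι a ⊠ Z ⊞ ι b ⊠ D) (ι a ⊠ (Z ⊠ Z) ⊞ ι b ⊠ (𝟚 ⊠ Z ⊠ D))
        cP = coords-resp (≈v-sym P≈') (coords-cong (coords-lin a b (coords-c⃗ i) (coords hT XT YT))
          (solve 2 (λ a b → a :* :1 :+ b :* :0 ⊜ a) a b) (K.+-congˡ (K.*-congˡ (K.*-identityʳ D)))
          (K.+-congˡ (K.*-congˡ (S.solve 2 (λ z d → d :* ((:1 :+ :1) :* z) ⊜ (:1 :+ :1) :* z :* d) Z D))))
        back : b ≈ 0# → Same P (C i)
        back b≈0 = cs zero , (λ e → proj₂ P (λ t → trans (P≈ t) (trans (+-cong (*-congʳ e) (+-congʳ (*-congʳ b≈0)))
            (solve 2 (λ x y → :0 :* x :+ (:0 :* y :+ :0) ⊜ :0) _ _)))) ,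
          λ t → trans (P≈ t) (trans (+-congˡ (+-congʳ (*-congʳ b≈0))) (solve 3 (λ a x y → a :* x :+ (:0 :* y :+ :0) ⊜ a :* x) _ _ _))
        finish : ConicSet plane X∞ P → Same P (C i)
        finish (inj₁ (j , same-j , _)) with same⇒multiple P same-j
        ... | r , r≉0 , Pj = back (decidable-stable (b ≟ 0#) λ b≉0 → KF.*-≉0 (KF.*-≉0 (ι-≉0 b≉0) D≉0) (KF.*-≉0 (ι-≉0 b≉0) D≉0) squared)
          where
          cPj : Coords (proj₁ P) r (ι r ⊠ X (c⃗ j)) (ι r ⊠ (X (c⃗ j) ⊠ X (c⃗ j)))
          cPj = coords-resp (≈v-sym Pj) (coords-cong (coords-* r (coords-c⃗ j)) (*-identityʳ r) K.refl K.refl)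
          ιr : ι r ≋ ι a
          ιr = ι-cong (trans (sym (h≈ cPj)) (h≈ cP))
          squared : (ι b ⊠ D) ⊠ (ι b ⊠ D) ≋ 𝟘
          squared = K.trans (S.solve 4 (λ a z b d → (b :* d) :* (b :* d) ⊜
              (a :* z :+ b :* d) :* (a :* z :+ b :* d) :- a :* (a :* (z :* z) :+ b :* ((:1 :+ :1) :* z :* d))) (ι a) Z (ι b) D)
            (K.trans (K.+-cong (K.*-cong eX eX) (K.-‿cong (K.*-cong (K.sym ιr) (K.trans (K.sym (Y≋ cP)) (Y≋ cPj)))))
              (S.solve 2 (λ r x → (r :* x) :* (r :* x) :- r :* (r :* (x :* x)) ⊜ :0) (ι r) (X (c⃗ j))))
            where
            eX : ι a ⊠ Z ⊞ ι b ⊠ D ≋ ι r ⊠ X (c⃗ j)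
            eX = K.trans (K.sym (X≋ cP)) (X≋ cPj)
        finish (inj₂ (r , r≉0 , Pp₂)) = back (ι-cancel D≉0 (K.trans (S.solve 2 (λ z b → b ⊜ :0 :* z :+ b) Z _)
            (K.trans (K.+-congʳ (K.*-congʳ (K.sym (K.trans (ι-cong a≈0) ι-0)))) (K.trans (K.sym (X≋ cP)) (K.trans (X≋ c2) (K.zeroʳ _))))))
          where
          c2 : Coords (proj₁ P) (r * 0#) (ι r ⊠ 𝟘) (ι r ⊠ (D ⊠ D))
          c2 = coords-resp (≈v-sym Pp₂) (coords-* r (coords-vec 0# 𝟘 (D ⊠ D)))
          a≈0 : a ≈ 0#
          a≈0 = trans (sym (h≈ cP)) (trans (h≈ c2) (zeroʳ r))

  opaque
    -- The ∞-point of the plane over `Z + F D` is `(0, 0, D²)`. A point with `X T = D` nonzero is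
    -- not a 0-point: it is the direction `p₁` of the plane with `Z = Y T / (2 D)`.
    infinite⇒dir : ∀ s T → t∞ T → Dir (inj₂ s) (proj₁ T)
    infinite⇒dir s T (inj₁ (π , cp , infty)) with through (π , cp) {pts (π , cp) (fromℕ< 2≤q)} (pts∈ (π , cp) _)
    ... | D , D≉0 , e with infty-multiple _ D D≉0 {π , cp} T e infty
    ... | r , T≈ = proj₁ infty , Y (proj₁ T) , K.trans (X≋ (coords-resp (≈v-sym T≈) (coords-* r (coords-vec 0# 𝟘 (D ⊠ D)))))
        (K.trans (K.zeroʳ _) (K.sym (K.zeroʳ _))) , K.sym (K.*-identityʳ _)
    infinite⇒dir s T (inj₂ (hT , off)) with X (proj₁ T) KF.≟ 𝟘
    ... | yes XT≈0 = hT , Y (proj₁ T) , K.trans XT≈0 (K.sym (K.zeroʳ _)) , K.sym (K.*-identityʳ _)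
    ... | no D≉0 = ⊥-elim (off plane CP-plane (span (∈-cplane (0# ∷ 1# ∷ 0# ∷ []) (coords hT
        (K.trans (S.solve 2 (λ z d → d ⊜ :0 :* z :+ :1 :* d) Z D) (K.sym (K.+-cong (K.*-congʳ ι-0) (K.*-congʳ ι-1))))
        (K.trans YT (K.trans (S.solve 2 (λ z d → (:1 :+ :1) :* z :* d ⊜ :0 :* (z :* z) :+ :1 :* ((:1 :+ :1) :* z :* d) :+ :0 :* (d :* d)) Z D)
          (K.sym (K.+-cong (K.+-cong (K.*-congʳ ι-0) (K.*-congʳ ι-1)) (K.*-congʳ ι-0)))))))))
      where
      D k Z : 𝕂
      D = X (proj₁ T)
      k = KF.recip (KF.*-≉0 2≉0ᴷ D≉0)
      Z = Y (proj₁ T) ⊠ k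
      open Over Z D D≉0
      YT : Y (proj₁ T) ≋ 𝟚 ⊠ Z ⊠ D
      YT = K.sym (K.trans (S.solve 3 (λ y k d → (:1 :+ :1) :* (y :* k) :* d ⊜ y :* (k :* ((:1 :+ :1) :* d))) (Y (proj₁ T)) k D)
        (K.trans (K.*-congˡ (KF.recip-* (KF.*-≉0 2≉0ᴷ D≉0))) (K.*-identityʳ _)))

  opaque
    -- For `T = (0, 0, W)` the two kinds of points are told apart by whether `W` is an `F`-multiple
    -- of some `D²` with `D` nonzero, which a finite search decides.
    dir⇒infinite : ∀ s T → Dir (inj₂ s) (proj₁ T) → t∞ T
    dir⇒infinite s T (hT , W , XT , YT) with KF.anyF? {P = λ D → ¬ D ≋ 𝟘 × ∃ λ r → W ≋ ι r ⊠ (D ⊠ D)}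
      (λ e (D≉0 , r , p) → (λ z → D≉0 (K.trans e z)) , r , K.trans p (K.*-congˡ (K.*-cong e e)))
      (λ D → ¬? (D KF.≟ 𝟘) ×-dec anyF? (λ e p → K.trans p (K.*-congʳ (ι-cong e))) (λ r → W KF.≟ (ι r ⊠ (D ⊠ D))))
    ... | yes (D , D≉0 , r , W≈) = inj₁ (plane , CP-plane , over-infty 𝟘 D D≉0 T (multiple≉0 T T≈) T≈)
      where
      open Over 𝟘 D D≉0
      T≈ : proj₁ T ≈v (r *v p₂)
      T≈ = coords-unique (coords hT (K.trans XT (K.zeroʳ _)) (K.trans YT (K.*-identityʳ _)))
        (coords-cong (coords-* r (coords-vec 0# 𝟘 (D ⊠ D))) (zeroʳ r) (K.zeroʳ _) (K.sym W≈))
    ... | no none = inj₂ (hT , λ π cp T∈π → off (π , cp) (spanned T∈π))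
      where
      off : ∀ π → ¬ proj₁ T ∈ π
      off π T∈ with through π (pts∈ π (fromℕ< 2≤q))
      ... | D , D≉0 , e with infinite-coords _ D D≉0 hT (≃-∈ e T∈)
      ... | r , s , _ , XT' , YT' = none (D , D≉0 , s , K.trans (K.sym (K.*-identityʳ W)) (K.trans (K.sym YT) (K.trans YT'
          (K.trans (K.+-congʳ (K.*-congʳ (K.trans (ι-cong r≈0) ι-0))) (S.solve 2 (λ a b → :0 :* a :+ b ⊜ b) _ _)))))
        where
        r≈0 : r ≈ 0#
        r≈0 = ι-cancel D≉0 (K.trans (K.sym XT') (K.trans XT (K.zeroʳ W)))

  spread-line : ∀ s T → (tS s T → Dir s (proj₁ T)) × (Dir s (proj₁ T) → tS s T)
  spread-line (inj₁ i) T = tangent⇒dir i T , dir⇒tangent i T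
  spread-line (inj₂ s) T = infinite⇒dir s T , dir⇒infinite s T

  -- The isomorphism of the Bruck-Bose plane with PG(2, K).

  k₀ k₁ k₂ : Fin 3
  k₀ = zero
  k₁ = suc zero
  k₂ = suc (suc zero)

  αβ≉0 : ∀ s → ¬ (α s ≋ 𝟘 × β s ≋ 𝟘)
  αβ≉0 (inj₁ i) (e , _) = KF.1≉0 e
  αβ≉0 (inj₂ _) (_ , e) = KF.1≉0 e

  fP : PtBB → LK.Point 3
  fP (inj₁ (P , affine)) = (ι (dot h (proj₁ P)) ∷ X (proj₁ P) ∷ Y (proj₁ P) ∷ []) , λ e → ι-≉0 affine (e k₀)
  fP (inj₂ s) = (𝟘 ∷ α s ∷ β s ∷ []) , λ e → αβ≉0 s (e k₁ , e k₂)

  -- The determinant of `(X v, Y v)` against `(α s, β s)`.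
  cross : SIdx → V 5 → 𝕂
  cross s v = β s ⊠ X v ⊖ α s ⊠ Y v

  opaque
    cross⇒multiple : ∀ s v → cross s v ≋ 𝟘 → ∃ λ r → X v ≋ r ⊠ α s × Y v ≋ r ⊠ β s
    cross⇒multiple (inj₁ i) v e = X v , K.sym (K.*-identityʳ _) , K.sym (K.trans (K.*-comm _ _)
      (K.trans (KF.x∙y⁻¹≈ε⇒x≈y _ _ e) (K.*-identityˡ _)))
    cross⇒multiple (inj₂ _) v e = Y v , K.trans (K.trans (S.solve 2 (λ x y → x ⊜ :1 :* x :- :0 :* y) (X v) (Y v)) e) (K.sym (K.zeroʳ _)) ,
      K.sym (K.*-identityʳ _)

  opaque
    multiple⇒cross : ∀ s v → (∃ λ r → X v ≋ r ⊠ α s × Y v ≋ r ⊠ β s) → cross s v ≋ 𝟘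
    multiple⇒cross s v (r , eX , eY) = K.trans (K.+-cong (K.*-congˡ eX) (K.-‿cong (K.*-congˡ eY)))
      (S.solve 3 (λ r a b → b :* (r :* a) :- a :* (r :* b) ⊜ :0) r (α s) (β s))

  opaque
    spread-point : ∀ s → ∃ λ (T : Pt) → Coords (proj₁ T) 0# (α s) (β s)
    spread-point s = (vec 0# (α s) (β s) , λ e → αβ≉0 s (K.trans (K.sym (X≋ cv)) (K.trans (X-resp e) (X≋ coords-zv)) ,
        K.trans (K.sym (Y≋ cv)) (K.trans (Y-resp e) (Y≋ coords-zv)))) , cv
      where
      cv : Coords (vec 0# (α s) (β s)) 0# (α s) (β s)
      cv = coords-vec 0# (α s) (β s)

  opaque
    -- An affine line arrives as a plane with an arbitrary basis; the search fixes an affine point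
    -- on it, from which the constant term of its equation is computed.
    anchor : ∀ π → AffinePlane π → ∃ λ v → InSpan (basis π) v × dot h v ≈ 1#
    anchor π affine with anyV? {P = λ v → InSpan (basis π) v × dot h v ≈ 1#}
      (λ e (p , r) → span-resp {w = basis π} e p , trans (sym (h-≈ e)) r) (λ v → inSpan? (basis π) v ×-dec (dot h v ≟ 1#))
    ... | yes found = found
    ... | no none = ⊥-elim (affine λ P P∈ → decidable-stable (dot h (proj₁ P) ≟ 0#) λ hP≉0 →
      none (recip hP≉0 *v proj₁ P , span-* {w = basis π} (recip hP≉0) P∈ , trans (dot-* h (recip hP≉0) (proj₁ P)) (recip-* hP≉0)))

  AffLine : Set (c ⊔ ℓ)
  AffLine = Σ (Sub 5 3) λ π → AffinePlane π × ∃ λ s → MeetsInfIn π s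

  base : AffLine → V 5
  base (π , affine , _) = proj₁ (anchor π affine)

  dir : AffLine → SIdx
  dir (_ , _ , s , _) = s

  -- The coefficients of the equation `cross s v = h(v) cross s b`, where `s` is the spread element
  -- of the line and `b` its anchor.
  fL : LnBB → LK.Point 3
  fL (inj₁ l) = (⊟ cross (dir l) (base l) ∷ β (dir l) ∷ ⊟ α (dir l) ∷ []) ,
    λ e → αβ≉0 (dir l) (K.trans (S.solve 1 (λ a → a ⊜ :- :- a) _) (K.trans (K.-‿cong (e k₂)) KF.-0#≈0#) , e k₁)
  fL (inj₂ _) = (𝟙 ∷ 𝟘 ∷ 𝟘 ∷ []) , λ e → KF.1≉0 (e k₀)

  lineForm : AffLine → V 5 → 𝕂
  lineForm l v = LK.dot (proj₁ (fL (inj₁ l))) (ι (dot h v) ∷ X v ∷ Y v ∷ [])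

  opaque
    lineForm-cross : ∀ l v → lineForm l v ≋ cross (dir l) (at v (base l) (- dot h v))
    lineForm-cross l v = K.trans (S.solve 7 (λ a b x₀ y₀ h x y → (:- (b :* x₀ :- a :* y₀)) :* h :+ (b :* x :+ ((:- a) :* y :+ :0)) ⊜
        b :* (x :+ (:- h) :* x₀) :- a :* (y :+ (:- h) :* y₀)) (α (dir l)) (β (dir l)) (X (base l)) (Y (base l)) (ι (dot h v)) (X v) (Y v))
      (K.sym (K.+-cong (K.*-congˡ (K.trans (X≋ shifted) (K.+-congˡ (K.*-congʳ (ι-neg _)))))
        (K.-‿cong (K.*-congˡ (K.trans (Y≋ shifted) (K.+-congˡ (K.*-congʳ (ι-neg _))))))))
      where
      shifted : Coords (at v (base l) (- dot h v)) (dot h v + (- dot h v) * dot h (base l)) (X v ⊞ ι (- dot h v) ⊠ X (base l)) (Y v ⊞ ι (- dot h v) ⊠ Y (base l))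
      shifted = coords-+ (own v) (coords-* (- dot h v) (own (base l)))

  opaque
    -- Subtracting `h(v)` times the anchor moves the question to infinity, where `MeetsInfIn` and
    -- `spread-line` answer it.
    on-line : ∀ l v → (InSpan (basis (proj₁ l)) v → lineForm l v ≋ 𝟘) × (lineForm l v ≋ 𝟘 → InSpan (basis (proj₁ l)) v)
    on-line l@(π , affine , s , meets) v = (λ v∈ → K.trans (lineForm-cross l v) (to (shift-in v∈))) ,
        (λ e → shift-out (from (K.trans (K.sym (lineForm-cross l v)) e)))
      where
      b u : V 5
      b = base l
      u = at v b (- dot h v)
      b∈ : InSpan (basis π) b
      b∈ = proj₁ (proj₂ (anchor π affine))
      hu : dot h u ≈ 0#
      hu = trans (dot-+ h v ((- dot h v) *v b)) (trans (+-congˡ (trans (dot-* h (- dot h v) b) (*-congˡ (proj₂ (proj₂ (anchor π affine))))))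
        (solve 1 (λ a → a :+ (:- a) :* :1 ⊜ :0) (dot h v)))
      shift-in : InSpan (basis π) v → InSpan (basis π) u
      shift-in v∈ = span-+ {w = basis π} v∈ (span-* {w = basis π} (- dot h v) b∈)
      shift-out : InSpan (basis π) u → InSpan (basis π) v
      shift-out u∈ = span-resp {w = basis π} (λ i → solve 3 (λ v a b → (v :+ (:- a) :* b) :+ a :* b ⊜ v) (v i) (dot h v) (b i))
        (span-+ {w = basis π} u∈ (span-* {w = basis π} (dot h v) b∈))
      to : InSpan (basis π) u → cross s u ≋ 𝟘
      to u∈ with u ≟v zv
      ... | yes u≈0 = K.trans (K.+-cong (K.*-congˡ (K.trans (X-resp u≈0) (X≋ coords-zv))) (K.-‿cong (K.*-congˡ (K.trans (Y-resp u≈0) (Y≋ coords-zv)))))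
          (S.solve 2 (λ a b → b :* :0 :- a :* :0 ⊜ :0) (α s) (β s))
      ... | no u≉0 = multiple⇒cross s u (proj₂ (proj₁ (spread-line s (u , u≉0)) (proj₁ (meets (u , u≉0) hu) u∈)))
      from : cross s u ≋ 𝟘 → InSpan (basis π) u
      from e with u ≟v zv
      ... | yes u≈0 = span-resp {w = basis π} (≈v-sym u≈0) (span-0 {w = basis π})
      ... | no u≉0 = proj₂ (meets (u , u≉0) hu) (proj₂ (spread-line s (u , u≉0)) (hu , cross⇒multiple s u e))

  opaque
    incidence : ∀ p l → (IncBB p l → LK.dot (proj₁ (fL l)) (proj₁ (fP p)) ≋ 𝟘) × (LK.dot (proj₁ (fL l)) (proj₁ (fP p)) ≋ 𝟘 → IncBB p l)
    incidence (inj₁ (P , affine)) (inj₁ l) = on-line l (proj₁ P)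
    incidence (inj₁ (P , affine)) (inj₂ _) = (λ ()) , λ e → ⊥-elim (ι-≉0 affine
      (K.trans (S.solve 3 (λ a b c → a ⊜ :1 :* a :+ (:0 :* b :+ (:0 :* c :+ :0))) _ _ _) e))
    incidence (inj₂ s) (inj₂ _) = (λ _ → S.solve 2 (λ a b → :1 :* :0 :+ (:0 :* a :+ (:0 :* b :+ :0)) ⊜ :0) _ _) , λ _ → tt
    incidence (inj₂ s) (inj₁ l) = to , from
      where
      value : ∀ {v r} → Coords v 0# (r ⊠ α s) (r ⊠ β s) → lineForm l v ≋ r ⊠ LK.dot (proj₁ (fL (inj₁ l))) (𝟘 ∷ α s ∷ β s ∷ [])
      value {r = r} cv = K.trans (K.+-cong (K.*-congˡ (K.trans (ι-cong (h≈ cv)) ι-0)) (K.+-cong (K.*-congˡ (X≋ cv)) (K.+-congʳ (K.*-congˡ (Y≋ cv)))))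
        (S.solve 6 (λ x y z r a b → x :* :0 :+ (y :* (r :* a) :+ (z :* (r :* b) :+ :0)) ⊜ r :* (x :* :0 :+ (y :* a :+ (z :* b :+ :0)))) _ _ _ r (α s) (β s))
      to : IncBB (inj₂ s) (inj₁ l) → LK.dot (proj₁ (fL (inj₁ l))) (𝟘 ∷ α s ∷ β s ∷ []) ≋ 𝟘
      to inc = let T , cT = spread-point s in K.trans (K.sym (K.*-identityˡ _)) (K.trans
        (K.sym (value (coords-cong cT refl (K.sym (K.*-identityˡ _)) (K.sym (K.*-identityˡ _)))))
        (proj₁ (on-line l (proj₁ T)) (inc T (proj₂ (spread-line s T) (h≈ cT , 𝟙 , K.trans (X≋ cT) (K.sym (K.*-identityˡ _)) ,
          K.trans (Y≋ cT) (K.sym (K.*-identityˡ _)))))))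
      from : LK.dot (proj₁ (fL (inj₁ l))) (𝟘 ∷ α s ∷ β s ∷ []) ≋ 𝟘 → IncBB (inj₂ s) (inj₁ l)
      from e T T∈ = let hT , r , XT , YT = proj₁ (spread-line s T) T∈ in
        proj₂ (on-line l (proj₁ T)) (K.trans (value (coords hT XT YT)) (K.trans (K.*-congˡ e) (K.zeroʳ r)))

  opaque
    -- A spread line contains the point with coordinates `(0, α, β)`, which fixes `(α, β)` up to a
    -- factor of `K`.
    same-dir : ∀ s s' → (SameT s s' → LK.Same (fP (inj₂ s)) (fP (inj₂ s'))) × (LK.Same (fP (inj₂ s)) (fP (inj₂ s')) → SameT s s')
    same-dir s s' = to , from
      where
      to : SameT s s' → LK.Same (fP (inj₂ s)) (fP (inj₂ s'))
      to s≡s' with spread-point s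
      ... | T , cT with proj₁ (spread-line s' T) (proj₁ (s≡s' T) (proj₂ (spread-line s T)
            (h≈ cT , 𝟙 , K.trans (X≋ cT) (K.sym (K.*-identityˡ _)) , K.trans (Y≋ cT) (K.sym (K.*-identityˡ _)))))
      ... | hT , r , XT , YT = r , (λ r≈0 → αβ≉0 s (zero-of r≈0 eα , zero-of r≈0 eβ)) ,
          λ { zero → K.sym (K.zeroʳ r) ; (suc zero) → eα ; (suc (suc zero)) → eβ }
        where
        eα : α s ≋ r ⊠ α s'
        eα = K.trans (K.sym (X≋ cT)) XT
        eβ : β s ≋ r ⊠ β s'
        eβ = K.trans (K.sym (Y≋ cT)) YT
        zero-of : ∀ {a b} → r ≋ 𝟘 → a ≋ r ⊠ b → a ≋ 𝟘
        zero-of r≈0 e = K.trans e (K.trans (K.*-congʳ r≈0) (K.zeroˡ _))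
      transfer : ∀ {s s' r} → α s ≋ r ⊠ α s' → β s ≋ r ⊠ β s' → ∀ T → tS s T → tS s' T
      transfer {s} {s'} {r} eα eβ T T∈ = let hT , t , XT , YT = proj₁ (spread-line s T) T∈ in
        proj₂ (spread-line s' T) (hT , t ⊠ r , K.trans XT (K.trans (K.*-congˡ eα) (K.sym (K.*-assoc _ _ _))) ,
          K.trans YT (K.trans (K.*-congˡ eβ) (K.sym (K.*-assoc _ _ _))))
      from : LK.Same (fP (inj₂ s)) (fP (inj₂ s')) → SameT s s'
      from (r , r≉0 , e) T = transfer {s} {s'} (e k₁) (e k₂) T , transfer {s'} {s} (back (e k₁)) (back (e k₂)) T
        where
        back : ∀ {a b} → a ≋ r ⊠ b → b ≋ KF.recip r≉0 ⊠ a
        back {a} {b} e' = K.sym (K.trans (K.*-congˡ e') (K.trans (K.sym (K.*-assoc _ _ _)) (K.trans (K.*-congʳ (KF.recip-* r≉0)) (K.*-identityˡ b))))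

  opaque
    fP-eq : ∀ p p' → (EqPt p p' → LK.Same (fP p) (fP p')) × (LK.Same (fP p) (fP p') → EqPt p p')
    fP-eq (inj₁ (P , affP)) (inj₁ (Q , affQ)) = to , from
      where
      to : Same P Q → LK.Same (fP (inj₁ (P , affP))) (fP (inj₁ (Q , affQ)))
      to (a , a≉0 , e) = ι a , ι-≉0 a≉0 , λ { zero → K.trans (ι-cong (h≈ cP)) (ι-* a _) ; (suc zero) → X≋ cP ; (suc (suc zero)) → Y≋ cP }
        where
        cP : Coords (proj₁ P) (a * dot h (proj₁ Q)) (ι a ⊠ X (proj₁ Q)) (ι a ⊠ Y (proj₁ Q))
        cP = coords-resp (λ i → sym (e i)) (coords-* a (own (proj₁ Q)))
      from : LK.Same (fP (inj₁ (P , affP))) (fP (inj₁ (Q , affQ))) → Same P Q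
      from (r , r≉0 , e) = a , *-≉0 affP (recip≉0 affQ) , coords-unique (own (proj₁ P))
          (coords-cong (coords-* a (own (proj₁ Q))) a*hQ (K.trans (K.*-congʳ ιa≈r) (K.sym (e k₁))) (K.trans (K.*-congʳ ιa≈r) (K.sym (e k₂))))
        where
        a : Carrier
        a = dot h (proj₁ P) * recip affQ
        a*hQ : a * dot h (proj₁ Q) ≈ dot h (proj₁ P)
        a*hQ = trans (*-assoc _ _ _) (trans (*-congˡ (recip-* affQ)) (*-identityʳ _))
        -- The factor `r` is forced into `F` by the first coordinates, which are nonzero elements of
        -- `F` for affine points.
        ιa≈r : ι a ≋ r
        ιa≈r = KF.x∙y⁻¹≈ε⇒x≈y _ _ (KF.*-cancel-0 (ι-≉0 affQ) (K.trans (S.solve 3 (λ q a r → q :* (a :- r) ⊜ a :* q :- r :* q) _ _ _)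
          (K.trans (K.+-cong (K.trans (K.sym (ι-* a _)) (ι-cong a*hQ)) (K.-‿cong (K.sym (e k₀)))) (K.-‿inverseʳ _))))
    fP-eq (inj₁ (P , affP)) (inj₂ s) = (λ ()) , λ (r , _ , e) → ⊥-elim (ι-≉0 affP (K.trans (e k₀) (K.zeroʳ r)))
    fP-eq (inj₂ s) (inj₁ (P , affP)) = (λ ()) , λ (r , r≉0 , e) → ⊥-elim (ι-≉0 affP (KF.*-cancel-0 r≉0 (K.sym (e k₀))))
    fP-eq (inj₂ s) (inj₂ s') = same-dir s s'

  opaque
    -- As 2 is invertible, every finite slope is that of a tangent.
    double-onto : ∀ Z → ∃ λ i → 𝟚 ⊠ X (c⃗ i) ≋ Z
    double-onto Z with X-onto (KF.recip 2≉0ᴷ ⊠ Z)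
    ... | i , e = i , K.trans (K.*-congˡ e) (K.trans (K.sym (K.*-assoc _ _ _)) (K.trans (K.*-congʳ (KF.*-recip 2≉0ᴷ)) (K.*-identityˡ Z)))

  opaque
    direction : ∀ a b → ¬ (a ≋ 𝟘 × b ≋ 𝟘) → ∃₂ λ s r → ¬ r ≋ 𝟘 × α s ≋ r ⊠ a × β s ≋ r ⊠ b
    direction a b n with a KF.≟ 𝟘
    ... | yes a≈0 = inj₂ tt , KF.recip b≉0 , KF.recip≉0 b≉0 , K.sym (K.trans (K.*-congˡ a≈0) (K.zeroʳ _)) , K.sym (KF.recip-* b≉0)
      where
      b≉0 : ¬ b ≋ 𝟘
      b≉0 b≈0 = n (a≈0 , b≈0)
    ... | no a≉0 with double-onto (KF.recip a≉0 ⊠ b)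
    ... | i , e = inj₁ i , KF.recip a≉0 , KF.recip≉0 a≉0 , K.sym (KF.recip-* a≉0) , e

  opaque
    fP-onto : ∀ x → ∃ λ p → LK.Same (fP p) x
    fP-onto (x , x≉0) with x k₀ KF.≟ 𝟘
    ... | no x₀≉0 = inj₁ (P , λ hP → 1≉0 (trans (sym (h≈ cP)) hP)) , r , KF.recip≉0 x₀≉0 ,
        λ { zero → K.trans (ι-cong (h≈ cP)) (K.trans ι-1 (K.sym (KF.recip-* x₀≉0))) ; (suc zero) → X≋ cP ; (suc (suc zero)) → Y≋ cP }
      where
      r : 𝕂
      r = KF.recip x₀≉0
      cP : Coords (vec 1# (r ⊠ x k₁) (r ⊠ x k₂)) 1# (r ⊠ x k₁) (r ⊠ x k₂)
      cP = coords-vec 1# (r ⊠ x k₁) (r ⊠ x k₂)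
      P : Pt
      P = vec 1# (r ⊠ x k₁) (r ⊠ x k₂) , affine≉0 (h≈ cP)
    ... | yes x₀≈0 with direction (x k₁) (x k₂) (λ (e₁ , e₂) → x≉0 λ { zero → x₀≈0 ; (suc zero) → e₁ ; (suc (suc zero)) → e₂ })
    ... | s , r , r≉0 , eα , eβ = inj₂ s , r , r≉0 ,
        λ { zero → K.sym (K.trans (K.*-congˡ x₀≈0) (K.zeroʳ r)) ; (suc zero) → eα ; (suc (suc zero)) → eβ }

  opaque
    same-line : ∀ l l' → (SameSub (proj₁ l) (proj₁ l') → LK.Same (fL (inj₁ l)) (fL (inj₁ l'))) ×
      (LK.Same (fL (inj₁ l)) (fL (inj₁ l')) → SameSub (proj₁ l) (proj₁ l'))
    same-line l@(π , affine , s , meets) l'@(π' , affine' , s' , meets') = to , from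
      where
      to : SameSub π π' → LK.Same (fL (inj₁ l)) (fL (inj₁ l'))
      to π≡π' with proj₁ (same-dir s s') (λ T →
          (λ T∈ → let hT = proj₁ (proj₁ (spread-line s T) T∈) in proj₁ (meets' T hT) (proj₁ (π≡π' T) (proj₂ (meets T hT) T∈))) ,
          (λ T∈ → let hT = proj₁ (proj₁ (spread-line s' T) T∈) in proj₁ (meets T hT) (proj₂ (π≡π' T) (proj₂ (meets' T hT) T∈))))
      ... | r , r≉0 , e = r , r≉0 , λ { zero → K.trans (K.-‿cong c≈) (S.solve 2 (λ r a → :- (r :* a) ⊜ r :* :- a) r _)
                                      ; (suc zero) → e k₂
                                      ; (suc (suc zero)) → K.trans (K.-‿cong (e k₁)) (S.solve 2 (λ r a → :- (r :* a) ⊜ r :* :- a) r _) }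
        where
        b b' : V 5
        b = base l
        b' = base l'
        hb : dot h b ≈ 1#
        hb = proj₂ (proj₂ (anchor π affine))
        b∈π' : InSpan (basis π') b
        b∈π' = proj₁ (π≡π' (b , affine≉0 hb)) (proj₁ (proj₂ (anchor π affine)))
        at-b : ⊟ cross s' b' ⊠ 𝟙 ⊞ (β s' ⊠ X b ⊞ (⊟ α s' ⊠ Y b ⊞ 𝟘)) ≋ 𝟘
        at-b = K.trans (K.+-congʳ (K.*-congˡ (K.sym (K.trans (ι-cong hb) ι-1)))) (proj₁ (on-line l' b) b∈π')
        c≈ : cross s b ≋ r ⊠ cross s' b'
        c≈ = K.trans (K.+-cong (K.*-congʳ (e k₂)) (K.-‿cong (K.*-congʳ (e k₁)))) (K.trans
          (S.solve 6 (λ r a b x y c → r :* b :* x :- r :* a :* y ⊜ r :* c :+ r :* ((:- c) :* :1 :+ (b :* x :+ ((:- a) :* y :+ :0))))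
            r (α s') (β s') (X b) (Y b) (cross s' b'))
          (K.trans (K.+-congˡ (K.trans (K.*-congˡ at-b) (K.zeroʳ r))) (K.+-identityʳ _)))
      from : LK.Same (fL (inj₁ l)) (fL (inj₁ l')) → SameSub π π'
      from (r , r≉0 , e) P = (λ P∈ → proj₂ (on-line l' v) (KF.*-cancel-0 r≉0 (K.trans (K.sym scaled) (proj₁ (on-line l v) P∈)))) ,
          (λ P∈ → proj₂ (on-line l v) (K.trans scaled (K.trans (K.*-congˡ (proj₁ (on-line l' v) P∈)) (K.zeroʳ r))))
        where
        v : V 5
        v = proj₁ P
        scaled : lineForm l v ≋ r ⊠ lineForm l' v
        scaled = K.trans (K.+-cong (K.*-congʳ (e k₀)) (K.+-cong (K.*-congʳ (e k₁)) (K.+-congʳ (K.*-congʳ (e k₂)))))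
          (S.solve 7 (λ r a b c x y z → r :* a :* x :+ (r :* b :* y :+ (r :* c :* z :+ :0)) ⊜ r :* (a :* x :+ (b :* y :+ (c :* z :+ :0)))) r _ _ _ _ _ _)

  opaque
    fL-eq : ∀ l l' → (EqLn l l' → LK.Same (fL l) (fL l')) × (LK.Same (fL l) (fL l') → EqLn l l')
    fL-eq (inj₁ l) (inj₁ l') = same-line l l'
    fL-eq (inj₁ l) (inj₂ _) = (λ ()) , λ (r , _ , e) → ⊥-elim (αβ≉0 (dir l)
      (K.trans (S.solve 1 (λ a → a ⊜ :- :- a) _) (K.trans (K.-‿cong (K.trans (e k₂) (K.zeroʳ r))) KF.-0#≈0#) , K.trans (e k₁) (K.zeroʳ r)))
    fL-eq (inj₂ _) (inj₁ l) = (λ ()) , λ (r , r≉0 , e) → ⊥-elim (αβ≉0 (dir l)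
      (K.trans (S.solve 1 (λ a → a ⊜ :- :- a) _) (K.trans (K.-‿cong (KF.*-cancel-0 r≉0 (K.sym (e k₂)))) KF.-0#≈0#) , KF.*-cancel-0 r≉0 (K.sym (e k₁))))
    fL-eq (inj₂ _) (inj₂ _) = (λ _ → 𝟙 , KF.1≉0 , λ i → K.sym (K.*-identityˡ _)) , λ _ → tt

  -- The affine line through v₀ in the direction s, an F-plane since K = F + F ω.
  module _ (s : SIdx) (v₀ : V 5) (hv₀ : dot h v₀ ≈ 1#) where
    e₁ e₂ : V 5
    e₁ = vec 0# (α s) (β s)
    e₂ = vec 0# (ω ⊠ α s) (ω ⊠ β s)

    opaque
      combo-coords : ∀ x → Coords (combo x (three v₀ e₁ e₂)) (x k₀) (ι (x k₀) ⊠ X v₀ ⊞ (ι (x k₁) ⊞ ι (x k₂) ⊠ ω) ⊠ α s)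
        (ι (x k₀) ⊠ Y v₀ ⊞ (ι (x k₁) ⊞ ι (x k₂) ⊠ ω) ⊠ β s)
      combo-coords x = coords-resp (λ i → solve 3 (λ a b c → a :+ b :+ c ⊜ a :+ (b :+ (c :+ :0))) _ _ _)
        (coords-cong (coords-+ (coords-lin (x k₀) (x k₁) (own v₀) (coords-vec _ _ _)) (coords-* (x k₂) (coords-vec _ _ _)))
          (trans (+-congʳ (+-congʳ (*-congˡ hv₀))) (solve 3 (λ a b c → a :* :1 :+ b :* :0 :+ c :* :0 ⊜ a) _ _ _))
          (arrange _ (α s)) (arrange _ (β s)))
        where
        arrange : ∀ V A → ι (x k₀) ⊠ V ⊞ ι (x k₁) ⊠ A ⊞ ι (x k₂) ⊠ (ω ⊠ A) ≋ ι (x k₀) ⊠ V ⊞ (ι (x k₁) ⊞ ι (x k₂) ⊠ ω) ⊠ A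
        arrange V A = S.solve 6 (λ a b c v w A → a :* v :+ b :* A :+ c :* (w :* A) ⊜ a :* v :+ (b :+ c :* w) :* A) (ι (x k₀)) (ι (x k₁)) (ι (x k₂)) V ω A

    opaque
      drop-base : ∀ {a Z W} → a ≈ 0# → ι a ⊠ Z ⊞ W ≋ W
      drop-base a≈0 = K.trans (K.+-congʳ (K.*-congʳ (K.trans (ι-cong a≈0) ι-0))) (S.solve 2 (λ z w → :0 :* z :+ w ⊜ w) _ _)

    opaque
      line-indep : Indep (three v₀ e₁ e₂)
      line-indep x rel = λ { zero → x₀≈0 ; (suc zero) → proj₁ both ; (suc (suc zero)) → proj₂ both }
        where
        cz : Coords zv (x k₀) (ι (x k₀) ⊠ X v₀ ⊞ (ι (x k₁) ⊞ ι (x k₂) ⊠ ω) ⊠ α s) (ι (x k₀) ⊠ Y v₀ ⊞ (ι (x k₁) ⊞ ι (x k₂) ⊠ ω) ⊠ β s)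
        cz = coords-resp rel (combo-coords x)
        x₀≈0 : x k₀ ≈ 0#
        x₀≈0 = trans (sym (h≈ cz)) (dot-0 h)
        both : x k₁ ≈ 0# × x k₂ ≈ 0#
        both = basis-indep _ _ (KF.x∙y⁻¹≈ε⇒x≈y _ _ (K.trans (S.solve 1 (λ a → a :- :0 ⊜ a) _) (decide ((ι (x k₁) ⊞ ι (x k₂) ⊠ ω) KF.≟ 𝟘))))
          where
          decide : Dec ((ι (x k₁) ⊞ ι (x k₂) ⊠ ω) ≋ 𝟘) → (ι (x k₁) ⊞ ι (x k₂) ⊠ ω) ≋ 𝟘
          decide (yes e) = e
          decide (no n) = ⊥-elim (αβ≉0 s (KF.*-cancel-0 n (K.trans (K.sym (drop-base x₀≈0)) (K.trans (K.sym (X≋ cz)) (X≋ coords-zv))) ,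
            KF.*-cancel-0 n (K.trans (K.sym (drop-base x₀≈0)) (K.trans (K.sym (Y≋ cz)) (Y≋ coords-zv)))))

    line-plane : Sub 5 3
    line-plane = record { basis = three v₀ e₁ e₂ ; indep = line-indep }

    opaque
      line-affine : AffinePlane line-plane
      line-affine all-inf = 1≉0 (trans (sym hv₀) (all-inf (v₀ , affine≉0 hv₀) (span-gen {w = three v₀ e₁ e₂} k₀)))

    opaque
      line-meets : MeetsInfIn line-plane s
      line-meets T hT = to , from
        where
        to : T ∈S line-plane → tS s T
        to (x , T≈) = proj₂ (spread-line s T) (hT , ι (x k₁) ⊞ ι (x k₂) ⊠ ω , K.trans (X≋ cT) (drop-base x₀≈0) , K.trans (Y≋ cT) (drop-base x₀≈0))
          where
          cT : Coords (proj₁ T) (x k₀) (ι (x k₀) ⊠ X v₀ ⊞ (ι (x k₁) ⊞ ι (x k₂) ⊠ ω) ⊠ α s) (ι (x k₀) ⊠ Y v₀ ⊞ (ι (x k₁) ⊞ ι (x k₂) ⊠ ω) ⊠ β s)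
          cT = coords-resp (≈v-sym T≈) (combo-coords x)
          x₀≈0 : x k₀ ≈ 0#
          x₀≈0 = trans (sym (h≈ cT)) hT
        from : tS s T → T ∈S line-plane
        from T∈ with proj₁ (spread-line s T) T∈
        ... | _ , r , XT , YT with basis-spans r
        ... | a , b , r≈ = (0# ∷ a ∷ b ∷ []) , coords-unique (coords hT XT YT) (coords-cong (combo-coords (0# ∷ a ∷ b ∷ [])) refl
          (K.trans (drop-base refl) (K.*-congʳ (K.sym r≈))) (K.trans (drop-base refl) (K.*-congʳ (K.sym r≈))))

    line : AffLine
    line = line-plane , line-affine , s , line-meets

  opaque
    solve-cross : ∀ s t → ∃₂ λ Z W → β s ⊠ Z ⊖ α s ⊠ W ≋ t
    solve-cross (inj₁ i) t = 𝟘 , ⊟ t , S.solve 2 (λ b t → b :* :0 :- :1 :* (:- t) ⊜ t) (𝟚 ⊠ X (c⃗ i)) t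
    solve-cross (inj₂ _) t = t , 𝟘 , S.solve 1 (λ t → :1 :* t :- :0 :* :0 ⊜ t) t

  opaque
    fL-onto-affine : ∀ x → ¬ (⊟ proj₁ x k₂ ≋ 𝟘 × proj₁ x k₁ ≋ 𝟘) → ∃ λ l → LK.Same (fL l) x
    fL-onto-affine (x , x≉0) n with direction (⊟ x k₂) (x k₁) n
    ... | s , r , r≉0 , eα , eβ with solve-cross s (⊟ (r ⊠ x k₀))
    ... | Z , W , cross≈ = inj₁ l , r , r≉0 , λ
        { zero → K.trans (K.-‿cong (K.trans base-cross (K.trans (K.+-cong (K.*-congˡ (X≋ cv)) (K.-‿cong (K.*-congˡ (Y≋ cv)))) cross≈)))
            (S.solve 1 (λ a → :- :- a ⊜ a) (r ⊠ x k₀))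
        ; (suc zero) → eβ
        ; (suc (suc zero)) → K.trans (K.-‿cong eα) (S.solve 2 (λ r a → :- (r :* :- a) ⊜ r :* a) r (x k₂)) }
      where
      v₀ : V 5
      v₀ = vec 1# Z W
      cv : Coords v₀ 1# Z W
      cv = coords-vec 1# Z W
      l : AffLine
      l = line s v₀ (h≈ cv)
      -- The anchor found by the search may differ from `v₀`, but both lie on the line.
      base-cross : cross s (base l) ≋ cross s v₀
      base-cross = K.trans (S.solve 5 (λ c b a x y → c ⊜ (b :* x :- a :* y) :- ((:- c) :* :1 :+ (b :* x :+ ((:- a) :* y :+ :0))))
          (cross s (base l)) (β s) (α s) (X v₀) (Y v₀))
        (K.trans (K.+-congˡ (K.-‿cong (K.trans (K.+-congʳ (K.*-congˡ (K.sym (K.trans (ι-cong (h≈ cv)) ι-1))))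
          (proj₁ (on-line l v₀) (span-gen {w = three v₀ (e₁ s v₀ (h≈ cv)) (e₂ s v₀ (h≈ cv))} k₀)))))
          (S.solve 1 (λ a → a :- :0 ⊜ a) _))

  opaque
    fL-onto : ∀ x → ∃ λ l → LK.Same (fL l) x
    fL-onto (x , x≉0) with x k₁ KF.≟ 𝟘 | x k₂ KF.≟ 𝟘
    ... | no x₁≉0 | _ = fL-onto-affine (x , x≉0) λ (_ , e) → x₁≉0 e
    ... | _ | no x₂≉0 = fL-onto-affine (x , x≉0) λ (e , _) → x₂≉0
      (K.trans (S.solve 1 (λ a → a ⊜ :- :- a) _) (K.trans (K.-‿cong e) KF.-0#≈0#))
    ... | yes x₁≈0 | yes x₂≈0 = inj₂ tt , KF.recip x₀≉0 , KF.recip≉0 x₀≉0 , λ { zero → K.sym (KF.recip-* x₀≉0)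
        ; (suc zero) → K.sym (K.trans (K.*-congˡ x₁≈0) (K.zeroʳ _)) ; (suc (suc zero)) → K.sym (K.trans (K.*-congˡ x₂≈0) (K.zeroʳ _)) }
      where
      x₀≉0 : ¬ x k₀ ≋ 𝟘
      x₀≉0 e = x≉0 λ { zero → e ; (suc zero) → x₁≈0 ; (suc (suc zero)) → x₂≈0 }

  iso : IsoPG2 K
  iso = record { fP = fP ; fP-eq = fP-eq ; fP-onto = fP-onto ; fL = fL ; fL-eq = fL-eq ; fL-onto = fL-onto ; f-inc = incidence }

  -- Twice the form `x₁² - x₀ x₂`; the only point of this conic with `x₀ = 0` is `(0, 0, 1)`, the
  -- image of `T∞`.
  conicMatrix : LK.M3
  conicMatrix zero (suc (suc zero)) = ⊟ 𝟙
  conicMatrix (suc (suc zero)) zero = ⊟ 𝟙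
  conicMatrix (suc zero) (suc zero) = 𝟚
  conicMatrix _ _ = 𝟘

  opaque
    conicMatrix-form : ∀ x → LK.Qform conicMatrix x ≋ 𝟚 ⊠ (x k₁ ⊠ x k₁ ⊖ x k₀ ⊠ x k₂)
    conicMatrix-form x = S.solve 3 (λ a b c →
      (a :* :0 :* a :+ (a :* :0 :* b :+ (a :* (:- :1) :* c :+ :0))) :+ ((b :* :0 :* a :+ (b :* (:1 :+ :1) :* b :+ (b :* :0 :* c :+ :0))) :+
        ((c :* (:- :1) :* a :+ (c :* :0 :* b :+ (c :* :0 :* c :+ :0))) :+ :0)) ⊜ (:1 :+ :1) :* (b :* b :- a :* c)) (x k₀) (x k₁) (x k₂)

  opaque
    conicMatrix-nondegenerate : LK.NonDegenerate conicMatrix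
    conicMatrix-nondegenerate = symmetric , λ d≈0 → 2≉0ᴷ (K.trans (S.solve 0 (:1 :+ :1 ⊜
        :- ((:0 :* ((:1 :+ :1) :* :0 :- :0 :* :0) :- :0 :* (:0 :* :0 :- :0 :* (:- :1))) :+ (:- :1) :* (:0 :* :0 :- (:1 :+ :1) :* (:- :1)))))
        (K.trans (K.-‿cong d≈0) KF.-0#≈0#))
      where
      symmetric : LK.Symmetric conicMatrix
      symmetric zero zero = K.refl
      symmetric zero (suc zero) = K.refl
      symmetric zero (suc (suc zero)) = K.refl
      symmetric (suc zero) zero = K.refl
      symmetric (suc zero) (suc zero) = K.refl
      symmetric (suc zero) (suc (suc zero)) = K.refl
      symmetric (suc (suc zero)) zero = K.refl
      symmetric (suc (suc zero)) (suc zero) = K.refl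
      symmetric (suc (suc zero)) (suc (suc zero)) = K.refl

  conic : LK.IsConicPG2 (λ x → ∃ λ p → CsetBB p × LK.Same (fP p) x)
  conic = conicMatrix , conicMatrix-nondegenerate , λ P → to P , from P
    where
    Q : LK.V 3 → 𝕂
    Q x = x k₁ ⊠ x k₁ ⊖ x k₀ ⊠ x k₂
    Q-scale : ∀ {x y r} → ¬ r ≋ 𝟘 → (∀ i → x i ≋ r ⊠ y i) → Q x ≋ 𝟘 → Q y ≋ 𝟘
    Q-scale {x} {y} {r} r≉0 e Qx = KF.*-cancel-0 (KF.*-≉0 r≉0 r≉0) (K.trans
      (S.solve 4 (λ r a b c → r :* r :* (b :* b :- a :* c) ⊜ r :* b :* (r :* b) :- r :* a :* (r :* c)) r (y k₀) (y k₁) (y k₂))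
      (K.trans (K.sym (K.+-cong (K.*-cong (e k₁) (e k₁)) (K.-‿cong (K.*-cong (e k₀) (e k₂))))) Qx))
    Q-C : ∀ p → CsetBB p → Q (proj₁ (fP p)) ≋ 𝟘
    Q-C (inj₁ (P , _)) (i , same-i) with same⇒multiple P same-i
    ... | a , _ , P≈ = K.trans (K.+-cong (K.*-cong (X≋ cP) (X≋ cP)) (K.-‿cong (K.*-cong (ι-cong (h≈ cP)) (Y≋ cP))))
        (S.solve 2 (λ a x → a :* x :* (a :* x) :- a :* (a :* (x :* x)) ⊜ :0) (ι a) (X (c⃗ i)))
      where
      cP : Coords (proj₁ P) a (ι a ⊠ X (c⃗ i)) (ι a ⊠ (X (c⃗ i) ⊠ X (c⃗ i)))
      cP = coords-resp (≈v-sym P≈) (coords-cong (coords-* a (coords-c⃗ i)) (*-identityʳ a) K.refl K.refl)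
    Q-C (inj₂ (inj₁ _)) ()
    Q-C (inj₂ (inj₂ _)) _ = S.solve 0 (:0 :* :0 :- :0 :* :1 ⊜ :0)
    to : ∀ x → (∃ λ p → CsetBB p × LK.Same (fP p) x) → LK.Qform conicMatrix (proj₁ x) ≋ 𝟘
    to (x , _) (p , Cp , r , r≉0 , e) = K.trans (conicMatrix-form x) (K.trans (K.*-congˡ (Q-scale r≉0 e (Q-C p Cp))) (K.zeroʳ _))
    from : ∀ x → LK.Qform conicMatrix (proj₁ x) ≋ 𝟘 → ∃ λ p → CsetBB p × LK.Same (fP p) x
    from (x , x≉0) Qx with x k₀ KF.≟ 𝟘
    ... | yes x₀≈0 = inj₂ (inj₂ tt) , tt , KF.recip x₂≉0 , KF.recip≉0 x₂≉0 ,
        λ { zero → K.sym (K.trans (K.*-congˡ x₀≈0) (K.zeroʳ _)) ; (suc zero) → K.sym (K.trans (K.*-congˡ x₁≈0) (K.zeroʳ _))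
          ; (suc (suc zero)) → K.sym (KF.recip-* x₂≉0) }
      where
      x₁≈0 : x k₁ ≋ 𝟘
      x₁≈0 = [ id , id ] (KF.zero-product (x k₁) (x k₁) (K.trans (S.solve 2 (λ b c → b :* b ⊜ (b :* b :- :0 :* c) :+ :0 :* c) (x k₁) (x k₂))
        (K.trans (K.+-cong (K.trans (K.+-congˡ (K.-‿cong (K.*-congʳ (K.sym x₀≈0)))) (KF.*-cancel-0 2≉0ᴷ (K.trans (K.sym (conicMatrix-form x)) Qx)))
          (K.zeroˡ _)) (K.+-identityʳ _))))
      x₂≉0 : ¬ x k₂ ≋ 𝟘
      x₂≉0 e = x≉0 λ { zero → x₀≈0 ; (suc zero) → x₁≈0 ; (suc (suc zero)) → e }
    ... | no x₀≉0 with X-onto (KF.recip x₀≉0 ⊠ x k₁)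
    ... | i , Xi = inj₁ (Point-c⃗ i , λ hP → 1≉0 (trans (sym (h-c⃗ i)) hP)) , (i , same-c⃗ i) , r , KF.recip≉0 x₀≉0 ,
        λ { zero → K.trans (ι-cong (h-c⃗ i)) (K.trans ι-1 (K.sym (KF.recip-* x₀≉0))) ; (suc zero) → Xi
          ; (suc (suc zero)) → K.trans (Y≈X² i) (K.trans (K.*-cong Xi Xi) square) }
      where
      r : 𝕂
      r = KF.recip x₀≉0
      square : (r ⊠ x k₁) ⊠ (r ⊠ x k₁) ≋ r ⊠ x k₂
      square = K.trans (S.solve 4 (λ r a b c → (r :* b) :* (r :* b) ⊜ r :* r :* (b :* b :- a :* c) :+ r :* a :* (r :* c)) r (x k₀) (x k₁) (x k₂))
        (K.trans (K.+-cong (K.trans (K.*-congˡ (KF.*-cancel-0 2≉0ᴷ (K.trans (K.sym (conicMatrix-form x)) Qx))) (K.zeroʳ _))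
          (K.trans (K.*-congʳ (KF.recip-* x₀≉0)) (K.*-identityˡ _))) (K.+-identityˡ _))

-- Finite fields: multiples of 1 and Fermat's theorem.

module Multiples {c ℓ} (R : CommutativeRing c ℓ) where
  open CommutativeRing R hiding (zero)
  open Algebra.Properties.Semiring.Mult semiring public using (×-homo-+; ×1-homo-*; ×-congˡ) renaming (_×_ to _·_)

  infixr 8 _^_
  _^_ : Carrier → ℕ → Carrier
  x ^ zero = 1#
  x ^ suc n = x * x ^ n

  nat : ℕ → Carrier
  nat n = n · 1#

  opaque
    nat-^ : ∀ p k → nat (p ℕ.^ k) ≈ nat p ^ k
    nat-^ p zero = +-identityʳ 1#
    nat-^ p (suc k) = trans (×1-homo-* p (p ℕ.^ k)) (*-congˡ (nat-^ p k))

  opaque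
    nat-*-0 : ∀ m {n} → nat n ≈ 0# → nat (m ℕ.* n) ≈ 0#
    nat-*-0 m {n} e = trans (×1-homo-* m n) (trans (*-congˡ e) (zeroʳ _))

module Fermat {c ℓ} (R : CommutativeRing c ℓ) (isField : LinAlg.IsField R) {Q : ℕ} (card : LinAlg.HasCard R Q) where
  open CommutativeRing R hiding (zero)
  open FieldLA R isField card public
  open Multiples R public
  open RingSolver R
  open Relation.Binary.Reasoning.Setoid setoid

  module Σ+ = Algebra.Properties.CommutativeMonoid.Sum +-commutativeMonoid
  module Π* = Algebra.Properties.CommutativeMonoid.Sum *-commutativeMonoid

  elements : (f g : Carrier → Carrier) → (∀ {x y} → x ≈ y → f x ≈ f y) → (∀ {x y} → x ≈ y → g x ≈ g y) →
    (∀ x → f (g x) ≈ x) → (∀ x → g (f x) ≈ x) → Permutation Q Q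
  elements f g f-cong g-cong fg gf = permutation (λ i → index (f (elem i))) (λ i → index (g (elem i)))
    (λ i → elem-injective _ _ (trans (elem-index _) (trans (f-cong (elem-index _)) (fg _))))
    (λ i → elem-injective _ _ (trans (elem-index _) (trans (g-cong (elem-index _)) (gf _))))

  -- Summing x + 1 over all x gives the sum of all x.
  opaque
    card·1≈0 : nat Q ≈ 0#
    card·1≈0 = begin
      nat Q  ≈⟨ solve 2 (λ s n → n ⊜ (s :+ n) :- s) total (nat Q) ⟩
      (total + nat Q) - total  ≈⟨ +-congʳ (begin
        total + nat Q  ≈⟨ +-congˡ (Σ+.sum-replicate Q) ⟨
        total + Σ+.sum {Q} (λ _ → 1#)  ≈⟨ Σ+.∑-distrib-+ elem (λ _ → 1#) ⟨
        Σ+.sum (λ i → elem i + 1#)  ≈⟨ Σ+.sum-cong-≋ (λ i → elem-index (elem i + 1#)) ⟨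
        Σ+.sum (λ i → elem (index (elem i + 1#)))  ≈⟨ Σ+.sum-permute elem shift ⟨
        total ∎) ⟩
      total - total  ≈⟨ -‿inverseʳ _ ⟩
      0# ∎
      where
      total : Carrier
      total = Σ+.sum elem
      shift : Permutation Q Q
      shift = elements (_+ 1#) (_- 1#) +-congʳ +-congʳ (solve 1 λ x → x :- :1 :+ :1 ⊜ x) (solve 1 λ x → x :+ :1 :- :1 ⊜ x)

  -- Multiplication by a permutes the nonzero elements, whose product is cancelled.
  opaque
    fermat : ∀ {n} → Q ≡ suc n → ∀ {a} → ¬ a ≈ 0# → a ^ n ≈ 1#
    fermat {n} ≡.refl {a} a≉0 = begin
      a ^ n  ≈⟨ sym (power n) ⟩
      Π*.sum {n} (λ _ → a)  ≈⟨ Π*.sum-cong-≋ (λ j → factor-other (away j)) ⟨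
      Π*.sum (λ j → factor (elem (punchIn i₀ j)))  ≈⟨ *-identityˡ _ ⟨
      1# * Π*.sum (λ j → factor (elem (punchIn i₀ j)))  ≈⟨ *-congʳ (factor-zero (elem-index 0#)) ⟨
      factor (elem i₀) * Π*.sum (λ j → factor (elem (punchIn i₀ j)))  ≈⟨ Π*.sum-remove {i = i₀} (λ i → factor (elem i)) ⟨
      Π*.sum (λ i → factor (elem i))  ≈⟨ cancelled ⟩
      1# ∎
      where
      i₀ : Fin (suc n)
      i₀ = index 0#
      away : ∀ j → ¬ elem (punchIn i₀ j) ≈ 0#
      away j e = punchInᵢ≢i i₀ j (elem-injective _ _ (trans e (sym (elem-index 0#))))
      pick : ∀ {x} → Dec (x ≈ 0#) → Carrier → Carrier
      pick (yes _) y = 1#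
      pick (no _) y = y
      -- Zero contributes 1 to both products: `unitPart` turns the product over the field into that
      -- of the nonzero elements, and `factor` contributes `a` for each of these, which gives the
      -- exponent `Q - 1`.
      unitPart factor : Carrier → Carrier
      unitPart x = pick (x ≟ 0#) x
      factor x = pick (x ≟ 0#) a
      factor-zero : ∀ {x} → x ≈ 0# → factor x ≈ 1#
      factor-zero {x} x≈0 with x ≟ 0#
      ... | yes _ = refl
      ... | no x≉0 = ⊥-elim (x≉0 x≈0)
      factor-other : ∀ {x} → ¬ x ≈ 0# → factor x ≈ a
      factor-other {x} x≉0 with x ≟ 0#
      ... | yes x≈0 = ⊥-elim (x≉0 x≈0)
      ... | no _ = refl
      power : ∀ n → Π*.sum {n} (λ _ → a) ≈ a ^ n
      power zero = refl
      power (suc n) = *-congˡ (power n)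
      unit-cong : ∀ {x y} → x ≈ y → unitPart x ≈ unitPart y
      unit-cong {x} {y} e with x ≟ 0# | y ≟ 0#
      ... | yes _ | yes _ = refl
      ... | yes x≈0 | no y≉0 = ⊥-elim (y≉0 (trans (sym e) x≈0))
      ... | no x≉0 | yes y≈0 = ⊥-elim (x≉0 (trans e y≈0))
      ... | no _ | no _ = e
      unit-* : ∀ x → unitPart (a * x) ≈ factor x * unitPart x
      unit-* x with x ≟ 0# | (a * x) ≟ 0#
      ... | yes _ | yes _ = sym (*-identityˡ 1#)
      ... | yes x≈0 | no ax≉0 = ⊥-elim (ax≉0 (trans (*-congˡ x≈0) (zeroʳ a)))
      ... | no x≉0 | yes ax≈0 = ⊥-elim (x≉0 (*-cancel-0 a≉0 ax≈0))
      ... | no _ | no _ = refl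
      unit≉0 : ∀ x → ¬ unitPart x ≈ 0#
      unit≉0 x with x ≟ 0#
      ... | yes _ = 1≉0
      ... | no x≉0 = x≉0
      product≉0 : ∀ {k} (f : Fin k → Carrier) → (∀ i → ¬ f i ≈ 0#) → ¬ Π*.sum f ≈ 0#
      product≉0 {zero} f f≉0 = 1≉0
      product≉0 {suc k} f f≉0 = *-≉0 (f≉0 zero) (product≉0 (f ∘ suc) (f≉0 ∘ suc))
      scale : Permutation (suc n) (suc n)
      scale = elements (a *_) (recip a≉0 *_) *-congˡ *-congˡ
        (λ x → trans (sym (*-assoc _ _ _)) (trans (*-congʳ (*-recip a≉0)) (*-identityˡ x)))
        (λ x → trans (sym (*-assoc _ _ _)) (trans (*-congʳ (recip-* a≉0)) (*-identityˡ x)))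
      u : Carrier
      u = Π*.sum (λ i → unitPart (elem i))
      m : Carrier
      m = Π*.sum (λ i → factor (elem i))
      permuted : u ≈ m * u
      permuted = begin
        u  ≈⟨ Π*.sum-permute (λ i → unitPart (elem i)) scale ⟩
        Π*.sum (λ i → unitPart (elem (index (a * elem i))))
          ≈⟨ Π*.sum-cong-≋ (λ i → trans (unit-cong (elem-index _)) (unit-* (elem i))) ⟩
        Π*.sum (λ i → factor (elem i) * unitPart (elem i))  ≈⟨ Π*.∑-distrib-+ (λ i → factor (elem i)) (λ i → unitPart (elem i)) ⟩
        m * u ∎
      cancelled : m ≈ 1#
      cancelled = sym (x∙y⁻¹≈ε⇒x≈y _ _ (*-cancel-0 (product≉0 (λ i → unitPart (elem i)) (λ i → unit≉0 (elem i)))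
        (trans (solve 2 (λ u m → u :* (:1 :- m) ⊜ u :- m :* u) u m) (trans (+-congʳ permuted) (-‿inverseʳ _)))))

  opaque
    fermat′ : ∀ {n} → Q ≡ suc n → ∀ a → a ^ suc n ≈ a
    fermat′ Q≡ a with a ≟ 0#
    ... | yes a≈0 = trans (*-congʳ a≈0) (trans (zeroˡ _) (sym a≈0))
    ... | no a≉0 = trans (*-congˡ (fermat Q≡ a≉0)) (*-identityʳ a)

-- Polynomials as coefficient vectors.

module Polynomial {c ℓ} (R : CommutativeRing c ℓ) where
  open import Data.Vec using (Vec; []; _∷_; lookup; _∷ʳ_)
  open CommutativeRing R hiding (zero)
  open Multiples R
  open RingSolver R
  open Relation.Binary.Reasoning.Setoid setoid
  open Algebra.Properties.Ring ring using (x∙y⁻¹≈ε⇒x≈y)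

  eval : ∀ {n} → Vec Carrier n → Carrier → Carrier
  eval [] x = 0#
  eval (c ∷ v) x = c + x * eval v x

  opaque
    eval-∷ʳ : ∀ {n} (v : Vec Carrier n) c x → eval (v ∷ʳ c) x ≈ eval v x + x ^ n * c
    eval-∷ʳ [] c x = solve 2 (λ c x → c :+ x :* :0 ⊜ :0 :+ :1 :* c) c x
    eval-∷ʳ {suc n} (d ∷ v) c x = trans (+-congˡ (*-congˡ (eval-∷ʳ v c x)))
      (solve 5 (λ d x e p c → d :+ x :* (e :+ p :* c) ⊜ d :+ x :* e :+ x :* p :* c) d x (eval v x) (x ^ n) c)

  AllZero : ∀ {n} → Vec Carrier n → Set ℓ
  AllZero v = ∀ i → lookup v i ≈ 0#

  opaque
    eval-0 : ∀ {n} (v : Vec Carrier n) → AllZero v → ∀ x → eval v x ≈ 0#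
    eval-0 [] z x = refl
    eval-0 (c ∷ v) z x = trans (+-cong (z zero) (trans (*-congˡ (eval-0 v (z ∘ suc) x)) (zeroʳ x))) (+-identityʳ 0#)

  -- Synthetic division by `x - b`: the entries are the partial values of Horner's scheme at `b`.
  quotient : ∀ {n} → Carrier → Vec Carrier (suc n) → Vec Carrier n
  quotient {zero} b (c ∷ []) = []
  quotient {suc n} b (c ∷ v) = eval v b ∷ quotient b v

  opaque
    eval-quotient : ∀ {n} b (v : Vec Carrier (suc n)) x → eval v x ≈ eval v b + (x - b) * eval (quotient b v) x
    eval-quotient {zero} b (c ∷ []) x = solve 3 (λ c x b → c :+ x :* :0 ⊜ c :+ b :* :0 :+ (x :- b) :* :0) c x b
    eval-quotient {suc n} b (c ∷ v) x = trans (+-congˡ (*-congˡ (eval-quotient b v x)))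
      (solve 5 (λ c x b e k → c :+ x :* (e :+ (x :- b) :* k) ⊜ c :+ b :* e :+ (x :- b) :* (e :+ x :* k)) c x b (eval v b) (eval (quotient b v) x))

  opaque
    quotient-0 : ∀ {n} b (v : Vec Carrier (suc n)) → eval v b ≈ 0# → AllZero (quotient b v) → AllZero v
    quotient-0 {zero} b (c ∷ []) vb z zero = trans (solve 2 (λ c b → c ⊜ c :+ b :* :0) c b) vb
    quotient-0 {suc n} b (c ∷ v) vb z = λ
      { zero → trans (solve 3 (λ c b e → c ⊜ (c :+ b :* e) :- b :* e) c b (eval v b))
          (trans (+-cong vb (-‿cong (trans (*-congˡ (z zero)) (zeroʳ b)))) (solve 0 (:0 :- :0 ⊜ :0)))
      ; (suc i) → quotient-0 b v (z zero) (z ∘ suc) i }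

  opaque
    -- A vector of length `n` stands for degree below `n`, so `n` distinct roots are too many; each
    -- step divides by the linear factor of one root.
    roots⇒0 : (∀ {x y} → ¬ x ≈ 0# → x * y ≈ 0# → y ≈ 0#) → ∀ {n} (r : Fin n → Carrier) → (∀ {i j} → r i ≈ r j → i ≡ j) →
      (v : Vec Carrier n) → (∀ i → eval v (r i) ≈ 0#) → AllZero v
    roots⇒0 domain {zero} r r-inj [] v0 ()
    roots⇒0 domain {suc n} r r-inj v v0 = quotient-0 (r zero) v (v0 zero)
      (roots⇒0 domain (r ∘ suc) (λ e → case-suc (r-inj e)) (quotient (r zero) v) λ i →
        domain (λ e → 0≢suc (r-inj (sym (x∙y⁻¹≈ε⇒x≈y _ _ e)))) (begin
          (r (suc i) - r zero) * eval (quotient (r zero) v) (r (suc i))  ≈⟨ solve 2 (λ a b → b ⊜ (a :+ b) :- a) (eval v (r zero)) _ ⟩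
          (eval v (r zero) + (r (suc i) - r zero) * eval (quotient (r zero) v) (r (suc i))) - eval v (r zero)
            ≈⟨ +-cong (trans (sym (eval-quotient (r zero) v (r (suc i)))) (v0 (suc i))) (-‿cong (v0 zero)) ⟩
          0# - 0#  ≈⟨ -‿inverseʳ 0# ⟩
          0# ∎))
      where
      case-suc : ∀ {n} {i j : Fin n} → Fin.suc i ≡ suc j → i ≡ j
      case-suc ≡.refl = ≡.refl
      0≢suc : ∀ {i : Fin n} → ¬ Fin.zero ≡ suc i
      0≢suc ()

-- Embedding a finite field in another of the same order.

module Embeddings {c ℓ κ μ} (E : CommutativeRing c ℓ) (isFieldE : LinAlg.IsField E) (K : CommutativeRing κ μ) (isFieldK : LinAlg.IsField K)
  {n : ℕ} (cardE : LinAlg.HasCard E (suc (suc n))) (cardK : LinAlg.HasCard K (suc (suc n)))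
  (char : ∀ m → CommutativeRing._≈_ E (Multiples.nat E m) (CommutativeRing.0# E) → CommutativeRing._≈_ K (Multiples.nat K m) (CommutativeRing.0# K)) where
  open import Data.Vec using (Vec; []; _∷_; map; replicate; zipWith; tabulate; lookup; _∷ʳ_; initLast)
  open CommutativeRing E hiding (zero)
  module K = CommutativeRing K
  open K using () renaming (Carrier to 𝕂; _≈_ to _≋_; _+_ to _⊞_; _*_ to _⊠_; -_ to ⊟_; 0# to 𝟘; 1# to 𝟙)
  open Fermat E isFieldE cardE
  module KF = Fermat K isFieldK cardK
  module P = Polynomial E
  module KP = Polynomial K
  open RingSolver E
  module S = RingSolver K
  open Relation.Binary.Reasoning.Setoid setoid

  Q : ℕ
  Q = suc (suc n)

  -- A subring of E × K which is the graph of a ring homomorphism from a subring of E to K.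
  record Graph : Set (c ⊔ ℓ ⊔ κ ⊔ μ) where
    field
      size : ℕ
      e : Fin size → Carrier
      f : Fin size → 𝕂
    infix 4 _↦_
    _↦_ : Carrier → 𝕂 → Set (ℓ ⊔ μ)
    a ↦ b = ∃ λ i → e i ≈ a × f i ≋ b
    field
      ↦-0 : 0# ↦ 𝟘
      ↦-1 : 1# ↦ 𝟙
      ↦-+ : ∀ i j → e i + e j ↦ f i ⊞ f j
      ↦-* : ∀ i j → e i * e j ↦ f i ⊠ f j
      ↦-neg : ∀ i → - e i ↦ ⊟ f i
      functional : ∀ i → e i ≈ 0# → f i ≋ 𝟘

  module InGraph (G : Graph) where
    open Graph G public

    opaque
      resp : ∀ {a a' b b'} → a ≈ a' → b ≋ b' → a ↦ b → a' ↦ b'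
      resp p r (i , x , y) = i , trans x p , K.trans y r

    opaque
      plus : ∀ {a a' b b'} → a ↦ b → a' ↦ b' → a + a' ↦ b ⊞ b'
      plus (i , x , y) (j , x' , y') = resp (+-cong x x') (K.+-cong y y') (↦-+ i j)

    opaque
      times : ∀ {a a' b b'} → a ↦ b → a' ↦ b' → a * a' ↦ b ⊠ b'
      times (i , x , y) (j , x' , y') = resp (*-cong x x') (K.*-cong y y') (↦-* i j)

    opaque
      minus : ∀ {a b} → a ↦ b → - a ↦ ⊟ b
      minus (i , x , y) = resp (-‿cong x) (K.-‿cong y) (↦-neg i)

    opaque
      power : ∀ {a b} m → a ↦ b → (a ^ m) ↦ (b KF.^ m)
      power zero p = ↦-1
      power (suc m) p = times p (power m p)

    opaque
      to-0 : ∀ {a b} → a ↦ b → a ≈ 0# → b ≋ 𝟘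
      to-0 (i , x , y) a≈0 = K.trans (K.sym y) (functional i (trans x a≈0))

    opaque
      unique : ∀ {a b b'} → a ↦ b → a ↦ b' → b ≋ b'
      unique p r = KF.x∙y⁻¹≈ε⇒x≈y _ _ (to-0 (plus p (minus r)) (-‿inverseʳ _))

    -- Otherwise a suitable power would show (1, 0), hence (0, -1), to be in the graph.
    opaque
      injective : ∀ {a b} → a ↦ b → b ≋ 𝟘 → a ≈ 0#
      injective {a} {b} p b≈0 = decidable-stable (a ≟ 0#) λ a≉0 → KF.1≉0 (K.trans
        (S.solve 1 (λ x → :1 ⊜ x :- (x :+ :- :1)) 𝟘) (K.trans (K.+-congˡ (K.-‿cong (to-0
          (plus (resp (fermat ≡.refl a≉0) (K.trans (K.*-congʳ b≈0) (K.zeroˡ _)) (power (suc n) p)) (minus ↦-1)) (-‿inverseʳ 1#))))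
          (S.solve 0 (:0 :- :0 ⊜ :0))))

  -- Every `β` of `K` is a candidate for the image of `α`. It is admissible if each polynomial over
  -- the graph that vanishes at `α` vanishes, with transported coefficients, at `β`; this plays the
  -- role of a root of the transported minimal polynomial.
  module Adjoin (G : Graph) (α : Carrier) where
    open InGraph G

    Coefs : Set
    Coefs = Vec (Fin size) Q

    valE : ∀ {m} → Vec (Fin size) m → Carrier
    valE v = P.eval (map e v) α

    valK : ∀ {m} → Vec (Fin size) m → 𝕂 → 𝕂
    valK v = KP.eval (map f v)

    -- g is the function on K of a polynomial over the graph of degree below Q whose value at α is a.
    Rep : Carrier → (𝕂 → 𝕂) → Set (ℓ ⊔ κ ⊔ μ)
    Rep a g = ∃ λ (v : Coefs) → valE v ≈ a × (∀ β → valK v β ≋ g β)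

    opaque
      rep-resp : ∀ {a a' g g'} → a ≈ a' → (∀ β → g β ≋ g' β) → Rep a g → Rep a' g'
      rep-resp p r (v , x , y) = v , trans x p , λ β → K.trans (y β) (r β)

    zeros : ∀ m → Vec (Fin size) m
    zeros m = replicate m (proj₁ ↦-0)

    opaque
      zerosE : ∀ m → valE (zeros m) ≈ 0#
      zerosE zero = refl
      zerosE (suc m) = trans (+-cong (proj₁ (proj₂ ↦-0)) (trans (*-congˡ (zerosE m)) (zeroʳ α))) (+-identityʳ 0#)

    opaque
      zerosK : ∀ m β → valK (zeros m) β ≋ 𝟘
      zerosK zero β = K.refl
      zerosK (suc m) β = K.trans (K.+-cong (proj₂ (proj₂ ↦-0)) (K.trans (K.*-congˡ (zerosK m β)) (K.zeroʳ β))) (K.+-identityʳ 𝟘)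

    opaque
      rep-const : ∀ {a b} → a ↦ b → Rep a (λ _ → b)
      rep-const (i , x , y) = i ∷ zeros (suc n) , trans (+-cong x (trans (*-congˡ (zerosE (suc n))) (zeroʳ α))) (+-identityʳ _) ,
        λ β → K.trans (K.+-cong y (K.trans (K.*-congˡ (zerosK (suc n) β)) (K.zeroʳ β))) (K.+-identityʳ _)

    addV : ∀ {m} → Vec (Fin size) m → Vec (Fin size) m → Vec (Fin size) m
    addV = zipWith (λ i j → proj₁ (↦-+ i j))

    opaque
      addE : ∀ {m} (v w : Vec (Fin size) m) → valE (addV v w) ≈ valE v + valE w
      addE [] [] = sym (+-identityʳ 0#)
      addE (i ∷ v) (j ∷ w) = trans (+-cong (proj₁ (proj₂ (↦-+ i j))) (*-congˡ (addE v w)))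
        (solve 5 (λ a b x p q → (a :+ b) :+ x :* (p :+ q) ⊜ (a :+ x :* p) :+ (b :+ x :* q)) _ _ α _ _)

    opaque
      addK : ∀ {m} (v w : Vec (Fin size) m) β → valK (addV v w) β ≋ valK v β ⊞ valK w β
      addK [] [] β = K.sym (K.+-identityʳ 𝟘)
      addK (i ∷ v) (j ∷ w) β = K.trans (K.+-cong (proj₂ (proj₂ (↦-+ i j))) (K.*-congˡ (addK v w β)))
        (S.solve 5 (λ a b x p q → (a :+ b) :+ x :* (p :+ q) ⊜ (a :+ x :* p) :+ (b :+ x :* q)) _ _ β _ _)

    opaque
      rep-+ : ∀ {a a' g g'} → Rep a g → Rep a' g' → Rep (a + a') (λ β → g β ⊞ g' β)
      rep-+ (v , x , y) (w , x' , y') = addV v w , trans (addE v w) (+-cong x x') , λ β → K.trans (addK v w β) (K.+-cong (y β) (y' β))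

    scaleV : ∀ {m} → Fin size → Vec (Fin size) m → Vec (Fin size) m
    scaleV i = map (λ j → proj₁ (↦-* i j))

    opaque
      scaleE : ∀ {m} i (v : Vec (Fin size) m) → valE (scaleV i v) ≈ e i * valE v
      scaleE i [] = sym (zeroʳ _)
      scaleE i (j ∷ v) = trans (+-cong (proj₁ (proj₂ (↦-* i j))) (*-congˡ (scaleE i v)))
        (solve 4 (λ a b x p → a :* b :+ x :* (a :* p) ⊜ a :* (b :+ x :* p)) _ _ α _)

    opaque
      scaleK : ∀ {m} i (v : Vec (Fin size) m) β → valK (scaleV i v) β ≋ f i ⊠ valK v β
      scaleK i [] β = K.sym (K.zeroʳ _)
      scaleK i (j ∷ v) β = K.trans (K.+-cong (proj₂ (proj₂ (↦-* i j))) (K.*-congˡ (scaleK i v β)))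
        (S.solve 4 (λ a b x p → a :* b :+ x :* (a :* p) ⊜ a :* (b :+ x :* p)) _ _ β _)

    opaque
      rep-scale : ∀ {a b a' g} → a ↦ b → Rep a' g → Rep (a * a') (λ β → b ⊠ g β)
      rep-scale (i , x , y) (v , x' , y') = scaleV i v , trans (scaleE i v) (*-cong x x') , λ β → K.trans (scaleK i v β) (K.*-cong y (y' β))

    opaque
      map-∷ʳ : ∀ {a b} {A : Set a} {B : Set b} (h : A → B) {m} (v : Vec A m) c → map h (v ∷ʳ c) ≡ map h v ∷ʳ h c
      map-∷ʳ h [] c = ≡.refl
      map-∷ʳ h (x ∷ v) c = ≡.cong (h x ∷_) (map-∷ʳ h v c)

    -- The top coefficient is folded using x ^ Q = x, valid on both fields.
    opaque
      rep-x* : ∀ {a g} → Rep a g → Rep (α * a) (λ β → β ⊠ g β)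
      rep-x* {a} {g} (v , x , y) with initLast v
      ... | w , i , ≡.refl = rep-resp
          (begin
            (e o + α * valE w) + (e o + α * (e i + α * valE (zeros n)))
              ≈⟨ +-cong (+-congʳ (proj₁ (proj₂ ↦-0))) (+-cong (proj₁ (proj₂ ↦-0)) (*-congˡ (+-congˡ (*-congˡ (zerosE n))))) ⟩
            (0# + α * valE w) + (0# + α * (e i + α * 0#))  ≈⟨ solve 3 (λ w a i → (:0 :+ a :* w) :+ (:0 :+ a :* (i :+ a :* :0)) ⊜ a :* w :+ a :* i) (valE w) α (e i) ⟩
            α * valE w + α * e i  ≈⟨ +-congˡ (*-congʳ (fermat′ ≡.refl α)) ⟨
            α * valE w + α ^ Q * e i  ≈⟨ solve 4 (λ w a i p → a :* w :+ a :* p :* i ⊜ a :* (w :+ p :* i)) (valE w) α (e i) (α ^ suc n) ⟩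
            α * (valE w + α ^ suc n * e i)  ≈⟨ *-congˡ (P.eval-∷ʳ (map e w) (e i) α) ⟨
            α * P.eval (map e w ∷ʳ e i) α  ≈⟨ *-congˡ (reflexive (≡.cong (λ v → P.eval v α) (map-∷ʳ e w i))) ⟨
            α * valE (w ∷ʳ i)  ≈⟨ *-congˡ x ⟩
            α * a ∎)
          (λ β → K.trans (K.+-cong (K.+-congʳ (proj₂ (proj₂ ↦-0))) (K.+-cong (proj₂ (proj₂ ↦-0)) (K.*-congˡ (K.+-congˡ (K.*-congˡ (zerosK n β))))))
            (K.trans (S.solve 3 (λ w a i → (:0 :+ a :* w) :+ (:0 :+ a :* (i :+ a :* :0)) ⊜ a :* w :+ a :* i) (valK w β) β (f i))
            (K.trans (K.+-congˡ (K.*-congʳ (K.sym (KF.fermat′ ≡.refl β))))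
            (K.trans (S.solve 4 (λ w a i p → a :* w :+ a :* p :* i ⊜ a :* (w :+ p :* i)) (valK w β) β (f i) (β KF.^ suc n))
            (K.*-congˡ (K.trans (K.sym (KP.eval-∷ʳ (map f w) (f i) β)) (K.trans (K.reflexive (≡.cong (λ v → KP.eval v β) (≡.sym (map-∷ʳ f w i)))) (y β))))))))
          ((addV (o ∷ w) (o ∷ i ∷ zeros n)) , addE (o ∷ w) (o ∷ i ∷ zeros n) , addK (o ∷ w) (o ∷ i ∷ zeros n))
        where
        o : Fin size
        o = proj₁ ↦-0

    opaque
      rep-*-vec : ∀ {a g m} (v : Vec (Fin size) m) → Rep a g → Rep (valE v * a) (λ β → valK v β ⊠ g β)
      rep-*-vec [] r = rep-resp (sym (zeroˡ _)) (λ β → K.sym (K.zeroˡ _)) (rep-const ↦-0)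
      rep-*-vec {a} {g} (i ∷ v) r = rep-resp
        (solve 4 (λ e a x p → e :* a :+ x :* (p :* a) ⊜ (e :+ x :* p) :* a) (e i) a α (valE v))
        (λ β → S.solve 4 (λ e a x p → e :* a :+ x :* (p :* a) ⊜ (e :+ x :* p) :* a) (f i) (g β) β (valK v β))
        (rep-+ (rep-scale (i , refl , K.refl) r) (rep-x* (rep-*-vec v r)))

    opaque
      rep-* : ∀ {a a' g g'} → Rep a g → Rep a' g' → Rep (a * a') (λ β → g β ⊠ g' β)
      rep-* (v , x , y) r = rep-resp (*-congʳ x) (λ β → K.*-congʳ (y β)) (rep-*-vec v r)

    opaque
      rep-neg : ∀ {a g} → Rep a g → Rep (- a) (λ β → ⊟ g β)
      rep-neg r = rep-resp (solve 1 (λ a → (:- :1) :* a ⊜ :- a) _) (λ β → S.solve 1 (λ a → (:- :1) :* a ⊜ :- a) _)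
        (rep-scale (minus ↦-1) r)

    opaque
      rep-pow : ∀ {a g} m → Rep a g → Rep (a ^ m) (λ β → g β KF.^ m)
      rep-pow zero r = rep-const ↦-1
      rep-pow (suc m) r = rep-* r (rep-pow m r)

    poly : Fin (size ℕ.^ Q) → Coefs
    poly i = tabulate (finToFun i)

    opaque
      poly-index : ∀ v → ∃ λ i → poly i ≡ v
      poly-index v = funToFin (lookup v) , ≡.trans (tabulate-cong (finToFun-funToFin (lookup v))) (tabulate∘lookup v)

    module At (β : 𝕂) where
      e' : Fin (size ℕ.^ Q) → Carrier
      e' i = valE (poly i)
      f' : Fin (size ℕ.^ Q) → 𝕂
      f' i = valK (poly i) β

      Functional : Set (ℓ ⊔ μ)
      Functional = ∀ i → e' i ≈ 0# → f' i ≋ 𝟘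

      opaque
        functional? : Dec Functional
        functional? = all? (λ i → (e' i ≟ 0#) →-dec (f' i KF.≟ 𝟘))

      opaque
        find : ∀ {a g} → Rep a g → ∃ λ i → e' i ≈ a × f' i ≋ g β
        find (v , x , y) with poly-index v
        ... | i , ≡.refl = i , x , y β

      rep : ∀ i → Rep (e' i) (valK (poly i))
      rep i = poly i , refl , λ _ → K.refl

      adjoin : Functional → Graph
      adjoin fun = record { size = size ℕ.^ Q ; e = e' ; f = f' ; ↦-0 = find (rep-const ↦-0) ; ↦-1 = find (rep-const ↦-1)
        ; ↦-+ = λ i j → find (rep-+ (rep i) (rep j)) ; ↦-* = λ i j → find (rep-* (rep i) (rep j))
        ; ↦-neg = λ i → find (rep-neg (rep i)) ; functional = fun }

      opaque
        bad : ¬ Functional → ∃ λ g → Rep 0# g × ¬ g β ≋ 𝟘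
        bad n with ¬∀⟶∃¬ _ _ (λ i → (e' i ≟ 0#) →-dec (f' i KF.≟ 𝟘)) n
        ... | i , ni with e' i ≟ 0# | f' i KF.≟ 𝟘
        ... | yes ei≈0 | no fi≉0 = valK (poly i) , rep-resp ei≈0 (λ _ → K.refl) (rep i) , fi≉0
        ... | _ | yes fi≈0 = ⊥-elim (ni λ _ → fi≈0)
        ... | no ei≉0 | _ = ⊥-elim (ni (⊥-elim ∘ ei≉0))

    -- Polynomials vanishing at α but not at β₁, …, βₘ combine to one with values 0 and 1, and 1 at all βⱼ.
    opaque
      separate : ∀ {m} (b : Fin m → 𝕂) → (∀ j → ∃ λ g → Rep 0# g × ¬ g (b j) ≋ 𝟘) →
        ∃ λ g → Rep 0# g × (∀ β → g β ≋ 𝟘 ⊎ g β ≋ 𝟙) × (∀ j → g (b j) ≋ 𝟙)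
      separate {zero} b bads = (λ _ → 𝟘) , rep-const ↦-0 , (λ β → inj₁ K.refl) , λ ()
      separate {suc m} b bads with separate (b ∘ suc) (bads ∘ suc) | bads zero
      ... | g , rg , 01-g , g1 | k , rk , k≉0 = u , ru , 01-u , at
        where
        k' u : 𝕂 → 𝕂
        -- By Fermat the exponent `Q - 1` turns nonzero values into 1, and `g + k' - g k'` is the
        -- disjunction of functions with values 0 and 1.
        k' β = k β KF.^ suc n
        u β = (g β ⊞ k' β) ⊞ (⊟ (g β ⊠ k' β))
        ru : Rep 0# u
        ru = rep-resp (trans (+-cong (+-cong refl zero-pow) (-‿cong (zeroˡ _))) (solve 0 (:0 :+ :0 :+ (:- :0) ⊜ :0))) (λ β → K.refl)
          (rep-+ (rep-+ rg (rep-pow (suc n) rk)) (rep-neg (rep-* rg (rep-pow (suc n) rk))))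
          where
          zero-pow : 0# ^ suc n ≈ 0#
          zero-pow = zeroˡ _
        k'-1 : ∀ {β} → ¬ k β ≋ 𝟘 → k' β ≋ 𝟙
        k'-1 = KF.fermat ≡.refl
        k'-01 : ∀ β → k' β ≋ 𝟘 ⊎ k' β ≋ 𝟙
        k'-01 β with k β KF.≟ 𝟘
        ... | yes e = inj₁ (K.trans (K.*-congʳ e) (K.zeroˡ _))
        ... | no n = inj₂ (k'-1 n)
        u-1ˡ : ∀ {β} → g β ≋ 𝟙 → u β ≋ 𝟙
        u-1ˡ e = K.trans (K.+-cong (K.+-congʳ e) (K.-‿cong (K.*-congʳ e))) (S.solve 1 (λ k → (:1 :+ k) :+ (:- (:1 :* k)) ⊜ :1) _)
        u-1ʳ : ∀ {β} → k' β ≋ 𝟙 → u β ≋ 𝟙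
        u-1ʳ e = K.trans (K.+-cong (K.+-congˡ e) (K.-‿cong (K.*-congˡ e))) (S.solve 1 (λ k → (k :+ :1) :+ (:- (k :* :1)) ⊜ :1) _)
        01-u : ∀ β → u β ≋ 𝟘 ⊎ u β ≋ 𝟙
        01-u β with 01-g β | k'-01 β
        ... | inj₂ e | _ = inj₂ (u-1ˡ e)
        ... | _ | inj₂ e = inj₂ (u-1ʳ e)
        ... | inj₁ e | inj₁ e' = inj₁ (K.trans (K.+-cong (K.+-cong e e') (K.-‿cong (K.*-cong e e'))) (S.solve 0 (:0 :+ :0 :+ (:- (:0 :* :0)) ⊜ :0)))
        at : ∀ j → u (b j) ≋ 𝟙
        at zero = u-1ʳ (k'-1 k≉0)
        at (suc j) = u-1ˡ (g1 j)

    -- A polynomial of degree below Q which is constant 1 on K is the polynomial 1.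
    opaque
      not-all-bad : ¬ (∀ j → ¬ At.Functional (KF.elem j))
      not-all-bad bads with separate KF.elem (λ j → At.bad (KF.elem j) (bads j))
      ... | g , rg , _ , g1 with rep-+ rg (rep-neg (rep-const ↦-1))
      ... | v , vE , vK = 1≉0 (trans (solve 0 (:1 ⊜ :- (:0 :- :1))) (trans (-‿cong (trans (sym vE) (P.eval-0 (map e v) coefE α))) -0#≈0#))
        where
        lookup-map : ∀ {a b} {A : Set a} {B : Set b} (h : A → B) {m} (v : Vec A m) i → lookup (map h v) i ≡ h (lookup v i)
        lookup-map h (x ∷ v) zero = ≡.refl
        lookup-map h (x ∷ v) (suc i) = lookup-map h v i
        coefK : KP.AllZero (map f v)
        coefK = KP.roots⇒0 KF.*-cancel-0 KF.elem (KF.elem-injective _ _) (map f v)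
          (λ j → K.trans (vK (KF.elem j)) (K.trans (K.+-congʳ (g1 j)) (K.-‿inverseʳ 𝟙)))
        coefE : P.AllZero (map e v)
        coefE i = trans (reflexive (lookup-map e v i)) (injective (lookup v i , refl , K.refl)
          (K.trans (K.reflexive (≡.sym (lookup-map f v i))) (coefK i)))

    opaque
      extend : ∃ λ G' → (∃ λ β → Graph._↦_ G' α β) × (∀ {a b} → a ↦ b → Graph._↦_ G' a b)
      extend with any? (λ j → At.functional? (KF.elem j))
      ... | no none = ⊥-elim (not-all-bad (λ j fun → none (j , fun)))
      ... | yes (j , fun) = At.adjoin β fun , (β , At.find β (rep-resp (*-identityʳ α) (λ β → K.*-identityʳ β) (rep-x* (rep-const ↦-1)))) ,
          λ p → At.find β (rep-const p)
        where
        β : 𝕂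
        β = KF.elem j

  opaque
    -- `Q` times 1 is 0 in both fields, so `m` can be reduced modulo `Q`; this keeps the prime graph
    -- finite.
    natural-index : ∀ m → ∃ λ (i : Fin Q) → nat (toℕ i) ≈ nat m × KF.nat (toℕ i) ≋ KF.nat m
    natural-index m = fromℕ< (m%n<n m Q) , reduceE , reduceK
      where
      r : toℕ (fromℕ< (m%n<n m Q)) ≡ m % Q
      r = toℕ-fromℕ< (m%n<n m Q)
      reduceE : nat (toℕ (fromℕ< (m%n<n m Q))) ≈ nat m
      reduceE = begin
        nat (toℕ (fromℕ< (m%n<n m Q)))  ≈⟨ ×-congˡ r ⟩
        nat (m % Q)  ≈⟨ +-identityʳ _ ⟨
        nat (m % Q) + 0#  ≈⟨ +-congˡ (nat-*-0 (m / Q) card·1≈0) ⟨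
        nat (m % Q) + nat ((m / Q) ℕ.* Q)  ≈⟨ ×-homo-+ 1# (m % Q) _ ⟨
        nat (m % Q ℕ.+ (m / Q) ℕ.* Q)  ≈⟨ ×-congˡ (≡.sym (m≡m%n+[m/n]*n m Q)) ⟩
        nat m ∎
      reduceK : KF.nat (toℕ (fromℕ< (m%n<n m Q))) ≋ KF.nat m
      reduceK = K.trans (KF.×-congˡ r) (K.trans (K.sym (K.+-identityʳ _)) (K.trans (K.+-congˡ (K.sym (KF.nat-*-0 (m / Q) KF.card·1≈0)))
        (K.trans (K.sym (KF.×-homo-+ 𝟙 (m % Q) _)) (KF.×-congˡ (≡.sym (m≡m%n+[m/n]*n m Q))))))

  opaque
    -- The start of the extension process: equal multiples of 1 correspond, and `char` makes the
    -- correspondence functional.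
    prime-graph : Graph
    prime-graph = record
      { size = Q ; e = λ i → nat (toℕ i) ; f = λ i → KF.nat (toℕ i)
      ; ↦-0 = natural-index 0
      ; ↦-1 = let i , x , y = natural-index 1 in i , trans x (+-identityʳ 1#) , K.trans y (K.+-identityʳ 𝟙)
      ; ↦-+ = λ i j → let l , x , y = natural-index (toℕ i ℕ.+ toℕ j) in
          l , trans x (×-homo-+ 1# (toℕ i) (toℕ j)) , K.trans y (KF.×-homo-+ 𝟙 (toℕ i) (toℕ j))
      ; ↦-* = λ i j → let l , x , y = natural-index (toℕ i ℕ.* toℕ j) in
          l , trans x (×1-homo-* (toℕ i) (toℕ j)) , K.trans y (KF.×1-homo-* (toℕ i) (toℕ j))
      ; ↦-neg = λ i → let l , x , y = natural-index (Q ℕ.∸ toℕ i) in l ,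
          trans x (negE {Q ℕ.∸ toℕ i} {toℕ i} (ℕ.m∸n+n≡m (ℕ.<⇒≤ (toℕ<n i)))) , K.trans y (negK {Q ℕ.∸ toℕ i} {toℕ i} (ℕ.m∸n+n≡m (ℕ.<⇒≤ (toℕ<n i))))
      ; functional = λ i → char (toℕ i) }
      where
      negE : ∀ {a b} → a ℕ.+ b ≡ Q → nat a ≈ - nat b
      negE {a} {b} e = x∙y⁻¹≈ε⇒x≈y _ _ (trans (solve 2 (λ a b → a :- :- b ⊜ a :+ b) (nat a) (nat b))
        (trans (sym (×-homo-+ 1# a b)) (trans (×-congˡ e) card·1≈0)))
      negK : ∀ {a b} → a ℕ.+ b ≡ Q → KF.nat a ≋ ⊟ KF.nat b
      negK {a} {b} e = KF.x∙y⁻¹≈ε⇒x≈y _ _ (K.trans (S.solve 2 (λ a b → a :- :- b ⊜ a :+ b) (KF.nat a) (KF.nat b))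
        (K.trans (K.sym (KF.×-homo-+ 𝟙 a b)) (K.trans (KF.×-congˡ e) KF.card·1≈0)))

  opaque
    covering : ∀ {m} (a : Fin m → Carrier) → ∃ λ G → ∀ j → ∃ λ b → Graph._↦_ G (a j) b
    covering {zero} a = prime-graph , λ ()
    covering {suc m} a with covering (a ∘ suc)
    ... | G , covers with Adjoin.extend G (a zero)
    ... | G' , new , old = G' , λ { zero → new ; (suc j) → proj₁ (covers j) , old (proj₂ (covers j)) }

  record Hom : Set (c ⊔ ℓ ⊔ κ ⊔ μ) where
    field
      φ : Carrier → 𝕂
      φ-cong : ∀ {a b} → a ≈ b → φ a ≋ φ b
      φ-+ : ∀ a b → φ (a + b) ≋ φ a ⊞ φ b
      φ-* : ∀ a b → φ (a * b) ≋ φ a ⊠ φ b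
      φ-0 : φ 0# ≋ 𝟘
      φ-1 : φ 1# ≋ 𝟙
      φ-injective : ∀ {a} → φ a ≋ 𝟘 → a ≈ 0#

  opaque
    hom : Hom
    hom with covering elem
    ... | G , covers = record { φ = φ ; φ-cong = λ {a} {b} e → unique (graph a) (resp (sym e) K.refl (graph b))
        ; φ-+ = λ a b → unique (graph (a + b)) (plus (graph a) (graph b)) ; φ-* = λ a b → unique (graph (a * b)) (times (graph a) (graph b))
        ; φ-0 = unique (graph 0#) ↦-0 ; φ-1 = unique (graph 1#) ↦-1 ; φ-injective = λ {a} → injective (graph a) }
      where
      open InGraph G
      φ : Carrier → 𝕂
      φ a = proj₁ (covers (index a))
      graph : ∀ a → a ↦ φ a
      graph a = resp (elem-index a) K.refl (proj₂ (covers (index a)))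

-- The characteristic of a finite field.

module Characteristic {c ℓ} (R : CommutativeRing c ℓ) (isField : LinAlg.IsField R) {Q : ℕ} (card : LinAlg.HasCard R Q) where
  open CommutativeRing R hiding (zero)
  open Fermat R isField card
  open RingSolver R

  opaque
    -- The `k`-th power of `nat p` is `nat Q = 0`, and a field has no nilpotent elements other than
    -- 0.
    prime·1≈0 : ∀ p k → Q ≡ p ℕ.^ k → nat p ≈ 0#
    prime·1≈0 p k e = root k (trans (sym (nat-^ p k)) (trans (×-congˡ (≡.sym e)) card·1≈0))
      where
      root : ∀ k → nat p ^ k ≈ 0# → nat p ≈ 0#
      root zero e = ⊥-elim (1≉0 e)
      root (suc k) e = [ id , root k ] (zero-product (nat p) (nat p ^ k) e)

  -- A nonzero remainder of `m` modulo `p` is coprime to `p`, and a Bézout relation between the two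
  -- would give `1 = 0`.
  annihilates⇒divides : ∀ {p} → Prime p → nat p ≈ 0# → ∀ m → nat m ≈ 0# → p ∣ m
  annihilates⇒divides {p} pr p0 m m0 = case (m % p) ≡.refl
    where
    instance nz = prime⇒nonZero pr
    r0 : nat (m % p) ≈ 0#
    r0 = trans (solve 2 (λ a b → a ⊜ (a :+ b) :- b) (nat (m % p)) (nat ((m / p) ℕ.* p))) (trans (+-cong
      (trans (sym (×-homo-+ 1# (m % p) _)) (trans (×-congˡ (≡.sym (m≡m%n+[m/n]*n m p))) m0)) (-‿cong (nat-*-0 (m / p) p0))) (-‿inverseʳ 0#))
    one : ∀ {a b} → nat a ≈ 0# → nat b ≈ 0# → 1 ℕ.+ a ≡ b → ⊥
    one {a} {b} a0 b0 e = 1≉0 (trans (sym (+-identityʳ 1#)) (trans (+-congˡ (sym a0)) (trans (×-congˡ e) b0)))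
    case : ∀ r → m % p ≡ r → p ∣ m
    case zero e = m%n≡0⇒n∣m m p e
    case (suc r) e with coprime-Bézout (prime⇒coprime pr (≡.subst (_< p) e (m%n<n m p)))
    ... | Bézout.+- x y eq' = ⊥-elim (one (nat-*-0 y (trans (×-congˡ (≡.sym e)) r0)) (nat-*-0 x p0) eq')
    ... | Bézout.-+ x y eq' = ⊥-elim (one (nat-*-0 x p0) (nat-*-0 y (trans (×-congˡ (≡.sym e)) r0)) eq')

-- The quadratic extension F(√ε).

module Quadratic {c ℓ} (F : CommutativeRing c ℓ) (isField : LinAlg.IsField F) {q : ℕ} (card : LinAlg.HasCard F q)
  (ε : CommutativeRing.Carrier F)
  (nonsquare : ∀ m → ¬ CommutativeRing._≈_ F (CommutativeRing._*_ F m m) ε) where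
  open CommutativeRing F
  open FieldLA F isField card
  open RingSolver F
  open Relation.Binary.Reasoning.Setoid setoid

  F[√ε] : CommutativeRing c ℓ
  F[√ε] = record
    { Carrier = Carrier × Carrier
    ; _≈_ = λ (a , b) (a' , b') → a ≈ a' × b ≈ b'
    ; _+_ = λ (a , b) (a' , b') → a + a' , b + b'
    ; _*_ = λ (a , b) (a' , b') → a * a' + ε * (b * b') , a * b' + b * a'
    ; -_ = λ (a , b) → - a , - b
    ; 0# = 0# , 0#
    ; 1# = 1# , 0#
    ; isCommutativeRing = record
      { isRing = record
        { +-isAbelianGroup = record
          { isGroup = record
            { isMonoid = record
              { isSemigroup = record
                { isMagma = record
                  { isEquivalence = record
                    { refl = refl , refl ; sym = λ (p , r) → sym p , sym r ; trans = λ (p , r) (p' , r') → trans p p' , trans r r' }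
                  ; ∙-cong = λ (p , r) (p' , r') → +-cong p p' , +-cong r r' }
                ; assoc = λ _ _ _ → +-assoc _ _ _ , +-assoc _ _ _ }
              ; identity = (λ _ → +-identityˡ _ , +-identityˡ _) , λ _ → +-identityʳ _ , +-identityʳ _ }
            ; inverse = (λ _ → -‿inverseˡ _ , -‿inverseˡ _) , λ _ → -‿inverseʳ _ , -‿inverseʳ _
            ; ⁻¹-cong = λ (p , r) → -‿cong p , -‿cong r }
          ; comm = λ _ _ → +-comm _ _ , +-comm _ _ }
        ; *-cong = λ (p , r) (p' , r') → +-cong (*-cong p p') (*-congˡ (*-cong r r')) , +-cong (*-cong p r') (*-cong r p')
        ; *-assoc = λ (a , b) (a' , b') (x , y) →
            solve 7 (λ a b a' b' x y ε → (a :* a' :+ ε :* (b :* b')) :* x :+ ε :* ((a :* b' :+ b :* a') :* y) ⊜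
              a :* (a' :* x :+ ε :* (b' :* y)) :+ ε :* (b :* (a' :* y :+ b' :* x))) a b a' b' x y ε ,
            solve 7 (λ a b a' b' x y ε → (a :* a' :+ ε :* (b :* b')) :* y :+ (a :* b' :+ b :* a') :* x ⊜
              a :* (a' :* y :+ b' :* x) :+ b :* (a' :* x :+ ε :* (b' :* y))) a b a' b' x y ε
        ; *-identity = (λ (a , b) → solve 3 (λ a b ε → :1 :* a :+ ε :* (:0 :* b) ⊜ a) a b ε , solve 2 (λ a b → :1 :* b :+ :0 :* a ⊜ b) a b) ,
            λ (a , b) → solve 3 (λ a b ε → a :* :1 :+ ε :* (b :* :0) ⊜ a) a b ε , solve 2 (λ a b → a :* :0 :+ b :* :1 ⊜ b) a b
        ; distrib = (λ (x , y) (a , b) (a' , b') →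
              solve 7 (λ a b a' b' x y ε → x :* (a :+ a') :+ ε :* (y :* (b :+ b')) ⊜ (x :* a :+ ε :* (y :* b)) :+ (x :* a' :+ ε :* (y :* b'))) a b a' b' x y ε ,
              solve 6 (λ a b a' b' x y → x :* (b :+ b') :+ y :* (a :+ a') ⊜ (x :* b :+ y :* a) :+ (x :* b' :+ y :* a')) a b a' b' x y) ,
            λ (x , y) (a , b) (a' , b') →
              solve 7 (λ a b a' b' x y ε → (a :+ a') :* x :+ ε :* ((b :+ b') :* y) ⊜ (a :* x :+ ε :* (b :* y)) :+ (a' :* x :+ ε :* (b' :* y))) a b a' b' x y ε ,
              solve 6 (λ a b a' b' x y → (a :+ a') :* y :+ (b :+ b') :* x ⊜ (a :* y :+ b :* x) :+ (a' :* y :+ b' :* x)) a b a' b' x y }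
      ; *-comm = λ (a , b) (a' , b') → solve 5 (λ a b a' b' ε → a :* a' :+ ε :* (b :* b') ⊜ a' :* a :+ ε :* (b' :* b)) a b a' b' ε ,
          solve 4 (λ a b a' b' → a :* b' :+ b :* a' ⊜ a' :* b :+ b' :* a) a b a' b' } }

  norm : Carrier × Carrier → Carrier
  norm (a , b) = a * a - ε * (b * b)

  -- A zero of `a² - ε b²` with `b` nonzero would make `ε` the square of `a / b`.
  norm≉0 : ∀ a b → ¬ (a ≈ 0# × b ≈ 0#) → ¬ norm (a , b) ≈ 0#
  norm≉0 a b n e with b ≟ 0#
  ... | yes b≈0 = n (decidable-stable (a ≟ 0#) (λ a≉0 → *-≉0 a≉0 a≉0 (trans (solve 2 (λ a ε → a :* a ⊜ a :* a :- ε :* (:0 :* :0)) a ε)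
      (trans (+-congˡ (-‿cong (*-congˡ (sym (*-cong b≈0 b≈0))))) e))) , b≈0)
  ... | no b≉0 = nonsquare (a * recip b≉0) (begin
      (a * r) * (a * r)  ≈⟨ solve 4 (λ a r ε b → (a :* r) :* (a :* r) ⊜ (a :* a :- ε :* (b :* b)) :* (r :* r) :+ ε :* ((r :* b) :* (r :* b))) a r ε b ⟩
      norm (a , b) * (r * r) + ε * ((r * b) * (r * b))  ≈⟨ +-cong (trans (*-congʳ e) (zeroˡ _)) (*-congˡ (*-cong (recip-* b≉0) (recip-* b≉0))) ⟩
      0# + ε * (1# * 1#)  ≈⟨ solve 1 (λ ε → :0 :+ ε :* (:1 :* :1) ⊜ ε) ε ⟩
      ε ∎)
    where
    r : Carrier
    r = recip b≉0

  F[√ε]-isField : LinAlg.IsField F[√ε]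
  F[√ε]-isField = (λ (e , _) → 1≉0 e) , λ (a , b) n → let k = recip (norm≉0 a b n) in (a * k , - (b * k)) ,
    trans (solve 4 (λ a b k ε → a :* (a :* k) :+ ε :* (b :* (:- (b :* k))) ⊜ (a :* a :- ε :* (b :* b)) :* k) a b k ε) (*-recip (norm≉0 a b n)) ,
    solve 3 (λ a b k → a :* (:- (b :* k)) :+ b :* (a :* k) ⊜ :0) a b k

  F[√ε]-card : LinAlg.HasCard F[√ε] (q ℕ.* q)
  F[√ε]-card = pair , injective , λ (a , b) → combine (index a) (index b) ,
      trans (reflexive (≡.cong (elem ∘ proj₁) (remQuot-combine (index a) (index b)))) (elem-index a) ,
      trans (reflexive (≡.cong (elem ∘ proj₂) (remQuot-combine (index a) (index b)))) (elem-index b)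
    where
    pair : Fin (q ℕ.* q) → Carrier × Carrier
    pair i = elem (proj₁ (remQuot {q} q i)) , elem (proj₂ (remQuot {q} q i))
    injective : ∀ i j → elem (proj₁ (remQuot {q} q i)) ≈ elem (proj₁ (remQuot {q} q j)) ×
      elem (proj₂ (remQuot {q} q i)) ≈ elem (proj₂ (remQuot {q} q j)) → i ≡ j
    injective i j (e , e') = ≡.trans (≡.sym (combine-remQuot {q} q i))
      (≡.trans (≡.cong₂ combine (elem-injective _ _ e) (elem-injective _ _ e')) (combine-remQuot {q} q j))

module OddCard {c ℓ} (R : CommutativeRing c ℓ) (isField : LinAlg.IsField R) {Q : ℕ} (card : LinAlg.HasCard R Q) where
  open CommutativeRing R
  open Fermat R isField card

  -- With `Q = 1 + 2 m` and `2 = 0` the relation `nat Q = 0` reads `1 = 0`.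
  odd⇒2≉0 : ∀ m → Q ≡ suc (2 ℕ.* m) → ¬ 1# + 1# ≈ 0#
  odd⇒2≉0 m e 2≈0 = 1≉0 (trans (sym (+-identityʳ 1#)) (trans (+-congˡ (sym (trans (×1-homo-* 2 m)
    (trans (*-congʳ (trans (+-congˡ (+-identityʳ 1#)) 2≈0)) (zeroˡ _))))) (trans (×-congˡ (≡.sym e)) card·1≈0)))

odd-square : ∀ {q} m → q ≡ suc (2 ℕ.* m) → ∃ λ k → q ℕ.* q ≡ suc (2 ℕ.* k)
odd-square {q} m ≡.refl = m ℕ.+ m ℕ.* q , ≡.cong suc (≡.trans (≡.cong (2 ℕ.* m ℕ.+_) (ℕ.*-assoc 2 m q)) (≡.sym (ℕ.*-distribˡ-+ 2 m (m ℕ.* q))))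

-- The conic model from the normal form.

module Assembly {c ℓ κ μ} (S : Setup c ℓ) (odd : OddPrimePower (Setup.q S))
  (K : CommutativeRing κ μ) (isFieldK : LinAlg.IsField K) (cardK : LinAlg.HasCard K (Setup.q S ℕ.* Setup.q S)) where
  open Setup S
  open CommutativeRing F
  open LinAlg F using (V)
  open RingSolver F
  module K = CommutativeRing K
  module KF = FieldLA K isFieldK cardK

  2≉0ᴷ : ¬ (K.1# K.+ K.1#) K.≈ K.0#
  2≉0ᴷ = let k , e = odd-square (proj₁ (proj₂ odd)) (proj₂ (proj₂ odd)) in OddCard.odd⇒2≉0 K isFieldK cardK k e

  open CPlanes S using (c⃗)
  open FieldLA F isField card using (recip; *-recip; *-cancel-0)
  open NormalForm S using (resp; lin; module Canonical; canonical)
  open Canonical canonical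
  open Quadratic F isField card ε ε-nonsquare

  -- Both fields have `q²` elements, a power of the same prime `p`: a vanishing multiple of 1 in the
  -- first forces `p` to divide `m`, and `p` times 1 is 0 in `K`.
  char : ∀ m → CommutativeRing._≈_ F[√ε] (Multiples.nat F[√ε] m) (CommutativeRing.0# F[√ε]) → Multiples.nat K m K.≈ K.0#
  char = go odd
    where
    go : OddPrimePower q → ∀ m → CommutativeRing._≈_ F[√ε] (Multiples.nat F[√ε] m) (CommutativeRing.0# F[√ε]) → Multiples.nat K m K.≈ K.0#
    go ((p , k , p-prime , _ , q≡) , _) m e = multiple (Characteristic.annihilates⇒divides F[√ε] F[√ε]-isField F[√ε]-card p-prime
        (Characteristic.prime·1≈0 F[√ε] F[√ε]-isField F[√ε]-card p (k ℕ.+ k) q²≡) m e)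
      where
      q²≡ : q ℕ.* q ≡ p ℕ.^ (k ℕ.+ k)
      q²≡ = ≡.trans (≡.cong₂ ℕ._*_ q≡ q≡) (≡.sym (ℕ.^-distribˡ-+-* p k k))
      multiple : p ∣ m → Multiples.nat K m K.≈ K.0#
      multiple (divides j m≡) = K.trans (Multiples.×-congˡ K m≡) (Multiples.nat-*-0 K j
        (Characteristic.prime·1≈0 K isFieldK cardK p (k ℕ.+ k) q²≡))

  2≤q² : ∃ λ n → q ℕ.* q ≡ suc (suc n)
  2≤q² = let n , e = ℕ.m≤n⇒∃[o]m+o≡n (ℕ.≤-trans (ℕ.≤-trans (s≤s (s≤s z≤n)) 7≤q) (ℕ.m≤m*n q q {{ℕ.>-nonZero (ℕ.≤-trans (s≤s z≤n) 7≤q)}})) in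
    n , ≡.sym e

  Embed : Set (c ⊔ ℓ ⊔ κ ⊔ μ)
  Embed = ∃ λ (φ : Carrier × Carrier → K.Carrier) → (∀ {a b} → CommutativeRing._≈_ F[√ε] a b → φ a K.≈ φ b) ×
    (∀ a b → φ (CommutativeRing._+_ F[√ε] a b) K.≈ (φ a K.+ φ b)) × (∀ a b → φ (CommutativeRing._*_ F[√ε] a b) K.≈ (φ a K.* φ b)) ×
    φ (0# , 0#) K.≈ K.0# × φ (1# , 0#) K.≈ K.1# × (∀ {a} → φ a K.≈ K.0# → proj₁ a ≈ 0# × proj₂ a ≈ 0#)

  opaque
    embed : Embed
    embed = go (proj₂ 2≤q²) F[√ε]-card cardK
      where
      go : ∀ {Q n} → Q ≡ suc (suc n) → LinAlg.HasCard F[√ε] Q → LinAlg.HasCard K Q → Embed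
      go ≡.refl cE cK = φ , φ-cong , φ-+ , φ-* , φ-0 , φ-1 , φ-injective
        where open Embeddings.Hom (Embeddings.hom F[√ε] F[√ε]-isField K isFieldK cE cK char)

  φ : Carrier × Carrier → K.Carrier
  φ = proj₁ embed
  φ-cong : ∀ {a b} → CommutativeRing._≈_ F[√ε] a b → φ a K.≈ φ b
  φ-cong = proj₁ (proj₂ embed)
  φ-+ : ∀ a b → φ (CommutativeRing._+_ F[√ε] a b) K.≈ (φ a K.+ φ b)
  φ-+ = proj₁ (proj₂ (proj₂ embed))
  φ-* : ∀ a b → φ (CommutativeRing._*_ F[√ε] a b) K.≈ (φ a K.* φ b)
  φ-* = proj₁ (proj₂ (proj₂ (proj₂ embed)))
  φ-0 : φ (0# , 0#) K.≈ K.0#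
  φ-0 = proj₁ (proj₂ (proj₂ (proj₂ (proj₂ embed))))
  φ-1 : φ (1# , 0#) K.≈ K.1#
  φ-1 = proj₁ (proj₂ (proj₂ (proj₂ (proj₂ (proj₂ embed)))))
  φ-kernel : ∀ {a} → φ a K.≈ K.0# → proj₁ a ≈ 0# × proj₂ a ≈ 0#
  φ-kernel = proj₂ (proj₂ (proj₂ (proj₂ (proj₂ (proj₂ embed)))))

  module E = FieldLA F[√ε] F[√ε]-isField F[√ε]-card

  φ-injective : ∀ {a b} → φ a K.≈ φ b → CommutativeRing._≈_ F[√ε] a b
  φ-injective {a} {b} e = E.x∙y⁻¹≈ε⇒x≈y a b (φ-kernel (K.trans (φ-+ a (CommutativeRing.-_ F[√ε] b)) (K.trans (K.+-congʳ e)
    (K.trans (K.sym (φ-+ b (CommutativeRing.-_ F[√ε] b))) (K.trans (φ-cong (CommutativeRing.-‿inverseʳ F[√ε] b)) φ-0)))))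

  -- An injective map between two sets of `q²` elements.
  φ-onto : ∀ Z → ∃ λ a → φ a K.≈ Z
  φ-onto Z = let i , e = injective⇒surjective (λ i → KF.index (φ (E.elem i)))
                   (λ {i} {j} e → E.elem-injective i j (φ-injective (KF.index-injective e))) (KF.index Z) in
    E.elem i , KF.index-injective e

  φ-scale : ∀ a x y → φ (a * x , a * y) K.≈ (φ (a , 0#) K.* φ (x , y))
  φ-scale a x y = K.trans (φ-cong (solve 4 (λ a x y ε → a :* x ⊜ a :* x :+ ε :* (:0 :* y)) a x y ε , solve 3 (λ a x y → a :* y ⊜ a :* y :+ :0 :* x) a x y))
    (φ-* (a , 0#) (x , y))

  φ-split : ∀ a b → φ (a , b) K.≈ (φ (a , 0#) K.+ (φ (b , 0#) K.* φ (0# , 1#)))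
  φ-split a b = K.trans (φ-cong (solve 2 (λ a b → a ⊜ a :+ b :* :0) a b , solve 1 (λ b → b ⊜ :0 :+ b :* :1) b))
    (K.trans (φ-+ (a , 0#) (b * 0# , b * 1#)) (K.+-congˡ (φ-scale b 0# 1#)))

  extension : Extension F K
  extension = record
    { ι = λ a → φ (a , 0#) ; ι-cong = λ e → φ-cong (e , refl)
    ; ι-+ = λ a b → K.trans (φ-cong (refl , sym (+-identityʳ 0#))) (φ-+ (a , 0#) (b , 0#))
    ; ι-* = λ a b → K.trans (φ-cong (refl , sym (zeroʳ a))) (φ-scale a b 0#)
    ; ι-0 = φ-0 ; ι-1 = φ-1 ; ι-≉0 = λ a≉0 e → a≉0 (proj₁ (φ-kernel e)) ; ω = φ (0# , 1#)
    ; basis-spans = λ Z → let (a , b) , e = φ-onto Z in a , b , K.trans (K.sym e) (φ-split a b)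
    ; basis-indep = λ a b e → φ-kernel (K.trans (φ-split a b) e) }

  form : ConicForm F K extension h c⃗
  form = record
    -- The square of `X = y + x √ε` is `(y² + ε x²) + 2 x y √ε`, whose components on C are `w` and
    -- `2 z`.
    { X = λ v → φ (y v , x v) ; Y = λ v → φ (w v , two * z v)
    ; X-resp = λ e → φ-cong (resp y-lin e , resp x-lin e)
    ; Y-resp = λ e → φ-cong (resp w-lin e , *-congˡ (resp z-lin e))
    ; X-lin = λ a u b v → K.trans (φ-cong (lin y-lin a u b v , lin x-lin a u b v))
        (K.trans (φ-+ (a * y u , a * x u) (b * y v , b * x v)) (K.+-cong (φ-scale a (y u) (x u)) (φ-scale b (y v) (x v))))
    ; Y-lin = λ a u b v → K.trans (φ-cong (lin w-lin a u b v , trans (*-congˡ (lin z-lin a u b v))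
          (solve 5 (λ t a u b v → t :* (a :* u :+ b :* v) ⊜ a :* (t :* u) :+ b :* (t :* v)) two a (z u) b (z v))))
        (K.trans (φ-+ (a * w u , a * (two * z u)) (b * w v , b * (two * z v))) (K.+-cong (φ-scale a (w u) (two * z u)) (φ-scale b (w v) (two * z v))))
    ; joint-injective = λ v hv Xv Yv → joint-injective v hv (proj₂ (φ-kernel Xv)) (proj₁ (φ-kernel Xv))
        (*-cancel-0 2≉0 (proj₂ (φ-kernel Yv))) (proj₁ (φ-kernel Yv))
    ; joint-surjective = λ a Z W → let (b , b') , eZ = φ-onto Z ; (d , d') , eW = φ-onto W
                                       v , hv , xv , yv , zv , wv = joint-surjective a b' b (recip 2≉0 * d') d in
        v , hv , K.trans (φ-cong (yv , xv)) eZ , K.trans (φ-cong (wv , trans (*-congˡ zv) (half d'))) eW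
    ; Y≈X² = λ P → K.trans (φ-cong (w≈y²+εx² P , trans (*-congˡ (z≈xy P)) (solve 2 (λ x y → (:1 :+ :1) :* (x :* y) ⊜ y :* x :+ x :* y) (x (c⃗ P)) (y (c⃗ P)))))
        (φ-* (y (c⃗ P) , x (c⃗ P)) (y (c⃗ P) , x (c⃗ P)))
    ; X-onto = λ Z → let (b , b') , eZ = φ-onto Z ; P , xP , yP = onto b' b in P , K.trans (φ-cong (yP , xP)) eZ }
    where
    two : Carrier
    two = 1# + 1#
    half : ∀ d → two * (recip 2≉0 * d) ≈ d
    half d = trans (sym (*-assoc _ _ _)) (trans (*-congʳ (*-recip 2≉0)) (*-identityˡ d))

  model : ConicModel S κ μ
  model = record { K = K ; isFieldK = isFieldK ; cardK = cardK ; ext = extension ; form = form ; 2≉0ᴷ = 2≉0ᴷ }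

  open BruckBose S model public using (iso; conic)

theorem3p25 : ∀ {c ℓ k m : Level} (q : ℕ) (F : CommutativeRing c ℓ) →
    LinAlg.IsField F → LinAlg.HasCard F q → OddPrimePower q → 7 ≤ q →
    (h : LinAlg.V F 5) → LinAlg.NonZero F h →
    (H : Config.Hyp F q h) → Config.Derived.Conclusion F q h H k m
theorem3p25 {c} {ℓ} q F isField card odd 7≤q h _ H K isFieldK cardK = iso , conic
  where
  S : Setup c ℓ
  S = record { F = F ; isField = isField ; card = card ; 7≤q = 7≤q ; h = h ; H = H
    ; 2≉0 = OddCard.odd⇒2≉0 F isField card (proj₁ (proj₂ odd)) (proj₂ (proj₂ odd)) }
  open Assembly S odd K isFieldK cardK
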